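{- Let $\Phi$ be a finite crystallographic root system with positive roots $\Phi^+$, let $I\subseteq\Phi^+$ be an order ideal in the root poset on $\Phi^+$, and let $\mathcal{A}_I$ be the corresponding root ideal arrangement. Then $\mathcal{A}_I$ is supersolvable if and only if its Orlik-Solomon algebra $\mathcal{OS}(\mathcal{A}_I)$ is Koszul.
   Context: Root systems are reduced. Let $\Phi$ be a finite crystallographic root system with positive roots $\Phi^+$ and simple roots $\Delta\subseteq\Phi^+$. Every $\gamma\in\Phi^+$ is uniquely $\gamma=\sum_{\alpha\in\Delta}\gamma_\alpha\alpha$ with nonnegative integers $\gamma_\alpha$. The root poset is the partial order on $\Phi^+$ given by $\gamma\le\gamma'$ iff $\gamma_\alpha\le\gamma'_\alpha$ for all $\alpha\in\Delta$. An order ideal is a subset $I\subseteq\Phi^+$ such that $\gamma_1\in I$ and $\gamma_2<\gamma_1$ imply $\gamma_2\in I$. The root ideal arrangement $\mathcal{A}_I$ is the set of hyperplanes $H_\gamma=\gamma^\perp$, $\gamma\in I$. Only its matroid matters, and it is identified with the finite set of pairwise non-parallel vectors $I$. For a finite set $\mathcal{A}$ of pairwise non-parallel vectors in a Euclidean space, the closure of $S\subseteq\mathcal{A}$ is $\mathrm{cl}(S)=\mathcal{A}\cap\mathrm{span}\,S$; a flat is a closed subset; the rank of a subset is the dimension of its span; a $k$-flat is a flat of rank $k$. $\mathcal{A}$ is supersolvable if, with $n$ the rank of $\mathcal{A}$, there is a partition $\mathcal{A}=\Pi_1\uplus\cdots\uplus\Pi_n$ such that for all $i\in\{1,\dots,n\}$,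 setting $\mathcal{A}_i=\Pi_1\uplus\cdots\uplus\Pi_i$: (1) $\mathcal{A}_i$ has rank $i$; (2) no $2$-flat of $\mathcal{A}_i$ is a subset of $\Pi_i$. (Equivalently, the lattice of flats of $\mathcal{A}$ has a maximal chain of modular elements.) Fix a coefficient field $K$. The Orlik-Solomon algebra $\mathcal{OS}(\mathcal{A})$ is the quotient of the exterior algebra over $K$ on generators $e_a$ ($a\in\mathcal{A}$, degree $1$) by the ideal generated by all $\partial(e_{a_1}\wedge\cdots\wedge e_{a_p})=\sum_{j=1}^p(-1)^{j-1}e_{a_1}\wedge\cdots\widehat{e_{a_j}}\cdots\wedge e_{a_p}$ with $\{a_1,\dots,a_p\}\subseteq\mathcal{A}$ linearly dependent. A connected graded $K$-algebra $A$ generated in degree $1$ is Koszul if $\mathrm{Tor}^A_i(K,K)_j=0$ whenever $i\ne j$ (equivalently, the trivial module $K$ has a linear minimal free resolution). -}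

module Defs where

open import Algebra.Apartness.Bundles using (HeytingField; HeytingCommutativeRing)
open import Algebra.Bundles using (Ring; CommutativeRing)
open import Algebra.Module.Bundles using (LeftModule)
import Algebra.Properties.CommutativeMonoid.Sum as Sum
import Algebra.Properties.Monoid.Mult as Mult
import Algebra.Properties.AbelianGroup as AbelianGroupProperties
import Algebra.Properties.Semiring.Exp as Exp
open import Data.Fin.Base using (Fin; zero; suc; toℕ)
open import Data.Fin.Subset using (Subset; _∈_; _∉_; _⊆_; ⊤; ⋃)
open import Data.Fin.Subset.Properties using (_∈?_)
open import Data.Integer.Base using (ℤ; +_; -[1+_])
open import Data.List.Base using (List; allFin; filter; length; lookup; take; tabulate)
open import Data.Nat.Base using (ℕ; zero; suc; _+_; _≤_)
import Data.Nat.Properties as ℕ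
open import Data.Product.Base using (_×_; _,_; ∃; ∃-syntax; ∃₂)
open import Data.Product using (∃!)
open import Data.Sum.Base using (_⊎_)
import Data.Unit.Polymorphic.Base as Unit
open import Data.Vec.Functional using (Vector; head; tail; removeAt)
open import Function.Base using (_∘_)
open import Function.Definitions using (Injective)
open import Level using (Level; _⊔_) renaming (suc to lsuc)
open import Relation.Binary.Core using (Rel)
open import Relation.Binary.PropositionalEquality.Core using (_≡_; _≢_; refl; trans; cong)
open import Relation.Binary.Structures using (IsStrictTotalOrder)
import Relation.Binary.Reasoning.Setoid as SetoidReasoning
open import Relation.Nullary.Negation using (¬_)
open import Relation.Unary using (Pred; U)

private
  variable
    c ℓ ℓ₁ ℓ₂ ℓ₃ a ℓa g r v ℓv p : Level

fieldRing : HeytingField c ℓ₁ ℓ₂ → CommutativeRing c ℓ₁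
fieldRing K = HeytingCommutativeRing.commutativeRing (HeytingField.heytingCommutativeRing K)

-- The library has no real numbers; scalars are taken in an arbitrary
-- (totally) ordered field, of which ℝ is the intended instance.

record OrderedField c ℓ₁ ℓ₂ ℓ₃ : Set (lsuc (c ⊔ ℓ₁ ⊔ ℓ₂ ⊔ ℓ₃)) where
  field
    heytingField : HeytingField c ℓ₁ ℓ₂

  open HeytingField heytingField public renaming (_+_ to _⊕_; _*_ to _⊛_)

  field
    _<_                : Rel Carrier ℓ₃
    isStrictTotalOrder : IsStrictTotalOrder _≈_ _<_
    <⇒#                : ∀ {x y} → x < y → x # y
    +-monoˡ-<          : ∀ z {x y} → x < y → (x ⊕ z) < (y ⊕ z)
    *-positive         : ∀ {x y} → 0# < x → 0# < y → 0# < (x ⊛ y)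

  commutativeRing : CommutativeRing c ℓ₁
  commutativeRing = fieldRing heytingField

  ring : Ring c ℓ₁
  ring = CommutativeRing.ring commutativeRing

  open Mult (CommutativeRing.+-monoid commutativeRing) using () renaming (_×_ to _times_)

  fromℤ : ℤ → Carrier
  fromℤ (+ n)    = n times 1#
  fromℤ -[1+ n ] = - (suc n times 1#)

-- Finite-dimensionality is not a field: a root system spans its space.

record EuclideanSpace (F : OrderedField c ℓ₁ ℓ₂ ℓ₃) v ℓv
                      : Set (c ⊔ ℓ₁ ⊔ ℓ₂ ⊔ ℓ₃ ⊔ lsuc (v ⊔ ℓv)) where
  private module F = OrderedField F
  field
    leftModule : LeftModule F.ring v ℓv

  open LeftModule leftModule public

  field
    ⟨_,_⟩             : Carrierᴹ → Carrierᴹ → F.Carrier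
    ⟨⟩-cong           : ∀ {x x′ y y′} → x ≈ᴹ x′ → y ≈ᴹ y′ → ⟨ x , y ⟩ F.≈ ⟨ x′ , y′ ⟩
    ⟨⟩-sym            : ∀ x y → ⟨ x , y ⟩ F.≈ ⟨ y , x ⟩
    ⟨⟩-additive       : ∀ x y z → ⟨ x +ᴹ y , z ⟩ F.≈ (⟨ x , z ⟩ F.⊕ ⟨ y , z ⟩)
    ⟨⟩-homogeneous    : ∀ k x y → ⟨ k *ₗ x , y ⟩ F.≈ (k F.⊛ ⟨ x , y ⟩)
    positive-definite : ∀ x → ¬ (x ≈ᴹ 0ᴹ) → F.0# F.< ⟨ x , x ⟩

module LinearAlgebra {F : OrderedField c ℓ₁ ℓ₂ ℓ₃} (E : EuclideanSpace F v ℓv) where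
  private module F = OrderedField F
  open EuclideanSpace E
  open Sum +ᴹ-commutativeMonoid using (sum)

  combination : ∀ {k} → Vector F.Carrier k → Vector Carrierᴹ k → Carrierᴹ
  combination s x = sum (λ i → s i *ₗ x i)

  LinearlyIndependent : ∀ {k} → Vector Carrierᴹ k → Set (c ⊔ ℓ₁ ⊔ ℓv)
  LinearlyIndependent x = ∀ s → combination s x ≈ᴹ 0ᴹ → ∀ i → s i F.≈ F.0#

  LinearlyDependent : ∀ {k} → Vector Carrierᴹ k → Set (c ⊔ ℓ₁ ⊔ ℓv)
  LinearlyDependent x = ∃[ s ] combination s x ≈ᴹ 0ᴹ × ∃[ i ] ¬ (s i F.≈ F.0#)

  Span : ∀ {k} → Vector Carrierᴹ k → Subset k → Pred Carrierᴹ (c ⊔ ℓ₁ ⊔ ℓv)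
  Span x S y = ∃[ s ] (∀ i → i ∉ S → s i F.≈ F.0#) × y ≈ᴹ combination s x

  IsBasis : ∀ {k} → Pred Carrierᴹ p → Vector Carrierᴹ k → Set (c ⊔ ℓ₁ ⊔ v ⊔ ℓv ⊔ p)
  IsBasis W b = LinearlyIndependent b × (∀ i → W (b i)) × (∀ x → W x → Span b ⊤ x)

  HasDimension : Pred Carrierᴹ p → ℕ → Set (c ⊔ ℓ₁ ⊔ v ⊔ ℓv ⊔ p)
  HasDimension W k = ∃[ b ] IsBasis {k = k} W b

module Arrangement {F : OrderedField c ℓ₁ ℓ₂ ℓ₃} (E : EuclideanSpace F v ℓv)
                   {N : ℕ} (𝒜 : Vector (EuclideanSpace.Carrierᴹ E) N) where
  open LinearAlgebra E

  HasRank : Subset N → ℕ → Set (c ⊔ ℓ₁ ⊔ v ⊔ ℓv)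
  HasRank S = HasDimension (Span 𝒜 S)

  -- Closure and flats are taken in the subarrangement B.
  Closure : Subset N → Subset N → Pred (Fin N) (c ⊔ ℓ₁ ⊔ ℓv)
  Closure B S x = x ∈ B × Span 𝒜 S (𝒜 x)

  IsFlat : Subset N → Subset N → Set (c ⊔ ℓ₁ ⊔ ℓv)
  IsFlat B X = X ⊆ B × (∀ x → Closure B X x → x ∈ X)

  IsFlatOfRank : ℕ → Subset N → Subset N → Set (c ⊔ ℓ₁ ⊔ v ⊔ ℓv)
  IsFlatOfRank k B X = IsFlat B X × HasRank X k

  IsPartition : ∀ {n} → Vector (Subset N) n → Set
  IsPartition Π = ∀ x → ∃! _≡_ (λ i → x ∈ Π i)

  -- Π₁ ∪ ⋯ ∪ Πᵢ; indices in Fin n start at 0, so that suc (toℕ i) parts are joined.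
  initial : ∀ {n} → Vector (Subset N) n → Fin n → Subset N
  initial Π i = ⋃ (take (suc (toℕ i)) (tabulate Π))

  Supersolvable : Set (c ⊔ ℓ₁ ⊔ v ⊔ ℓv)
  Supersolvable =
    ∃[ n ] HasRank ⊤ n ×
    ∃[ Π ] IsPartition {n} Π ×
      (∀ i → HasRank (initial Π i) (suc (toℕ i)) ×
             (∀ X → IsFlatOfRank 2 (initial Π i) X → ¬ (X ⊆ Π i)))

record RootSystem {F : OrderedField c ℓ₁ ℓ₂ ℓ₃} (E : EuclideanSpace F v ℓv) (N : ℕ)
                  : Set (c ⊔ ℓ₁ ⊔ v ⊔ ℓv) where
  private module F = OrderedField F
  open EuclideanSpace E
  open LinearAlgebra E
  field
    root     : Vector Carrierᴹ N
    distinct : Injective _≡_ _≈ᴹ_ root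

  -- k = 2⟨β,α⟩ / ⟨α,α⟩ for β = root i, α = root j; k is unique since ⟨α,α⟩ > 0.
  IsCartanNumber : Fin N → Fin N → F.Carrier → Set ℓ₁
  IsCartanNumber i j k =
    (k F.⊛ ⟨ root j , root j ⟩) F.≈ (⟨ root i , root j ⟩ F.⊕ ⟨ root i , root j ⟩)

  field
    spans            : ∀ x → Span root ⊤ x
    nonzero          : ∀ i → ¬ (root i ≈ᴹ 0ᴹ)
    reduced          : ∀ i j k → root j ≈ᴹ (k *ₗ root i) → k F.≈ F.1# ⊎ k F.≈ (F.- F.1#)
    reflection       : ∀ i j k → IsCartanNumber i j k →
                       ∃[ m ] root m ≈ᴹ (root i +ᴹ (-ᴹ (k *ₗ root j)))
    crystallographic : ∀ i j → ∃[ z ] IsCartanNumber i j (F.fromℤ z)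

-- The choice of Δ determines Φ⁺: a root is positive when its coefficients on Δ
-- are natural numbers.

record Base {F : OrderedField c ℓ₁ ℓ₂ ℓ₃} {E : EuclideanSpace F v ℓv} {N : ℕ}
            (Φ : RootSystem E N) : Set (c ⊔ ℓ₁ ⊔ v ⊔ ℓv) where
  open EuclideanSpace E
  open LinearAlgebra E
  open RootSystem Φ
  open Sum +ᴹ-commutativeMonoid using (sum)
  open Mult +ᴹ-monoid using () renaming (_×_ to _times_)
  field
    rank    : ℕ
    simple  : Vector (Fin N) rank
    isBasis : IsBasis U (root ∘ simple)

  simpleSum : Vector ℕ rank → Carrierᴹ
  simpleSum n = sum (λ α → n α times root (simple α))

  field
    signed : ∀ i → ∃[ n ] (root i ≈ᴹ simpleSum n ⊎ root i ≈ᴹ (-ᴹ simpleSum n))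

  HasCoefficients : Fin N → Vector ℕ rank → Set ℓv
  HasCoefficients i n = root i ≈ᴹ simpleSum n

  Positive : Pred (Fin N) ℓv
  Positive i = ∃ (HasCoefficients i)

  _≼_ : Rel (Fin N) ℓv
  i ≼ j = ∃₂ λ m n → HasCoefficients i m × HasCoefficients j n × (∀ α → m α ≤ n α)

  _≺_ : Rel (Fin N) ℓv
  i ≺ j = i ≼ j × i ≢ j

  IsOrderIdeal : Subset N → Set ℓv
  IsOrderIdeal I = (∀ i → i ∈ I → Positive i) ×
                   (∀ i j → i ∈ I → Positive j → j ≺ i → j ∈ I)

-- The hyperplanes γ^⊥ are represented by their normals γ ∈ I.

members : ∀ {N} → Subset N → List (Fin N)
members I = filter (_∈? I) (allFin _)

rootArrangement : {F : OrderedField c ℓ₁ ℓ₂ ℓ₃} {E : EuclideanSpace F v ℓv} {N : ℕ}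
                  (Φ : RootSystem E N) (I : Subset N) →
                  Vector (EuclideanSpace.Carrierᴹ E) (length (members I))
rootArrangement Φ I = RootSystem.root Φ ∘ lookup (members I)

-- The degree of a product is only required to be propositionally equal to
-- the sum of the degrees, which avoids transports in the associativity law.

record GradedAlgebra (R : CommutativeRing c ℓ) a ℓa : Set (c ⊔ ℓ ⊔ lsuc (a ⊔ ℓa)) where
  private module R = CommutativeRing R
  field
    component : ℕ → LeftModule R.ring a ℓa

  open module Component {d} = LeftModule (component d) public
    using (_≈ᴹ_; _+ᴹ_; 0ᴹ; -ᴹ_; _*ₗ_)

  Deg : ℕ → Set a
  Deg d = LeftModule.Carrierᴹ (component d)

  field
    one : Deg 0
    mul : ∀ {m n d} → m + n ≡ d → Deg m → Deg n → Deg d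

    mul-cong      : ∀ {m n d} (e : m + n ≡ d) {x x′ : Deg m} {y y′ : Deg n} →
                    x ≈ᴹ x′ → y ≈ᴹ y′ → mul e x y ≈ᴹ mul e x′ y′
    mul-assoc     : ∀ {l m n lm mn d} (e₁ : l + m ≡ lm) (e₂ : lm + n ≡ d)
                    (e₃ : m + n ≡ mn) (e₄ : l + mn ≡ d)
                    (x : Deg l) (y : Deg m) (z : Deg n) →
                    mul e₂ (mul e₁ x y) z ≈ᴹ mul e₄ x (mul e₃ y z)
    mul-identityˡ : ∀ {n} (e : 0 + n ≡ n) (x : Deg n) → mul e one x ≈ᴹ x
    mul-identityʳ : ∀ {n} (e : n + 0 ≡ n) (x : Deg n) → mul e x one ≈ᴹ x
    mul-distribˡ  : ∀ {m n d} (e : m + n ≡ d) (x : Deg m) (y z : Deg n) →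
                    mul e x (y +ᴹ z) ≈ᴹ (mul e x y +ᴹ mul e x z)
    mul-distribʳ  : ∀ {m n d} (e : m + n ≡ d) (x y : Deg m) (z : Deg n) →
                    mul e (x +ᴹ y) z ≈ᴹ (mul e x z +ᴹ mul e y z)
    mul-scalarˡ   : ∀ {m n d} (e : m + n ≡ d) k (x : Deg m) (y : Deg n) →
                    mul e (k *ₗ x) y ≈ᴹ (k *ₗ mul e x y)
    mul-scalarʳ   : ∀ {m n d} (e : m + n ≡ d) k (x : Deg m) (y : Deg n) →
                    mul e x (k *ₗ y) ≈ᴹ (k *ₗ mul e x y)

module Quotient {R : CommutativeRing c ℓ} (A : GradedAlgebra R a ℓa)
                (Rel₀ : ∀ {d} → GradedAlgebra.Deg A d → Set r) where
  private module R = CommutativeRing R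
  open GradedAlgebra A
  private
    module M (d : ℕ) = LeftModule (component d)
    module MG (d : ℕ) = AbelianGroupProperties (M.+ᴹ-abelianGroup d)

  data Ideal : ∀ {d} → Deg d → Set (c ⊔ a ⊔ ℓa ⊔ r) where
    generator : ∀ {d} {x : Deg d} → Rel₀ x → Ideal x
    resp      : ∀ {d} {x y : Deg d} → x ≈ᴹ y → Ideal x → Ideal y
    zeroᴵ     : ∀ {d} → Ideal (0ᴹ {d})
    plus      : ∀ {d} {x y : Deg d} → Ideal x → Ideal y → Ideal (x +ᴹ y)
    scale     : ∀ {d} k {x : Deg d} → Ideal x → Ideal (k *ₗ x)
    mulˡ      : ∀ {m n d} (e : m + n ≡ d) (x : Deg m) {y : Deg n} → Ideal y → Ideal (mul e x y)
    mulʳ      : ∀ {m n d} (e : m + n ≡ d) {x : Deg m} (y : Deg n) → Ideal x → Ideal (mul e x y)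

  _~_ : ∀ {d} → Rel (Deg d) (c ⊔ a ⊔ ℓa ⊔ r)
  x ~ y = ∃[ z ] Ideal z × x ≈ᴹ (y +ᴹ z)

  ≈⇒~ : ∀ {d} {x y : Deg d} → x ≈ᴹ y → x ~ y
  ≈⇒~ {d} {x} {y} x≈y = 0ᴹ , zeroᴵ , M.≈ᴹ-trans d x≈y (M.≈ᴹ-sym d (M.+ᴹ-identityʳ d y))

  private
    neg≈ : ∀ {d} (x : Deg d) → ((R.- R.1#) *ₗ x) ≈ᴹ (-ᴹ x)
    neg≈ {d} x = MG.inverseˡ-unique d _ _ (begin
      ((R.- R.1#) *ₗ x) +ᴹ x              ≈⟨ M.+ᴹ-congˡ d (M.≈ᴹ-sym d (M.*ₗ-identityˡ d x)) ⟩
      ((R.- R.1#) *ₗ x) +ᴹ (R.1# *ₗ x)    ≈⟨ M.≈ᴹ-sym d (M.*ₗ-distribʳ d x _ _) ⟩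
      ((R.- R.1#) R.+ R.1#) *ₗ x          ≈⟨ M.*ₗ-congʳ d (R.-‿inverseˡ R.1#) ⟩
      R.0# *ₗ x                           ≈⟨ M.*ₗ-zeroˡ d x ⟩
      0ᴹ                                  ∎)
      where open SetoidReasoning (M.≈ᴹ-setoid d)

    neg : ∀ {d} {x : Deg d} → Ideal x → Ideal (-ᴹ x)
    neg i = resp (neg≈ _) (scale _ i)

    interchange : ∀ {d} (x y z w : Deg d) →
                  ((x +ᴹ y) +ᴹ (z +ᴹ w)) ≈ᴹ ((x +ᴹ z) +ᴹ (y +ᴹ w))
    interchange {d} x y z w = begin
      (x +ᴹ y) +ᴹ (z +ᴹ w) ≈⟨ M.+ᴹ-assoc d x y _ ⟩
      x +ᴹ (y +ᴹ (z +ᴹ w)) ≈⟨ M.+ᴹ-congˡ d (M.≈ᴹ-sym d (M.+ᴹ-assoc d y z w)) ⟩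
      x +ᴹ ((y +ᴹ z) +ᴹ w) ≈⟨ M.+ᴹ-congˡ d (M.+ᴹ-congʳ d (M.+ᴹ-comm d y z)) ⟩
      x +ᴹ ((z +ᴹ y) +ᴹ w) ≈⟨ M.+ᴹ-congˡ d (M.+ᴹ-assoc d z y w) ⟩
      x +ᴹ (z +ᴹ (y +ᴹ w)) ≈⟨ M.≈ᴹ-sym d (M.+ᴹ-assoc d x z _) ⟩
      (x +ᴹ z) +ᴹ (y +ᴹ w) ∎
      where open SetoidReasoning (M.≈ᴹ-setoid d)

    ~-sym : ∀ {d} {x y : Deg d} → x ~ y → y ~ x
    ~-sym {d} {x} {y} (z , i , eq) = -ᴹ z , neg i , (begin
      y                  ≈⟨ M.≈ᴹ-sym d (M.+ᴹ-identityʳ d y) ⟩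
      y +ᴹ 0ᴹ            ≈⟨ M.+ᴹ-congˡ d (M.≈ᴹ-sym d (M.-ᴹ‿inverseʳ d z)) ⟩
      y +ᴹ (z +ᴹ (-ᴹ z)) ≈⟨ M.≈ᴹ-sym d (M.+ᴹ-assoc d y z _) ⟩
      (y +ᴹ z) +ᴹ (-ᴹ z) ≈⟨ M.+ᴹ-congʳ d (M.≈ᴹ-sym d eq) ⟩
      x +ᴹ (-ᴹ z)        ∎)
      where open SetoidReasoning (M.≈ᴹ-setoid d)

    ~-trans : ∀ {d} {x y z : Deg d} → x ~ y → y ~ z → x ~ z
    ~-trans {d} {x} {y} {z} (u , i , eq) (w , j , eq′) = w +ᴹ u , plus j i , (begin
      x               ≈⟨ eq ⟩
      y +ᴹ u          ≈⟨ M.+ᴹ-congʳ d eq′ ⟩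
      (z +ᴹ w) +ᴹ u   ≈⟨ M.+ᴹ-assoc d z w u ⟩
      z +ᴹ (w +ᴹ u)   ∎)
      where open SetoidReasoning (M.≈ᴹ-setoid d)

    +-cong~ : ∀ {d} {x x′ y y′ : Deg d} → x ~ x′ → y ~ y′ → (x +ᴹ y) ~ (x′ +ᴹ y′)
    +-cong~ {d} (u , i , eq) (w , j , eq′) =
      u +ᴹ w , plus i j , M.≈ᴹ-trans d (M.+ᴹ-cong d eq eq′) (interchange _ _ _ _)

    *ₗ-cong~ : ∀ {d k k′} {x x′ : Deg d} → k R.≈ k′ → x ~ x′ → (k *ₗ x) ~ (k′ *ₗ x′)
    *ₗ-cong~ {d} {k′ = k′} k≈ (u , i , eq) =
      k′ *ₗ u , scale k′ i , M.≈ᴹ-trans d (M.*ₗ-cong d k≈ eq) (M.*ₗ-distribˡ d k′ _ u)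

    -‿cong~ : ∀ {d} {x x′ : Deg d} → x ~ x′ → (-ᴹ x) ~ (-ᴹ x′)
    -‿cong~ {d} (u , i , eq) =
      -ᴹ u , neg i , M.≈ᴹ-trans d (M.-ᴹ‿cong d eq) (M.≈ᴹ-sym d (MG.⁻¹-∙-comm d _ u))

    mul-cong~ : ∀ {m n d} (e : m + n ≡ d) {x x′ : Deg m} {y y′ : Deg n} →
                x ~ x′ → y ~ y′ → mul e x y ~ mul e x′ y′
    mul-cong~ {m} {n} {d} e {x} {x′} {y} {y′} (u , i , eq) (w , j , eq′) =
      mul e x′ w +ᴹ mul e u (y′ +ᴹ w) , plus (mulˡ e x′ j) (mulʳ e _ i) , (begin
      mul e x y                                        ≈⟨ mul-cong e eq eq′ ⟩
      mul e (x′ +ᴹ u) (y′ +ᴹ w)                        ≈⟨ mul-distribʳ e x′ u _ ⟩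
      mul e x′ (y′ +ᴹ w) +ᴹ mul e u (y′ +ᴹ w)          ≈⟨ M.+ᴹ-congʳ d (mul-distribˡ e x′ y′ w) ⟩
      (mul e x′ y′ +ᴹ mul e x′ w) +ᴹ mul e u (y′ +ᴹ w) ≈⟨ M.+ᴹ-assoc d _ _ _ ⟩
      mul e x′ y′ +ᴹ (mul e x′ w +ᴹ mul e u (y′ +ᴹ w)) ∎)
      where open SetoidReasoning (M.≈ᴹ-setoid d)

    quotientComponent : ℕ → LeftModule R.ring a (c ⊔ a ⊔ ℓa ⊔ r)
    quotientComponent d = record
      { Carrierᴹ = Deg d ; _≈ᴹ_ = _~_ ; _+ᴹ_ = _+ᴹ_ ; _*ₗ_ = _*ₗ_ ; 0ᴹ = 0ᴹ ; -ᴹ_ = -ᴹ_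
      ; isLeftModule = record
        { isLeftSemimodule = record
          { +ᴹ-isCommutativeMonoid = record
            { isMonoid = record
              { isSemigroup = record
                { isMagma = record
                  { isEquivalence = record
                    { refl = ≈⇒~ (M.≈ᴹ-refl d) ; sym = ~-sym ; trans = ~-trans }
                  ; ∙-cong = +-cong~ }
                ; assoc = λ x y z → ≈⇒~ (M.+ᴹ-assoc d x y z) }
              ; identity = (λ x → ≈⇒~ (M.+ᴹ-identityˡ d x)) , (λ x → ≈⇒~ (M.+ᴹ-identityʳ d x)) }
            ; comm = λ x y → ≈⇒~ (M.+ᴹ-comm d x y) }
          ; isPreleftSemimodule = record
            { *ₗ-cong = *ₗ-cong~
            ; *ₗ-zeroˡ = λ x → ≈⇒~ (M.*ₗ-zeroˡ d x)
            ; *ₗ-distribʳ = λ x k l → ≈⇒~ (M.*ₗ-distribʳ d x k l)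
            ; *ₗ-identityˡ = λ x → ≈⇒~ (M.*ₗ-identityˡ d x)
            ; *ₗ-assoc = λ k l x → ≈⇒~ (M.*ₗ-assoc d k l x)
            ; *ₗ-zeroʳ = λ k → ≈⇒~ (M.*ₗ-zeroʳ d k)
            ; *ₗ-distribˡ = λ k x y → ≈⇒~ (M.*ₗ-distribˡ d k x y) } }
        ; -ᴹ‿cong = -‿cong~
        ; -ᴹ‿inverse = (λ x → ≈⇒~ (M.-ᴹ‿inverseˡ d x)) , (λ x → ≈⇒~ (M.-ᴹ‿inverseʳ d x)) } }

  quotient : GradedAlgebra R a (c ⊔ a ⊔ ℓa ⊔ r)
  quotient = record
    { component     = quotientComponent
    ; one           = one
    ; mul           = mul
    ; mul-cong      = mul-cong~
    ; mul-assoc     = λ e₁ e₂ e₃ e₄ x y z → ≈⇒~ (mul-assoc e₁ e₂ e₃ e₄ x y z)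
    ; mul-identityˡ = λ e x → ≈⇒~ (mul-identityˡ e x)
    ; mul-identityʳ = λ e x → ≈⇒~ (mul-identityʳ e x)
    ; mul-distribˡ  = λ e x y z → ≈⇒~ (mul-distribˡ e x y z)
    ; mul-distribʳ  = λ e x y z → ≈⇒~ (mul-distribʳ e x y z)
    ; mul-scalarˡ   = λ e k x y → ≈⇒~ (mul-scalarˡ e k x y)
    ; mul-scalarʳ   = λ e k x y → ≈⇒~ (mul-scalarʳ e k x y)
    }

module Exterior (R : CommutativeRing c ℓ) (G : Set g) where
  private module R = CommutativeRing R

  infixl 6 _⊞_
  infixr 7 _·_
  infix  4 _≋_

  data Term : ℕ → Set (c ⊔ g) where
    e    : G → Term 1
    𝟙    : Term 0
    𝟘    : ∀ {d} → Term d
    _⊞_  : ∀ {d} → Term d → Term d → Term d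
    _·_  : ∀ {d} → R.Carrier → Term d → Term d
    prod : ∀ {m n d} → m + n ≡ d → Term m → Term n → Term d

  -- The least congruence making Term an associative unital algebra in which
  -- generators anticommute and square to zero; the last condition is
  -- independent in characteristic 2.
  data _≋_ : ∀ {d} → Term d → Term d → Set (c ⊔ ℓ ⊔ g) where
    ≋-refl  : ∀ {d} {x : Term d} → x ≋ x
    ≋-sym   : ∀ {d} {x y : Term d} → x ≋ y → y ≋ x
    ≋-trans : ∀ {d} {x y z : Term d} → x ≋ y → y ≋ z → x ≋ z

    ⊞-cong    : ∀ {d} {x x′ y y′ : Term d} → x ≋ x′ → y ≋ y′ → x ⊞ y ≋ x′ ⊞ y′
    ·-cong    : ∀ {d k k′} {x x′ : Term d} → k R.≈ k′ → x ≋ x′ → k · x ≋ k′ · x′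
    prod-cong : ∀ {m n d} (eq : m + n ≡ d) {x x′ : Term m} {y y′ : Term n} →
                x ≋ x′ → y ≋ y′ → prod eq x y ≋ prod eq x′ y′

    ⊞-assoc     : ∀ {d} (x y z : Term d) → (x ⊞ y) ⊞ z ≋ x ⊞ (y ⊞ z)
    ⊞-comm      : ∀ {d} (x y : Term d) → x ⊞ y ≋ y ⊞ x
    ⊞-identityˡ : ∀ {d} (x : Term d) → 𝟘 ⊞ x ≋ x
    ·-zeroˡ     : ∀ {d} (x : Term d) → R.0# · x ≋ 𝟘
    ·-zeroʳ     : ∀ {d} k → k · 𝟘 {d} ≋ 𝟘
    ·-identity  : ∀ {d} (x : Term d) → R.1# · x ≋ x
    ·-assoc     : ∀ {d} k l (x : Term d) → (k R.* l) · x ≋ k · (l · x)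
    ·-distribˡ  : ∀ {d} k (x y : Term d) → k · (x ⊞ y) ≋ k · x ⊞ k · y
    ·-distribʳ  : ∀ {d} (x : Term d) k l → (k R.+ l) · x ≋ k · x ⊞ l · x

    prod-assoc     : ∀ {l m n lm mn d} (e₁ : l + m ≡ lm) (e₂ : lm + n ≡ d)
                     (e₃ : m + n ≡ mn) (e₄ : l + mn ≡ d)
                     (x : Term l) (y : Term m) (z : Term n) →
                     prod e₂ (prod e₁ x y) z ≋ prod e₄ x (prod e₃ y z)
    prod-identityˡ : ∀ {n} (eq : 0 + n ≡ n) (x : Term n) → prod eq 𝟙 x ≋ x
    prod-identityʳ : ∀ {n} (eq : n + 0 ≡ n) (x : Term n) → prod eq x 𝟙 ≋ x
    prod-distribˡ  : ∀ {m n d} (eq : m + n ≡ d) (x : Term m) (y z : Term n) →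
                     prod eq x (y ⊞ z) ≋ prod eq x y ⊞ prod eq x z
    prod-distribʳ  : ∀ {m n d} (eq : m + n ≡ d) (x y : Term m) (z : Term n) →
                     prod eq (x ⊞ y) z ≋ prod eq x z ⊞ prod eq y z
    prod-scalarˡ   : ∀ {m n d} (eq : m + n ≡ d) k (x : Term m) (y : Term n) →
                     prod eq (k · x) y ≋ k · prod eq x y
    prod-scalarʳ   : ∀ {m n d} (eq : m + n ≡ d) k (x : Term m) (y : Term n) →
                     prod eq x (k · y) ≋ k · prod eq x y

    anticommute : ∀ s t → prod refl (e s) (e t) ⊞ prod refl (e t) (e s) ≋ 𝟘
    square-zero : ∀ s → prod refl (e s) (e s) ≋ 𝟘

  private
    ⊞-inverseʳ : ∀ {d} (x : Term d) → x ⊞ (R.- R.1#) · x ≋ 𝟘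
    ⊞-inverseʳ x =
      ≋-trans (⊞-cong (≋-sym (·-identity x)) ≋-refl)
      (≋-trans (≋-sym (·-distribʳ x _ _))
      (≋-trans (·-cong (R.-‿inverseʳ R.1#) ≋-refl) (·-zeroˡ x)))

    exteriorPower : ℕ → LeftModule R.ring (c ⊔ g) (c ⊔ ℓ ⊔ g)
    exteriorPower d = record
      { Carrierᴹ = Term d ; _≈ᴹ_ = _≋_ ; _+ᴹ_ = _⊞_ ; _*ₗ_ = _·_ ; 0ᴹ = 𝟘
      ; -ᴹ_ = (R.- R.1#) ·_
      ; isLeftModule = record
        { isLeftSemimodule = record
          { +ᴹ-isCommutativeMonoid = record
            { isMonoid = record
              { isSemigroup = record
                { isMagma = record
                  { isEquivalence = record { refl = ≋-refl ; sym = ≋-sym ; trans = ≋-trans }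
                  ; ∙-cong = ⊞-cong }
                ; assoc = ⊞-assoc }
              ; identity = ⊞-identityˡ , (λ x → ≋-trans (⊞-comm x 𝟘) (⊞-identityˡ x)) }
            ; comm = ⊞-comm }
          ; isPreleftSemimodule = record
            { *ₗ-cong = ·-cong ; *ₗ-zeroˡ = ·-zeroˡ ; *ₗ-distribʳ = ·-distribʳ
            ; *ₗ-identityˡ = ·-identity ; *ₗ-assoc = ·-assoc ; *ₗ-zeroʳ = ·-zeroʳ
            ; *ₗ-distribˡ = ·-distribˡ } }
        ; -ᴹ‿cong = ·-cong R.refl
        ; -ᴹ‿inverse = (λ x → ≋-trans (⊞-comm _ x) (⊞-inverseʳ x)) , ⊞-inverseʳ } }

  exteriorAlgebra : GradedAlgebra R (c ⊔ g) (c ⊔ ℓ ⊔ g)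
  exteriorAlgebra = record
    { component     = exteriorPower
    ; one           = 𝟙
    ; mul           = prod
    ; mul-cong      = prod-cong
    ; mul-assoc     = prod-assoc
    ; mul-identityˡ = prod-identityˡ
    ; mul-identityʳ = prod-identityʳ
    ; mul-distribˡ  = prod-distribˡ
    ; mul-distribʳ  = prod-distribʳ
    ; mul-scalarˡ   = prod-scalarˡ
    ; mul-scalarʳ   = prod-scalarʳ
    }

  wedge : ∀ {d} → Vector G d → Term d
  wedge {zero}  t = 𝟙
  wedge {suc d} t = prod refl (e (head t)) (wedge (tail t))

  -- Indices start at 0, so the sign of the j-th summand is (-1)^j.
  ∂ : ∀ {d} → Vector G (suc d) → Term d
  ∂ {d} t = sum (λ j → ((R.- R.1#) ^ toℕ j) · wedge (removeAt t j))
    where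
    open Sum (LeftModule.+ᴹ-commutativeMonoid (exteriorPower d)) using (sum)
    open Exp R.semiring using (_^_)

module OrlikSolomon (K : HeytingField c ℓ ℓ₁) {F : OrderedField a ℓa ℓ₂ ℓ₃}
                    {E : EuclideanSpace F v ℓv} {N : ℕ}
                    (𝒜 : Vector (EuclideanSpace.Carrierᴹ E) N) where
  open LinearAlgebra E using (LinearlyDependent)
  open Exterior (fieldRing K) (Fin N)

  -- The empty family is independent, so only non-empty ones occur.
  data Relator : ∀ {d} → Term d → Set (c ⊔ a ⊔ ℓa ⊔ ℓv) where
    ∂-dependent : ∀ {d} (t : Vector (Fin N) (suc d)) → Injective _≡_ _≡_ t →
                  LinearlyDependent (𝒜 ∘ t) → Relator (∂ t)

  𝒪𝒮 : GradedAlgebra (fieldRing K) c (c ⊔ ℓ ⊔ a ⊔ ℓa ⊔ ℓv)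
  𝒪𝒮 = Quotient.quotient exteriorAlgebra Relator

-- Tor^A(K,K) of a connected graded algebra A as the homology of K ⊗_A P, with
-- P the normalised bar resolution P_i = A ⊗ A₊^{⊗ i} of the trivial module K.
-- Here K ⊗_A P_i = A₊^{⊗ i}, with differential
--   [x₁|…|xᵢ] ↦ Σ_{1≤s<i} (-1)^{s-1} [x₁|…|xₛxₛ₊₁|…|xᵢ],
-- the two outer terms being zero because A₊ acts trivially on K.

module Tor {R : CommutativeRing c ℓ} (A : GradedAlgebra R a ℓa) where
  private module R = CommutativeRing R
  open GradedAlgebra A

  infixl 6 _⊞_
  infixr 7 _·_
  infix  4 _≋_

  -- Bar i j is the part of internal degree j of A₊^{⊗ i}:
  -- Bar (1 + i) j = ⨁ Deg (1 + d) ⊗ Bar i j′ over 1 + d + j′ = j.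
  data Bar : ℕ → ℕ → Set (c ⊔ a) where
    []   : Bar 0 0
    cons : ∀ {i d j′ j} → suc d + j′ ≡ j → Deg (suc d) → Bar i j′ → Bar (suc i) j
    𝟘    : ∀ {i j} → Bar i j
    _⊞_  : ∀ {i j} → Bar i j → Bar i j → Bar i j
    _·_  : ∀ {i j} → R.Carrier → Bar i j → Bar i j

  data _≋_ : ∀ {i j} → Bar i j → Bar i j → Set (c ⊔ ℓ ⊔ a ⊔ ℓa) where
    ≋-refl  : ∀ {i j} {x : Bar i j} → x ≋ x
    ≋-sym   : ∀ {i j} {x y : Bar i j} → x ≋ y → y ≋ x
    ≋-trans : ∀ {i j} {x y z : Bar i j} → x ≋ y → y ≋ z → x ≋ z

    ⊞-cong    : ∀ {i j} {x x′ y y′ : Bar i j} → x ≋ x′ → y ≋ y′ → x ⊞ y ≋ x′ ⊞ y′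
    ·-cong    : ∀ {i j k k′} {x x′ : Bar i j} → k R.≈ k′ → x ≋ x′ → k · x ≋ k′ · x′
    cons-cong : ∀ {i d j′ j} (eq : suc d + j′ ≡ j) {u u′ : Deg (suc d)} {x x′ : Bar i j′} →
                u ≈ᴹ u′ → x ≋ x′ → cons eq u x ≋ cons eq u′ x′

    ⊞-assoc     : ∀ {i j} (x y z : Bar i j) → (x ⊞ y) ⊞ z ≋ x ⊞ (y ⊞ z)
    ⊞-comm      : ∀ {i j} (x y : Bar i j) → x ⊞ y ≋ y ⊞ x
    ⊞-identityˡ : ∀ {i j} (x : Bar i j) → 𝟘 ⊞ x ≋ x
    ·-zeroˡ     : ∀ {i j} (x : Bar i j) → R.0# · x ≋ 𝟘
    ·-zeroʳ     : ∀ {i j} k → k · 𝟘 {i} {j} ≋ 𝟘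
    ·-identity  : ∀ {i j} (x : Bar i j) → R.1# · x ≋ x
    ·-assoc     : ∀ {i j} k l (x : Bar i j) → (k R.* l) · x ≋ k · (l · x)
    ·-distribˡ  : ∀ {i j} k (x y : Bar i j) → k · (x ⊞ y) ≋ k · x ⊞ k · y
    ·-distribʳ  : ∀ {i j} (x : Bar i j) k l → (k R.+ l) · x ≋ k · x ⊞ l · x

    cons-distribˡ : ∀ {i d j′ j} (eq : suc d + j′ ≡ j) (u : Deg (suc d)) (x y : Bar i j′) →
                    cons eq u (x ⊞ y) ≋ cons eq u x ⊞ cons eq u y
    cons-distribʳ : ∀ {i d j′ j} (eq : suc d + j′ ≡ j) (u w : Deg (suc d)) (x : Bar i j′) →
                    cons eq (u +ᴹ w) x ≋ cons eq u x ⊞ cons eq w x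
    cons-scalarˡ  : ∀ {i d j′ j} (eq : suc d + j′ ≡ j) k (u : Deg (suc d)) (x : Bar i j′) →
                    cons eq (k *ₗ u) x ≋ k · cons eq u x
    cons-scalarʳ  : ∀ {i d j′ j} (eq : suc d + j′ ≡ j) k (u : Deg (suc d)) (x : Bar i j′) →
                    cons eq u (k · x) ≋ k · cons eq u x

  -- Multiplies the first tensor factor by u on the left.
  absorb : ∀ {i d j′ j} → suc d + j′ ≡ j → Deg (suc d) → Bar (suc i) j′ → Bar (suc i) j
  absorb {d = d} eq u (cons {d = d′} {j′ = j″} eq′ w x) =
    cons (trans (ℕ.+-assoc (suc d) (suc d′) j″) (trans (cong (λ n → suc d + n) eq′) eq))
         (mul refl u w) x
  absorb eq u 𝟘       = 𝟘
  absorb eq u (x ⊞ y) = absorb eq u x ⊞ absorb eq u y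
  absorb eq u (k · x) = k · absorb eq u x

  δ : ∀ {i j} → Bar (suc i) j → Bar i j
  δ 𝟘       = 𝟘
  δ (x ⊞ y) = δ x ⊞ δ y
  δ (k · x) = k · δ x
  δ {zero}  (cons eq u x) = 𝟘
  δ {suc i} (cons eq u x) = absorb eq u x ⊞ (R.- R.1#) · cons eq u (δ x)

  IsCycle : ∀ {i j} → Bar i j → Set (c ⊔ ℓ ⊔ a ⊔ ℓa)
  IsCycle {zero}  x = Unit.⊤
  IsCycle {suc i} x = δ x ≋ 𝟘

  IsBoundary : ∀ {i j} → Bar i j → Set (c ⊔ ℓ ⊔ a ⊔ ℓa)
  IsBoundary {i} {j} x = ∃[ y ] δ {i} {j} y ≋ x

  TorVanishes : ℕ → ℕ → Set (c ⊔ ℓ ⊔ a ⊔ ℓa)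
  TorVanishes i j = (x : Bar i j) → IsCycle x → IsBoundary x

Koszul : (K : HeytingField c ℓ ℓ₁) → GradedAlgebra (fieldRing K) a ℓa → Set (c ⊔ ℓ ⊔ a ⊔ ℓa)
Koszul K A = ∀ i j → i ≢ j → Tor.TorVanishes A i j

{-# OPTIONS --safe #-}
module Submission where

-- If 𝒜 is supersolvable, the line through two atoms x, y of one part contains an atom z of an earlier part, so that
-- e_x e_y = e_z (e_y - e_x). Hence the monomials with at most one factor from each part form a basis of the
-- Orlik-Solomon algebra, and peeling off first factors contracts the bar complex outside the diagonal.
-- Conversely, call a simple root w good if the line through any two roots of I involving w contains a root below one of
-- them that does not involve w; removing good simple roots one at a time yields the partition. An end of the Dynkin
-- diagram is good unless I contains one of two configurations, of types D₄ and F₄, with a dependency among five roots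
-- that produces a nonzero class in Tor₂ of degree 4.

open import Defs
open import Algebra.Apartness.Bundles using (HeytingField; HeytingCommutativeRing)
open import Algebra.Bundles using (AbelianGroup; CommutativeRing; Ring)
open import Algebra.Module.Bundles using (LeftModule)
import Algebra.Properties.AbelianGroup as AbelianGroupProperties
import Algebra.Properties.CommutativeMonoid.Sum as Sum
import Algebra.Properties.Monoid.Mult as Mult
import Algebra.Properties.Ring as RingProperties
import Algebra.Properties.Semiring.Exp as Exp
open import Data.Bool.Base using (Bool; true; false; T; _∧_; _∨_; not)
import Data.Empty.Polymorphic as Empty
open import Data.Empty using (⊥; ⊥-elim)
open import Data.Fin.Base as Fin using (Fin; zero; suc; toℕ)
import Data.Fin.Properties as Fin
open import Data.Fin.Subset using (Subset; _∈_; _∉_; _⊆_)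
open import Data.Integer.Base as Z using (ℤ; +_; -[1+_]) renaming (0ℤ to 0z; 1ℤ to 1z)
import Data.Integer.Properties as Z
open import Data.List.Base using (List; []; _∷_)
open import Data.List.Relation.Binary.Permutation.Propositional as Perm using (_↭_)
open import Data.Maybe.Base using (Maybe; just; nothing)
open import Data.Nat.Base as ℕ using (ℕ; zero; suc; _+_; _≤_; _<_; z≤n; s≤s)
open import Data.Nat.Induction using (<-wellFounded)
import Data.Nat.Properties as ℕ
open import Data.Product.Base using (_×_; _,_; ∃; ∃-syntax; ∃₂) renaming (proj₁ to fst; proj₂ to snd)
open import Data.Sum.Base using (_⊎_; [_,_]′) renaming (inj₁ to inl; inj₂ to inr)
open import Data.Unit.Base using (tt)
import Data.Unit.Polymorphic.Base as Unit
open import Data.Vec.Base as Vec using (Vec; []; _∷_)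
import Data.Vec.Functional as Vector
open import Data.Vec.Functional using (Vector)
open import Function.Base using (_∘_; id; _$_)
open import Function.Bundles using (_⇔_; mk⇔)
open import Function.Definitions using (Injective)
open import Induction.WellFounded using (Acc; acc)
open import Level using (Level; _⊔_; 0ℓ)
open import Relation.Binary.Definitions using (tri<; tri≈; tri>; Tri)
open import Relation.Binary.PropositionalEquality.Core using (_≡_; _≢_; refl; sym; trans; cong; cong₂; subst; subst₂)
import Relation.Binary.Reasoning.Setoid as SetoidReasoning
open import Relation.Nullary using (¬_; Dec; yes; no; does) renaming (contradiction to contra)
open import Relation.Nullary.Decidable using (_×-dec_; ¬?; map′)

-- That the monomials span is immediate from the quadratic relations. Their independence is not, and
-- the quadratic relations by themselves say nothing about the boundaries of longer dependent sets.
-- Both are settled by one explicit module, built part by part, on which every e_m acts and which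
-- carries a derivation D with D e_m + e_m D = 1: a dependent word acts as zero because repeated use
-- of the quadratic relation lowers the levels of its factors, and applying D to this vanishing word
-- kills its boundary. In the converse no classification of root systems is invoked. A candidate for
-- w is an end of a dominant root θ: in 2 = Σ θ_i ⟨α_i, θ^∨⟩ all terms are nonnegative, so very few
-- simple roots can pair positively with θ. Only subsystems of type G₂, D₄ and F₄ are enumerated. In
-- types G₂ and F₄ a further node is impossible, because it would form too large an angle with some
-- enumerated root. The comparison with an exterior algebra is multiplicative only up to degree 3.
-- In degree 4 the boundary of the five-term dependency is zero in the Orlik-Solomon algebra while
-- its image is not, and it is this failure that the Tor class records.

infixr 5 _⨾_
_⨾_ : ∀ {a} {A : Set a} {x y z : A} → x ≡ y → y ≡ z → x ≡ z
_⨾_ = trans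

-- Abelian groups, modules and linear maps.

module Renamed{c ℓ m ℓm}{R : Ring c ℓ}(M : LeftModule R m ℓm)where
 open LeftModule M public using()renaming(≈ᴹ-trans to infixr 5 _⊚_; ≈ᴹ-sym to sm; ≈ᴹ-refl to rf; +ᴹ-cong to +≈; +ᴹ-congˡ to +≈ˡ; +ᴹ-congʳ to +≈ʳ; -ᴹ‿cong to -≈; +ᴹ-identityʳ to +0; +ᴹ-identityˡ to 0+; *ₗ-identityˡ to 1*)

-- Proof by reflection: an expression is normalised to its vector of integer coefficients, and
-- `solve` only asks that two such closed vectors agree, which `refl` settles.
module AbelianGroupSolver{c ℓ}(G : AbelianGroup c ℓ)where
 open AbelianGroup G
 open AbelianGroupProperties G using(⁻¹-∙-comm; ε⁻¹≈ε; ⁻¹-involutive)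
 open Mult monoid using(×-homo-+)renaming(_×_ to _times_)
 open SetoidReasoning setoid

 infixl 6 _:+_
 infixr 8 :-_

 data Expr(n : ℕ) : Set where
  #_ : Fin n -> Expr n
  _:+_ : Expr n -> Expr n -> Expr n
  :-_ : Expr n -> Expr n
  :0 : Expr n

 ⟦_⟧ : ∀{n} -> Expr n -> Vec Carrier n -> Carrier
 ⟦ # i ⟧ ρ = Vec.lookup ρ i
 ⟦ s :+ t ⟧ ρ = ⟦ s ⟧ ρ ∙ ⟦ t ⟧ ρ
 ⟦ :- s ⟧ ρ = ⟦ s ⟧ ρ ⁻¹
 ⟦ :0 ⟧ ρ = ε

 interchange : ∀ a b x y →(a ∙ b)∙(x ∙ y)≈(a ∙ x)∙(b ∙ y)
 interchange a b x y = begin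
  (a ∙ b)∙(x ∙ y)≈⟨ assoc a b _ ⟩
  a ∙(b ∙(x ∙ y))≈⟨ ∙-congˡ(assoc b x y)⟨
  a ∙((b ∙ x)∙ y)≈⟨ ∙-congˡ(∙-congʳ(comm b x))⟩
  a ∙((x ∙ b)∙ y)≈⟨ ∙-congˡ(assoc x b y)⟩
  a ∙(x ∙(b ∙ y))≈⟨ assoc a x _ ⟨
  (a ∙ x)∙(b ∙ y)∎

 infixr 8 _•_
 _•_ : ℤ -> Carrier -> Carrier
 (+ n)• x = n times x
 -[1+ n ] • x =(suc n times x)⁻¹

 ⊖-• : ∀ m n x →(m Z.⊖ n)• x ≈ m times x ∙(n times x)⁻¹
 ⊖-• zero zero x = sym'(inverseʳ ε)where sym' = AbelianGroup.sym G
 ⊖-• zero(suc n)x = AbelianGroup.sym G(identityˡ _)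
 ⊖-•(suc m)zero x = AbelianGroup.sym G(AbelianGroup.trans G(∙-congˡ ε⁻¹≈ε)(identityʳ _))
 ⊖-•(suc m)(suc n)x rewrite Z.[1+m]⊖[1+n]≡m⊖n m n = begin
  (m Z.⊖ n)• x ≈⟨ ⊖-• m n x ⟩
  m times x ∙(n times x)⁻¹ ≈⟨ identityˡ _ ⟨
  ε ∙(m times x ∙(n times x)⁻¹)≈⟨ ∙-congʳ(inverseʳ x)⟨
  (x ∙ x ⁻¹)∙(m times x ∙(n times x)⁻¹)≈⟨ interchange _ _ _ _ ⟩
  (x ∙ m times x)∙(x ⁻¹ ∙(n times x)⁻¹)≈⟨ ∙-congˡ(⁻¹-∙-comm _ _)⟩
  (x ∙ m times x)∙(x ∙ n times x)⁻¹ ∎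

 •-+ : ∀ a b x →(a Z.+ b)• x ≈ a • x ∙ b • x
 •-+(+ m)(+ n)x = ×-homo-+ x m n
 •-+(+ m)-[1+ n ] x = ⊖-• m(suc n)x
 •-+ -[1+ m ](+ n)x = AbelianGroup.trans G(⊖-• n(suc m)x)(comm _ _)
 •-+ -[1+ m ] -[1+ n ] x = AbelianGroup.trans G(⁻¹-cong(begin
  x ∙(x ∙(m + n)times x)≈⟨ assoc x x _ ⟨
  (x ∙ x)∙(m + n)times x ≈⟨ ∙-congˡ(×-homo-+ x m n)⟩
  (x ∙ x)∙(m times x ∙ n times x)≈⟨ interchange _ _ _ _ ⟩
  (x ∙ m times x)∙(x ∙ n times x)∎))(AbelianGroup.sym G(⁻¹-∙-comm _ _))

 •-neg : ∀ a x →(Z.- a)• x ≈(a • x)⁻¹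
 •-neg(+ zero)x = AbelianGroup.sym G ε⁻¹≈ε
 •-neg Z.+[1+ n ] x = AbelianGroup.refl G
 •-neg -[1+ n ] x = AbelianGroup.sym G(⁻¹-involutive _)

 evalᵛ : ∀{n} -> Vec ℤ n -> Vec Carrier n -> Carrier
 evalᵛ [] [] = ε
 evalᵛ(a ∷ as)(x ∷ ρ) = a • x ∙ evalᵛ as ρ

 coefficients : ∀{n} -> Expr n -> Vec ℤ n
 coefficients(# i) = Vec.replicate _ 0z Vec.[ i ]≔ 1z
 coefficients(s :+ t) = Vec.zipWith Z._+_(coefficients s)(coefficients t)
 coefficients(:- s) = Vec.map Z.-_(coefficients s)
 coefficients :0 = Vec.replicate _ 0z

 evalᵛ-0 : ∀{n}(ρ : Vec Carrier n)-> evalᵛ(Vec.replicate n 0z)ρ ≈ ε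
 evalᵛ-0 [] = AbelianGroup.refl G
 evalᵛ-0(x ∷ ρ) = AbelianGroup.trans G(identityˡ _)(evalᵛ-0 ρ)

 evalᵛ-var : ∀{n}(i : Fin n)ρ -> evalᵛ(Vec.replicate n 0z Vec.[ i ]≔ 1z)ρ ≈ Vec.lookup ρ i
 evalᵛ-var zero(x ∷ ρ) = AbelianGroup.trans G(∙-cong(identityʳ x)(evalᵛ-0 ρ))(identityʳ x)
 evalᵛ-var(suc i)(x ∷ ρ) = AbelianGroup.trans G(identityˡ _)(evalᵛ-var i ρ)

 evalᵛ-+ : ∀{n}(a b : Vec ℤ n)ρ -> evalᵛ(Vec.zipWith Z._+_ a b)ρ ≈ evalᵛ a ρ ∙ evalᵛ b ρ
 evalᵛ-+ [] [] [] = AbelianGroup.sym G(identityʳ ε)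
 evalᵛ-+(a ∷ p)(b ∷ q)(x ∷ ρ) =
  AbelianGroup.trans G(∙-cong(•-+ a b x)(evalᵛ-+ p q ρ))(interchange _ _ _ _)

 evalᵛ-neg : ∀{n}(a : Vec ℤ n)ρ -> evalᵛ(Vec.map Z.-_ a)ρ ≈ evalᵛ a ρ ⁻¹
 evalᵛ-neg [] [] = AbelianGroup.sym G ε⁻¹≈ε
 evalᵛ-neg(a ∷ p)(x ∷ ρ) =
  AbelianGroup.trans G(∙-cong(•-neg a x)(evalᵛ-neg p ρ))(⁻¹-∙-comm _ _)

 correct : ∀{n}(s : Expr n)ρ -> evalᵛ(coefficients s)ρ ≈ ⟦ s ⟧ ρ
 correct(# i)ρ = evalᵛ-var i ρ
 correct(s :+ t)ρ = AbelianGroup.trans G(evalᵛ-+(coefficients s)_ ρ)(∙-cong(correct s ρ)(correct t ρ))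
 correct(:- s)ρ = AbelianGroup.trans G(evalᵛ-neg(coefficients s)ρ)(⁻¹-cong(correct s ρ))
 correct :0 ρ = evalᵛ-0 ρ

 solve : ∀{n}(ρ : Vec Carrier n)(s t : Expr n)-> coefficients s ≡ coefficients t -> ⟦ s ⟧ ρ ≈ ⟦ t ⟧ ρ
 solve ρ s t eq = begin
  ⟦ s ⟧ ρ ≈⟨ correct s ρ ⟨
  evalᵛ(coefficients s)ρ ≡⟨ cong(\ a -> evalᵛ a ρ)eq ⟩
  evalᵛ(coefficients t)ρ ≈⟨ correct t ρ ⟩
  ⟦ t ⟧ ρ ∎

 pattern v0 = # zero
 pattern v1 = # suc zero
 pattern v2 = # suc(suc zero)
 pattern v3 = # suc(suc(suc zero))
 pattern v4 = # suc(suc(suc(suc zero)))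
 pattern v5 = # suc(suc(suc(suc(suc zero))))

module ModuleTheory{c ℓ m ℓm}{R : Ring c ℓ}(M : LeftModule R m ℓm)where
 private module R = Ring R
 open LeftModule M
 open Renamed M
 open AbelianGroupProperties +ᴹ-abelianGroup public
  using()renaming(inverseˡ-unique to -ᴹ-unique; ε⁻¹≈ε to -0≈0; ⁻¹-∙-comm to -ᴹ-+; ⁻¹-involutive to -ᴹ-invol)
 open AbelianGroupSolver +ᴹ-abelianGroup public using(solve; #_; _:+_; :-_; :0)
 open Sum +ᴹ-commutativeMonoid public using(sum; sum-cong-≋; ∑-distrib-+; sum-replicate-zero; sum-remove; ∑-comm)
 open SetoidReasoning ≈ᴹ-setoid

 -1*ₗ : ∀ x →(R.- R.1#)*ₗ x ≈ᴹ -ᴹ x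
 -1*ₗ x = -ᴹ-unique _ _(begin
  (R.- R.1#)*ₗ x +ᴹ x ≈⟨ +≈ˡ(1* x)⟨
  (R.- R.1#)*ₗ x +ᴹ R.1# *ₗ x ≈⟨ *ₗ-distribʳ x _ _ ⟨
  ((R.- R.1#)R.+ R.1#)*ₗ x ≈⟨ *ₗ-congʳ(R.-‿inverseˡ R.1#)⟩
  R.0# *ₗ x ≈⟨ *ₗ-zeroˡ x ⟩
  0ᴹ ∎)

 *ₗ-neg : ∀ k x -> k *ₗ(-ᴹ x)≈ᴹ -ᴹ(k *ₗ x)
 *ₗ-neg k x = -ᴹ-unique _ _(begin
  k *ₗ(-ᴹ x)+ᴹ k *ₗ x ≈⟨ *ₗ-distribˡ k _ _ ⟨
  k *ₗ(-ᴹ x +ᴹ x)≈⟨ *ₗ-congˡ(-ᴹ‿inverseˡ x)⟩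
  k *ₗ 0ᴹ ≈⟨ *ₗ-zeroʳ k ⟩
  0ᴹ ∎)

 sum-zero : ∀{n}{f : Vector Carrierᴹ n} →(∀ i -> f i ≈ᴹ 0ᴹ)-> sum f ≈ᴹ 0ᴹ
 sum-zero{n} f≈0 = sum-cong-≋ f≈0 ⊚ sum-replicate-zero n

 -- An Iverson bracket: a sum over the atoms of one level becomes a sum over all of `Fin n` with
 -- guarded terms, so that no level is ever reindexed.
 infixr 3 _⊢_
 _⊢_ : ∀{p}{P : Set p} -> Dec P -> Carrierᴹ -> Carrierᴹ
 yes _ ⊢ x = x
 no _ ⊢ x = 0ᴹ

 ⊢-yes : ∀{p}{P : Set p}(d : Dec P){x} -> P →(d ⊢ x)≈ᴹ x
 ⊢-yes(yes _)p = rf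
 ⊢-yes(no ¬p)p = contra p ¬p

 ⊢-no : ∀{p}{P : Set p}(d : Dec P){x} -> ¬ P →(d ⊢ x)≈ᴹ 0ᴹ
 ⊢-no(yes p)¬p = contra p ¬p
 ⊢-no(no _)¬p = rf

 ⊢-cong : ∀{p}{P : Set p}(d : Dec P){x y} →(P -> x ≈ᴹ y)→(d ⊢ x)≈ᴹ(d ⊢ y)
 ⊢-cong(yes p)h = h p
 ⊢-cong(no _)h = rf

 ⊢-+ : ∀{p}{P : Set p}(d : Dec P)x y →(d ⊢(x +ᴹ y))≈ᴹ((d ⊢ x)+ᴹ(d ⊢ y))
 ⊢-+(yes p)x y = rf
 ⊢-+(no _)x y = sm(+0 _)

 module _{n}{p}{P : Fin n -> Set p} where
  ∑ :(∀ i -> Dec(P i))-> Vector Carrierᴹ n -> Carrierᴹ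
  ∑ P? f = sum(\ i -> P? i ⊢ f i)

  ∑-cong : ∀ P?{f g} →(∀ i -> P i -> f i ≈ᴹ g i)-> ∑ P? f ≈ᴹ ∑ P? g
  ∑-cong P? h = sum-cong-≋(\ i -> ⊢-cong(P? i)(h i))

  ∑-+ : ∀ P? f g -> ∑ P?(\ i -> f i +ᴹ g i)≈ᴹ ∑ P? f +ᴹ ∑ P? g
  ∑-+ P? f g = sum-cong-≋(\ i -> ⊢-+(P? i)(f i)(g i))⊚
   ∑-distrib-+(\ i -> P? i ⊢ f i)(\ i -> P? i ⊢ g i)

  ∑-zero : ∀ P?{f} →(∀ i -> P i -> f i ≈ᴹ 0ᴹ)-> ∑ P? f ≈ᴹ 0ᴹ
  ∑-zero P?{f} h = sum-zero(\ i -> go i(P? i))where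
   go : ∀ i(d : Dec(P i))→(d ⊢ f i)≈ᴹ 0ᴹ
   go i(yes p) = h i p
   go i(no _) = rf

 ∑-single : ∀{n p}{P : Fin n -> Set p}(P? : ∀ i -> Dec(P i)){f : Vector Carrierᴹ n}(k : Fin n)->
       P k →(∀ i -> P i -> i ≢ k -> f i ≈ᴹ 0ᴹ)-> ∑ P? f ≈ᴹ f k
 ∑-single{suc n}{P = P} P?{f} zero pk h = +≈(⊢-yes(P? zero)pk)
   (∑-zero(\ i -> P?(suc i))(\ i p -> h(suc i)p(\())))⊚ +0 _
 ∑-single{suc n}{P = P} P?{f}(suc k)pk h = +≈ first
   (∑-single(\ i -> P?(suc i))k pk(\ i p i≢k -> h(suc i)p(i≢k ∘ Fin.suc-injective)))⊚ 0+ _ where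
  first :(P? zero ⊢ f zero)≈ᴹ 0ᴹ
  first with P? zero
  ... | yes p = h zero p(\())
  ... | no _ = rf

record Lin{c ℓ m ℓm n ℓn}{R : Ring c ℓ}(M : LeftModule R m ℓm)(N : LeftModule R n ℓn)
       (f : LeftModule.Carrierᴹ M -> LeftModule.Carrierᴹ N) : Set(c ⊔ m ⊔ ℓm ⊔ ℓn)where
 private
  module M = LeftModule M
  module N = LeftModule N
  module MT = ModuleTheory M
  module NT = ModuleTheory N
 field
  map-cong : ∀{x y} -> x M.≈ᴹ y -> f x N.≈ᴹ f y
  map-+ : ∀ x y -> f(x M.+ᴹ y)N.≈ᴹ f x N.+ᴹ f y
  map-* : ∀ k x -> f(k M.*ₗ x)N.≈ᴹ k N.*ₗ f x

 map-0 : f M.0ᴹ N.≈ᴹ N.0ᴹ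
 map-0 = N.≈ᴹ-trans(map-cong(M.≈ᴹ-sym(M.*ₗ-zeroˡ M.0ᴹ)))(N.≈ᴹ-trans(map-* _ _)(N.*ₗ-zeroˡ _))

 map-≈0 : ∀{x} -> x M.≈ᴹ M.0ᴹ -> f x N.≈ᴹ N.0ᴹ
 map-≈0 h = N.≈ᴹ-trans(map-cong h)map-0

 map-neg : ∀ x -> f(M.-ᴹ x)N.≈ᴹ N.-ᴹ f x
 map-neg x = N.≈ᴹ-trans(map-cong(M.≈ᴹ-sym(MT.-1*ₗ x)))(N.≈ᴹ-trans(map-* _ x)(NT.-1*ₗ _))

 map-⊢ : ∀{p}{P : Set p}(d : Dec P)x -> f(d MT.⊢ x)N.≈ᴹ(d NT.⊢ f x)
 map-⊢(yes _)x = N.≈ᴹ-refl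
 map-⊢(no _)x = map-0

 map-sum : ∀{k}(t : Vector M.Carrierᴹ k)-> f(MT.sum t)N.≈ᴹ NT.sum(\ i -> f(t i))
 map-sum{zero} t = map-0
 map-sum{suc k} t = N.≈ᴹ-trans(map-+ _ _)(N.+ᴹ-congˡ(map-sum(Vector.tail t)))

 map-∑ : ∀{k p}{P : Fin k -> Set p}(P? : ∀ i -> Dec(P i))t -> f(MT.∑ P? t)N.≈ᴹ NT.∑ P?(\ i -> f(t i))
 map-∑ P? t = N.≈ᴹ-trans(map-sum(\ i -> P? i MT.⊢ t i))(NT.sum-cong-≋(\ i -> map-⊢(P? i)(t i)))

module _{c ℓ m ℓm n ℓn p ℓp}{R : Ring c ℓ}{M : LeftModule R m ℓm}{N : LeftModule R n ℓn}{P : LeftModule R p ℓp} where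
 private
  module P = LeftModule P

 ∘-lin : ∀{f g} -> Lin N P f -> Lin M N g -> Lin M P(f ∘ g)
 ∘-lin F G = record
  { map-cong = F.map-cong ∘ G.map-cong
  ; map-+ = \ x y -> P.≈ᴹ-trans(F.map-cong(G.map-+ x y))(F.map-+ _ _)
  ; map-* = \ k x -> P.≈ᴹ-trans(F.map-cong(G.map-* k x))(F.map-* _ _)} where
  module F = Lin F
  module G = Lin G

module _{c ℓ m ℓm n ℓn}{R : CommutativeRing c ℓ}(M : LeftModule(CommutativeRing.ring R)m ℓm)
     (N : LeftModule(CommutativeRing.ring R)n ℓn)where
 private
  module R = CommutativeRing R
  module M = LeftModule M
  module N = LeftModule N
  module NT = ModuleTheory N

 zero-lin : Lin M N(\ _ -> N.0ᴹ)
 zero-lin = record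
  { map-cong = \ _ -> N.≈ᴹ-refl
  ; map-+ = \ _ _ -> N.≈ᴹ-sym(N.+ᴹ-identityʳ _)
  ; map-* = \ _ _ -> N.≈ᴹ-sym(N.*ₗ-zeroʳ _)}

 +-lin : ∀{f g} -> Lin M N f -> Lin M N g -> Lin M N(\ x -> f x N.+ᴹ g x)
 +-lin F G = record
  { map-cong = \ h -> N.+ᴹ-cong(F.map-cong h)(G.map-cong h)
  ; map-+ = \ x y -> N.≈ᴹ-trans(N.+ᴹ-cong(F.map-+ x y)(G.map-+ x y))
    (AbelianGroupSolver.interchange N.+ᴹ-abelianGroup _ _ _ _)
  ; map-* = \ k x -> N.≈ᴹ-trans(N.+ᴹ-cong(F.map-* k x)(G.map-* k x))(N.≈ᴹ-sym(N.*ₗ-distribˡ k _ _))} where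
  module F = Lin F
  module G = Lin G

 neg-lin : ∀{f} -> Lin M N f -> Lin M N(\ x -> N.-ᴹ f x)
 neg-lin F = record
  { map-cong = \ h -> N.-ᴹ‿cong(F.map-cong h)
  ; map-+ = \ x y -> N.≈ᴹ-trans(N.-ᴹ‿cong(F.map-+ x y))(N.≈ᴹ-sym(NT.-ᴹ-+ _ _))
  ; map-* = \ k x -> N.≈ᴹ-trans(N.-ᴹ‿cong(F.map-* k x))(N.≈ᴹ-sym(NT.*ₗ-neg k _))}
  where module F = Lin F

 ⊢-lin : ∀{p}{P : Set p}(d : Dec P){f} -> Lin M N f -> Lin M N(\ x -> d NT.⊢ f x)
 ⊢-lin(yes _)F = F
 ⊢-lin(no _)F = zero-lin

 sum-lin : ∀{k}{f : Fin k -> M.Carrierᴹ -> N.Carrierᴹ} →(∀ i -> Lin M N(f i))->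
        Lin M N(\ x -> NT.sum(\ i -> f i x))
 sum-lin{zero} F = zero-lin
 sum-lin{suc k} F = +-lin(F zero)(sum-lin(\ i -> F(suc i)))

 ∑-lin : ∀{k p}{P : Fin k -> Set p}(P? : ∀ i -> Dec(P i)){f : Fin k -> M.Carrierᴹ -> N.Carrierᴹ} ->
       (∀ i -> Lin M N(f i))-> Lin M N(\ x -> NT.∑ P?(\ i -> f i x))
 ∑-lin P? F = sum-lin(\ i -> ⊢-lin(P? i)(F i))

id-lin : ∀{c ℓ m ℓm}{R : Ring c ℓ}(M : LeftModule R m ℓm)-> Lin M M id
id-lin M = record{ map-cong = id; map-+ = \ _ _ -> LeftModule.≈ᴹ-refl M; map-* = \ _ _ -> LeftModule.≈ᴹ-refl M }

-- Fibrations of atoms and the stagewise model of the Orlik-Solomon algebra.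

-- The matroid data of a supersolvable arrangement: the index of the part of each atom and,
-- for two atoms x ≠ y of the same part, the atom of an earlier part on the line through x and y.
record Fibration(N : ℕ)d : Set(Level.suc d)where
 field
  lev : Fin N -> ℕ
  third : Fin N -> Fin N -> Fin N
  thd-sym : ∀ x y -> third x y ≡ third y x
  thd-lower : ∀{x y} -> x ≢ y -> lev x ≡ lev y -> lev(third x y)< lev x
  -- Abstract linear dependence of a list in which repetitions are allowed; the closure properties
  -- that follow are the only linear algebra that enters the model.
  Dep : List(Fin N)-> Set d
  Dep-resp : ∀{s t} -> s ↭ t -> Dep s -> Dep t
  Dep-collide : ∀{t} -> Dep t -> ∃ \ x -> ∃ \ y -> ∃ \ u -> t ↭ x ∷ y ∷ u × lev x ≡ lev y
  Dep-thd : ∀{x y u} -> x ≢ y -> lev x ≡ lev y -> Dep(x ∷ y ∷ u)-> Dep(third x y ∷ y ∷ u)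
  Dep-triangle : ∀{x y z} -> x ≢ y -> x ≢ z -> y ≢ z -> lev x ≡ lev y -> lev x ≡ lev z ->
          Dep(third x y ∷ third x z ∷ third y z ∷ [])

-- A model of the Orlik-Solomon algebra on the atoms of level < l, acting on itself: E m is left
-- multiplication by e_m, g the parity involution and D the derivation with D e_m = 1.
module Representation{c ℓ ℓd}(R : CommutativeRing c ℓ){N : ℕ}(𝓕 : Fibration N ℓd)where
 open Fibration 𝓕
 private module R = CommutativeRing R

 record Stage(l : ℕ) : Set(Level.suc(c ⊔ ℓ))where
  field
   M : LeftModule R.ring c ℓ
  open LeftModule M public
  open Renamed M public
  open ModuleTheory M public
  field
   E : Fin N -> Carrierᴹ -> Carrierᴹ
   g D : Carrierᴹ -> Carrierᴹ
   E-lin : ∀ m -> Lin M M(E m)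
   g-lin : Lin M M g
   D-lin : Lin M M D
   gg : ∀ v -> g(g v)≈ᴹ v
   gE : ∀ m v -> g(E m v)≈ᴹ -ᴹ E m(g v)
   gD : ∀ v -> g(D v)≈ᴹ -ᴹ D(g v)
   DE : ∀ m v -> lev m < l -> D(E m v)+ᴹ E m(D v)≈ᴹ v
   E-square : ∀ m v -> E m(E m v)≈ᴹ 0ᴹ
   E-anti : ∀ x y v -> E x(E y v)+ᴹ E y(E x v)≈ᴹ 0ᴹ
   E-thd : ∀{x y} v -> x ≢ y -> lev x ≡ lev y -> E x(E y v)≈ᴹ E(third x y)(E y v +ᴹ -ᴹ E x v)

  module E m = Lin(E-lin m)
  module g = Lin g-lin
  module D = Lin D-lin
  open SetoidReasoning ≈ᴹ-setoid

  E* ∂* : List(Fin N)-> Carrierᴹ -> Carrierᴹ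
  E* [] v = v
  E*(t ∷ u)v = E t(E* u v)
  ∂* [] v = 0ᴹ
  ∂*(t ∷ u)v = E* u v +ᴹ -ᴹ E t(∂* u v)

  Vanishes : List(Fin N)-> Set(c ⊔ ℓ)
  Vanishes t = ∀ v -> E* t v ≈ᴹ 0ᴹ

  E*-cong : ∀ t{v w} -> v ≈ᴹ w -> E* t v ≈ᴹ E* t w
  E*-cong [] h = h
  E*-cong(t ∷ u)h = E.map-cong t(E*-cong u h)

  swap-anti : ∀ x y v -> E x(E y v)≈ᴹ -ᴹ E y(E x v)
  swap-anti x y v = -ᴹ-unique _ _(E-anti x y v)

  E*-↭ : ∀{s t} -> s ↭ t -> ∀ v -> E* s v ≈ᴹ E* t v ⊎ E* s v ≈ᴹ -ᴹ E* t v
  E*-↭ Perm.refl v = inl rf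
  E*-↭(Perm.prep x p)v with E*-↭ p v
  ... | inl h = inl(E.map-cong x h)
  ... | inr h = inr(E.map-cong x h ⊚ E.map-neg x _)
  E*-↭(Perm.swap x y p)v with E*-↭ p v
  ... | inl h = inr(E.map-cong x(E.map-cong y h)⊚ swap-anti x y _)
  ... | inr h = inl(begin
   E x(E y _)≈⟨ E.map-cong x(E.map-cong y h)⟩
   E x(E y(-ᴹ _))≈⟨ E.map-cong x(E.map-neg y _)⟩
   E x(-ᴹ E y _)≈⟨ E.map-neg x _ ⟩
   -ᴹ E x(E y _)≈⟨ -≈(swap-anti x y _)⟩
   -ᴹ -ᴹ E y(E x _)≈⟨ -ᴹ-invol _ ⟩
   E y(E x _)∎)
  E*-↭(Perm.trans p q)v with E*-↭ p v | E*-↭ q v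
  ... | inl h | inl k = inl(h ⊚ k)
  ... | inl h | inr k = inr(h ⊚ k)
  ... | inr h | inl k = inr(h ⊚ -≈ k)
  ... | inr h | inr k = inl(h ⊚ -≈ k ⊚ -ᴹ-invol _)

  van-↭ : ∀{s t} -> s ↭ t -> Vanishes t -> Vanishes s
  van-↭ p h v with E*-↭ p v
  ... | inl k = k ⊚ h v
  ... | inr k = k ⊚ -≈(h v)⊚ -0≈0

  levels : List(Fin N)-> ℕ
  levels [] = 0
  levels(t ∷ u) = lev t + levels u

  levels-↭ : ∀{s t} -> s ↭ t -> levels s ≡ levels t
  levels-↭ Perm.refl = refl
  levels-↭(Perm.prep x p) = cong(\ n -> lev x + n)(levels-↭ p)
  levels-↭{x ∷ y ∷ s}{_ ∷ _ ∷ t}(Perm.swap x y p) = cong(\ n -> lev x +(lev y + n))(levels-↭ p)⨾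
   sym(ℕ.+-assoc(lev x)(lev y)(levels t))⨾ cong(ℕ._+ levels t)(ℕ.+-comm(lev x)(lev y))⨾ ℕ.+-assoc(lev y)(lev x)(levels t)
  levels-↭(Perm.trans p q) = levels-↭ p ⨾ levels-↭ q

  -- Induction on the sum of the levels. Two factors x, y share a level; either they coincide and
  -- the square vanishes, or e_x e_y = e_z (e_y - e_x) splits the word into two that are again
  -- dependent by `Dep-thd` and have a smaller sum, z being of lower level.
  Dep-van : ∀{t} -> Dep t -> Vanishes t
  Dep-van{t} dep = go t dep(<-wellFounded(levels t))where
   go : ∀ t -> Dep t -> Acc _<_(levels t)-> Vanishes t
   go t dep(acc rs)with Dep-collide dep
   ... | x , y , u , p , lev≡ = van-↭ p reduced where
    dep' = Dep-resp p dep
    reduced : Vanishes(x ∷ y ∷ u)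
    reduced v with x Fin.≟ y
    ... | yes refl = E-square x _
    ... | no x≢y = begin
     E x(E y w)≈⟨ E-thd w x≢y lev≡ ⟩
     E(third x y)(E y w +ᴹ -ᴹ E x w)≈⟨ E.map-+ _ _ _ ⟩
     E(third x y)(E y w)+ᴹ E(third x y)(-ᴹ E x w)≈⟨ +≈ first(E.map-neg _ _ ⊚ -≈ second)⟩
     0ᴹ +ᴹ -ᴹ 0ᴹ ≈⟨ -ᴹ‿inverseʳ 0ᴹ ⟩
     0ᴹ ∎ where
     w = E* u v
     smaller : ∀ z -> lev z ≡ lev x -> lev(third x y)+(lev z + levels u)< levels t
     smaller z eq = subst(\ n -> lev(third x y)+(lev z + levels u)< n)(sym(levels-↭ p))
      (subst(\ n -> lev(third x y)+(n + levels u)< lev x +(lev y + levels u))(sym lev≡ ⨾ sym eq)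
       (ℕ.+-monoˡ-<(lev y + levels u)(thd-lower x≢y lev≡)))
     first = go(third x y ∷ y ∷ u)(Dep-thd x≢y lev≡ dep')(rs(smaller y(sym lev≡)))v
     second = go(third x y ∷ x ∷ u)
      (subst(\ z -> Dep(z ∷ x ∷ u))(thd-sym y x)(Dep-thd(x≢y ∘ sym)(sym lev≡)(Dep-resp(Perm.swap x y Perm.refl)dep')))
      (rs(smaller x refl))v

  data Below : List(Fin N)-> Set where
   [] : Below []
   _∷_ : ∀{t u} -> lev t < l -> Below u -> Below(t ∷ u)

  -- The iterated Leibniz rule. Since g anticommutes with every E, conjugating the word by g
  -- supplies the sign (-1)^length of the last term without mentioning the length.
  D-E* : ∀{t} -> Below t -> ∀ v -> D(E* t v)≈ᴹ ∂* t v +ᴹ g(E* t(g(D v)))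
  D-E* [] v = sm(0+ _ ⊚ gg _)
  D-E*{t ∷ u}(t< ∷ u<)v = begin
   D(E t w)≈⟨ solve(D(E t w)∷ E t(D w)∷ [])(# zero)((# zero :+ # suc zero) :+ :- # suc zero)refl ⟩
   (D(E t w)+ᴹ E t(D w))+ᴹ -ᴹ E t(D w)≈⟨ +≈(DE t w t<)(-≈(E.map-cong t(D-E* u< v)))⟩
   w +ᴹ -ᴹ E t(∂* u v +ᴹ g x)≈⟨ +≈ˡ(-≈(E.map-+ t _ _))⟩
   w +ᴹ -ᴹ(E t(∂* u v)+ᴹ E t(g x))≈⟨ solve(w ∷ E t(∂* u v)∷ E t(g x)∷ [])(# zero :+ :-(# suc zero :+ # suc(suc zero)))((# zero :+ :- # suc zero) :+ :- # suc(suc zero))refl ⟩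
   (w +ᴹ -ᴹ E t(∂* u v))+ᴹ -ᴹ E t(g x)≈⟨ +≈ˡ(gE t x)⟨
   ∂*(t ∷ u)v +ᴹ g(E t x)∎ where
   w = E* u v
   x = E* u(g(D v))

  -- Applying D to a word that acts as zero: by `D-E*` everything but the boundary vanishes. This is
  -- why the generators of the Orlik-Solomon ideal act as zero.
  ∂*-van : ∀{t} -> Below t -> Dep t -> ∀ v -> ∂* t v ≈ᴹ 0ᴹ
  ∂*-van{t} t< dep v = begin
   ∂* t v ≈⟨ +0 _ ⟨
   ∂* t v +ᴹ 0ᴹ ≈⟨ +≈ˡ(g.map-≈0(Dep-van dep _))⟨
   ∂* t v +ᴹ g(E* t(g(D v)))≈⟨ D-E* t< v ⟨
   D(E* t v)≈⟨ D.map-≈0(Dep-van dep v)⟩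
   0ᴹ ∎

 open import Algebra.Module.Construct.TensorUnit using()renaming(leftModule to tensorUnit)

 stage0 : Stage 0
 stage0 = record
  { M = K
  ; E = \ _ _ -> R.0#; g = id; D = \ _ -> R.0#
  ; E-lin = \ _ -> zero-lin{R = R} K K
  ; g-lin = id-lin K
  ; D-lin = zero-lin{R = R} K K
  ; gg = \ _ -> R.refl
  ; gE = \ _ _ -> R.sym KT.-0≈0
  ; gD = \ _ -> R.sym KT.-0≈0
  ; DE = \ _ _()
  ; E-square = \ _ _ -> R.refl
  ; E-anti = \ _ _ _ -> R.+-identityʳ _
  ; E-thd = \ _ _ _ -> R.refl } where
  K = tensorUnit{R = R.ring}
  module KT = ModuleTheory K

 -- The pair (a , b) stands for a + Σ b_x e_x, x ranging over the atoms of level l.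
 module Next{l}(S : Stage l)where
  open Stage S
  open SetoidReasoning ≈ᴹ-setoid

  L? : ∀ x -> Dec(lev x ≡ l)
  L? x = lev x ℕ.≟ l

  Carrier' : Set c
  Carrier' = Carrierᴹ ×(Fin N -> Carrierᴹ)

  -- Coordinates at atoms of other levels carry no meaning, so equality does not look at them.
  _≈'_ : Carrier' -> Carrier' -> Set ℓ
  (a , b)≈'(a' , b') = a ≈ᴹ a' ×(∀ x -> lev x ≡ l -> b x ≈ᴹ b' x)

  M' : LeftModule R.ring c ℓ
  M' = record
   { Carrierᴹ = Carrier'
   ; _≈ᴹ_ = _≈'_
   ; _+ᴹ_ = \(a , b)(a' , b')-> a +ᴹ a' , \ x -> b x +ᴹ b' x
   ; _*ₗ_ = \ k(a , b)-> k *ₗ a , \ x -> k *ₗ b x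
   ; 0ᴹ = 0ᴹ , \ _ -> 0ᴹ
   ; -ᴹ_ = \(a , b)-> -ᴹ a , \ x -> -ᴹ b x
   ; isLeftModule = record
    { isLeftSemimodule = record
     { +ᴹ-isCommutativeMonoid = record
      { isMonoid = record
       { isSemigroup = record
        { isMagma = record
         { isEquivalence = record
          { refl = rf , \ _ _ -> rf
          ; sym = \(p , q)-> sm p , \ x h -> sm(q x h)
          ; trans = \(p , q)(p' , q')-> p ⊚ p' , \ x h -> q x h ⊚ q' x h }
         ; ∙-cong = \(p , q)(p' , q')-> +≈ p p' , \ x h -> +≈(q x h)(q' x h)}
        ; assoc = \ _ _ _ -> +ᴹ-assoc _ _ _ , \ _ _ -> +ᴹ-assoc _ _ _ }
       ; identity =(\ _ -> 0+ _ , \ _ _ -> 0+ _),(\ _ -> +0 _ , \ _ _ -> +0 _)}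
      ; comm = \ _ _ -> +ᴹ-comm _ _ , \ _ _ -> +ᴹ-comm _ _ }
     ; isPreleftSemimodule = record
      { *ₗ-cong = \ k(p , q)-> *ₗ-cong k p , \ x h -> *ₗ-cong k(q x h)
      ; *ₗ-zeroˡ = \ _ -> *ₗ-zeroˡ _ , \ _ _ -> *ₗ-zeroˡ _
      ; *ₗ-distribʳ = \ _ _ _ -> *ₗ-distribʳ _ _ _ , \ _ _ -> *ₗ-distribʳ _ _ _
      ; *ₗ-identityˡ = \ _ -> 1* _ , \ _ _ -> 1* _
      ; *ₗ-assoc = \ _ _ _ -> *ₗ-assoc _ _ _ , \ _ _ -> *ₗ-assoc _ _ _
      ; *ₗ-zeroʳ = \ _ -> *ₗ-zeroʳ _ , \ _ _ -> *ₗ-zeroʳ _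
      ; *ₗ-distribˡ = \ _ _ _ -> *ₗ-distribˡ _ _ _ , \ _ _ -> *ₗ-distribˡ _ _ _ } }
    ; -ᴹ‿cong = \(p , q)-> -≈ p , \ x h -> -≈(q x h)
    ; -ᴹ‿inverse =(\ _ -> -ᴹ‿inverseˡ _ , \ _ _ -> -ᴹ‿inverseˡ _),(\ _ -> -ᴹ‿inverseʳ _ , \ _ _ -> -ᴹ‿inverseʳ _)} }

  module M' = LeftModule M'
  module M'T = ModuleTheory M'

  first-lin : Lin M' M fst
  first-lin = record{ map-cong = fst; map-+ = \ _ _ -> rf; map-* = \ _ _ -> rf }

  pair-lin : ∀{f : Carrier' -> Carrierᴹ}{h : Fin N -> Carrier' -> Carrierᴹ} -> Lin M' M f ->
         (∀ z -> lev z ≡ l -> Lin M' M(h z))-> Lin M' M'(\ v -> f v , \ z -> h z v)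
  pair-lin F H = record
   { map-cong = \ p -> Lin.map-cong F p , \ z q -> Lin.map-cong(H z q)p
   ; map-+ = \ v w -> Lin.map-+ F v w , \ z q -> Lin.map-+(H z q)v w
   ; map-* = \ k v -> Lin.map-* F k v , \ z q -> Lin.map-*(H z q)k v }

  second-lin : ∀ z -> lev z ≡ l -> Lin M' M(\ v -> snd v z)
  second-lin z q = record{ map-cong = \ p -> snd p z q; map-+ = \ _ _ -> rf; map-* = \ _ _ -> rf }

  -- For c = `third m z` one wants e_m (b e_z) = e_c b (e_z - e_m); this is its e_z part. The guard
  -- accounts for e_m e_m = 0.
  H : Fin N -> Fin N -> Carrierᴹ -> Carrierᴹ
  H m z v = ¬?(z Fin.≟ m)⊢ E(third m z)v

  H-lin : ∀ m z -> Lin M M(H m z)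
  H-lin m z = ⊢-lin{R = R} M M(¬?(z Fin.≟ m))(E-lin(third m z))

  module H m z = Lin(H-lin m z)

  H-same : ∀ m v -> H m m v ≈ᴹ 0ᴹ
  H-same m v = ⊢-no(¬?(m Fin.≟ m))(\ h -> h refl)

  H-other : ∀{m z} -> z ≢ m -> ∀ v -> H m z v ≈ᴹ E(third m z)v
  H-other{m}{z} z≢m v = ⊢-yes(¬?(z Fin.≟ m))z≢m

  -- Coefficient of e_m in e_m · v for lev m = l, obtained from e_m e_y = e_c (e_y - e_m), c = thd m y.
  diagonal : Fin N -> Carrier' -> Carrierᴹ
  diagonal m(a , b) = g a +ᴹ -ᴹ ∑ L?(\ y -> H m y(b y))

  top : Fin N -> Carrier' -> Carrier'
  top m v = 0ᴹ , \ z -> H m z(snd v z)+ᴹ(z Fin.≟ m ⊢ diagonal m v)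

  sub-lin : ∀{f h : Carrier' -> Carrierᴹ} -> Lin M' M f -> Lin M' M h -> Lin M' M(\ v -> f v +ᴹ -ᴹ h v)
  sub-lin F H = +-lin{R = R} M' M F(neg-lin{R = R} M' M H)

  ∑-lin' : ∀{f : Fin N -> Carrier' -> Carrierᴹ} →(∀ y -> lev y ≡ l -> Lin M' M(f y))->
        Lin M' M(\ v -> ∑ L?(\ y -> f y v))
  ∑-lin'{f} F = record
   { map-cong = \ p -> ∑-cong L?(\ y q -> Lin.map-cong(F y q)p)
   ; map-+ = \ v w -> ∑-cong L?(\ y q -> Lin.map-+(F y q)v w)⊚ ∑-+ L?(\ y -> f y v)(\ y -> f y w)
   ; map-* = \ k v -> ∑-cong L?(\ y q -> Lin.map-*(F y q)k v)⊚
     sm(Lin.map-∑(scal-lin k)L?(\ y -> f y v))} where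
   scal-lin : ∀ k -> Lin M M(k *ₗ_)
   scal-lin k = record
    { map-cong = *ₗ-congˡ
    ; map-+ = \ _ _ -> *ₗ-distribˡ _ _ _
    ; map-* = \ k′ x -> sm(*ₗ-assoc k k′ x)⊚ *ₗ-congʳ(R.*-comm k k′)⊚ *ₗ-assoc k′ k x }

  diagonal-lin : ∀ m -> Lin M' M(diagonal m)
  diagonal-lin m = sub-lin(∘-lin g-lin first-lin)(∑-lin'(\ y q -> ∘-lin(H-lin m y)(second-lin y q)))

  top-lin : ∀ m -> Lin M' M'(top m)
  top-lin m = pair-lin(zero-lin{R = R} M' M)
   (\ z q -> +-lin{R = R} M' M(∘-lin(H-lin m z)(second-lin z q))(⊢-lin{R = R} M' M(z Fin.≟ m)(diagonal-lin m)))

  top-at : ∀ m v -> snd(top m v)m ≈ᴹ diagonal m v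
  top-at m v = +≈(H-same m _)(⊢-yes(m Fin.≟ m)refl)⊚ 0+ _

  top-off : ∀{m z} -> z ≢ m -> ∀ v -> snd(top m v)z ≈ᴹ E(third m z)(snd v z)
  top-off{m}{z} z≢m v = +≈(H-other z≢m _)(⊢-no(z Fin.≟ m)z≢m)⊚ +0 _

  each : Fin N -> Carrier' -> Carrier'
  each m(a , b) = E m a , \ z -> E m(b z)

  each-lin : ∀ m -> Lin M' M'(each m)
  each-lin m = pair-lin(∘-lin(E-lin m)first-lin)(\ z q -> ∘-lin(E-lin m)(second-lin z q))

  act : ∀ m -> Tri(lev m < l)(lev m ≡ l)(l < lev m)-> Carrier' -> Carrier'
  act m(tri< _ _ _)v = each m v
  act m(tri≈ _ _ _)v = top m v
  act m(tri> _ _ _)v = M'.0ᴹ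

  cmp : ∀ m -> Tri(lev m < l)(lev m ≡ l)(l < lev m)
  cmp m = ℕ.<-cmp(lev m)l

  E' : Fin N -> Carrier' -> Carrier'
  E' m = act m(cmp m)

  act-lin : ∀ m t -> Lin M' M'(act m t)
  act-lin m(tri< _ _ _) = each-lin m
  act-lin m(tri≈ _ _ _) = top-lin m
  act-lin m(tri> _ _ _) = zero-lin{R = R} M' M'

  act-low : ∀{m} -> lev m < l -> ∀ t v -> act m t v M'.≈ᴹ each m v
  act-low m<(tri< _ _ _)v = M'.≈ᴹ-refl
  act-low m<(tri≈ m≮ _ _)v = contra m< m≮
  act-low m<(tri> m≮ _ _)v = contra m< m≮

  -- Dictated by g (b e_z) = - g(b) e_z and by the twisted Leibniz rule D (b e_z) = D(b) e_z + g(b).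
  g' D' : Carrier' -> Carrier'
  g'(a , b) = g a , \ z -> -ᴹ g(b z)
  D'(a , b) = D a +ᴹ ∑ L?(\ z -> g(b z)), \ z -> D(b z)

  g'-lin : Lin M' M' g'
  g'-lin = pair-lin(∘-lin g-lin first-lin)
   (\ z q -> neg-lin{R = R} M' M(∘-lin g-lin(second-lin z q)))

  D'-lin : Lin M' M' D'
  D'-lin = pair-lin(+-lin{R = R} M' M(∘-lin D-lin first-lin)(∑-lin'(\ y q -> ∘-lin g-lin(second-lin y q))))
   (\ z q -> ∘-lin D-lin(second-lin z q))

  neg-∑ : ∀ f -> -ᴹ ∑ L? f ≈ᴹ ∑ L?(\ y -> -ᴹ f y)
  neg-∑ f = Lin.map-∑(neg-lin{R = R} M M(id-lin M))L? f

  gH : ∀ m z v -> g(H m z v)≈ᴹ -ᴹ H m z(g v)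
  gH m z v with z Fin.≟ m
  ... | yes _ = g.map-0 ⊚ sm -0≈0
  ... | no _ = gE _ _

  gg' : ∀ v -> g'(g' v)M'.≈ᴹ v
  gg'(a , b) = gg a , \ z _ -> begin
   -ᴹ g(-ᴹ g(b z))≈⟨ -≈(g.map-neg _)⟩
   -ᴹ -ᴹ g(g(b z))≈⟨ -ᴹ-invol _ ⟩
   g(g(b z))≈⟨ gg _ ⟩
   b z ∎

  by-atom : ∀{P : Fin N -> Set ℓ} m →(lev m ≡ l -> P m)→(∀ z -> lev z ≡ l -> z ≢ m -> P z)-> ∀ z -> lev z ≡ l -> P z
  by-atom m at off z q with z Fin.≟ m
  ... | yes refl = at q
  ... | no z≢m = off z q z≢m

  gtop : ∀ m v -> g'(top m v)M'.≈ᴹ M'.-ᴹ top m(g' v)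
  gtop m v@(a , b) = g.map-0 ⊚ sm -0≈0 , by-atom m
   (\ q -> -≈(begin
    g(snd(top m v)m)≈⟨ g.map-cong(top-at m v)⟩
    g(g a +ᴹ -ᴹ ∑ L?(\ y -> H m y(b y)))≈⟨ g.map-+ _ _ ⟩
    g(g a)+ᴹ g(-ᴹ ∑ L?(\ y -> H m y(b y)))≈⟨ +≈ˡ(g.map-neg _)⟩
    g(g a)+ᴹ -ᴹ g(∑ L?(\ y -> H m y(b y)))≈⟨ +≈ˡ(-≈(g.map-∑ L?(\ y -> H m y(b y))⊚
                                    ∑-cong L?(\ y _ -> gH m y(b y)⊚ sm(H.map-neg m y _))))⟩
    g(g a)+ᴹ -ᴹ ∑ L?(\ y -> H m y(-ᴹ g(b y)))≈⟨ top-at m(g' v)⟨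
    snd(top m(g' v))m ∎))
   (\ z q z≢m -> -≈(begin
    g(snd(top m v)z)≈⟨ g.map-cong(top-off z≢m v)⟩
    g(E(third m z)(b z))≈⟨ gE _ _ ⟩
    -ᴹ E(third m z)(g(b z))≈⟨ E.map-neg _ _ ⟨
    E(third m z)(-ᴹ g(b z))≈⟨ top-off z≢m(g' v)⟨
    snd(top m(g' v))z ∎))

  gE' : ∀ m t v -> g'(act m t v)M'.≈ᴹ M'.-ᴹ act m t(g' v)
  gE' m(tri< _ _ _)(a , b) = gE m a , \ z _ -> -≈(gE m(b z)⊚ sm(E.map-neg m _))
  gE' m(tri≈ _ _ _)v = gtop m v
  gE' m(tri> _ _ _)v = M'.≈ᴹ-trans(Lin.map-0 g'-lin)(M'.≈ᴹ-sym M'T.-0≈0)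

  gD' : ∀ v -> g'(D' v)M'.≈ᴹ M'.-ᴹ D'(g' v)
  gD'(a , b) =(begin
    g(D a +ᴹ ∑ L?(\ z -> g(b z)))≈⟨ g.map-+ _ _ ⟩
    g(D a)+ᴹ g(∑ L?(\ z -> g(b z)))≈⟨ +≈(gD a)(g.map-∑ L?(\ z -> g(b z)))⟩
    -ᴹ D(g a)+ᴹ ∑ L?(\ z -> g(g(b z)))≈⟨ +≈ˡ(∑-cong L?(\ z _ -> sm(-ᴹ-invol _)⊚ -≈(sm(g.map-neg _))))⟩
    -ᴹ D(g a)+ᴹ ∑ L?(\ z -> -ᴹ g(-ᴹ g(b z)))≈⟨ +≈ˡ(neg-∑(\ z -> g(-ᴹ g(b z))))⟨
    -ᴹ D(g a)+ᴹ -ᴹ ∑ L?(\ z -> g(-ᴹ g(b z)))≈⟨ -ᴹ-+ _ _ ⟩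
    -ᴹ(D(g a)+ᴹ ∑ L?(\ z -> g(-ᴹ g(b z))))∎)
   , \ z _ -> -≈(gD(b z)⊚ sm(D.map-neg _))

  -- In the first component the coefficients of e_m v add up to g(a), because the entries `H m z`
  -- cancel against the diagonal one; hence D returns a. The other components reduce to `DE` for the
  -- lower atoms `third m z`.
  DE-top : ∀ m v -> lev m ≡ l -> D'(top m v)M'.+ᴹ top m(D' v)M'.≈ᴹ v
  DE-top m v@(a , b)refl = first , by-atom m(\ q -> at)(\ z q z≢m -> begin
    D(snd(top m v)z)+ᴹ snd(top m(D' v))z ≈⟨ +≈(D.map-cong(top-off z≢m v))(top-off z≢m(D' v))⟩
    D(E(third m z)(b z))+ᴹ E(third m z)(D(b z))≈⟨ DE _ _(thd-lower(z≢m ∘ sym)(sym q))⟩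
    b z ∎)where
   h : Fin N -> Carrierᴹ
   h y = H m y(b y)
   first = begin
    (D 0ᴹ +ᴹ ∑ L?(\ z -> g(snd(top m v)z)))+ᴹ 0ᴹ ≈⟨ +0 _ ⟩
    D 0ᴹ +ᴹ ∑ L?(\ z -> g(snd(top m v)z))≈⟨ +≈ D.map-0(sm(g.map-∑ L?(snd(top m v))))⟩
    0ᴹ +ᴹ g(∑ L?(snd(top m v)))≈⟨ 0+ _ ⟩
    g(∑ L?(snd(top m v)))≈⟨ g.map-cong(∑-+ L? h(\ z -> z Fin.≟ m ⊢ diagonal m v))⟩
    g(∑ L? h +ᴹ ∑ L?(\ z -> z Fin.≟ m ⊢ diagonal m v))≈⟨ g.map-cong(+≈ˡ(∑-single L? m refl(\ z _ -> ⊢-no(z Fin.≟ m))⊚ ⊢-yes(m Fin.≟ m)refl))⟩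
    g(∑ L? h +ᴹ(g a +ᴹ -ᴹ ∑ L? h))≈⟨ g.map-cong(solve(∑ L? h ∷ g a ∷ [])(# zero :+(# suc zero :+ :- # zero))(# suc zero)refl)⟩
    g(g a)≈⟨ gg a ⟩
    a ∎
   at = begin
    D(snd(top m v)m)+ᴹ snd(top m(D' v))m
     ≈⟨ +≈(D.map-cong(top-at m v))(top-at m(D' v))⟩
    D(g a +ᴹ -ᴹ ∑ L? h)+ᴹ(g(D a +ᴹ ∑ L?(\ z -> g(b z)))+ᴹ -ᴹ ∑ L?(\ y -> H m y(D(b y))))
     ≈⟨ +≈(D.map-+ _ _ ⊚ +≈ˡ(D.map-neg _ ⊚ -≈(D.map-∑ L? h)))
           (+≈ʳ(g.map-+ _ _ ⊚ +≈(gD a)(g.map-∑ L?(\ z -> g(b z))⊚ ∑-cong L?(\ z _ -> gg(b z)))))⟩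
    (D(g a)+ᴹ -ᴹ ∑ L?(\ y -> D(h y)))+ᴹ((-ᴹ D(g a)+ᴹ ∑ L? b)+ᴹ -ᴹ ∑ L?(\ y -> H m y(D(b y))))
     ≈⟨ solve(D(g a)∷ ∑ L?(\ y -> D(h y))∷ ∑ L? b ∷ ∑ L?(\ y -> H m y(D(b y)))∷ [])
        ((# zero :+ :- # suc zero) :+((:- # zero :+ # suc(suc zero)) :+ :- # suc(suc(suc zero))))
        (# suc(suc zero) :+ :-(# suc zero :+ # suc(suc(suc zero))))refl ⟩
    ∑ L? b +ᴹ -ᴹ(∑ L?(\ y -> D(h y))+ᴹ ∑ L?(\ y -> H m y(D(b y))))
     ≈⟨ +≈ˡ(-≈(sm(∑-+ L?(\ y -> D(h y))(\ y -> H m y(D(b y)))))⊚ neg-∑ _)⟩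
    ∑ L? b +ᴹ ∑ L?(\ y -> -ᴹ(D(h y)+ᴹ H m y(D(b y))))
     ≈⟨ ∑-+ L? b(\ y -> -ᴹ(D(h y)+ᴹ H m y(D(b y))))⟨
    ∑ L?(\ y -> b y +ᴹ -ᴹ(D(h y)+ᴹ H m y(D(b y))))
     ≈⟨ ∑-single L? m refl(\ y q y≢m -> +≈ˡ(-≈(+≈(D.map-cong(H-other y≢m _))(H-other y≢m _)⊚
        DE _ _(thd-lower(y≢m ∘ sym)(sym q))))⊚ -ᴹ‿inverseʳ _)⟩
    b m +ᴹ -ᴹ(D(h m)+ᴹ H m m(D(b m)))
     ≈⟨ +≈ˡ(-≈(+≈(D.map-≈0(H-same m _))(H-same m _)⊚ +0 _)⊚ -0≈0)⟩
    b m +ᴹ 0ᴹ ≈⟨ +0 _ ⟩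
    b m ∎

  DE' : ∀ m t v -> lev m < suc l -> D'(act m t v)M'.+ᴹ act m t(D' v)M'.≈ᴹ v
  DE' m(tri< m< _ _)(a , b)_ =(begin
    (D(E m a)+ᴹ ∑ L?(\ z -> g(E m(b z))))+ᴹ E m(D a +ᴹ ∑ L?(\ z -> g(b z)))
     ≈⟨ +≈(+≈ˡ(∑-cong L?(\ z _ -> gE m(b z))⊚ sm(neg-∑ _)))
           (E.map-+ m _ _ ⊚ +≈ˡ(E.map-∑ m L?(\ z -> g(b z))))⟩
    (D(E m a)+ᴹ -ᴹ ∑ L?(\ z -> E m(g(b z))))+ᴹ(E m(D a)+ᴹ ∑ L?(\ z -> E m(g(b z))))
     ≈⟨ solve(D(E m a)∷ ∑ L?(\ z -> E m(g(b z)))∷ E m(D a)∷ [])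
        ((# zero :+ :- # suc zero) :+(# suc(suc zero) :+ # suc zero))(# zero :+ # suc(suc zero))refl ⟩
    D(E m a)+ᴹ E m(D a)≈⟨ DE m a m< ⟩
    a ∎), \ z _ -> DE m(b z)m<
  DE' m(tri≈ _ m≡ _)v _ = DE-top m v m≡
  DE' m(tri> _ _ m>)v m< = contra m<(ℕ.≤⇒≯ m>)

  top-square : ∀ m v -> top m(top m v)M'.≈ᴹ M'.0ᴹ
  top-square m v@(a , b) = rf , by-atom m
   (\ q -> begin
    snd(top m(top m v))m ≈⟨ top-at m(top m v)⟩
    g 0ᴹ +ᴹ -ᴹ ∑ L?(\ y -> H m y(snd(top m v)y))≈⟨ +≈ g.map-0(-≈(∑-zero L? zeros))⟩
    0ᴹ +ᴹ -ᴹ 0ᴹ ≈⟨ -ᴹ‿inverseʳ 0ᴹ ⟩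
    0ᴹ ∎)
   (\ z q z≢m -> top-off z≢m(top m v)⊚ E.map-cong _(top-off z≢m v)⊚ E-square _ _)where
   zeros = by-atom m(\ _ -> H-same m _)(\ y _ y≢m -> H-other y≢m _ ⊚ E.map-cong _(top-off y≢m v)⊚ E-square _ _)

  square' : ∀ m t v -> act m t(act m t v)M'.≈ᴹ M'.0ᴹ
  square' m(tri< _ _ _)(a , b) = E-square m a , \ z _ -> E-square m(b z)
  square' m(tri≈ _ _ _)v = top-square m v
  square' m(tri> _ _ _)v = M'.≈ᴹ-refl

  each-top : ∀ x y v -> each x(top y v)M'.+ᴹ top y(each x v)M'.≈ᴹ M'.0ᴹ
  each-top x y v@(a , b) = +0 _ ⊚ E.map-0 x , by-atom y
   (\ q -> begin
    E x(snd(top y v)y)+ᴹ snd(top y(each x v))y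
     ≈⟨ +≈(E.map-cong x(top-at y v))(top-at y(each x v))⟩
    E x(g a +ᴹ -ᴹ ∑ L?(\ w -> H y w(b w)))+ᴹ(g(E x a)+ᴹ -ᴹ ∑ L?(\ w -> H y w(E x(b w))))
     ≈⟨ +≈(E.map-+ x _ _ ⊚ +≈ˡ(E.map-neg x _ ⊚ -≈(E.map-∑ x L?(\ w -> H y w(b w)))))
        (+≈(gE x a)(-≈(∑-cong L?(\ w _ -> anti w)⊚ sm(neg-∑ _))))⟩
    (E x(g a)+ᴹ -ᴹ ∑ L?(\ w -> E x(H y w(b w))))+ᴹ(-ᴹ E x(g a)+ᴹ -ᴹ -ᴹ ∑ L?(\ w -> E x(H y w(b w))))
     ≈⟨ solve(E x(g a)∷ ∑ L?(\ w -> E x(H y w(b w)))∷ [])((# zero :+ :- # suc zero) :+(:- # zero :+ :- :- # suc zero)) :0 refl ⟩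
    0ᴹ ∎)
   (\ z q z≢y -> +≈(E.map-cong x(top-off z≢y v))(top-off z≢y(each x v))⊚ E-anti x _ _)where
   anti : ∀ w -> H y w(E x(b w))≈ᴹ -ᴹ E x(H y w(b w))
   anti w with w Fin.≟ y
   ... | yes _ = sm(-≈(E.map-0 x)⊚ -0≈0)
   ... | no _ = swap-anti _ x _

  -- The boundary of the dependent triple k, a, b of lower atoms, e_a e_b - e_k e_b + e_k e_a,
  -- already acts as zero on the previous stage. It is the compatibility needed for the action of
  -- three atoms of the new level.
  triangle : ∀{x y z} -> x ≢ y -> z ≢ x -> z ≢ y -> lev x ≡ lev y -> lev x ≡ lev z -> lev x ≡ l -> ∀ v ->
        E(third x z)(E(third y z)v)≈ᴹ E(third x y)(E(third y z)v +ᴹ -ᴹ E(third x z)v)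
  triangle{x}{y}{z} x≢y z≢x z≢y xy xz refl v = begin
   E a(E b v)≈⟨ solve(E a(E b v)∷ E k(E b v +ᴹ -ᴹ E a v)∷ [])(# zero)((# zero :+ :- # suc zero) :+ # suc zero)refl ⟩
   (E a(E b v)+ᴹ -ᴹ E k(E b v +ᴹ -ᴹ E a v))+ᴹ E k(E b v +ᴹ -ᴹ E a v)
    ≈⟨ +≈ʳ(+≈ˡ(-≈(E.map-cong k(+≈ˡ(-≈(E.map-cong a(sm(+≈ˡ(-≈(E.map-0 b)⊚ -0≈0)⊚ +0 _))))))))⟩
   ∂*(k ∷ a ∷ b ∷ [])v +ᴹ E k(E b v +ᴹ -ᴹ E a v)≈⟨ +≈ʳ(∂*-van below(Dep-triangle x≢y(z≢x ∘ sym)(z≢y ∘ sym)xy xz)v)⟩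
   0ᴹ +ᴹ E k(E b v +ᴹ -ᴹ E a v)≈⟨ 0+ _ ⟩
   E k(E b v +ᴹ -ᴹ E a v)∎ where
   a = third x z
   b = third y z
   k = third x y
   below = thd-lower x≢y xy ∷ thd-lower(z≢x ∘ sym)xz ∷ subst(\ n -> lev b < n)(sym xy)(thd-lower(z≢y ∘ sym)(sym xy ⨾ xz))∷ []

  module _{x y}(x≢y : x ≢ y)(xl : lev x ≡ l)(yl : lev y ≡ l)(v : Carrier')where
   private
    a = fst v
    b = snd v
    k = third x y
    kk : ∀{w} -> E k(E k w)≈ᴹ 0ᴹ
    kk = E-square k _
    yx : ∀ w -> E(third y x)w ≈ᴹ E k w
    yx w = ≈ᴹ-reflexive(cong(\ z -> E z w)(thd-sym y x))
    xy = xl ⨾ sym yl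
    diff : ∀ p q -> E k(p +ᴹ -ᴹ q)≈ᴹ E k p +ᴹ -ᴹ E k q
    diff p q = E.map-+ k _ _ ⊚ +≈ˡ(E.map-neg k q)
    d = diagonal y v

    -- One term of the diagonal coefficient of e_x (e_y v): at w = x it disappears, at w = y the
    -- diagonal coefficient of e_y v enters, and elsewhere `triangle` applies.
    summand : ∀ w -> lev w ≡ l -> H x w(snd(top y v)w)≈ᴹ
         (E k(H y w(b w))+ᴹ -ᴹ E k(H x w(b w)))+ᴹ(w Fin.≟ y ⊢ E k d)
    summand w q = go(w Fin.≟ x)(w Fin.≟ y)where
     rhs =(E k(H y w(b w))+ᴹ -ᴹ E k(H x w(b w)))+ᴹ(w Fin.≟ y ⊢ E k d)
     go : Dec(w ≡ x)-> Dec(w ≡ y)-> H x w(snd(top y v)w)≈ᴹ rhs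
     go(yes refl)_ = H-same x _ ⊚ sm(begin
      rhs ≈⟨ +≈(+≈(E.map-cong k(H-other x≢y _ ⊚ yx _)⊚ kk)(-≈(E.map-≈0 k(H-same x _))))(⊢-no(x Fin.≟ y)x≢y)⟩
      (0ᴹ +ᴹ -ᴹ 0ᴹ)+ᴹ 0ᴹ ≈⟨ solve []((:0 :+ :- :0) :+ :0) :0 refl ⟩
      0ᴹ ∎)
     go(no w≢x)(yes refl) = begin
      H x y(snd(top y v)y)≈⟨ H-other w≢x _ ⟩
      E k(snd(top y v)y)≈⟨ E.map-cong k(top-at y v)⟩
      E k d ≈⟨ solve(E k d ∷ [])(# zero)((:0 :+ :- :0) :+ # zero)refl ⟩
      (0ᴹ +ᴹ -ᴹ 0ᴹ)+ᴹ E k d ≈⟨ +≈(+≈(E.map-≈0 k(H-same y _))(-≈(E.map-cong k(H-other w≢x _)⊚ kk)))(⊢-yes(y Fin.≟ y)refl)⟨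
      rhs ∎
     go(no w≢x)(no w≢y) = begin
      H x w(snd(top y v)w)≈⟨ H-other w≢x _ ⟩
      E(third x w)(snd(top y v)w)≈⟨ E.map-cong _(top-off w≢y v)⟩
      E(third x w)(E(third y w)(b w))≈⟨ triangle x≢y w≢x w≢y xy(xl ⨾ sym q)xl(b w)⟩
      E k(E(third y w)(b w)+ᴹ -ᴹ E(third x w)(b w))≈⟨ diff _ _ ⟩
      E k(E(third y w)(b w))+ᴹ -ᴹ E k(E(third x w)(b w))≈⟨ +0 _ ⟨
      (E k(E(third y w)(b w))+ᴹ -ᴹ E k(E(third x w)(b w)))+ᴹ 0ᴹ
       ≈⟨ +≈(+≈(E.map-cong k(H-other w≢y _))(-≈(E.map-cong k(H-other w≢x _))))(⊢-no(w Fin.≟ y)w≢y)⟨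
      rhs ∎

   -- Checked coordinate by coordinate: at x by summing `summand`, at y because e_k e_k = 0 removes
   -- the contribution of e_x v, and at every other atom by `triangle`.
   top-thd : top x(top y v)M'.≈ᴹ each k(top y v M'.+ᴹ M'.-ᴹ top x v)
   top-thd = sm(E.map-≈0 k(-ᴹ‿inverseʳ 0ᴹ)), by-atom x(\ _ -> at)
    (by-atom'(\ y≢x -> begin
      snd(top x(top y v))y ≈⟨ top-off y≢x(top y v)⟩
      E k(snd(top y v)y)≈⟨ solve(E k(snd(top y v)y)∷ [])(# zero)(# zero :+ :- :0)refl ⟩
      E k(snd(top y v)y)+ᴹ -ᴹ 0ᴹ ≈⟨ +≈ˡ(-≈(E.map-cong k(top-off y≢x v)⊚ kk))⟨
      E k(snd(top y v)y)+ᴹ -ᴹ E k(snd(top x v)y)≈⟨ diff _ _ ⟨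
      E k(snd(top y v)y +ᴹ -ᴹ snd(top x v)y)∎)
     (\ z q z≢x z≢y -> begin
      snd(top x(top y v))z ≈⟨ top-off z≢x(top y v)⟩
      E(third x z)(snd(top y v)z)≈⟨ E.map-cong _(top-off z≢y v)⟩
      E(third x z)(E(third y z)(b z))≈⟨ triangle x≢y z≢x z≢y xy(xl ⨾ sym q)xl(b z)⟩
      E k(E(third y z)(b z)+ᴹ -ᴹ E(third x z)(b z))≈⟨ E.map-cong k(+≈(top-off z≢y v)(-≈(top-off z≢x v)))⟨
      E k(snd(top y v)z +ᴹ -ᴹ snd(top x v)z)∎))where
    target : Fin N -> Set ℓ
    target z = snd(top x(top y v))z ≈ᴹ E k(snd(top y v)z +ᴹ -ᴹ snd(top x v)z)
    by-atom' :(y ≢ x -> target y)→(∀ z -> lev z ≡ l -> z ≢ x -> z ≢ y -> target z)-> ∀ z -> lev z ≡ l -> z ≢ x -> target z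
    by-atom' p h z q z≢x = go(z Fin.≟ y)where
     go : Dec(z ≡ y)-> target z
     go(yes eq) = subst target(sym eq)(p(\ y≡x -> z≢x(eq ⨾ y≡x)))
     go(no z≢y) = h z q z≢x z≢y
    Hy = ∑ L?(\ w -> H y w(b w))
    Hx = ∑ L?(\ w -> H x w(b w))
    total = begin
     ∑ L?(\ w -> H x w(snd(top y v)w))≈⟨ ∑-cong L? summand ⟩
     ∑ L?(\ w →(E k(H y w(b w))+ᴹ -ᴹ E k(H x w(b w)))+ᴹ(w Fin.≟ y ⊢ E k d))
      ≈⟨ ∑-+ L?(\ w -> E k(H y w(b w))+ᴹ -ᴹ E k(H x w(b w)))(\ w -> w Fin.≟ y ⊢ E k d)⟩
     ∑ L?(\ w -> E k(H y w(b w))+ᴹ -ᴹ E k(H x w(b w)))+ᴹ ∑ L?(\ w -> w Fin.≟ y ⊢ E k d)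
      ≈⟨ +≈(∑-+ L?(\ w -> E k(H y w(b w)))(\ w -> -ᴹ E k(H x w(b w))))
            (∑-single L? y yl(\ z _ -> ⊢-no(z Fin.≟ y))⊚ ⊢-yes(y Fin.≟ y)refl)⟩
     (∑ L?(\ w -> E k(H y w(b w)))+ᴹ ∑ L?(\ w -> -ᴹ E k(H x w(b w))))+ᴹ E k d
      ≈⟨ +≈ʳ(+≈(sm(E.map-∑ k L?(\ w -> H y w(b w))))(sm(neg-∑(\ w -> E k(H x w(b w))))⊚ -≈(sm(E.map-∑ k L?(\ w -> H x w(b w))))))⟩
     (E k Hy +ᴹ -ᴹ E k Hx)+ᴹ E k d ∎
    at : target x
    at = begin
     snd(top x(top y v))x
      ≈⟨ top-at x(top y v)⟩
     g 0ᴹ +ᴹ -ᴹ ∑ L?(\ w -> H x w(snd(top y v)w))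
      ≈⟨ +≈ g.map-0(-≈(total ⊚ +≈ˡ(diff(g a)Hy)))⟩
     0ᴹ +ᴹ -ᴹ((E k Hy +ᴹ -ᴹ E k Hx)+ᴹ(E k(g a)+ᴹ -ᴹ E k Hy))
      ≈⟨ solve(E k Hy ∷ E k Hx ∷ E k(g a)∷ [])(:0 :+ :-((# zero :+ :- # suc zero) :+(# suc(suc zero) :+ :- # zero)))(:0 :+ :-(# suc(suc zero) :+ :- # suc zero))refl ⟩
     0ᴹ +ᴹ -ᴹ(E k(g a)+ᴹ -ᴹ E k Hx)
      ≈⟨ +≈(E.map-cong k(top-off x≢y v ⊚ yx _)⊚ kk)(-≈(diff(g a)Hx))⟨
     E k(snd(top y v)x)+ᴹ -ᴹ E k(diagonal x v)
      ≈⟨ +≈ˡ(-≈(E.map-cong k(top-at x v)))⟨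
     E k(snd(top y v)x)+ᴹ -ᴹ E k(snd(top x v)x)
      ≈⟨ diff _ _ ⟨
     E k(snd(top y v)x +ᴹ -ᴹ snd(top x v)x)∎

  thd' : ∀{x y} t s r v -> x ≢ y -> lev x ≡ lev y -> act x t(act y s v)M'.≈ᴹ act(third x y)r(act y s v M'.+ᴹ M'.-ᴹ act x t v)
  thd'{x}(tri< x< _ _)(tri< y< _ _)r v x≢y xy =
   M'.≈ᴹ-trans(E-thd _ x≢y xy , \ z _ -> E-thd _ x≢y xy)(M'.≈ᴹ-sym(act-low(ℕ.<-trans(thd-lower x≢y xy)x<)r _))
  thd'{x}{y}(tri≈ _ x≡ _)(tri≈ _ y≡ _)r v x≢y xy =
   M'.≈ᴹ-trans(top-thd x≢y x≡ y≡ v)(M'.≈ᴹ-sym(act-low(subst(\ n -> lev(third x y)< n)x≡(thd-lower x≢y xy))r _))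
  thd'{x}{y}(tri> _ _ _)(tri> _ _ _)r v x≢y xy =
   M'.≈ᴹ-sym(Lin.map-≈0(act-lin(third x y)r)(M'.-ᴹ‿inverseʳ M'.0ᴹ))
  thd'(tri< x< _ _)(tri≈ y≮ _ _)r v x≢y xy = contra(subst(_< l)xy x<)y≮
  thd'(tri< x< _ _)(tri> y≮ _ _)r v x≢y xy = contra(subst(_< l)xy x<)y≮
  thd'(tri≈ x≮ _ _)(tri< y< _ _)r v x≢y xy = contra(subst(_< l)(sym xy)y<)x≮
  thd'(tri≈ _ x≡ _)(tri> _ y≢ _)r v x≢y xy = contra(sym xy ⨾ x≡)y≢
  thd'(tri> x≮ _ _)(tri< y< _ _)r v x≢y xy = contra(subst(_< l)(sym xy)y<)x≮
  thd'(tri> _ x≢ _)(tri≈ _ y≡ _)r v x≢y xy = contra(xy ⨾ y≡)x≢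

  anti' : ∀ x y t s v -> act x t(act y s v)M'.+ᴹ act y s(act x t v)M'.≈ᴹ M'.0ᴹ
  anti' x y(tri< _ _ _)(tri< _ _ _)v = E-anti x y _ , \ _ _ -> E-anti x y _
  anti' x y(tri< _ _ _)(tri≈ _ _ _)v = each-top x y v
  anti' x y(tri≈ _ _ _)(tri< _ _ _)v = M'.≈ᴹ-trans(M'.+ᴹ-comm(top x(each y v))_)(each-top y x v)
  anti' x y(tri≈ _ x≡ _)(tri≈ _ y≡ _)v with x Fin.≟ y
  ... | yes refl = M'.≈ᴹ-trans(M'.+ᴹ-cong(top-square x v)(top-square x v))(M'.+ᴹ-identityʳ _)
  -- Both products are multiples of the same e_k by the symmetry of `third`, namely e_k (e_y - e_x)
  -- and e_k (e_x - e_y).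
  ... | no x≢y = M'.≈ᴹ-trans(M'.+ᴹ-cong(top-thd x≢y x≡ y≡ v)
    (M'.≈ᴹ-trans(top-thd(x≢y ∘ sym)y≡ x≡ v)(M'.≈ᴹ-reflexive(cong(\ z -> each z(top x v M'.+ᴹ M'.-ᴹ top y v))(thd-sym y x)))))
   (M'.≈ᴹ-trans(M'.≈ᴹ-sym(Lin.map-+(each-lin(third x y))(top y v M'.+ᴹ M'.-ᴹ top x v)(top x v M'.+ᴹ M'.-ᴹ top y v)))
    (Lin.map-≈0(each-lin(third x y))(M'T.solve(top x v ∷ top y v ∷ [])((M'T.# suc zero M'T.:+ M'T.:- M'T.# zero)M'T.:+(M'T.# zero M'T.:+ M'T.:- M'T.# suc zero))M'T.:0 refl)))
  anti' x y(tri> _ _ _)s v = M'.≈ᴹ-trans(M'.+ᴹ-identityˡ _)(Lin.map-0(act-lin y s))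
  anti' x y t@(tri< _ _ _)(tri> _ _ _)v = M'.≈ᴹ-trans(M'.+ᴹ-identityʳ _)(Lin.map-0(act-lin x t))
  anti' x y t@(tri≈ _ _ _)(tri> _ _ _)v = M'.≈ᴹ-trans(M'.+ᴹ-identityʳ _)(Lin.map-0(act-lin x t))

  next : Stage(suc l)
  next = record
   { M = M'; E = E'; g = g'; D = D'
   ; E-lin = \ m -> act-lin m(cmp m)
   ; g-lin = g'-lin
   ; D-lin = D'-lin
   ; gg = gg'
   ; gE = \ m -> gE' m(cmp m)
   ; gD = gD'
   ; DE = \ m -> DE' m(cmp m)
   ; E-square = \ m -> square' m(cmp m)
   ; E-anti = \ x y -> anti' x y(cmp x)(cmp y)
   ; E-thd = \{x}{y} v -> thd'(cmp x)(cmp y)(cmp(third x y))v }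

 stage : ∀ l -> Stage l
 stage zero = stage0
 stage(suc l) = Next.next(stage l)

-- Terms of the exterior algebra as operators on a module.

module Interpretation{c ℓ g m ℓm}(R : CommutativeRing c ℓ){G : Set g}
           (M : LeftModule(CommutativeRing.ring R)m ℓm)
           (act : G -> LeftModule.Carrierᴹ M -> LeftModule.Carrierᴹ M)
           (act-lin : ∀ s -> Lin M M(act s))
           (act-square : ∀ s v -> LeftModule._≈ᴹ_ M(act s(act s v))(LeftModule.0ᴹ M))
           (act-anti : ∀ s t v -> LeftModule._≈ᴹ_ M(LeftModule._+ᴹ_ M(act s(act t v))(act t(act s v)))(LeftModule.0ᴹ M))where
 private module R = CommutativeRing R
 open LeftModule M
 open Renamed M
 open ModuleTheory M
 open Exterior R G
 module act s = Lin(act-lin s)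

 ⟦_⟧ : ∀{d} -> Term d -> Carrierᴹ -> Carrierᴹ
 ⟦ e s ⟧ v = act s v
 ⟦ 𝟙 ⟧ v = v
 ⟦ 𝟘 ⟧ v = 0ᴹ
 ⟦ x ⊞ y ⟧ v = ⟦ x ⟧ v +ᴹ ⟦ y ⟧ v
 ⟦ k · x ⟧ v = k *ₗ ⟦ x ⟧ v
 ⟦ prod _ x y ⟧ v = ⟦ x ⟧(⟦ y ⟧ v)

 scale-lin : ∀ k -> Lin M M(k *ₗ_)
 scale-lin k = record
  { map-cong = *ₗ-congˡ
  ; map-+ = \ _ _ -> *ₗ-distribˡ _ _ _
  ; map-* = \ k′ x -> sm(*ₗ-assoc k k′ x)⊚ *ₗ-congʳ(R.*-comm k k′)⊚ *ₗ-assoc k′ k x }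

 ⟦⟧-lin : ∀{d}(x : Term d)-> Lin M M ⟦ x ⟧
 ⟦⟧-lin(e s) = act-lin s
 ⟦⟧-lin 𝟙 = id-lin M
 ⟦⟧-lin 𝟘 = zero-lin{R = R} M M
 ⟦⟧-lin(x ⊞ y) = +-lin{R = R} M M(⟦⟧-lin x)(⟦⟧-lin y)
 ⟦⟧-lin(k · x) = ∘-lin(scale-lin k)(⟦⟧-lin x)
 ⟦⟧-lin(prod _ x y) = ∘-lin(⟦⟧-lin x)(⟦⟧-lin y)

 module ⟦⟧{d}(x : Term d) = Lin(⟦⟧-lin x)

 sound : ∀{d}{x y : Term d} -> x ≋ y -> ∀ v -> ⟦ x ⟧ v ≈ᴹ ⟦ y ⟧ v
 sound ≋-refl v = rf
 sound(≋-sym h)v = sm(sound h v)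
 sound(≋-trans h k)v = sound h v ⊚ sound k v
 sound(⊞-cong h k)v = +≈(sound h v)(sound k v)
 sound(·-cong h k)v = *ₗ-cong h(sound k v)
 sound(prod-cong _{x}{x′} h k)v = ⟦⟧.map-cong x(sound k v)⊚ sound h _
 sound(⊞-assoc x y z)v = +ᴹ-assoc _ _ _
 sound(⊞-comm x y)v = +ᴹ-comm _ _
 sound(⊞-identityˡ x)v = 0+ _
 sound(·-zeroˡ x)v = *ₗ-zeroˡ _
 sound(·-zeroʳ k)v = *ₗ-zeroʳ _
 sound(·-identity x)v = 1* _
 sound(·-assoc k l x)v = *ₗ-assoc _ _ _
 sound(·-distribˡ k x y)v = *ₗ-distribˡ _ _ _
 sound(·-distribʳ x k l)v = *ₗ-distribʳ _ _ _
 sound(prod-assoc _ _ _ _ x y z)v = rf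
 sound(prod-identityˡ _ x)v = rf
 sound(prod-identityʳ _ x)v = rf
 sound(prod-distribˡ _ x y z)v = ⟦⟧.map-+ x _ _
 sound(prod-distribʳ _ x y z)v = rf
 sound(prod-scalarˡ _ k x y)v = rf
 sound(prod-scalarʳ _ k x y)v = ⟦⟧.map-* x _ _
 sound(anticommute s t)v = act-anti s t v
 sound(square-zero s)v = act-square s v

 -- `bdry` is the alternating sum `∂` in Leibniz form, which allows induction along the list; `⟦∂⟧`
 -- identifies the two.
 word bdry : List G -> Carrierᴹ -> Carrierᴹ
 word [] v = v
 word(t ∷ u)v = act t(word u v)
 bdry [] v = 0ᴹ
 bdry(t ∷ u)v = word u v +ᴹ -ᴹ act t(bdry u v)

 toList : ∀{n} -> Vector G n -> List G
 toList{zero} t = []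
 toList{suc n} t = Vector.head t ∷ toList(Vector.tail t)

 ⟦wedge⟧ : ∀{d}(t : Vector G d)v -> ⟦ wedge t ⟧ v ≈ᴹ word(toList t)v
 ⟦wedge⟧{zero} t v = rf
 ⟦wedge⟧{suc d} t v = act.map-cong(Vector.head t)(⟦wedge⟧(Vector.tail t)v)

 private
  open Exp R.semiring using(_^_)
  module T d = Sum(LeftModule.+ᴹ-commutativeMonoid(GradedAlgebra.component exteriorAlgebra d))

  ⟦sum⟧ : ∀{d n}(t : Vector(Term d)n)v -> ⟦ T.sum d t ⟧ v ≈ᴹ sum(\ j -> ⟦ t j ⟧ v)
  ⟦sum⟧{n = zero} t v = rf
  ⟦sum⟧{n = suc n} t v = +≈ˡ(⟦sum⟧(Vector.tail t)v)

 ⟦∂⟧ : ∀{d}(t : Vector G(suc d))v -> ⟦ ∂ t ⟧ v ≈ᴹ bdry(toList t)v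
 ⟦∂⟧{zero} t v = begin
  R.1# *ₗ v +ᴹ 0ᴹ ≈⟨ +≈(1* v)(sm(-≈(act.map-0 _)⊚ -0≈0))⟩
  v +ᴹ -ᴹ act(Vector.head t)0ᴹ ∎
  where open SetoidReasoning ≈ᴹ-setoid
 ⟦∂⟧{suc d} t v = +≈(1* _ ⊚ ⟦wedge⟧(Vector.tail t)v)(begin
  ⟦ T.sum(suc d)(\ j →((R.- R.1#)^ suc(toℕ j))· wedge(Vector.removeAt t(suc j)))⟧ v
   ≈⟨ ⟦sum⟧(\ j →((R.- R.1#)^ suc(toℕ j))· wedge(Vector.removeAt t(suc j)))v ⟩
  sum(\ j →((R.- R.1#)R.*((R.- R.1#)^ toℕ j))*ₗ act t0(⟦ w j ⟧ v))
   ≈⟨ sum-cong-≋{_}{\ j →((R.- R.1#)R.*((R.- R.1#)^ toℕ j))*ₗ act t0(⟦ w j ⟧ v)}{\ j -> -ᴹ act t0(((R.- R.1#)^ toℕ j)*ₗ ⟦ w j ⟧ v)}(\ j -> *ₗ-assoc _ _ _ ⊚ -1*ₗ _ ⊚ -≈(sm(act.map-* t0 _ _)))⟩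
  sum(\ j -> -ᴹ act t0(((R.- R.1#)^ toℕ j)*ₗ ⟦ w j ⟧ v))
   ≈⟨ Lin.map-sum(neg-lin{R = R} M M(act-lin t0))(\ j →((R.- R.1#)^ toℕ j)*ₗ ⟦ w j ⟧ v)⟨
  -ᴹ act t0(sum(\ j →((R.- R.1#)^ toℕ j)*ₗ ⟦ w j ⟧ v))
   ≈⟨ -≈(act.map-cong t0(⟦sum⟧(\ j →((R.- R.1#)^ toℕ j)· w j)v))⟨
  -ᴹ act t0(⟦ ∂(Vector.tail t)⟧ v)
   ≈⟨ -≈(act.map-cong t0(⟦∂⟧(Vector.tail t)v))⟩
  -ᴹ act t0(bdry(toList(Vector.tail t))v)∎)where
  open SetoidReasoning ≈ᴹ-setoid
  t0 = Vector.head t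
  w : Fin(suc d)-> Term d
  w j = wedge(Vector.removeAt(Vector.tail t)j)

 -- The ideal in degree d is built from relators of degree at most d, so an action that kills the
 -- relators up to degree `n` descends to the quotient in these degrees. The bound is used twice:
 -- unrestricted for the model, and with 3 for the obstruction.
 module OfQuotient{r}(Rel₀ : ∀{d} -> Term d -> Set r)(n : ℕ)
          (relators : ∀{d}{x : Term d} -> d ≤ n -> Rel₀ x -> ∀ v -> ⟦ x ⟧ v ≈ᴹ 0ᴹ)where
  open Quotient exteriorAlgebra Rel₀

  ideal-van : ∀{d}{x : Term d} -> d ≤ n -> Ideal x -> ∀ v -> ⟦ x ⟧ v ≈ᴹ 0ᴹ
  ideal-van d≤(generator r)v = relators d≤ r v
  ideal-van d≤(resp h i)v = sm(sound h v)⊚ ideal-van d≤ i v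
  ideal-van d≤ zeroᴵ v = rf
  ideal-van d≤(plus i j)v = +≈(ideal-van d≤ i v)(ideal-van d≤ j v)⊚ +0 _
  ideal-van d≤(scale k i)v = *ₗ-congˡ(ideal-van d≤ i v)⊚ *ₗ-zeroʳ k
  ideal-van d≤(mulˡ{p}{q} refl x i)v = ⟦⟧.map-≈0 x(ideal-van(ℕ.≤-trans(ℕ.m≤n+m q p)d≤)i v)
  ideal-van d≤(mulʳ{p}{q} refl y i)v = ideal-van(ℕ.≤-trans(ℕ.m≤m+n p q)d≤)i _

  sound~ : ∀{d}{x y : Term d} -> d ≤ n -> x ~ y -> ∀ v -> ⟦ x ⟧ v ≈ᴹ ⟦ y ⟧ v
  sound~ d≤(z , i , h)v = sound h v ⊚ +≈ˡ(ideal-van d≤ i v)⊚ +0 _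

-- Normal forms: stripping the first factor of a monomial.

module Strip{c ℓ ℓd}(R : CommutativeRing c ℓ){N : ℕ}(𝓕 : Fibration N ℓd)where
 open Fibration 𝓕
 open Representation R 𝓕
 private module R = CommutativeRing R
 open import Algebra.Module.Construct.TensorUnit using()renaming(leftModule to tensorUnit)
 K : LeftModule R.ring c ℓ
 K = tensorUnit{R = R.ring}
 module K = LeftModule K
 module KT = ModuleTheory K

 -- In the basis of monomials with increasing levels: κ is the constant coefficient, ρ k removes the
 -- first factor e_k, and π t keeps the monomials in atoms of level ≥ t.
 record Strips{l}(S : Stage l) : Set(c ⊔ ℓ)where
  open Stage S
  field
   κ : Carrierᴹ -> R.Carrier
   ι : R.Carrier -> Carrierᴹ
   ρ : Fin N -> Carrierᴹ -> Carrierᴹ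
   π : ℕ -> Carrierᴹ -> Carrierᴹ
   κ-lin : Lin M K κ
   ι-lin : Lin K M ι
   ρ-lin : ∀ k -> Lin M M(ρ k)
   π-lin : ∀ t -> Lin M M(π t)
   κE : ∀ m v -> κ(E m v)R.≈ R.0#
   κg : ∀ v -> κ(g v)R.≈ κ v
   gι : ∀ a -> g(ι a)≈ᴹ ι a
   κπ : ∀ t v -> κ(π t v)R.≈ κ v
   π-top : ∀{t} -> l ≤ t -> ∀ v -> π t v ≈ᴹ ι(κ v)
   ρE-other : ∀{k m} -> lev m ≤ lev k -> m ≢ k -> ∀ v -> ρ k(E m v)≈ᴹ 0ᴹ
   ρE-same : ∀{k} -> lev k < l -> ∀ v -> ρ k(E k v)≈ᴹ π(suc(lev k))v
   decompose : ∀ t v -> v ≈ᴹ π t v +ᴹ ∑(\ m -> lev m ℕ.<? t)(\ m -> E m(ρ m v))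

 strips0 : Strips stage0
 strips0 = record
  { κ = id; ι = id; ρ = \ _ _ -> R.0#; π = \ _ -> id
  ; κ-lin = id-lin K; ι-lin = id-lin K
  ; ρ-lin = \ _ -> zero-lin{R = R} K K
  ; π-lin = \ _ -> id-lin K
  ; κE = \ _ _ -> R.refl; κg = \ _ -> R.refl; gι = \ _ -> R.refl; κπ = \ _ _ -> R.refl
  ; π-top = \ _ _ -> R.refl
  ; ρE-other = \ _ _ _ -> R.refl
  ; ρE-same = \()
  ; decompose = \ t v -> R.sym(R.trans(R.+-congˡ(KT.∑-zero(\ m -> lev m ℕ.<? t)(\ _ _ -> R.refl)))(R.+-identityʳ v))}

 module NextStrips{l}(S : Stage l)(P : Strips S)where
  open Stage S
  open Strips P
  open Next S
  open SetoidReasoning ≈ᴹ-setoid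
  module κ = Lin κ-lin
  module ι = Lin ι-lin

  κ' : Carrier' -> R.Carrier
  κ'(a , b) = κ a

  ι' : R.Carrier -> Carrier'
  ι' k = ι k , \ _ -> 0ᴹ

  ι'-lin : Lin K M' ι'
  ι'-lin = record
   { map-cong = \ h -> ι.map-cong h , \ _ _ -> rf
   ; map-+ = \ x y -> ι.map-+ x y , \ _ _ -> sm(+0 _)
   ; map-* = \ k x -> ι.map-* k x , \ _ _ -> sm(*ₗ-zeroʳ k)}

  κ'-lin : Lin M' K κ'
  κ'-lin = ∘-lin κ-lin first-lin

  strip : ∀ k -> Tri(lev k < l)(lev k ≡ l)(l < lev k)-> Carrier' -> Carrier'
  strip k(tri< _ _ _)(a , b) = ρ k a , \ z -> ρ k(b z)
  -- Levels increase along a monomial, so one that starts with an atom of the top level has no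
  -- further factor: only the constant part of b k contributes.
  strip k(tri≈ _ _ _)(a , b) = ι'(κ(b k))
  strip k(tri> _ _ _)v = M'.0ᴹ

  keep : ∀ t -> Dec(t ≤ l)-> Carrier' -> Carrier'
  keep t(yes _)(a , b) = π t a , \ z -> π t(b z)
  -- All atoms of this stage have level at most l < t; only the empty monomial survives.
  keep t(no _)v = ι'(κ' v)

  strip-lin : ∀ k t -> Lin M' M'(strip k t)
  strip-lin k(tri< _ _ _) = pair-lin(∘-lin(ρ-lin k)first-lin)(\ z q -> ∘-lin(ρ-lin k)(second-lin z q))
  strip-lin k(tri≈ _ q _) = ∘-lin ι'-lin(∘-lin κ-lin(second-lin k q))
  strip-lin k(tri> _ _ _) = zero-lin{R = R} M' M'

  keep-lin : ∀ t s -> Lin M' M'(keep t s)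
  keep-lin t(yes _) = pair-lin(∘-lin(π-lin t)first-lin)(\ z q -> ∘-lin(π-lin t)(second-lin z q))
  keep-lin t(no _) = ∘-lin ι'-lin κ'-lin

  κH : ∀ m z v -> κ(H m z v)R.≈ R.0#
  κH m z v with z Fin.≟ m
  ... | yes _ = κ.map-0
  ... | no _ = κE _ _

  κ-diagonal : ∀ m v -> κ(diagonal m v)R.≈ κ(fst v)
  κ-diagonal m v@(a , b) = R.trans(κ.map-+ _ _)(R.trans(R.+-cong(κg a)
   (R.trans(κ.map-neg _)(R.trans(R.-‿cong(R.trans(κ.map-∑ L?(\ y -> H m y(b y)))(KT.∑-zero L?(\ y _ -> κH m y _))))KT.-0≈0)))
   (R.+-identityʳ _))

  κE' : ∀ m t v -> κ'(act m t v)R.≈ R.0#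
  κE' m(tri< _ _ _)v = κE m _
  κE' m(tri≈ _ _ _)v = κ.map-0
  κE' m(tri> _ _ _)v = κ.map-0

  κπ' : ∀ t s v -> κ'(keep t s v)R.≈ κ' v
  κπ' t(yes _)v = κπ t _
  κπ' t(no t≰)v = R.trans(R.sym(κ.map-cong(π-top ℕ.≤-refl _)))(κπ l _)

  π-top' : ∀{t} -> suc l ≤ t -> ∀ s v -> keep t s v M'.≈ᴹ ι'(κ' v)
  π-top' l<(yes t≤)v = contra l<(ℕ.≤⇒≯ t≤)
  π-top' l<(no _)v = M'.≈ᴹ-refl

  -- In normal form every monomial of e_m v begins with e_m itself or with an atom of level below
  -- that of m, the latter because atoms of the same level are exchanged through `third`.
  ρE-other' : ∀{k m} s t -> lev m ≤ lev k -> m ≢ k -> ∀ v -> strip k s(act m t v)M'.≈ᴹ M'.0ᴹ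
  ρE-other'{k}{m}(tri< k< _ _)t m≤ m≢ v = M'.≈ᴹ-trans
   (Lin.map-cong(strip-lin k(tri< k<(ℕ.<⇒≢ k<)(ℕ.<⇒≯ k<)))(act-low(ℕ.≤-<-trans m≤ k<)t v))
   (ρE-other m≤ m≢ _ , \ _ _ -> ρE-other m≤ m≢ _)
  ρE-other'{k}{m}(tri≈ _ k≡ _)(tri< _ _ _)m≤ m≢ v = Lin.map-≈0 ι'-lin(κE m _)
  ρE-other'{k}{m}(tri≈ _ k≡ _)(tri≈ _ _ _)m≤ m≢ v = Lin.map-≈0 ι'-lin
   (R.trans(κ.map-cong(top-off(m≢ ∘ sym)v))(κE _ _))
  ρE-other'{k}{m}(tri≈ _ k≡ _)(tri> _ _ _)m≤ m≢ v = Lin.map-≈0 ι'-lin κ.map-0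
  ρE-other'(tri> _ _ _)t m≤ m≢ v = M'.≈ᴹ-refl

  -- Only the monomials of v all of whose levels exceed that of k stay normal after e_k is put in
  -- front; the others are rewritten so as to begin with a lower atom.
  ρE-same' : ∀{k} s s' t -> lev k < suc l -> ∀ v -> strip k s(act k s' v)M'.≈ᴹ keep(suc(lev k))t v
  ρE-same'{k}(tri< k< _ _)s'(yes _)_ v = M'.≈ᴹ-trans
   (Lin.map-cong(strip-lin k(tri< k<(ℕ.<⇒≢ k<)(ℕ.<⇒≯ k<)))(act-low k< s' v))
   (ρE-same k< _ , \ _ _ -> ρE-same k< _)
  ρE-same'{k}(tri< k< _ _)s'(no k≮)_ v = contra k< k≮
  ρE-same'{k}(tri≈ k≮ _ _)s'(yes k<)_ v = contra k< k≮
  ρE-same'{k}(tri≈ _ k≡ _)(tri≈ _ _ _)(no _)_ v = Lin.map-cong ι'-lin(R.trans(κ.map-cong(top-at k v))(κ-diagonal k v))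
  ρE-same'{k}(tri≈ k≮ _ _)(tri< k< _ _)(no _)_ v = contra k< k≮
  ρE-same'{k}(tri≈ _ k≡ _)(tri> _ k≢ _)(no _)_ v = contra k≡ k≢
  ρE-same'{k}(tri> _ _ k>)s' t k< v = contra k<(ℕ.≤⇒≯ k>)

  ρ' : Fin N -> Carrier' -> Carrier'
  ρ' k = strip k(cmp k)

  low-term' : ∀ m s t -> lev m < l -> ∀ v -> act m s(strip m t v)M'.≈ᴹ(E m(ρ m(fst v)), \ z -> E m(ρ m(snd v z)))
  low-term' m s(tri< _ _ _)m< v = act-low m< s _
  low-term' m s(tri≈ m≮ _ _)m< v = contra m< m≮
  low-term' m s(tri> m≮ _ _)m< v = contra m< m≮

  low-term : ∀ m -> lev m < l -> ∀ v -> E' m(ρ' m v)M'.≈ᴹ(E m(ρ m(fst v)), \ z -> E m(ρ m(snd v z)))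
  low-term m = low-term' m(cmp m)(cmp m)

  top-term : ∀ m s t -> lev m ≡ l -> ∀ v -> act m s(strip m t v)M'.≈ᴹ(0ᴹ , \ z -> z Fin.≟ m ⊢ ι(κ(snd v m)))
  top-term m(tri≈ _ _ _)(tri≈ _ _ _)m≡ v = rf , \ z q -> +≈(H.map-0 m z)
   (⊢-cong(z Fin.≟ m)(\ _ -> +≈(gι _)(-≈(∑-zero L?(\ y _ -> H.map-0 m y))⊚ -0≈0)⊚ +0 _))⊚ 0+ _
  top-term m(tri≈ _ _ _)(tri< _ m≢ _)m≡ v = contra m≡ m≢
  top-term m(tri≈ _ _ _)(tri> _ m≢ _)m≡ v = contra m≡ m≢
  top-term m(tri< _ m≢ _)_ m≡ v = contra m≡ m≢
  top-term m(tri> _ m≢ _)_ m≡ v = contra m≡ m≢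

  high-term : ∀ m s t -> l < lev m -> ∀ v -> act m s(strip m t v)M'.≈ᴹ M'.0ᴹ
  high-term m(tri> _ _ _)_ m> v = M'.≈ᴹ-refl
  high-term m(tri< _ _ m≯)_ m> v = contra m> m≯
  high-term m(tri≈ _ _ m≯)_ m> v = contra m> m≯

  <? : ∀ t m -> Dec(lev m < t)
  <? t m = lev m ℕ.<? t

  term : Fin N -> Carrier' -> Carrier'
  term m v = E' m(ρ' m v)

  -- For t ≤ l this is coordinatewise. For larger t nothing but the constant remains on the left,
  -- and the constants of the coordinates b z, which the lower stage leaves over, are accounted for
  -- by the one-letter monomials e_z of level l.
  decompose' : ∀ t s v -> v M'.≈ᴹ keep t s v M'.+ᴹ M'T.∑(<? t)(\ m -> term m v)
  decompose' t(yes t≤)v@(a , b) =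
    decompose t a ⊚ +≈ˡ(∑-cong(<? t)(\ m m< -> sm(fst(low-term m(ℕ.<-≤-trans m< t≤)v)))⊚
     sm(Lin.map-∑ first-lin(<? t)(\ m -> term m v)))
   , \ z q -> decompose t(b z)⊚ +≈ˡ(∑-cong(<? t)(\ m m< -> sm(snd(low-term m(ℕ.<-≤-trans m< t≤)v)z q))⊚
     sm(Lin.map-∑(second-lin z q)(<? t)(\ m -> term m v)))
  decompose' t(no t≰)v@(a , b) = first , second where
   l<t = ℕ.≰⇒> t≰
   drop : ∀(f : Vector Carrierᴹ N)→(∀ m -> ¬ lev m < l -> f m ≈ᴹ 0ᴹ)-> ∑(<? t)f ≈ᴹ ∑(<? l)f
   drop f h = sum-cong-≋(\ m -> go m(<? t m)(<? l m))where
    go : ∀ m(x : Dec(lev m < t))(y : Dec(lev m < l))→(x ⊢ f m)≈ᴹ(y ⊢ f m)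
    go m(yes _)(yes _) = rf
    go m(yes _)(no ¬p) = h m ¬p
    go m(no ¬p)(yes p) = contra(ℕ.<-trans p l<t)¬p
    go m(no _)(no _) = rf
   first0 : ∀ m -> ¬ lev m < l -> fst(term m v)≈ᴹ 0ᴹ
   first0 m m≮ with ℕ.<-cmp(lev m)l
   ... | tri< m< _ _ = contra m< m≮
   ... | tri≈ _ m≡ _ = rf
   ... | tri> _ _ _ = rf
   first : a ≈ᴹ ι(κ a)+ᴹ fst(M'T.∑(<? t)(\ m -> term m v))
   first = begin
    a ≈⟨ decompose l a ⟩
    π l a +ᴹ ∑(<? l)(\ m -> E m(ρ m a))≈⟨ +≈(π-top ℕ.≤-refl a)(∑-cong(<? l)(\ m m< -> sm(fst(low-term m m< v))))⟩
    ι(κ a)+ᴹ ∑(<? l)(\ m -> fst(term m v))≈⟨ +≈ˡ(sm(drop(\ m -> fst(term m v))first0))⟩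
    ι(κ a)+ᴹ ∑(<? t)(\ m -> fst(term m v))≈⟨ +≈ˡ(sm(Lin.map-∑ first-lin(<? t)(\ m -> term m v)))⟩
    ι(κ a)+ᴹ fst(M'T.∑(<? t)(\ m -> term m v))∎
   second : ∀ z -> lev z ≡ l -> b z ≈ᴹ 0ᴹ +ᴹ snd(M'T.∑(<? t)(\ m -> term m v))z
   second z q = begin
    b z ≈⟨ decompose l(b z)⟩
    π l(b z)+ᴹ ∑(<? l)(\ m -> E m(ρ m(b z)))≈⟨ +≈(π-top ℕ.≤-refl(b z))(sm(drop low low-high ⊚ ∑-cong(<? l)low-low))⟩
    ι(κ(b z))+ᴹ ∑(<? t)low ≈⟨ +≈ʳ(sm(∑-single(<? t)z(subst(_< t)(sym q)l<t)(\ m _ m≢z -> ⊢-no(m Fin.≟ z)m≢z)⊚ ⊢-yes(z Fin.≟ z)refl))⟩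
    ∑(<? t)(\ m -> m Fin.≟ z ⊢ ι(κ(b z)))+ᴹ ∑(<? t)low ≈⟨ ∑-+(<? t)(\ m -> m Fin.≟ z ⊢ ι(κ(b z)))low ⟨
    ∑(<? t)(\ m →(m Fin.≟ z ⊢ ι(κ(b z)))+ᴹ low m)≈⟨ ∑-cong(<? t)(\ m _ -> each-term m)⟨
    ∑(<? t)(\ m -> snd(term m v)z)≈⟨ Lin.map-∑(second-lin z q)(<? t)(\ m -> term m v)⟨
    snd(M'T.∑(<? t)(\ m -> term m v))z ≈⟨ 0+ _ ⟨
    0ᴹ +ᴹ snd(M'T.∑(<? t)(\ m -> term m v))z ∎ where
    low : Vector Carrierᴹ N
    low m = <? l m ⊢ E m(ρ m(b z))
    low-high : ∀ m -> ¬ lev m < l -> low m ≈ᴹ 0ᴹ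
    low-high m m≮ = ⊢-no(<? l m)m≮
    low-low : ∀ m -> lev m < l -> low m ≈ᴹ E m(ρ m(b z))
    low-low m m< = ⊢-yes(<? l m)m<
    each-term : ∀ m -> snd(term m v)z ≈ᴹ(m Fin.≟ z ⊢ ι(κ(b z)))+ᴹ low m
    each-term m = case(ℕ.<-cmp(lev m)l)where
     case : Tri(lev m < l)(lev m ≡ l)(l < lev m)-> snd(term m v)z ≈ᴹ(m Fin.≟ z ⊢ ι(κ(b z)))+ᴹ low m
     case(tri< m< m≢ _) = snd(low-term m m< v)z q ⊚ sm(+≈
      (⊢-no(m Fin.≟ z)(\{ refl -> m≢ q }))(low-low m m<)⊚ 0+ _)
     case(tri≈ m≮ m≡ _) = snd(top-term m(cmp m)(cmp m)m≡ v)z q ⊚ flip(z Fin.≟ m)(m Fin.≟ z)⊚ sm(+≈ˡ(low-high m m≮)⊚ +0 _)where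
      flip : ∀(x : Dec(z ≡ m))(y : Dec(m ≡ z))→(x ⊢ ι(κ(b m)))≈ᴹ(y ⊢ ι(κ(b z)))
      flip(yes refl)(yes _) = rf
      flip(yes refl)(no h) = contra refl h
      flip(no h)(yes refl) = contra refl h
      flip(no _)(no _) = rf
     case(tri> m≮ m≢ m>) = snd(high-term m(cmp m)(cmp m)m> v)z q ⊚ sm(+≈
      (⊢-no(m Fin.≟ z)(\{ refl -> m≢ q }))(low-high m m≮)⊚ 0+ _)

  nextStrips : Strips next
  nextStrips = record
   { κ = κ'; ι = ι'; ρ = ρ'; π = \ t -> keep t(t ℕ.≤? l)
   ; κ-lin = κ'-lin; ι-lin = ι'-lin
   ; ρ-lin = \ k -> strip-lin k(cmp k)
   ; π-lin = \ t -> keep-lin t(t ℕ.≤? l)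
   ; κE = \ m -> κE' m(cmp m)
   ; κg = \ v -> κg(fst v)
   ; gι = \ a -> gι a , \ _ _ -> -≈ g.map-0 ⊚ -0≈0
   ; κπ = \ t -> κπ' t(t ℕ.≤? l)
   ; π-top = \{t} l<t -> π-top' l<t(t ℕ.≤? l)
   ; ρE-other = \{k}{m} -> ρE-other'(cmp k)(cmp m)
   ; ρE-same = \{k} -> ρE-same'(cmp k)(cmp k)(suc(lev k)ℕ.≤? l)
   ; decompose = \ t -> decompose' t(t ℕ.≤? l)}

 strips : ∀ l -> Strips(stage l)
 strips zero = strips0
 strips(suc l) = NextStrips.nextStrips(stage l)(strips l)

-- Linear algebra of the bar complex.

module BarComplex{c ℓ a ℓa}{R : CommutativeRing c ℓ}(A : GradedAlgebra R a ℓa)where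
 private module R = CommutativeRing R
 open GradedAlgebra A
 open Tor A

 barM : ℕ -> ℕ -> LeftModule R.ring(c ⊔ a)(c ⊔ ℓ ⊔ a ⊔ ℓa)
 barM i j = record
  { Carrierᴹ = Bar i j; _≈ᴹ_ = _≋_; _+ᴹ_ = _⊞_; _*ₗ_ = _·_; 0ᴹ = 𝟘; -ᴹ_ =(R.- R.1#)·_
  ; isLeftModule = record
   { isLeftSemimodule = record
    { +ᴹ-isCommutativeMonoid = record
     { isMonoid = record
      { isSemigroup = record
       { isMagma = record
        { isEquivalence = record{ refl = ≋-refl; sym = ≋-sym; trans = ≋-trans }
        ; ∙-cong = ⊞-cong }
       ; assoc = ⊞-assoc }
      ; identity = ⊞-identityˡ ,(\ x -> ≋-trans(⊞-comm x 𝟘)(⊞-identityˡ x))}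
     ; comm = ⊞-comm }
    ; isPreleftSemimodule = record
     { *ₗ-cong = ·-cong; *ₗ-zeroˡ = ·-zeroˡ; *ₗ-distribʳ = ·-distribʳ
     ; *ₗ-identityˡ = ·-identity; *ₗ-assoc = ·-assoc; *ₗ-zeroʳ = ·-zeroʳ
     ; *ₗ-distribˡ = ·-distribˡ } }
   ; -ᴹ‿cong = ·-cong R.refl
   ; -ᴹ‿inverse =(\ x -> ≋-trans(⊞-comm _ x)(inverseʳ x)), inverseʳ } } where
  inverseʳ :(x : Bar i j)-> x ⊞(R.- R.1#)· x ≋ 𝟘
  inverseʳ x =
   ≋-trans(⊞-cong(≋-sym(·-identity x))≋-refl)
   (≋-trans(≋-sym(·-distribʳ x _ _))
   (≋-trans(·-cong(R.-‿inverseʳ R.1#)≋-refl)(·-zeroˡ x)))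

 module B i j = LeftModule(barM i j)
 module BT i j = ModuleTheory(barM i j)

 cons-linʳ : ∀{i d j′ j}(eq : suc d + j′ ≡ j)(u : Deg(suc d))-> Lin(barM i j′)(barM(suc i)j)(cons eq u)
 cons-linʳ{d = d} eq u = record{ map-cong = cons-cong eq(LeftModule.≈ᴹ-refl(component(suc d))); map-+ = cons-distribˡ eq u; map-* = \ k -> cons-scalarʳ eq k u }

 cons-linˡ : ∀{i d j′ j}(eq : suc d + j′ ≡ j)(x : Bar i j′)-> Lin(component(suc d))(barM(suc i)j)(\ u -> cons eq u x)
 cons-linˡ eq x = record{ map-cong = \ h -> cons-cong eq h ≋-refl; map-+ = \ u w -> cons-distribʳ eq u w x; map-* = \ k u -> cons-scalarˡ eq k u x }

 mul-linˡ : ∀{m n d}(eq : m + n ≡ d)(y : Deg n)-> Lin(component m)(component d)(\ x -> mul eq x y)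
 mul-linˡ{n = n} eq y = record{ map-cong = \ h -> mul-cong eq h(LeftModule.≈ᴹ-refl(component n)); map-+ = \ u w -> mul-distribʳ eq u w y; map-* = \ k u -> mul-scalarˡ eq k u y }

 mul-linʳ : ∀{m n d}(eq : m + n ≡ d)(x : Deg m)-> Lin(component n)(component d)(mul eq x)
 mul-linʳ{m} eq x = record{ map-cong = mul-cong eq(LeftModule.≈ᴹ-refl(component m)); map-+ = mul-distribˡ eq x; map-* = \ k u -> mul-scalarʳ eq k x u }

 record Bilin{t ℓt}(T : LeftModule R.ring t ℓt)i j
         (φ : ∀{d j′} -> suc d + j′ ≡ j -> Deg(suc d)-> Bar i j′ -> LeftModule.Carrierᴹ T) : Set(c ⊔ ℓ ⊔ a ⊔ ℓa ⊔ ℓt)where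
  field
   left : ∀{d j′}(eq : suc d + j′ ≡ j)(x : Bar i j′)-> Lin(component(suc d))T(\ u -> φ eq u x)
   right : ∀{d j′}(eq : suc d + j′ ≡ j)(u : Deg(suc d))-> Lin(barM i j′)T(φ eq u)

 module _{t ℓt}(T : LeftModule R.ring t ℓt){i j}
      (φ : ∀{d j′} -> suc d + j′ ≡ j -> Deg(suc d)-> Bar i j′ -> LeftModule.Carrierᴹ T)where
  private module T = LeftModule T

  -- The universal property of the tensor product. `absorb` and `δ`, which are defined by recursion
  -- on terms, inherit their linearity from it through `resp-lin`.
  extend : Bar(suc i)j -> T.Carrierᴹ
  extend(cons eq u x) = φ eq u x
  extend 𝟘 = T.0ᴹ
  extend(x ⊞ y) = extend x T.+ᴹ extend y
  extend(k · x) = k T.*ₗ extend x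

  extend-lin : Bilin T i j φ -> Lin(barM(suc i)j)T extend
  extend-lin β = record{ map-cong = extend-cong; map-+ = \ _ _ -> T.≈ᴹ-refl; map-* = \ _ _ -> T.≈ᴹ-refl } where
   open Bilin β
   extend-cong : ∀{x y} -> x ≋ y -> extend x T.≈ᴹ extend y
   extend-cong ≋-refl = T.≈ᴹ-refl
   extend-cong(≋-sym h) = T.≈ᴹ-sym(extend-cong h)
   extend-cong(≋-trans h k) = T.≈ᴹ-trans(extend-cong h)(extend-cong k)
   extend-cong(⊞-cong h k) = T.+ᴹ-cong(extend-cong h)(extend-cong k)
   extend-cong(·-cong h k) = T.*ₗ-cong h(extend-cong k)
   extend-cong(cons-cong eq h k) = T.≈ᴹ-trans(Lin.map-cong(left eq _)h)(Lin.map-cong(right eq _)k)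
   extend-cong(⊞-assoc x y z) = T.+ᴹ-assoc _ _ _
   extend-cong(⊞-comm x y) = T.+ᴹ-comm _ _
   extend-cong(⊞-identityˡ x) = T.+ᴹ-identityˡ _
   extend-cong(·-zeroˡ x) = T.*ₗ-zeroˡ _
   extend-cong(·-zeroʳ k) = T.*ₗ-zeroʳ _
   extend-cong(·-identity x) = T.*ₗ-identityˡ _
   extend-cong(·-assoc k l x) = T.*ₗ-assoc _ _ _
   extend-cong(·-distribˡ k x y) = T.*ₗ-distribˡ _ _ _
   extend-cong(·-distribʳ x k l) = T.*ₗ-distribʳ _ _ _
   extend-cong(cons-distribˡ eq u x y) = Lin.map-+(right eq u)x y
   extend-cong(cons-distribʳ eq u w x) = Lin.map-+(left eq x)u w
   extend-cong(cons-scalarˡ eq k u x) = Lin.map-*(left eq x)k u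
   extend-cong(cons-scalarʳ eq k u x) = Lin.map-*(right eq u)k x

 module _{t ℓt}{T : LeftModule R.ring t ℓt} where
  private module T = LeftModule T

  -- Pure tensors generate; almost every identity of chains below is reduced to `cons` by this.
  agree : ∀{i j}{f h : Bar(suc i)j -> T.Carrierᴹ} -> Lin(barM(suc i)j)T f -> Lin(barM(suc i)j)T h ->
      (∀{d j′}(eq : suc d + j′ ≡ j)u(x : Bar i j′)-> f(cons eq u x)T.≈ᴹ h(cons eq u x))-> ∀ x -> f x T.≈ᴹ h x
  agree F H φ(cons eq u x) = φ eq u x
  agree F H φ 𝟘 = T.≈ᴹ-trans(Lin.map-0 F)(T.≈ᴹ-sym(Lin.map-0 H))
  agree F H φ(x ⊞ y) = T.≈ᴹ-trans(Lin.map-+ F x y)(T.≈ᴹ-trans(T.+ᴹ-cong(agree F H φ x)(agree F H φ y))(T.≈ᴹ-sym(Lin.map-+ H x y)))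
  agree F H φ(k · x) = T.≈ᴹ-trans(Lin.map-* F k x)(T.≈ᴹ-trans(T.*ₗ-congˡ(agree F H φ x))(T.≈ᴹ-sym(Lin.map-* H k x)))

  resp-lin : ∀{i j}{f h : Bar i j -> T.Carrierᴹ} →(∀ x -> f x ≡ h x)-> Lin(barM i j)T h -> Lin(barM i j)T f
  resp-lin{f = f}{h} e H = record
   { map-cong = \{x}{y} p -> subst₂ T._≈ᴹ_(sym(e x))(sym(e y))(Lin.map-cong H p)
   ; map-+ = \ x y -> subst₂ T._≈ᴹ_(sym(e _))(cong₂ T._+ᴹ_(sym(e x))(sym(e y)))(Lin.map-+ H x y)
   ; map-* = \ k x -> subst₂ T._≈ᴹ_(sym(e _))(cong(k T.*ₗ_)(sym(e x)))(Lin.map-* H k x)}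

 absorb-linʳ : ∀{i d j′ j}(eq : suc d + j′ ≡ j)(u : Deg(suc d))-> Lin(barM(suc i)j′)(barM(suc i)j)(absorb eq u)
 absorb-linʳ{i}{d}{j′}{j} eq u = resp-lin same(extend-lin(barM(suc i)j)φ(record
   { left = \ eq′ x -> ∘-lin(cons-linˡ _ x)(mul-linʳ refl u)
   ; right = \ eq′ w -> cons-linʳ _ _ }))where
  φ : ∀{d′ j″} -> suc d′ + j″ ≡ j′ -> Deg(suc d′)-> Bar i j″ -> Bar(suc i)j
  φ eq′ w x = absorb eq u(cons eq′ w x)
  same : ∀ x -> absorb eq u x ≡ extend(barM(suc i)j)φ x
  same(cons _ _ _) = refl
  same 𝟘 = refl
  same(x ⊞ y) = cong₂ _⊞_(same x)(same y)
  same(k · x) = cong(k ·_)(same x)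

 absorb-linˡ : ∀{i d j′ j}(eq : suc d + j′ ≡ j)(x : Bar(suc i)j′)-> Lin(component(suc d))(barM(suc i)j)(\ u -> absorb eq u x)
 absorb-linˡ eq(cons eq′ w x) = ∘-lin(cons-linˡ _ x)(mul-linˡ refl w)
 absorb-linˡ{i}{d}{j = j} eq 𝟘 = zero-lin{R = R}(component(suc d))(barM(suc i)j)
 absorb-linˡ{i}{d}{j = j} eq(x ⊞ y) = +-lin{R = R}(component(suc d))(barM(suc i)j)(absorb-linˡ eq x)(absorb-linˡ eq y)
 absorb-linˡ{i}{d}{j = j} eq(k · x) = record
  { map-cong = \ h -> ·-cong R.refl(X.map-cong h)
  ; map-+ = \ u w -> ≋-trans(·-cong R.refl(X.map-+ u w))(·-distribˡ k _ _)
  ; map-* = \ l u -> ≋-trans(·-cong R.refl(X.map-* l u))(≋-trans(≋-sym(·-assoc k l _))(≋-trans(·-cong(R.*-comm k l)≋-refl)(·-assoc l k _)))}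
  where module X = Lin(absorb-linˡ{i}{d} eq x)

 δ-lin : ∀ i j -> Lin(barM(suc i)j)(barM i j)δ
 δ-lin zero j = resp-lin same(extend-lin(barM 0 j)(\ _ _ _ -> 𝟘)(record
   { left = \{d} _ _ -> zero-lin{R = R}(component(suc d))(barM 0 j); right = \{_}{j′} _ _ -> zero-lin{R = R}(barM 0 j′)(barM 0 j)}))where
  same : ∀ x -> δ{zero}{j} x ≡ extend(barM 0 j)(\ _ _ _ -> 𝟘)x
  same(cons _ _ _) = refl
  same 𝟘 = refl
  same(x ⊞ y) = cong₂ _⊞_(same x)(same y)
  same(k · x) = cong(k ·_)(same x)
 δ-lin(suc i)j = resp-lin same(extend-lin(barM(suc i)j)φ(record
   { left = \{d} eq x -> +-lin{R = R}(component(suc d))(barM(suc i)j)(absorb-linˡ eq x)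
     (neg-lin{R = R}(component(suc d))(barM(suc i)j)(cons-linˡ eq(δ x)))
   ; right = \{_}{j′} eq u -> +-lin{R = R}(barM(suc i)j′)(barM(suc i)j)(absorb-linʳ eq u)
     (neg-lin{R = R}(barM(suc i)j′)(barM(suc i)j)(∘-lin(cons-linʳ eq u)(δ-lin i j′)))}))where
  φ : ∀{d j′} -> suc d + j′ ≡ j -> Deg(suc d)-> Bar(suc i)j′ -> Bar(suc i)j
  φ eq u x = absorb eq u x ⊞(R.- R.1#)· cons eq u(δ x)
  same : ∀ x -> δ{suc i}{j} x ≡ extend(barM(suc i)j)φ x
  same(cons _ _ _) = refl
  same 𝟘 = refl
  same(x ⊞ y) = cong₂ _⊞_(same x)(same y)
  same(k · x) = cong(k ·_)(same x)

 module δ i j = Lin(δ-lin i j)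

 cons-irrelevant : ∀{i d j′ j}(p q : suc d + j′ ≡ j){u : Deg(suc d)}{x : Bar i j′} -> cons p u x ≋ cons q u x
 cons-irrelevant p q{u}{x} = B.≈ᴹ-reflexive _ _(cong(\ r -> cons r u x)(ℕ.≡-irrelevant p q))

 -- Associativity of the product. The degrees on the two sides agree only propositionally, so
 -- `regroup` and `transport` generalise them until the equation can be matched with `refl`.
 absorb-absorb : ∀{i d d′ j j′ j″}(p : suc d + j′ ≡ j)(q : suc d′ + j″ ≡ j′)(r : suc d + suc d′ + j″ ≡ j)
         (u : Deg(suc d))(w : Deg(suc d′))(x : Bar(suc i)j″)->
         absorb p u(absorb q w x)≋ absorb r(mul refl u w)x
 absorb-absorb{i}{d}{d′}{j} p q r u w = agree(∘-lin(absorb-linʳ p u)(absorb-linʳ q w))(absorb-linʳ r(mul refl u w))φ where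
  φ : ∀{d″ k}(eq : suc d″ + k ≡ _)(y : Deg(suc d″))(x : Bar i k)->
    absorb p u(absorb q w(cons eq y x))≋ absorb r(mul refl u w)(cons eq y x)
  φ{d″}{k} refl y x = regroup(suc d′ + suc d″)(ℕ.+-assoc(suc d)(suc d′)(suc d″))_ _ where
   regroup : ∀ n(e : suc d + suc d′ + suc d″ ≡ suc d + n){n+ : suc d′ + suc d″ ≡ n}
        (s : suc(d + n)+ k ≡ j)(t : suc(d + suc d′ + suc d″)+ k ≡ j)->
        cons s(mul refl u(mul n+ w y))x ≋ cons t(mul refl(mul refl u w)y)x
   regroup n e{n+ = n+} s t = ≋-trans(cons-cong s(LeftModule.≈ᴹ-sym(component _)(mul-assoc refl e n+ refl u w y))≋-refl)(transport e s t)where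
    transport : ∀{m}(e : suc d + suc d′ + suc d″ ≡ suc m)(s : suc m + k ≡ j)(t : suc(d + suc d′ + suc d″)+ k ≡ j)->
          cons s(mul e(mul refl u w)y)x ≋ cons t(mul refl(mul refl u w)y)x
    transport refl s t = cons-irrelevant s t

 absorb-cons : ∀{i d d′ j j′ j″}(p : suc d + j′ ≡ j)(q : suc d′ + j″ ≡ j′)(r : suc d + suc d′ + j″ ≡ j)
        (u : Deg(suc d))(w : Deg(suc d′))(x : Bar i j″)->
        absorb p u(cons q w x)≋ cons r(mul refl u w)x
 absorb-cons p q r u w x = cons-irrelevant _ r

 δ-absorb : ∀{i d j′ j}(eq : suc d + j′ ≡ j)(u : Deg(suc d))(x : Bar(suc(suc i))j′)-> δ(absorb eq u x)≋ absorb eq u(δ x)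
 δ-absorb{i}{d}{j′}{j} eq u = agree(∘-lin(δ-lin(suc i)j)(absorb-linʳ eq u))(∘-lin(absorb-linʳ eq u)(δ-lin(suc i)j′))
  (\{d′}{j″} eq′ w x -> ⊞-cong(≋-sym(absorb-absorb eq eq′ _ u w x))≋-refl)

 δδ : ∀{i j}(x : Bar(suc(suc i))j)-> δ(δ x)≋ 𝟘
 δδ{zero}{j} = agree(∘-lin(δ-lin 0 j)(δ-lin 1 j))(zero-lin{R = R}(barM 2 j)(barM 0 j))(\ eq u x ->
  ≋-trans(⊞-cong(degree0 eq u x)≋-refl)(B.≈ᴹ-trans _ _(⊞-identityˡ _)(·-zeroʳ _)))where
  degree0 : ∀{d j′ j}(eq : suc d + j′ ≡ j)(u : Deg(suc d))(x : Bar 1 j′)-> δ(absorb eq u x)≋ 𝟘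
  degree0{j = j} eq u = agree(∘-lin(δ-lin 0 j)(absorb-linʳ eq u))(zero-lin{R = R}(barM 1 _)(barM 0 j))(\ _ _ _ -> ≋-refl)
 δδ{suc i}{j} = agree(∘-lin(δ-lin(suc i)j)(δ-lin(suc(suc i))j))(zero-lin{R = R}(barM(suc(suc(suc i)))j)(barM(suc i)j))φ where
  φ : ∀{d j′}(eq : suc d + j′ ≡ j)(u : Deg(suc d))(x : Bar(suc(suc i))j′)->
    δ(absorb eq u x)⊞(R.- R.1#)·(absorb eq u(δ x)⊞(R.- R.1#)· cons eq u(δ(δ x)))≋ 𝟘
  φ eq u x = begin
   δ(absorb eq u x)⊞(R.- R.1#)·(absorb eq u(δ x)⊞(R.- R.1#)· cons eq u(δ(δ x)))
    ≈⟨ ⊞-cong(δ-absorb eq u x)(·-cong R.refl(⊞-cong ≋-refl(·-cong R.refl(≋-trans(cons-cong eq(LeftModule.≈ᴹ-refl(component _))(δδ x))(Lin.map-0(cons-linʳ eq u))))))⟩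
   absorb eq u(δ x)⊞(R.- R.1#)·(absorb eq u(δ x)⊞(R.- R.1#)· 𝟘)
    ≈⟨ solve(absorb eq u(δ x)∷ [])(# zero :+ :-(# zero :+ :- :0)) :0 refl ⟩
   𝟘 ∎ where
   open SetoidReasoning(B.≈ᴹ-setoid(suc i)j)
   open BT(suc i)j

 bar0-zero : ∀{j} -> j ≢ 0 →(x : Bar 0 j)-> x ≋ 𝟘
 bar0-zero j≢ [] = contra refl j≢
 bar0-zero j≢ 𝟘 = ≋-refl
 bar0-zero j≢(x ⊞ y) = ≋-trans(⊞-cong(bar0-zero j≢ x)(bar0-zero j≢ y))(⊞-identityˡ 𝟘)
 bar0-zero j≢(k · x) = ≋-trans(·-cong R.refl(bar0-zero j≢ x))(·-zeroʳ k)

 bar-degree0-zero : ∀{i}(x : Bar(suc i)0)-> x ≋ 𝟘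
 bar-degree0-zero{i} = agree(id-lin(barM(suc i)0))(zero-lin{R = R}(barM(suc i)0)(barM(suc i)0))(\())

-- Contracting the bar complex outside the diagonal.

-- An algebra that is, as a left module over itself, described by its monomials with increasing levels.
record LinModel{c ℓ a ℓa}{R : CommutativeRing c ℓ}(A : GradedAlgebra R a ℓa)(N : ℕ) : Set(c ⊔ ℓ ⊔ a ⊔ ℓa)where
 private module R = CommutativeRing R
 open GradedAlgebra A
 field
  lev : Fin N -> ℕ
  n : ℕ
  ε : Fin N -> Deg 1
  strip : Fin N -> ∀{d} -> Deg(suc d)-> Deg d
  high : ℕ -> ∀{d} -> Deg d -> Deg d
  scal : Deg 0 -> R.Carrier
  strip-lin : ∀ k{d} -> Lin(component(suc d))(component d)(strip k)
  high-lin : ∀ t{d} -> Lin(component d)(component d)(high t)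
  scal-cong : ∀{u w : Deg 0} -> u ≈ᴹ w -> scal u R.≈ scal w
  scal-+ : ∀(u w : Deg 0)-> scal(u +ᴹ w)R.≈ scal u R.+ scal w
  scal-* : ∀ k(u : Deg 0)-> scal(k *ₗ u)R.≈ k R.* scal u
  scal-one : scal one R.≈ R.1#
  scal-one* : ∀ u -> u ≈ᴹ scal u *ₗ one
  strip-other : ∀{k m d} -> lev m ≤ lev k -> m ≢ k →(u : Deg d)-> strip k(mul refl(ε m)u)≈ᴹ 0ᴹ
  strip-same : ∀{k d}(u : Deg d)-> strip k(mul refl(ε k)u)≈ᴹ high(suc(lev k))u
  high-scal : ∀ t(u : Deg 0)-> high t u ≈ᴹ u
  high-top : ∀{d}(u : Deg(suc d))-> high n u ≈ᴹ 0ᴹ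
  decompose : ∀ t{d}(u : Deg(suc d))-> u ≈ᴹ high t u +ᴹ
           ModuleTheory.∑(component(suc d))(\ m -> lev m ℕ.<? t)(\ m -> mul refl(ε m)(strip m u))
  ε-square : ∀ m -> mul refl(ε m)(ε m)≈ᴹ 0ᴹ
  ε-anti : ∀ k m -> mul refl(ε k)(ε m)≈ᴹ -ᴹ mul refl(ε m)(ε k)
  ε-thd : ∀{k m} -> k ≢ m -> lev k ≡ lev m -> ∃ \ x -> lev x < lev k ×
           mul refl(ε k)(ε m)≈ᴹ mul refl(ε x)(ε m)+ᴹ -ᴹ mul refl(ε x)(ε k)

module KoszulOfModel{c ℓ a ℓa}{R : CommutativeRing c ℓ}{A : GradedAlgebra R a ℓa}{N : ℕ}(𝓜 : LinModel A N)where
 private module R = CommutativeRing R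
 open GradedAlgebra A hiding(_≈ᴹ_; _+ᴹ_; 0ᴹ; -ᴹ_; _*ₗ_)
 open LinModel 𝓜
 open Tor A
 open BarComplex A
 open import Algebra.Module.Construct.DirectProduct using()renaming(leftModule to _⊗_)
 private
  module A d = LeftModule(component d)
  module AT d = ModuleTheory(component d)

 -- A ⊗ A₊^{⊗ i} = A₊^{⊗ (1 + i)} ⊕ A₊^{⊗ i}.
 C : ℕ -> ℕ -> LeftModule R.ring(c ⊔ a)(c ⊔ ℓ ⊔ a ⊔ ℓa)
 C i j = barM(suc i)j ⊗ barM i j

 module C i j = LeftModule(C i j)

 -- Left multiplication by u on A ⊗ A₊^{⊗ i}: on the first summand u is absorbed into the leading
 -- factor, on the second, which is 1 ⊗ A₊^{⊗ i}, it becomes the leading factor.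
 apply : ∀{d i j′ j} -> suc d + j′ ≡ j -> Deg(suc d)-> C.Carrierᴹ i j′ -> Bar(suc i)j
 apply eq u(p , q) = absorb eq u p ⊞ cons eq u q

 app : Fin N -> ∀{i j} -> C.Carrierᴹ i j -> Bar(suc i)(suc j)
 app m = apply refl(ε m)

 apply-linʳ : ∀{d i j′ j}(eq : suc d + j′ ≡ j)(u : Deg(suc d))-> Lin(C i j′)(barM(suc i)j)(apply eq u)
 apply-linʳ{i = i}{j = j} eq u = record
  { map-cong = \(h , k)-> ⊞-cong(Lin.map-cong(absorb-linʳ eq u)h)(Lin.map-cong(cons-linʳ eq u)k)
  ; map-+ = \ _ _ -> ≋-trans(⊞-cong(Lin.map-+(absorb-linʳ eq u)_ _)(cons-distribˡ eq u _ _))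
    (AbelianGroupSolver.interchange(B.+ᴹ-abelianGroup(suc i)j)_ _ _ _)
  ; map-* = \ k _ -> ≋-trans(⊞-cong(Lin.map-*(absorb-linʳ eq u)_ _)(cons-scalarʳ eq k u _))(≋-sym(·-distribˡ k _ _))}

 apply-linˡ : ∀{d i j′ j}(eq : suc d + j′ ≡ j)(y : C.Carrierᴹ i j′)-> Lin(component(suc d))(barM(suc i)j)(\ u -> apply eq u y)
 apply-linˡ{d}{i}{j = j} eq(p , q) = +-lin{R = R}(component(suc d))(barM(suc i)j)(absorb-linˡ eq p)(cons-linˡ eq q)

 app-lin : ∀ m{i j} -> Lin(C i j)(barM(suc i)(suc j))(app m)
 app-lin m = apply-linʳ refl(ε m)

 scal-0 : ∀{u} -> A._≈ᴹ_ 0 u(A.0ᴹ 0)-> scal u R.≈ R.0#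
 scal-0 h = R.trans(scal-cong(A.≈ᴹ-trans 0 h(A.≈ᴹ-sym 0(A.*ₗ-zeroˡ 0 _))))(R.trans(scal-* R.0#(A.0ᴹ 0))(R.zeroˡ _))

 module _(k : Fin N){i j : ℕ} where
  -- A leading factor of degree 1 loses its only letter; the remaining scalar no longer lies in A₊
  -- and moves the chain to the second summand of `C`.
  stripping : ∀{d j′} -> suc d + j′ ≡ suc j -> Deg(suc d)-> Bar i j′ -> C.Carrierᴹ i j
  stripping{zero} refl u x = 𝟘 , scal(strip k u)· x
  stripping{suc d} eq u x = cons(ℕ.suc-injective eq)(strip k u)x , 𝟘

  stripᴮ : Bar(suc i)(suc j)-> C.Carrierᴹ i j
  stripᴮ = extend(C i j)stripping

  stripᴮ-lin : Lin(barM(suc i)(suc j))(C i j)stripᴮ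
  stripᴮ-lin = extend-lin(C i j)stripping(record{ left = left; right = right })where
   left : ∀{d j′}(eq : suc d + j′ ≡ suc j)(x : Bar i j′)-> Lin(component(suc d))(C i j)(\ u -> stripping eq u x)
   left{zero} refl x = record
    { map-cong = \ h -> ≋-refl , ·-cong(scal-cong(Lin.map-cong(strip-lin k)h))≋-refl
    ; map-+ = \ u w -> ≋-sym(⊞-identityˡ 𝟘), ≋-trans(·-cong(R.trans(scal-cong(Lin.map-+(strip-lin k)u w))(scal-+ _ _))≋-refl)(·-distribʳ x _ _)
    ; map-* = \ l u -> ≋-sym(·-zeroʳ l), ≋-trans(·-cong(R.trans(scal-cong(Lin.map-*(strip-lin k)l u))(scal-* _ _))≋-refl)(·-assoc _ _ x)}
   left{suc d} eq x = record
    { map-cong = \ h -> Lin.map-cong(∘-lin(cons-linˡ _ x)(strip-lin k))h , ≋-refl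
    ; map-+ = \ u w -> Lin.map-+(∘-lin(cons-linˡ _ x)(strip-lin k))u w , ≋-sym(⊞-identityˡ 𝟘)
    ; map-* = \ l u -> Lin.map-*(∘-lin(cons-linˡ _ x)(strip-lin k))l u , ≋-sym(·-zeroʳ l)}
   right : ∀{d j′}(eq : suc d + j′ ≡ suc j)(u : Deg(suc d))-> Lin(barM i j′)(C i j)(stripping eq u)
   right{zero} refl u = record
    { map-cong = \ h -> ≋-refl , ·-cong R.refl h
    ; map-+ = \ x y -> ≋-sym(⊞-identityˡ 𝟘), ·-distribˡ _ x y
    ; map-* = \ l x -> ≋-sym(·-zeroʳ l), ≋-trans(≋-sym(·-assoc _ _ x))(≋-trans(·-cong(R.*-comm _ _)≋-refl)(·-assoc _ _ x))}
   right{suc d} eq u = record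
    { map-cong = \ h -> Lin.map-cong(cons-linʳ _(strip k u))h , ≋-refl
    ; map-+ = \ x y -> cons-distribˡ _ _ x y , ≋-sym(⊞-identityˡ 𝟘)
    ; map-* = \ l x -> cons-scalarʳ _ l _ x , ≋-sym(·-zeroʳ l)}

 module _(t : ℕ){i j : ℕ} where
  raise : ∀{d j′} -> suc d + j′ ≡ j -> Deg(suc d)-> Bar i j′ -> Bar(suc i)j
  raise eq u x = cons eq(high t u)x

  highᴮ : Bar(suc i)j -> Bar(suc i)j
  highᴮ = extend(barM(suc i)j)raise

  highᴮ-lin : Lin(barM(suc i)j)(barM(suc i)j)highᴮ
  highᴮ-lin = extend-lin(barM(suc i)j)raise(record
   { left = \ eq x -> ∘-lin(cons-linˡ eq x)(high-lin t)
   ; right = \ eq u -> cons-linʳ eq(high t u)})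

 highᴮ-top : ∀{i j}(x : Bar(suc i)j)-> highᴮ n x ≋ 𝟘
 highᴮ-top{i}{j} = agree(highᴮ-lin n)(zero-lin{R = R}(barM(suc i)j)(barM(suc i)j))
  (\ eq u x -> ≋-trans(cons-cong eq(high-top u)≋-refl)(Lin.map-0(cons-linˡ eq x)))

 ε-one : ∀ m -> A._≈ᴹ_ 1(ε m)(mul refl(ε m)one)
 ε-one m = A.≈ᴹ-sym 1(mul-identityʳ refl(ε m))

 strip-app-other : ∀{k m} -> lev m ≤ lev k -> m ≢ k -> ∀{i j}(y : C.Carrierᴹ i j)-> C._≈ᴹ_ i j(stripᴮ k(app m y))(C.0ᴹ i j)
 strip-app-other{k}{m} m≤ m≢{i}{j}(p , q) = C.≈ᴹ-trans i j(C.+ᴹ-cong i j(first p)second)(C.+ᴹ-identityʳ i j _)where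
  first : ∀ p -> C._≈ᴹ_ i j(stripᴮ k(absorb refl(ε m)p))(C.0ᴹ i j)
  first = agree(∘-lin(stripᴮ-lin k)(absorb-linʳ refl(ε m)))(zero-lin{R = R}(barM(suc i)j)(C i j))
   (\ eq u x -> ≋-trans(cons-cong _(strip-other m≤ m≢ u)≋-refl)(Lin.map-0(cons-linˡ _ x)), ≋-refl)
  second : C._≈ᴹ_ i j(𝟘 , scal(strip k(ε m))· q)(C.0ᴹ i j)
  second = ≋-refl , ≋-trans(·-cong(scal-0(A.≈ᴹ-trans 0(Lin.map-cong(strip-lin k)(ε-one m))(strip-other m≤ m≢ one)))≋-refl)(·-zeroˡ q)

 strip-app-same : ∀{k i j}(p : Bar(suc i)j)(q : Bar i j)-> C._≈ᴹ_ i j(stripᴮ k(app k(p , q)))(highᴮ(suc(lev k))p , q)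
 strip-app-same{k}{i}{j} p q = C.≈ᴹ-trans i j(C.+ᴹ-cong i j(first p)second)(≋-trans(⊞-comm _ 𝟘)(⊞-identityˡ _), ⊞-identityˡ q)where
  ι1-lin : Lin(barM(suc i)j)(C i j)(_, 𝟘)
  ι1-lin = record{ map-cong = _, ≋-refl; map-+ = \ _ _ -> ≋-refl , ≋-sym(⊞-identityˡ 𝟘); map-* = \ l _ -> ≋-refl , ≋-sym(·-zeroʳ l)}
  first : ∀ p -> C._≈ᴹ_ i j(stripᴮ k(absorb refl(ε k)p))(highᴮ(suc(lev k))p , 𝟘)
  first = agree(∘-lin(stripᴮ-lin k)(absorb-linʳ refl(ε k)))(∘-lin ι1-lin(highᴮ-lin(suc(lev k))))
   (\ eq u x -> ≋-trans(cons-cong _(strip-same u)≋-refl)(cons-irrelevant _ eq), ≋-refl)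
  second : C._≈ᴹ_ i j(𝟘 , scal(strip k(ε k))· q)(𝟘 , q)
  second = ≋-refl , ≋-trans(·-cong(R.trans(scal-cong(A.≈ᴹ-trans 0(Lin.map-cong(strip-lin k)(ε-one k))
   (A.≈ᴹ-trans 0(strip-same one)(high-scal _ one))))scal-one)≋-refl)(·-identity q)

 <? : ∀ t m -> Dec(lev m < t)
 <? t m = lev m ℕ.<? t

 decomposeᴮ : ∀ t{i j}(p : Bar(suc i)(suc j))-> p ≋ highᴮ t p ⊞ BT.∑(suc i)(suc j)(<? t)(\ m -> app m(stripᴮ m p))
 decomposeᴮ t{i}{j} = agree(id-lin B')(+-lin{R = R} B' B'(highᴮ-lin t)
   (∑-lin{R = R} B' B'(<? t)(\ m -> ∘-lin(app-lin m)(stripᴮ-lin m))))φ where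
  B' = barM(suc i)(suc j)
  term : ∀{d j′}(eq : suc d + j′ ≡ suc j)(u : Deg(suc d))(x : Bar i j′)m -> cons eq(mul refl(ε m)(strip m u))x ≋ app m(stripping m eq u x)
  term{zero} refl u x m = begin
   cons refl(mul refl(ε m)(strip m u))x ≈⟨ cons-cong refl(A.≈ᴹ-trans 1(mul-cong refl(A.≈ᴹ-refl 1)(scal-one* _))(A.≈ᴹ-trans 1(mul-scalarʳ refl s(ε m)one)(A.*ₗ-congˡ 1(A.≈ᴹ-sym 1(ε-one m)))))≋-refl ⟩
   cons refl(A._*ₗ_ 1 s(ε m))x ≈⟨ cons-scalarˡ refl s(ε m)x ⟩
   s · cons refl(ε m)x ≈⟨ cons-scalarʳ refl s(ε m)x ⟨
   cons refl(ε m)(s · x)≈⟨ ⊞-identityˡ _ ⟨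
   𝟘 ⊞ cons refl(ε m)(s · x)∎ where
   open SetoidReasoning(B.≈ᴹ-setoid(suc i)(suc j))
   s = scal(strip m u)
  term{suc d} eq u x m = ≋-trans(cons-irrelevant _ _)(≋-trans(≋-sym(⊞-identityˡ _))(≋-trans(⊞-comm 𝟘 _)(⊞-cong ≋-refl(≋-sym(Lin.map-0(cons-linʳ refl(ε m)))))))
  φ : ∀{d j′}(eq : suc d + j′ ≡ suc j)(u : Deg(suc d))(x : Bar i j′)->
    cons eq u x ≋ cons eq(high t u)x ⊞ BT.∑(suc i)(suc j)(<? t)(\ m -> app m(stripping m eq u x))
  φ{d} eq u x = ≋-trans(cons-cong eq(decompose t u)≋-refl)(≋-trans(cons-distribʳ eq _ _ x)(⊞-cong ≋-refl
   (≋-trans(Lin.map-∑(cons-linˡ eq x)(<? t)(\ m -> mul refl(ε m)(strip m u)))(BT.∑-cong(suc i)(suc j)(<? t)(\ m _ -> term eq u x m)))))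

 -- Membership in the sum of e_m (A ⊗ A₊^{⊗ i}) over the atoms of level below t. The coordinates are
 -- recorded because the contraction operates on them.
 record Filt(t : ℕ){i j : ℕ}(x : Bar(suc i)(suc j)) : Set(c ⊔ ℓ ⊔ a ⊔ ℓa)where
  constructor _,_
  field
   coordinates : Fin N -> C.Carrierᴹ i j
   expansion : x ≋ BT.∑(suc i)(suc j)(<? t)(\ m -> app m(coordinates m))

 module _{i j : ℕ} where
  open BT(suc i)(suc j)

  filt-resp : ∀{t}{x x′ : Bar(suc i)(suc j)} -> x ≋ x′ -> Filt t x′ -> Filt t x
  filt-resp h(y , k) = y , ≋-trans h k

  filt-0 : ∀{t} -> Filt t{i}{j} 𝟘
  filt-0{t} =(\ _ -> C.0ᴹ i j), ≋-sym(∑-zero(<? t)(\ m _ -> Lin.map-0(app-lin m)))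

  filt-+ : ∀{t}{x x′ : Bar(suc i)(suc j)} -> Filt t x -> Filt t x′ -> Filt t(x ⊞ x′)
  filt-+{t}(y , h)(y′ , h') =(\ m -> C._+ᴹ_ i j(y m)(y′ m)), ≋-trans(⊞-cong h h')(≋-trans
   (≋-sym(∑-+(<? t)(\ m -> app m(y m))(\ m -> app m(y′ m))))
   (∑-cong(<? t)(\ m _ -> ≋-sym(Lin.map-+(app-lin m)(y m)(y′ m)))))

  filt-∑ : ∀{t k p}{P : Fin k -> Set p}(P? : ∀ x -> Dec(P x)){f : Fin k -> Bar(suc i)(suc j)} ->
         (∀ m -> P m -> Filt t(f m))-> Filt t(∑ P? f)
  filt-∑{k = zero} P? h = filt-0
  filt-∑{t}{suc k}{P = P} P?{f} h = filt-+(go(P? zero))(filt-∑(\ x -> P?(suc x))(\ m -> h(suc m)))where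
   go :(q : Dec(P zero))-> Filt t(q ⊢ f zero)
   go(yes q) = h zero q
   go(no _) = filt-0

  filt-app : ∀{t m} -> lev m < t →(y : C.Carrierᴹ i j)-> Filt t(app m y)
  filt-app{t}{m} m< y =(\ m' -> m' Fin.≟ m C⊢ y), ≋-sym(≋-trans
    (∑-single(<? t){\ m' -> app m'(m' Fin.≟ m C⊢ y)} m m<(\ m' _ m'≢ -> ≋-trans(Lin.map-cong(app-lin m')(CT.⊢-no(m' Fin.≟ m)m'≢))(Lin.map-0(app-lin m'))))
    (Lin.map-cong(app-lin m)(CT.⊢-yes(m Fin.≟ m)refl)))where
   module CT = ModuleTheory(C i j)
   open CT using()renaming(_⊢_ to _C⊢_)

  filt-mono : ∀{t t'}{x : Bar(suc i)(suc j)} -> t ≤ t' -> Filt t x -> Filt t' x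
  filt-mono{t} t≤(y , h) = filt-resp h(filt-∑(<? t)(\ m m< -> filt-app(ℕ.<-≤-trans m< t≤)(y m)))

 apply-mul : ∀{i j} k m(y : C.Carrierᴹ i j)-> absorb refl(ε k)(app m y)≋ apply refl(mul refl(ε k)(ε m))y
 apply-mul k m(p , q) = ⊞-cong(absorb-absorb refl refl refl(ε k)(ε m)p)(absorb-cons refl refl refl(ε k)(ε m)q)

 filt-apply : ∀{i j t x} k -> lev x < t →(y : C.Carrierᴹ i j)-> Filt t(apply refl(mul refl(ε x)(ε k))y)
 filt-apply{x = x} k x< y = filt-resp(≋-trans(≋-sym(apply-mul x k y))
  (≋-trans(≋-sym(⊞-identityˡ _))(≋-trans(⊞-comm 𝟘 _)(⊞-cong ≋-refl(≋-sym(Lin.map-0(cons-linʳ refl(ε x))))))))(filt-app x<(app k y , 𝟘))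

 filt-neg : ∀{i j t}{x : Bar(suc i)(suc j)} -> Filt t x -> Filt t((R.- R.1#)· x)
 filt-neg{i}{j}{t}(y , h) =(\ m -> C.-ᴹ_ i j(y m)), ≋-trans(·-cong R.refl h)
  (≋-trans(Lin.map-∑(neg-lin{R = R} B' B'(id-lin B'))(<? t)(\ m -> app m(y m)))(BT.∑-cong(suc i)(suc j)(<? t)(\ m _ -> ≋-sym(Lin.map-neg(app-lin m)(y m)))))
  where B' = barM(suc i)(suc j)

 -- Multiplication by an atom of level t lowers the filtration from `suc t` to t: e_k e_m is - e_m
 -- e_k if m is lower, zero if m = k, and e_x (e_m - e_k) with x lower if m is another atom of level
 -- t.
 absorb-filt : ∀{i j t k} -> lev k ≡ t →{z : Bar(suc i)(suc j)} -> Filt(suc t)z -> Filt t(absorb refl(ε k)z)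
 absorb-filt{i}{j}{t}{k} k≡{z}(y , h) = filt-resp
   (≋-trans(Lin.map-cong(absorb-linʳ refl(ε k))h)(Lin.map-∑(absorb-linʳ refl(ε k))(<?(suc t))(\ m -> app m(y m))))
   (filt-∑(<?(suc t))(\ m m< -> filt-resp(apply-mul k m(y m))(go m(ℕ.<-cmp(lev m)t)m<)))where
  E : Deg 2 -> Fin N -> Bar(suc i)(suc(suc j))
  E u m = apply refl u(y m)
  module L m = Lin(apply-linˡ{d = 1}{j = suc(suc j)} refl(y m))
  go : ∀ m -> Tri(lev m < t)(lev m ≡ t)(t < lev m)-> lev m < suc t -> Filt t(E(mul refl(ε k)(ε m))m)
  go m(tri< m< _ _)_ = filt-resp(≋-trans(L.map-cong m(ε-anti k m))(L.map-neg m _))(filt-neg(filt-apply k m<(y m)))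
  go m(tri> _ _ m>)m≤ = contra m≤(ℕ.≤⇒≯ m>)
  go m(tri≈ _ m≡ _)_ with k Fin.≟ m
  ... | yes refl = filt-resp(≋-trans(L.map-cong m(ε-square m))(L.map-0 m))filt-0
  ... | no k≢m with ε-thd k≢m(k≡ ⨾ sym m≡)
  ... | x , x< , eq = filt-resp(≋-trans(L.map-cong m eq)(≋-trans(L.map-+ m _ _)(⊞-cong ≋-refl(L.map-neg m _))))
   (filt-+(filt-apply m x<t(y m))(filt-neg(filt-apply k x<t(y m))))
   where x<t = subst(lev x <_)k≡ x<

 -- The differential of A ⊗ A₊^{⊗ i} split along the two summands: the boundary of 1 ⊗ q contains q
 -- itself, with its first factor now regarded as an element of A.
 d′ : ∀{i j} -> C.Carrierᴹ(suc i)j -> C.Carrierᴹ i j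
 d′(p , q) = δ p ⊞ q ,(R.- R.1#)· δ q

 δ-app : ∀{i j} m(y : C.Carrierᴹ(suc i)j)-> δ(app m y)≋ app m(d′ y)
 δ-app{i}{j} m(p , q) = begin
  δ(absorb refl(ε m)p)⊞(absorb refl(ε m)q ⊞(R.- R.1#)· cons refl(ε m)(δ q))
   ≈⟨ ⊞-cong(δ-absorb refl(ε m)p)≋-refl ⟩
  absorb refl(ε m)(δ p)⊞(absorb refl(ε m)q ⊞(R.- R.1#)· cons refl(ε m)(δ q))
   ≈⟨ ⊞-assoc _ _ _ ⟨
  (absorb refl(ε m)(δ p)⊞ absorb refl(ε m)q)⊞(R.- R.1#)· cons refl(ε m)(δ q)
   ≈⟨ ⊞-cong ≋-refl(≋-sym(cons-scalarʳ refl _(ε m)(δ q)))⟩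
  app m(d′(p , q))∎
  where open SetoidReasoning(B.≈ᴹ-setoid(suc i)(suc j))

 -- That z stays in the filtration step of x is indispensable to the induction: the primitives found
 -- for shorter chains are fed to `absorb-filt`.
 Claim : ℕ -> ℕ -> Set(c ⊔ ℓ ⊔ a ⊔ ℓa)
 Claim i t = ∀{j} -> j ≢ i →(x : Bar(suc i)(suc j))-> Filt t x -> δ x ≋ 𝟘 ->
       ∃ \(z : Bar(suc(suc i))(suc j))-> δ z ≋ x × Filt t z

 -- Off the diagonal the scalar coordinates live in `Bar 0 j` with j ≠ 0 and vanish, so x = Σ e_m
 -- p_m is the boundary of Σ [e_m | p_m].
 claim0 : ∀ t -> Claim 0 t
 claim0 t{j} j≢ x(y , h)_ = z , ≋-trans(≋-trans(Lin.map-∑(δ-lin 1(suc j))(<? t)(\ m -> app m(𝟘 , p m)))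
   (BT.∑-cong 1(suc j)(<? t)(\ m _ -> bdry m)))(≋-sym h),(\ m -> 𝟘 , p m), ≋-refl where
  p : Fin N -> Bar 1 j
  p m = fst(y m)
  z = BT.∑ 2(suc j)(<? t)(\ m -> app m(𝟘 , p m))
  bdry : ∀ m -> δ(app m(𝟘 , p m))≋ app m(y m)
  bdry m = ≋-trans(δ-app m(𝟘 , p m))(Lin.map-cong(app-lin m)(⊞-identityˡ _ , ≋-trans(bar0-zero j≢ _)(≋-sym(bar0-zero j≢(snd(y m))))))

 module Step(i : ℕ)(previous : ∀ t -> Claim i t)where
  low-degree : ∀{t}(x : Bar(suc(suc i))1)-> Filt t x -> x ≋ 𝟘
  low-degree{t} x(y , h) = ≋-trans h(BT.∑-zero(suc(suc i))1(<? t)(\ m _ ->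
   ≋-trans(Lin.map-cong(app-lin m)(bar-degree0-zero(fst(y m)), bar-degree0-zero(snd(y m))))(Lin.map-0(app-lin m))))

  claim : ∀ t -> Claim(suc i)t
  claim t{zero} j≢ x fx _ = 𝟘 , ≋-sym(low-degree{t} x fx), filt-0
  claim zero{suc j} j≢ x(y , h)_ = 𝟘 , ≋-sym(≋-trans h(BT.∑-zero(suc(suc i))(suc(suc j))(<? 0){\ m -> app m(y m)}(\ m()))), filt-0
  claim(suc t){suc j} j≢ x(y , h)cycle = finish where
   J = suc(suc j)
   open BT(suc(suc i))J
   open SetoidReasoning(B.≈ᴹ-setoid(suc(suc i))J)
   p : Fin N -> Bar(suc(suc i))(suc j)
   p m = fst(y m)
   q : Fin N -> Bar(suc i)(suc j)
   q m = snd(y m)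

   -- Strip e_k from the cycle condition. As k has the highest level that occurs, all other summands
   -- are annihilated by `strip-app-other`, leaving conditions on p_k and q_k alone.
   stripped : ∀ k -> lev k ≡ t -> C._≈ᴹ_ i(suc j)(highᴮ(suc(lev k))(δ(p k)⊞ q k),(R.- R.1#)· δ(q k))(C.0ᴹ i(suc j))
   stripped k k≡ = trans'(sym'(strip-app-same(δ(p k)⊞ q k)((R.- R.1#)· δ(q k))))(trans'(sym'(trans'
     (Lin.map-∑(stripᴮ-lin k)(<?(suc t))(\ m -> app m(d′(y m))))
     (CT.∑-single(<?(suc t)){\ m -> stripᴮ k(app m(d′(y m)))} k(s≤s(ℕ.≤-reflexive k≡))(\ m m< m≢ -> strip-app-other(ℕ.≤-trans(ℕ.≤-pred m<)(ℕ.≤-reflexive(sym k≡)))m≢(d′(y m))))))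
    (Lin.map-≈0(stripᴮ-lin k)(≋-trans(≋-sym(≋-trans(δ.map-cong(suc i)J h)
     (≋-trans(δ.map-∑(suc i)J(<?(suc t))(\ m -> app m(y m)))(BT.∑-cong(suc i)J(<?(suc t))(\ m _ -> δ-app m(y m))))))cycle)))where
    trans' = C.≈ᴹ-trans i(suc j)
    sym' = C.≈ᴹ-sym i(suc j)
    module CT = ModuleTheory(C i(suc j))

   δq : ∀ k -> lev k ≡ t -> δ(q k)≋ 𝟘
   δq k k≡ = ≋-trans(≋-sym(BT.-ᴹ-invol i(suc j)_))(≋-trans(·-cong R.refl(snd(stripped k k≡)))(·-zeroʳ _))

   Killer : Fin N -> Bar(suc(suc i))(suc j)-> Set _
   Killer k z = lev k ≡ t -> δ z ≋ δ(p k)⊞ q k × Filt(suc t)z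

   -- δ p_k + q_k is a cycle, and `stripped` says that its high part vanishes, so `decomposeᴮ` puts
   -- it into `Filt (suc t)` and the claim for one factor fewer applies. The value off level t is a
   -- default.
   killer : ∀ k -> ∃(Killer k)
   killer k with lev k ℕ.≟ t
   ... | no k≢ = 𝟘 , \ k≡ -> contra k≡ k≢
   ... | yes k≡ = let(z , e , f) = previous(suc t)(j≢ ∘ cong suc)(δ(p k)⊞ q k)((\ m -> stripᴮ m(δ(p k)⊞ q k)), ≋-trans(decomposeᴮ(suc t)_)(≋-trans(⊞-cong(subst(\ s -> highᴮ(suc s)(δ(p k)⊞ q k)≋ 𝟘)k≡(fst(stripped k k≡)))≋-refl)(⊞-identityˡ _)))(≋-trans(⊞-cong(δδ(p k))(δq k k≡))(⊞-identityˡ 𝟘))in z , \ _ -> e , f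

   z0 : Fin N -> Bar(suc(suc i))(suc j)
   z0 k = fst(killer k)
   =? : ∀ m -> Dec(lev m ≡ t)
   =? m = lev m ℕ.≟ t
   r : Fin N -> Bar(suc(suc i))(suc j)
   r k = p k ⊞(R.- R.1#)· z0 k
   x1 : Bar(suc(suc i))J
   x1 = ∑(<? t)(\ m -> app m(y m))⊞ ∑ =?(\ k -> absorb refl(ε k)(z0 k))
   w : Bar(suc(suc(suc i)))J
   w = BT.∑(suc(suc(suc i)))J =?(\ k -> app k(𝟘 , r k))

   -- The heart of the contraction: up to the boundary of [e_k | p_k - z_k], the summand e_k y_k may
   -- be replaced by e_k z_k, which `absorb-filt` places one level lower.
   rewrite-top : ∀ k -> lev k ≡ t -> app k(y k)≋ absorb refl(ε k)(z0 k)⊞ δ(app k(𝟘 , r k))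
   rewrite-top k k≡ = ≋-sym(begin
    absorb refl(ε k)(z0 k)⊞ δ(app k(𝟘 , r k))
     ≈⟨ ⊞-cong ≋-refl(δ-app k(𝟘 , r k))⟩
    absorb refl(ε k)(z0 k)⊞ app k(𝟘 ⊞ r k ,(R.- R.1#)· δ(r k))
     ≈⟨ ⊞-cong ≋-refl(Lin.map-cong(app-lin k)(⊞-identityˡ _ , negδ))⟩
    absorb refl(ε k)(z0 k)⊞ app k(r k , q k)
     ≈⟨ solve(absorb refl(ε k)(z0 k)∷ absorb refl(ε k)(p k)∷ cons refl(ε k)(q k)∷ [])
        (# zero :+((# suc zero :+ :- # zero) :+ # suc(suc zero)))(# suc zero :+ # suc(suc zero))refl ⟩
    app k(y k)∎)where
    negδ :(R.- R.1#)· δ(r k)≋ q k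
    negδ = ≋-trans(·-cong R.refl(⊞-cong ≋-refl(·-cong R.refl(fst(snd(killer k)k≡)))))
     (BT.solve(suc i)(suc j)(δ(p k)∷ q k ∷ [])(BT.:-_(BT._:+_(BT.#_ zero)(BT.:-_(BT._:+_(BT.#_ zero)(BT.#_(suc zero))))))(BT.#_(suc zero))refl)

   split : ∀(f : Vector(Bar(suc(suc i))J)N)-> ∑(<?(suc t))f ≋ ∑(<? t)f ⊞ ∑ =? f
   split f = ≋-trans(sum-cong-≋(\ m -> go m(<?(suc t)m)(<? t m)(=? m)))(∑-distrib-+(\ m -> <? t m ⊢ f m)(\ m -> =? m ⊢ f m))where
    go : ∀ m(a : Dec(lev m < suc t))(b : Dec(lev m < t))(c : Dec(lev m ≡ t))→(a ⊢ f m)≋(b ⊢ f m)⊞(c ⊢ f m)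
    go m(yes _)(yes b)(yes c) = contra c(ℕ.<⇒≢ b)
    go m(yes _)(yes _)(no _) = ≋-sym(≋-trans(⊞-comm _ _)(⊞-identityˡ _))
    go m(yes _)(no _)(yes _) = ≋-sym(⊞-identityˡ _)
    go m(yes a)(no b)(no c) = contra(ℕ.≤∧≢⇒<(ℕ.≤-pred a)c)b
    go m(no a)(yes b)_ = contra(ℕ.m<n⇒m<1+n b)a
    go m(no a)(no _)(yes c) = contra(s≤s(ℕ.≤-reflexive c))a
    go m(no _)(no _)(no _) = ≋-sym(⊞-identityˡ 𝟘)

   x≋ : x ≋ x1 ⊞ δ w
   x≋ = begin
    x ≈⟨ h ⟩
    ∑(<?(suc t))(\ m -> app m(y m))≈⟨ split(\ m -> app m(y m))⟩
    ∑(<? t)(\ m -> app m(y m))⊞ ∑ =?(\ m -> app m(y m))≈⟨ ⊞-cong ≋-refl(∑-cong =? rewrite-top)⟩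
    ∑(<? t)(\ m -> app m(y m))⊞ ∑ =?(\ k -> absorb refl(ε k)(z0 k)⊞ δ(app k(𝟘 , r k)))
     ≈⟨ ⊞-cong ≋-refl(∑-+ =?(\ k -> absorb refl(ε k)(z0 k))(\ k -> δ(app k(𝟘 , r k))))⟩
    ∑(<? t)(\ m -> app m(y m))⊞(∑ =?(\ k -> absorb refl(ε k)(z0 k))⊞ ∑ =?(\ k -> δ(app k(𝟘 , r k))))
     ≈⟨ ⊞-assoc _ _ _ ⟨
    x1 ⊞ ∑ =?(\ k -> δ(app k(𝟘 , r k)))
     ≈⟨ ⊞-cong ≋-refl(≋-sym(δ.map-∑(suc(suc i))J =?(\ k -> app k(𝟘 , r k))))⟩
    x1 ⊞ δ w ∎

   x1-filt : Filt t x1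
   x1-filt = filt-+(y , ≋-refl)(filt-∑ =?(\ k k≡ -> absorb-filt k≡(snd(snd(killer k)k≡))))

   w-filt : Filt(suc t)w
   w-filt = filt-∑ =?(\ k k≡ -> filt-app(s≤s(ℕ.≤-reflexive k≡))(𝟘 , r k))

   x1-cycle : δ x1 ≋ 𝟘
   x1-cycle = ≋-trans(≋-sym(≋-trans(⊞-cong ≋-refl(δδ w))(≋-trans(⊞-comm _ 𝟘)(⊞-identityˡ _))))(≋-trans(≋-sym(δ.map-cong(suc i)J x≋))cycle)

   finish : ∃ \ z -> δ z ≋ x × Filt(suc t)z
   finish = let(z , e , f) = claim t j≢ x1 x1-filt x1-cycle in
    z ⊞ w , ≋-trans(⊞-cong e ≋-refl)(≋-sym x≋), filt-+(filt-mono(ℕ.n≤1+n t)f)w-filt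

 claim : ∀ i t -> Claim i t
 claim zero = claim0
 claim(suc i) = Step.claim i(claim i)

 torVanishes : ∀ i j -> i ≢ j -> TorVanishes i j
 torVanishes zero j i≢j x _ = 𝟘 , ≋-sym(bar0-zero(i≢j ∘ sym)x)
 torVanishes(suc i)zero i≢j x _ = 𝟘 , ≋-sym(bar-degree0-zero x)
 -- At t = n the high part of any element of positive degree is zero, so every chain lies in
 -- `Filt n`.
 torVanishes(suc i)(suc j)i≢j x cycle =
  let(z , e , _) = claim i n(\ j≡i -> i≢j(cong suc(sym j≡i)))x((\ m -> stripᴮ m x), ≋-trans(decomposeᴮ n x)(≋-trans(⊞-cong(highᴮ-top x)≋-refl)(⊞-identityˡ _)))cycle in z , e

-- Comparing the model with the algebra.

module Section{c ℓ α ℓα ℓd}{R : CommutativeRing c ℓ}(A : GradedAlgebra R α ℓα){N : ℕ}(𝓕 : Fibration N ℓd)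
        (ε : Fin N -> GradedAlgebra.Deg A 1)
        (ε-square : ∀ m -> GradedAlgebra._≈ᴹ_ A(GradedAlgebra.mul A refl(ε m)(ε m))(GradedAlgebra.0ᴹ A))
        (ε-anti : ∀ k m -> GradedAlgebra._≈ᴹ_ A(GradedAlgebra.mul A refl(ε k)(ε m))(GradedAlgebra.-ᴹ_ A(GradedAlgebra.mul A refl(ε m)(ε k))))
        (ε-thd : ∀{x y} -> x ≢ y -> Fibration.lev 𝓕 x ≡ Fibration.lev 𝓕 y -> GradedAlgebra._≈ᴹ_ A(GradedAlgebra.mul A refl(ε x)(ε y))
         (GradedAlgebra.mul A refl(ε(Fibration.third 𝓕 x y))(GradedAlgebra._+ᴹ_ A(ε y)(GradedAlgebra.-ᴹ_ A(ε x)))))where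
 private module R = CommutativeRing R
 open GradedAlgebra A hiding(_≈ᴹ_; _+ᴹ_; 0ᴹ; -ᴹ_; _*ₗ_)
 open Fibration 𝓕
 open Representation R 𝓕
 open Strip R 𝓕
 open BarComplex A using(mul-linˡ; mul-linʳ)
 private
  module A{d} = LeftModule(component d)
  module AT{d} = ModuleTheory(component d)
  module S l = Stage(stage l)
 open A using(_≈ᴹ_; _+ᴹ_; 0ᴹ; -ᴹ_; _*ₗ_)

 L? : ∀ l x -> Dec(lev x ≡ l)
 L? l x = lev x ℕ.≟ l

 d+1 : ∀ d -> d + 1 ≡ suc d
 d+1 d = ℕ.+-comm d 1

 _·ε_ : ∀{d} -> Deg d -> Fin N -> Deg(suc d)
 u ·ε x = mul(d+1 _)u(ε x)

 ε·_ : ∀ m{d} -> Deg d -> Deg(suc d)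
 ε·_ m u = mul refl(ε m)u

 -- The degree d component of a stage element, read in A. The new atom multiplies on the right, in
 -- accordance with the normal form a + Σ b_x e_x.
 sec : ∀ l{d} -> S.Carrierᴹ l -> Deg d
 sec zero{zero} k = k *ₗ one
 sec zero{suc d} k = 0ᴹ
 sec(suc l){zero}(a , b) = sec l a
 sec(suc l){suc d}(a , b) = sec l a +ᴹ AT.∑(L? l)(\ x -> sec l(b x)·ε x)

 sec-lin : ∀ l d -> Lin(S.M l)(component d)(sec l)
 sec-lin zero zero = record
  { map-cong = A.*ₗ-congʳ; map-+ = \ x y -> A.*ₗ-distribʳ one x y; map-* = \ k x -> A.*ₗ-assoc k x one }
 sec-lin zero(suc d) = zero-lin{R = R}(S.M 0)(component(suc d))
 sec-lin(suc l)zero = ∘-lin(sec-lin l zero)first-lin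
  where open Next(stage l)
 sec-lin(suc l)(suc d) = +-lin{R = R} M'(component(suc d))(∘-lin(sec-lin l(suc d))first-lin)sums where
  open Next(stage l)hiding(L?)
  term : ∀ x -> lev x ≡ l -> Lin M'(component(suc d))(\ v -> sec l(snd v x)·ε x)
  term x q = ∘-lin(mul-linˡ(d+1 d)(ε x))(∘-lin(sec-lin l d)(second-lin x q))
  sums : Lin M'(component(suc d))(\ v -> AT.∑(L? l)(\ x -> sec l(snd v x)·ε x))
  sums = record
   { map-cong = \ p -> AT.∑-cong(L? l)(\ y q -> Lin.map-cong(term y q)p)
   ; map-+ = \ v w -> A.≈ᴹ-trans(AT.∑-cong(L? l)(\ y q -> Lin.map-+(term y q)v w))
     (AT.∑-+(L? l)(\ x -> sec l(snd v x)·ε x)(\ x -> sec l(snd w x)·ε x))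
   ; map-* = \ k v -> A.≈ᴹ-trans(AT.∑-cong(L? l)(\ y q -> Lin.map-*(term y q)k v))
     (A.≈ᴹ-sym(Lin.map-∑(scal-lin k)(L? l)(\ x -> sec l(snd v x)·ε x)))} where
   scal-lin : ∀ k -> Lin(component(suc d))(component(suc d))(k *ₗ_)
   scal-lin k = record
    { map-cong = A.*ₗ-congˡ
    ; map-+ = \ _ _ -> A.*ₗ-distribˡ _ _ _
    ; map-* = \ k′ x -> A.≈ᴹ-trans(A.≈ᴹ-sym(A.*ₗ-assoc k k′ x))(A.≈ᴹ-trans(A.*ₗ-congʳ(R.*-comm k k′))(A.*ₗ-assoc k′ k x))}

 module sec l d = Lin(sec-lin l d)
 module ·ε d x = Lin(mul-linˡ{d}(d+1 d)(ε x))
 module ε· d m = Lin(mul-linʳ{n = d} refl(ε m))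

 ·ε·ε : ∀{d}(u : Deg d)x y →(u ·ε x)·ε y ≈ᴹ mul(ℕ.+-comm d 2)u(mul refl(ε x)(ε y))
 ·ε·ε{d} u x y = mul-assoc(d+1 d)(d+1(suc d))refl(ℕ.+-comm d 2)u(ε x)(ε y)

 ε··ε : ∀{d} m(u : Deg d)x →(ε·_ m u)·ε x ≈ᴹ ε·_ m(u ·ε x)
 ε··ε{d} m u x = mul-assoc refl(d+1(suc d))(d+1 d)refl(ε m)u(ε x)

 swap-ε : ∀{d}(u : Deg d)x y →(u ·ε x)·ε y ≈ᴹ -ᴹ((u ·ε y)·ε x)
 swap-ε{d} u x y = A.≈ᴹ-trans(·ε·ε u x y)(A.≈ᴹ-trans(U.map-cong(ε-anti x y))
  (A.≈ᴹ-trans(U.map-neg _)(A.-ᴹ‿cong(A.≈ᴹ-sym(·ε·ε u y x)))))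
  where module U = Lin(mul-linʳ(ℕ.+-comm d 2)u)

 -- On degree d the involution g is the sign (-1)^d, which is the cost of moving ε m to the other
 -- side.
 commute : ∀ l{d} m v -> sec l{d}(S.g l v)·ε m ≈ᴹ ε·_ m(sec l{d} v)
 commute zero{zero} m k = begin
  (k *ₗ one)·ε m ≈⟨ mul-scalarˡ(d+1 0)k one(ε m)⟩
  k *ₗ(one ·ε m)≈⟨ A.*ₗ-congˡ(mul-identityˡ(d+1 0)(ε m))⟩
  k *ₗ ε m ≈⟨ A.*ₗ-congˡ(mul-identityʳ refl(ε m))⟨
  k *ₗ ε·_ m one ≈⟨ mul-scalarʳ refl k(ε m)one ⟨
  ε·_ m(k *ₗ one)∎
  where open SetoidReasoning A.≈ᴹ-setoid
 commute zero{suc d} m k = A.≈ᴹ-trans(·ε.map-0 _ m)(A.≈ᴹ-sym(ε·.map-0 _ m))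
 commute(suc l){zero} m(a , b) = commute l m a
 commute(suc l){suc d} m(a , b) = begin
  (sec l(g a)+ᴹ AT.∑(L? l)(\ x -> sec l(S.-ᴹ_ l(g(b x)))·ε x))·ε m
   ≈⟨ ·ε.map-+ _ m _ _ ⟩
  sec l(g a)·ε m +ᴹ AT.∑(L? l)(\ x -> sec l(S.-ᴹ_ l(g(b x)))·ε x)·ε m
   ≈⟨ A.+ᴹ-cong(commute l m a)(·ε.map-∑ _ m(L? l)(\ x -> sec l(S.-ᴹ_ l(g(b x)))·ε x))⟩
  ε·_ m(sec l a)+ᴹ AT.∑(L? l)(\ x →(sec l(S.-ᴹ_ l(g(b x)))·ε x)·ε m)
   ≈⟨ A.+ᴹ-congˡ(AT.∑-cong(L? l)(\ x _ -> term x))⟩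
  ε·_ m(sec l a)+ᴹ AT.∑(L? l)(\ x -> ε·_ m(sec l(b x)·ε x))
   ≈⟨ A.+ᴹ-congˡ(ε·.map-∑ _ m(L? l)(\ x -> sec l(b x)·ε x))⟨
  ε·_ m(sec l a)+ᴹ ε·_ m(AT.∑(L? l)(\ x -> sec l(b x)·ε x))
   ≈⟨ ε·.map-+ _ m _ _ ⟨
  ε·_ m(sec l a +ᴹ AT.∑(L? l)(\ x -> sec l(b x)·ε x))∎ where
  open SetoidReasoning A.≈ᴹ-setoid
  g = S.g l
  term : ∀ x →(sec l(S.-ᴹ_ l(g(b x)))·ε x)·ε m ≈ᴹ ε·_ m(sec l(b x)·ε x)
  term x = begin
   (sec l(S.-ᴹ_ l(g(b x)))·ε x)·ε m ≈⟨ swap-ε _ x m ⟩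
   -ᴹ((sec l(S.-ᴹ_ l(g(b x)))·ε m)·ε x)≈⟨ A.-ᴹ‿cong(·ε.map-cong _ x(·ε.map-cong _ m(sec.map-neg l _ _)))⟩
   -ᴹ(((-ᴹ sec l(g(b x)))·ε m)·ε x)≈⟨ A.-ᴹ‿cong(A.≈ᴹ-trans(·ε.map-cong _ x(·ε.map-neg _ m _))(·ε.map-neg _ x _))⟩
   -ᴹ -ᴹ((sec l(g(b x))·ε m)·ε x)≈⟨ AT.-ᴹ-invol _ ⟩
   (sec l(g(b x))·ε m)·ε x ≈⟨ ·ε.map-cong _ x(commute l m(b x))⟩
   (ε·_ m(sec l(b x)))·ε x ≈⟨ ε··ε m _ x ⟩
   ε·_ m(sec l(b x)·ε x)∎

 sec-E0 : ∀ l m v -> sec l{0}(S.E l m v)≈ᴹ 0ᴹ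
 sec-E0 zero m v = A.*ₗ-zeroˡ one
 sec-E0(suc l)m v = go(ℕ.<-cmp(lev m)l)where
  open Next(stage l)
  go : ∀ t -> sec(suc l){0}(act m t v)≈ᴹ 0ᴹ
  go(tri< _ _ _) = sec-E0 l m(fst v)
  go(tri≈ _ _ _) = sec.map-0 l 0
  go(tri> _ _ _) = sec.map-0 l 0

 sec-E : ∀ l{d} m -> lev m < l -> ∀ v -> sec l{suc d}(S.E l m v)≈ᴹ ε·_ m(sec l{d} v)
 sec-E(suc l){d} m m<1+l v = go(ℕ.<-cmp(lev m)l)d where
  open Next(stage l)hiding(L?)
  a = fst v
  b = snd v
  ∑H : ∀{d} -> Deg d
  ∑H = AT.∑(L? l)(\ y -> sec l(H m y(b y)))

  -- The diagonal coefficient is a sum over all z; distributing it turns the expression into a sum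
  -- of terms to each of which the relation `ε-thd` applies in `term`.
  top-part : lev m ≡ l -> ∀ d -> sec(suc l){suc d}(top m v)≈ᴹ
        ε·_ m(sec l a)+ᴹ AT.∑(L? l)(\ z -> sec l{d}(H m z(b z))·ε z +ᴹ -ᴹ(sec l(H m z(b z))·ε m))
  top-part m≡ d = begin
   sec l(S.0ᴹ l)+ᴹ AT.∑(L? l)(\ z -> sec l(snd(top m v)z)·ε z)
    ≈⟨ A.+ᴹ-cong(sec.map-0 l _)(AT.∑-cong(L? l)(\ z _ -> A.≈ᴹ-trans(·ε.map-cong _ z(sec.map-+ l _ _ _))(·ε.map-+ _ z _ _)))⟩
   0ᴹ +ᴹ AT.∑(L? l)(\ z -> sec l(H m z(b z))·ε z +ᴹ sec l(S._⊢_ l(z Fin.≟ m)(diagonal m v))·ε z)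
    ≈⟨ A.≈ᴹ-trans(A.+ᴹ-identityˡ _)(AT.∑-+(L? l)(\ z -> sec l(H m z(b z))·ε z)(\ z -> sec l(S._⊢_ l(z Fin.≟ m)(diagonal m v))·ε z))⟩
   AT.∑(L? l)(\ z -> sec l(H m z(b z))·ε z)+ᴹ AT.∑(L? l)(\ z -> sec l(S._⊢_ l(z Fin.≟ m)(diagonal m v))·ε z)
    ≈⟨ A.+ᴹ-congˡ(AT.∑-single(L? l){\ z -> sec l(S._⊢_ l(z Fin.≟ m)(diagonal m v))·ε z} m m≡(\ z _ z≢m -> ·ε.map-≈0 _ z(sec.map-≈0 l _(S.⊢-no l(z Fin.≟ m)z≢m))))⟩
   AT.∑(L? l)(\ z -> sec l(H m z(b z))·ε z)+ᴹ sec l(S._⊢_ l(m Fin.≟ m)(diagonal m v))·ε m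
    ≈⟨ A.+ᴹ-congˡ(·ε.map-cong _ m(sec.map-cong l _(S.⊢-yes l(m Fin.≟ m)refl)))⟩
   AT.∑(L? l)(\ z -> sec l(H m z(b z))·ε z)+ᴹ sec l(diagonal m v)·ε m
    ≈⟨ A.+ᴹ-congˡ(·ε.map-cong _ m(A.≈ᴹ-trans(sec.map-+ l _ _ _)(A.+ᴹ-congˡ(A.≈ᴹ-trans(sec.map-neg l _ _)(A.-ᴹ‿cong(sec.map-∑ l _(L? l)(\ y -> H m y(b y))))))))⟩
   AT.∑(L? l)(\ z -> sec l(H m z(b z))·ε z)+ᴹ(sec l(S.g l a)+ᴹ -ᴹ ∑H)·ε m
    ≈⟨ A.+ᴹ-congˡ(A.≈ᴹ-trans(·ε.map-+ _ m _ _)(A.+ᴹ-cong(commute l m a)(A.≈ᴹ-trans(·ε.map-neg _ m _)(A.-ᴹ‿cong(·ε.map-∑ _ m(L? l)(\ y -> sec l(H m y(b y))))))))⟩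
   AT.∑(L? l)(\ z -> sec l(H m z(b z))·ε z)+ᴹ(ε·_ m(sec l a)+ᴹ -ᴹ AT.∑(L? l)(\ z -> sec l(H m z(b z))·ε m))
    ≈⟨ AT.solve(AT.∑(L? l)(\ z -> sec l(H m z(b z))·ε z)∷ ε·_ m(sec l a)∷ AT.∑(L? l)(\ z -> sec l(H m z(b z))·ε m)∷ [])
       (AT.#_ zero AT.:+(AT.#_(suc zero)AT.:+ AT.:-_(AT.#_(suc(suc zero)))))(AT.#_(suc zero)AT.:+(AT.#_ zero AT.:+ AT.:-_(AT.#_(suc(suc zero)))))refl ⟩
   ε·_ m(sec l a)+ᴹ(AT.∑(L? l)(\ z -> sec l(H m z(b z))·ε z)+ᴹ -ᴹ AT.∑(L? l)(\ z -> sec l(H m z(b z))·ε m))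
    ≈⟨ A.+ᴹ-congˡ(A.+ᴹ-congˡ(Lin.map-∑(neg-lin{R = R}(component(suc d))(component(suc d))(id-lin(component(suc d))))(L? l)(\ z -> sec l(H m z(b z))·ε m)))⟩
   ε·_ m(sec l a)+ᴹ(AT.∑(L? l)(\ z -> sec l(H m z(b z))·ε z)+ᴹ AT.∑(L? l)(\ z -> -ᴹ(sec l(H m z(b z))·ε m)))
    ≈⟨ A.+ᴹ-congˡ(AT.∑-+(L? l)(\ z -> sec l(H m z(b z))·ε z)(\ z -> -ᴹ(sec l(H m z(b z))·ε m)))⟨
   ε·_ m(sec l a)+ᴹ AT.∑(L? l)(\ z -> sec l(H m z(b z))·ε z +ᴹ -ᴹ(sec l(H m z(b z))·ε m))∎
   where open SetoidReasoning(A.≈ᴹ-setoid{suc d})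

  term0 : ∀ z -> sec l{0}(H m z(b z))≈ᴹ 0ᴹ
  term0 z with z Fin.≟ m
  ... | yes _ = sec.map-0 l 0
  ... | no _ = sec-E0 l _ _

  term : lev m ≡ l -> ∀{d} z -> lev z ≡ l -> sec l{suc d}(H m z(b z))·ε z +ᴹ -ᴹ(sec l(H m z(b z))·ε m)≈ᴹ ε·_ m(sec l{d}(b z)·ε z)
  term m≡{d} z z≡ = case(z Fin.≟ m)where
   u = sec l{d}(S.g l(b z))
   module U = Lin(mul-linʳ(ℕ.+-comm d 2)u)
   k = third m z
   open SetoidReasoning(A.≈ᴹ-setoid{suc(suc d)})
   case : Dec(z ≡ m)-> sec l{suc d}(H m z(b z))·ε z +ᴹ -ᴹ(sec l(H m z(b z))·ε m)≈ᴹ ε·_ m(sec l{d}(b z)·ε z)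
   case(yes refl) = A.≈ᴹ-trans(A.-ᴹ‿inverseʳ _)(A.≈ᴹ-sym(begin
    ε·_ z(sec l(b z)·ε z)≈⟨ ε··ε z _ z ⟨
    (ε·_ z(sec l(b z)))·ε z ≈⟨ ·ε.map-cong _ z(commute l z(b z))⟨
    (u ·ε z)·ε z ≈⟨ ·ε·ε u z z ⟩
    mul _ u(mul refl(ε z)(ε z))≈⟨ U.map-≈0(ε-square z)⟩
    0ᴹ ∎))
   case(no z≢m) = begin
    sec l(H m z(b z))·ε z +ᴹ -ᴹ(sec l(H m z(b z))·ε m)
     ≈⟨ A.+ᴹ-cong(·ε.map-cong _ z moved)(A.-ᴹ‿cong(·ε.map-cong _ m moved))⟩
    (u ·ε k)·ε z +ᴹ -ᴹ((u ·ε k)·ε m)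
     ≈⟨ A.+ᴹ-cong(·ε·ε u k z)(A.≈ᴹ-trans(A.-ᴹ‿cong(·ε·ε u k m))(A.≈ᴹ-sym(U.map-neg _)))⟩
    mul _ u(mul refl(ε k)(ε z))+ᴹ mul _ u(-ᴹ mul refl(ε k)(ε m))
     ≈⟨ U.map-+ _ _ ⟨
    mul _ u(mul refl(ε k)(ε z)+ᴹ -ᴹ mul refl(ε k)(ε m))
     ≈⟨ U.map-cong(A.≈ᴹ-sym(A.≈ᴹ-trans(ε-thd(z≢m ∘ sym)(m≡ ⨾ sym z≡))(A.≈ᴹ-trans(ε·.map-+ _ k _ _)(A.+ᴹ-congˡ(ε·.map-neg _ k _)))))⟩
    mul _ u(mul refl(ε m)(ε z))
     ≈⟨ ·ε·ε u m z ⟨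
    (u ·ε m)·ε z
     ≈⟨ ·ε.map-cong _ z(commute l m(b z))⟩
    (ε·_ m(sec l(b z)))·ε z
     ≈⟨ ε··ε m _ z ⟩
    ε·_ m(sec l(b z)·ε z)∎ where
    moved : sec l(H m z(b z))≈ᴹ u ·ε k
    moved = A.≈ᴹ-trans(sec.map-cong l _(H-other z≢m(b z)))
     (A.≈ᴹ-trans(sec-E l k(subst(lev k <_)m≡(thd-lower(z≢m ∘ sym)(m≡ ⨾ sym z≡)))(b z))(A.≈ᴹ-sym(commute l k(b z))))

  go : ∀ t d -> sec(suc l){suc d}(act m t v)≈ᴹ ε·_ m(sec(suc l){d} v)
  go(tri< m< _ _)zero = A.≈ᴹ-trans(A.+ᴹ-cong(sec-E l m m< a)(AT.∑-zero(L? l)(\ x _ -> ·ε.map-≈0 _ x(sec-E0 l m(b x)))))(A.+ᴹ-identityʳ _)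
  go(tri< m< _ _)(suc d) = begin
   sec l(S.E l m a)+ᴹ AT.∑(L? l)(\ x -> sec l(S.E l m(b x))·ε x)
    ≈⟨ A.+ᴹ-cong(sec-E l m m< a)(AT.∑-cong(L? l)(\ x _ -> A.≈ᴹ-trans(·ε.map-cong _ x(sec-E l m m<(b x)))(ε··ε m _ x)))⟩
   ε·_ m(sec l a)+ᴹ AT.∑(L? l)(\ x -> ε·_ m(sec l(b x)·ε x))
    ≈⟨ A.+ᴹ-congˡ(ε·.map-∑ _ m(L? l)(\ x -> sec l(b x)·ε x))⟨
   ε·_ m(sec l a)+ᴹ ε·_ m(AT.∑(L? l)(\ x -> sec l(b x)·ε x))
    ≈⟨ ε·.map-+ _ m _ _ ⟨
   ε·_ m(sec(suc l)v)∎
   where open SetoidReasoning(A.≈ᴹ-setoid{suc(suc d)})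
  go(tri≈ _ m≡ _)zero = A.≈ᴹ-trans(top-part m≡ 0)(A.≈ᴹ-trans(A.+ᴹ-congˡ(AT.∑-zero(L? l)(\ z _ ->
   A.≈ᴹ-trans(A.+ᴹ-cong(·ε.map-≈0 _ z(term0 z))(A.≈ᴹ-trans(A.-ᴹ‿cong(·ε.map-≈0 _ m(term0 z)))AT.-0≈0))(A.+ᴹ-identityʳ _))))(A.+ᴹ-identityʳ _))
  go(tri≈ _ m≡ _)(suc d) = A.≈ᴹ-trans(top-part m≡(suc d))(A.≈ᴹ-trans(A.+ᴹ-congˡ(A.≈ᴹ-trans(AT.∑-cong(L? l)(term m≡))
   (A.≈ᴹ-sym(ε·.map-∑ _ m(L? l)(\ x -> sec l(b x)·ε x)))))(A.≈ᴹ-sym(ε·.map-+ _ m _ _)))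
  go(tri> _ _ m>)d = contra m<1+l(ℕ.≤⇒≯ m>)

 sec-ι : ∀ l{d} k -> sec l{suc d}(Strips.ι(strips l)k)≈ᴹ 0ᴹ
 sec-ι zero k = A.≈ᴹ-refl
 sec-ι(suc l){d} k = A.≈ᴹ-trans(A.+ᴹ-cong(sec-ι l k)(AT.∑-zero(L? l)(\ x _ -> ·ε.map-≈0 _ x(sec.map-0 l d))))(A.+ᴹ-identityʳ _)

 sec-κ : ∀ l v -> sec l{0} v ≈ᴹ Strips.κ(strips l)v *ₗ one
 sec-κ zero v = A.≈ᴹ-refl
 sec-κ(suc l)v = sec-κ l(fst v)

 κι : ∀ l k -> Strips.κ(strips l)(Strips.ι(strips l)k)R.≈ k
 κι zero k = R.refl
 κι(suc l)k = κι l k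

-- The quotient algebra acts faithfully on the vacuum.

module ModelOfFibration{c ℓ ℓd r}(R : CommutativeRing c ℓ){N : ℕ}(𝓕 : Fibration N ℓd)(n : ℕ)
  (bounded : ∀ m -> Fibration.lev 𝓕 m < n)(Rel₀ : ∀{d} -> Exterior.Term R(Fin N)d -> Set r)where
 private module R = CommutativeRing R
 open Fibration 𝓕
 open Representation R 𝓕
 open Strip R 𝓕
 open Stage(stage n)using(E-lin; E-square; E-anti; E*; ∂*; Below; []; _∷_; ∂*-van)renaming(M to Mₙ; E to Eₙ)
 open Exterior R(Fin N)
 open Interpretation R Mₙ Eₙ E-lin E-square E-anti
 open Quotient exteriorAlgebra Rel₀ using(_~_; ≈⇒~; quotient)
 private
  module M = LeftModule Mₙ

 bdry≈∂* : ∀ t v -> bdry t v ≡ ∂* t v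
 bdry≈∂* [] v = refl
 bdry≈∂*(t ∷ u)v = cong₂(\ x y -> x M.+ᴹ M.-ᴹ Eₙ t y)(words u v)(bdry≈∂* u v)where
  words : ∀ u v -> word u v ≡ E* u v
  words [] v = refl
  words(t ∷ u)v = cong(Eₙ t)(words u v)

 ∂-sound : ∀{d}(t : Vector(Fin N)(suc d))-> Dep(toList t)-> ∀ v -> ⟦ ∂ t ⟧ v M.≈ᴹ M.0ᴹ
 ∂-sound t dep v = M.≈ᴹ-trans(⟦∂⟧ t v)(M.≈ᴹ-trans(M.≈ᴹ-reflexive(bdry≈∂*(toList t)v))(∂*-van(below(toList t))dep v))where
  below : ∀ u -> Below u
  below [] = []
  below(t ∷ u) = bounded t ∷ below u

 module _(relators : ∀{d}{x : Term d} -> Rel₀ x -> ∀ v -> ⟦ x ⟧ v M.≈ᴹ M.0ᴹ)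
      (thd-rel : ∀{x y} -> x ≢ y -> lev x ≡ lev y -> prod refl(e x)(e y)~ prod refl(e(third x y))(e y ⊞(R.- R.1#)· e x))where
  private
   module Q d = LeftModule(GradedAlgebra.component quotient d)
   module QT d = ModuleTheory(GradedAlgebra.component quotient d)
   open Strips(strips n)

   anti~ : ∀ k m -> prod refl(e k)(e m)~((R.- R.1#)· prod refl(e m)(e k))
   anti~ k m = QT.-ᴹ-unique 2 _ _(≈⇒~(anticommute k m))

   open Section quotient 𝓕 e(\ m -> ≈⇒~(square-zero m))anti~ thd-rel

   sound~ : ∀{d}{x y : Term d} -> x ~ y -> ∀ v -> ⟦ x ⟧ v M.≈ᴹ ⟦ y ⟧ v
   sound~{d} = OfQuotient.sound~ Rel₀ d(\ _ -> relators)ℕ.≤-refl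

   vacuum : M.Carrierᴹ
   vacuum = ι R.1#

   at-vacuum : ∀{d} -> Lin(GradedAlgebra.component quotient d)Mₙ(\ u -> ⟦ u ⟧ vacuum)
   at-vacuum = record{ map-cong = \ h -> sound~ h vacuum; map-+ = \ _ _ -> M.≈ᴹ-refl; map-* = \ _ _ -> M.≈ᴹ-refl }

   -- Acting by x in the model is multiplying by x in the algebra. The degree equation is left
   -- arbitrary, since the products in x carry their own.
   sec-action : ∀{p q d : ℕ}(eq : p + q ≡ d)(x : Term p)v -> sec n{d}(⟦ x ⟧ v)~ prod eq x(sec n{q} v)
   sec-action refl(e s)v = sec-E n s(bounded s)v
   sec-action refl 𝟙 v = ≈⇒~(≋-sym(prod-identityˡ refl _))
   sec-action{d = d} eq 𝟘 v = Q.≈ᴹ-trans d(sec.map-0 n d)(≈⇒~(≋-sym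
    (≋-trans(prod-cong eq(≋-sym(·-zeroˡ 𝟘))≋-refl)(≋-trans(prod-scalarˡ eq _ _ _)(·-zeroˡ _)))))
   sec-action{d = d} eq(x ⊞ y)v = Q.≈ᴹ-trans d(sec.map-+ n d _ _)(Q.≈ᴹ-trans d
    (Q.+ᴹ-cong d(sec-action eq x v)(sec-action eq y v))(≈⇒~(≋-sym(prod-distribʳ eq x y _))))
   sec-action{d = d} eq(k · x)v = Q.≈ᴹ-trans d(sec.map-* n d _ _)(Q.≈ᴹ-trans d
    (Q.*ₗ-congˡ d(sec-action eq x v))(≈⇒~(≋-sym(prod-scalarˡ eq k x _))))
   sec-action{q = q}{d} eq(prod{p}{p'}{pp} eq′ x y)v = Q.≈ᴹ-trans d(sec-action whole x(⟦ y ⟧ v))(Q.≈ᴹ-trans d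
    (GradedAlgebra.mul-cong quotient whole(Q.≈ᴹ-refl p)(sec-action refl y v))(≈⇒~(≋-sym(prod-assoc eq′ eq refl whole x y _))))where
    whole : p +(p' + q)≡ d
    whole = sym(ℕ.+-assoc p p' q)⨾ cong(_+ q)eq′ ⨾ eq

   sec-vacuum : sec n{0} vacuum ~ 𝟙
   sec-vacuum = Q.≈ᴹ-trans 0(sec-κ n vacuum)(Q.≈ᴹ-trans 0(Q.*ₗ-congʳ 0(κι n R.1#))(≈⇒~(·-identity 𝟙)))

   -- An element is determined by its action on the vacuum, so stripping and the decompositions can
   -- be computed in the model and transported back.
   recover : ∀{d}(u : Term d)-> sec n(⟦ u ⟧ vacuum)~ u
   recover{d} u = Q.≈ᴹ-trans d(sec-action(ℕ.+-identityʳ d)u vacuum)(Q.≈ᴹ-trans d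
    (GradedAlgebra.mul-cong quotient(ℕ.+-identityʳ d)(Q.≈ᴹ-refl d)sec-vacuum)(≈⇒~(prod-identityʳ _ u)))

  linModel : LinModel quotient N
  linModel = record
   { lev = lev; n = n; ε = e
   ; strip = \ k u -> sec n(ρ k(⟦ u ⟧ vacuum))
   ; high = \ t u -> sec n(π t(⟦ u ⟧ vacuum))
   ; scal = \ u -> κ(⟦ u ⟧ vacuum)
   ; strip-lin = \ k{d} -> ∘-lin(sec-lin n d)(∘-lin(ρ-lin k)at-vacuum)
   ; high-lin = \ t{d} -> ∘-lin(sec-lin n d)(∘-lin(π-lin t)at-vacuum)
   ; scal-cong = \ h -> Lin.map-cong κ-lin(sound~ h vacuum)
   ; scal-+ = \ _ _ -> Lin.map-+ κ-lin _ _
   ; scal-* = \ _ _ -> Lin.map-* κ-lin _ _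
   ; scal-one = κι n R.1#
   ; scal-one* = \ u -> Q.≈ᴹ-trans 0(Q.≈ᴹ-sym 0(recover u))(sec-κ n _)
   ; strip-other = \{k}{m}{d} m≤ m≢ u -> sec.map-≈0 n d(ρE-other m≤ m≢(⟦ u ⟧ vacuum))
   ; strip-same = \{k}{d} u -> sec.map-cong n d(ρE-same(bounded k)(⟦ u ⟧ vacuum))
   ; high-scal = \ t u -> Q.≈ᴹ-trans 0(sec-κ n _)(Q.≈ᴹ-trans 0(Q.*ₗ-congʳ 0(κπ t _))(Q.≈ᴹ-trans 0(Q.≈ᴹ-sym 0(sec-κ n _))(recover u)))
   ; high-top = \{d} u -> Q.≈ᴹ-trans(suc d)(sec.map-cong n(suc d)(π-top ℕ.≤-refl(⟦ u ⟧ vacuum)))(sec-ι n _)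
   ; decompose = \ t{d} u -> Q.≈ᴹ-trans(suc d)(Q.≈ᴹ-sym(suc d)(recover u))(Q.≈ᴹ-trans(suc d)
     (sec.map-cong n(suc d)(decompose t(⟦ u ⟧ vacuum)))(Q.≈ᴹ-trans(suc d)(sec.map-+ n(suc d)_ _)(Q.+ᴹ-congˡ(suc d)
     (Q.≈ᴹ-trans(suc d)(sec.map-∑ n(suc d)(\ m -> lev m ℕ.<? t)(\ m -> Eₙ m(ρ m(⟦ u ⟧ vacuum))))
      (QT.∑-cong(suc d)(\ m -> lev m ℕ.<? t)(\ m _ -> sec-E n m(bounded m)_))))))
   ; ε-square = \ m -> ≈⇒~(square-zero m)
   ; ε-anti = anti~
   ; ε-thd = \{k}{m} k≢m k≡m -> third k m , thd-lower k≢m k≡m , Q.≈ᴹ-trans 2(thd-rel k≢m k≡m)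
     (≈⇒~(≋-trans(prod-distribˡ refl _ _ _)(⊞-cong ≋-refl(prod-scalarʳ refl _ _ _))))}

-- Solvers, and elimination over ordered fields.

module IntegerSolver{c ℓ}(R : CommutativeRing c ℓ)where
 private module R = CommutativeRing R
 open R using(_≈_)
 open AbelianGroupSolver R.+-abelianGroup using(_•_; •-+; •-neg)
 open import Algebra.Properties.Semiring.Mult R.semiring using(×1-homo-*)
 open import Algebra.Properties.Ring R.ring using(-‿distribˡ-*; -‿distribʳ-*)
 import Algebra.Solver.Ring
 open import Algebra.Solver.Ring.AlmostCommutativeRing using(fromCommutativeRing; _-Raw-AlmostCommutative⟶_)
 open SetoidReasoning R.setoid

 ιz : ℤ -> R.Carrier
 ιz z = z • R.1#

 ιz-+ : ∀ a b -> ιz(a Z.+ b)≈ ιz a R.+ ιz b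
 ιz-+ a b = •-+ a b R.1#

 ιz-neg : ∀ a -> ιz(Z.- a)≈ R.- ιz a
 ιz-neg a = •-neg a R.1#

 private
  pos*pos : ∀ m n -> ιz(+ m Z.* + n)≈ ιz(+ m)R.* ιz(+ n)
  pos*pos m n = R.trans(R.reflexive(cong ιz(sym(Z.pos-* m n))))(×1-homo-* m n)

  pos* : ∀ m b -> ιz(+ m Z.* b)≈ ιz(+ m)R.* ιz b
  pos* m(+ n) = pos*pos m n
  pos* m -[1+ n ] = begin
   ιz(+ m Z.*(Z.-(+ suc n)))≡⟨ cong ιz(Z.neg-distribʳ-*(+ m)(+ suc n))⟨
   ιz(Z.-(+ m Z.* + suc n))≈⟨ ιz-neg(+ m Z.* + suc n)⟩
   R.- ιz(+ m Z.* + suc n)≈⟨ R.-‿cong(pos*pos m(suc n))⟩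
   R.-(ιz(+ m)R.* ιz(+ suc n))≈⟨ -‿distribʳ-* _ _ ⟩
   ιz(+ m)R.* ιz -[1+ n ] ∎

 ιz-* : ∀ a b -> ιz(a Z.* b)≈ ιz a R.* ιz b
 ιz-*(+ m)b = pos* m b
 ιz-* -[1+ m ] b = begin
  ιz((Z.-(+ suc m))Z.* b)≡⟨ cong ιz(Z.neg-distribˡ-*(+ suc m)b)⟨
  ιz(Z.-(+ suc m Z.* b))≈⟨ ιz-neg(+ suc m Z.* b)⟩
  R.- ιz(+ suc m Z.* b)≈⟨ R.-‿cong(pos*(suc m)b)⟩
  R.-(ιz(+ suc m)R.* ιz b)≈⟨ -‿distribˡ-* _ _ ⟩
  ιz -[1+ m ] R.* ιz b ∎

 private
  decide : ∀ a b -> Maybe(ιz a ≈ ιz b)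
  decide a b with a Z.≟ b
  ... | yes refl = just R.refl
  ... | no _ = nothing

  morphism : Z.+-*-rawRing -Raw-AlmostCommutative⟶ fromCommutativeRing R
  morphism = record
   { ⟦_⟧ = ιz; +-homo = ιz-+; *-homo = ιz-*; -‿homo = ιz-neg; 0-homo = R.refl; 1-homo = R.+-identityʳ R.1# }

 open Algebra.Solver.Ring Z.+-*-rawRing(fromCommutativeRing R)morphism decide public
  using(solve; prove; Polynomial; ⟦_⟧; ⟦_⟧↓; _:=_; _:+_; _:*_; :-_; _:-_; con; var)

module FieldTheory{c ℓ₁ ℓ₂}(K : HeytingField c ℓ₁ ℓ₂)where
 open HeytingField K
 private module R = CommutativeRing(fieldRing K)
 open IntegerSolver(fieldRing K)public
 open SetoidReasoning R.setoid

 private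
  minus-0 : ∀ x -> x - 0# ≈ x
  minus-0 x = solve 1(\ x -> x :- con 0z := x)R.refl x

 1≉0 : ¬(1# ≈ 0#)
 1≉0 h = #-irrefl h(invertible⇒#(1# , R.trans(R.*-identityˡ _)(minus-0 1#), R.trans(R.*-identityʳ _)(minus-0 1#)))

module OrderedFieldTheory{c ℓ₁ ℓ₂ ℓ₃}(F : OrderedField c ℓ₁ ℓ₂ ℓ₃)where
 open OrderedField F using(Carrier; _≈_; _⊕_; _⊛_; -_; 0#; 1#; ring; commutativeRing; heytingField; isStrictTotalOrder; <⇒#; #⇒invertible; #-sym)
 open import Relation.Binary.Structures using(module IsStrictTotalOrder)
 open IsStrictTotalOrder isStrictTotalOrder using(compare; _≟_)public
 open FieldTheory heytingField public
 private module R = CommutativeRing commutativeRing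
 open SetoidReasoning R.setoid

 inverse : ∀{x} -> ¬(x ≈ 0#)-> ∃ \ y -> x ⊛ y ≈ 1#
 inverse{x} x≉0 with compare x 0#
 ... | tri≈ _ x≈0 _ = contra x≈0 x≉0
 ... | tri< x<0 _ _ = let(y , _ , h) = #⇒invertible(<⇒# x<0)in y , R.trans(R.*-congʳ(R.sym(solve 1(\ x -> x :- con 0z := x)R.refl x)))h
 ... | tri> _ _ 0<x = let(y , _ , h) = #⇒invertible(#-sym(<⇒# 0<x))in y , R.trans(R.*-congʳ(R.sym(solve 1(\ x -> x :- con 0z := x)R.refl x)))h

 cancel : ∀{x y} -> ¬(x ≈ 0#)-> x ⊛ y ≈ 0# -> y ≈ 0#
 cancel{x}{y} x≉0 h = let(z , xz) = inverse x≉0 in begin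
  y ≈⟨ R.*-identityˡ y ⟨
  1# ⊛ y ≈⟨ R.*-congʳ xz ⟨
  (x ⊛ z)⊛ y ≈⟨ solve 3(\ x y z →(x :* z) :* y := z :*(x :* y))R.refl x y z ⟩
  z ⊛(x ⊛ y)≈⟨ R.*-congˡ h ⟩
  z ⊛ 0# ≈⟨ R.zeroʳ z ⟩
  0# ∎

 open import Algebra.Module.Construct.TensorUnit using()renaming(leftModule to tensorUnit)
 line : LeftModule ring c ℓ₁
 line = tensorUnit{R = ring}

 module Line = ModuleTheory line
 open Line using(sum; sum-cong-≋; sum-zero)

 *ʳ-lin : ∀ a -> Lin line line(_⊛ a)
 *ʳ-lin a = record{ map-cong = R.*-congʳ; map-+ = \ x y -> R.distribʳ a x y; map-* = \ k x -> R.*-assoc k x a }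

 Kernel : ∀{k r} →(Fin k -> Fin r -> Carrier)-> Vector Carrier k -> Set ℓ₁
 Kernel m s = ∀ j -> sum(\ i -> s i ⊛ m i j)≈ 0#

 -- Gaussian elimination by rows, constructive because trichotomy decides equality with zero: a zero
 -- row is itself a relation; otherwise a pivot clears its column, and a relation of the smaller
 -- matrix extends by the coefficient -(t q) of the pivot row.
 rowRelation : ∀{k r}(m : Fin k -> Fin r -> Carrier)->
        (∃ \ s -> Kernel m s × ∃ \ i -> ¬(s i ≈ 0#))⊎((∀ s -> Kernel m s -> ∀ i -> s i ≈ 0#)× k ≤ r)
 rowRelation{zero} m = inr((\ _ _()), z≤n)
 rowRelation{suc k}{r} m with Fin.any?(\ c -> ¬?(m zero c ≟ 0#))
 ... | no allzero = inl(s , kernel , zero , 1≉0)where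
  s : Vector Carrier(suc k)
  s zero = 1#
  s(suc _) = 0#
  kernel : Kernel m s
  kernel j with m zero j ≟ 0#
  ... | yes h = R.trans(R.+-cong(R.trans(R.*-identityˡ _)h)(sum-zero(\ i -> R.zeroˡ(m(suc i)j))))(R.+-identityʳ _)
  ... | no ¬h = contra(j , ¬h)allzero
 rowRelation{suc k}{zero} m | yes((), _)
 rowRelation{suc k}{suc r} m | yes(c , p≉0) = go(rowRelation m')where
  p = m zero c
  q = fst(inverse p≉0)
  pq : p ⊛ q ≈ 1#
  pq = snd(inverse p≉0)
  m' : Fin k -> Fin r -> Carrier
  m' i j = m(suc i)(Fin.punchIn c j)⊕ -((m(suc i)c ⊛ q)⊛ m zero(Fin.punchIn c j))
  reduced : ∀(s : Vector Carrier k)j -> sum(\ i -> s i ⊛ m' i j)≈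
       sum(\ i -> s i ⊛ m(suc i)(Fin.punchIn c j))⊕ -((sum(\ i -> s i ⊛ m(suc i)c)⊛ q)⊛ m zero(Fin.punchIn c j))
  reduced s j = begin
   sum(\ i -> s i ⊛ m' i j)
    ≈⟨ sum-cong-≋{_}{\ i -> s i ⊛ m' i j}(\ i -> solve 5(\ s a b q z -> s :*(a :+ :-((b :* q) :* z)) := s :* a :+(s :* b) :*(:-(q :* z)))R.refl
       (s i)(m(suc i)(Fin.punchIn c j))(m(suc i)c)q(m zero(Fin.punchIn c j)))⟩
   sum(\ i -> s i ⊛ m(suc i)(Fin.punchIn c j)⊕(s i ⊛ m(suc i)c)⊛(-(q ⊛ m zero(Fin.punchIn c j))))
    ≈⟨ Line.∑-distrib-+(\ i -> s i ⊛ m(suc i)(Fin.punchIn c j))(\ i →(s i ⊛ m(suc i)c)⊛(-(q ⊛ m zero(Fin.punchIn c j))))⟩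
   sum(\ i -> s i ⊛ m(suc i)(Fin.punchIn c j))⊕ sum(\ i →(s i ⊛ m(suc i)c)⊛(-(q ⊛ m zero(Fin.punchIn c j))))
    ≈⟨ R.+-congˡ(Lin.map-sum(*ʳ-lin(-(q ⊛ m zero(Fin.punchIn c j))))(\ i -> s i ⊛ m(suc i)c))⟨
   sum(\ i -> s i ⊛ m(suc i)(Fin.punchIn c j))⊕ sum(\ i -> s i ⊛ m(suc i)c)⊛(-(q ⊛ m zero(Fin.punchIn c j)))
    ≈⟨ R.+-congˡ(solve 3(\ a q z -> a :*(:-(q :* z)) := :-((a :* q) :* z))R.refl(sum(\ i -> s i ⊛ m(suc i)c))q(m zero(Fin.punchIn c j)))⟩
   _ ∎
  go :((∃ \ s -> Kernel m' s × ∃ \ i -> ¬(s i ≈ 0#))⊎((∀ s -> Kernel m' s -> ∀ i -> s i ≈ 0#)× k ≤ r))->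
     (∃ \ s -> Kernel m s × ∃ \ i -> ¬(s i ≈ 0#))⊎((∀ s -> Kernel m s -> ∀ i -> s i ≈ 0#)× suc k ≤ suc r)
  go(inl(s' , kernel' , i , s≉0)) = inl(s , kernel , suc i , s≉0)where
   t = sum(\ i -> s' i ⊛ m(suc i)c)
   s : Vector Carrier(suc k)
   s zero = -(t ⊛ q)
   s(suc i) = s' i
   kernel : Kernel m s
   kernel j with c Fin.≟ j
   ... | yes refl = begin
    (-(t ⊛ q))⊛ p ⊕ t ≈⟨ solve 3(\ t q p →(:-(t :* q)) :* p :+ t := t :*(con 1z :- p :* q))R.refl t q p ⟩
    t ⊛((1# ⊕ 0#)⊕ -(p ⊛ q))≈⟨ R.*-congˡ(R.+-cong(R.+-identityʳ 1#)(R.-‿cong pq))⟩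
    t ⊛(1# ⊕ - 1#)≈⟨ R.*-congˡ(R.-‿inverseʳ 1#)⟩
    t ⊛ 0# ≈⟨ R.zeroʳ t ⟩
    0# ∎
   ... | no c≢j = subst(\ j →(-(t ⊛ q))⊛ m zero j ⊕ sum(\ i -> s' i ⊛ m(suc i)j)≈ 0#)(Fin.punchIn-punchOut c≢j)(begin
    (-(t ⊛ q))⊛ m zero j′ ⊕ sum(\ i -> s' i ⊛ m(suc i)j′)
     ≈⟨ solve 4(\ t q z a →(:-(t :* q)) :* z :+ a := a :+ :-((t :* q) :* z))R.refl t q(m zero j′)(sum(\ i -> s' i ⊛ m(suc i)j′))⟩
    sum(\ i -> s' i ⊛ m(suc i)j′)⊕ -((t ⊛ q)⊛ m zero j′)≈⟨ reduced s'(Fin.punchOut c≢j)⟨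
    sum(\ i -> s' i ⊛ m' i(Fin.punchOut c≢j))≈⟨ kernel'(Fin.punchOut c≢j)⟩
    0# ∎)
    where j′ = Fin.punchIn c(Fin.punchOut c≢j)
  go(inr(indep' , k≤r)) = inr(independent , s≤s k≤r)where
   independent : ∀ s -> Kernel m s -> ∀ i -> s i ≈ 0#
   independent s kernel = \{ zero -> s0≈0; (suc i)-> tail≈0 i } where
    t = sum(\ i -> s(suc i)⊛ m(suc i)c)
    tail≈0 : ∀ i -> s(suc i)≈ 0#
    tail≈0 = indep'(s ∘ suc)(\ j -> let z = m zero(Fin.punchIn c j); a = sum(\ i -> s(suc i)⊛ m(suc i)(Fin.punchIn c j))in begin
     sum(\ i -> s(suc i)⊛ m' i j)≈⟨ reduced(s ∘ suc)j ⟩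
     a ⊕ -((t ⊛ q)⊛ z)≈⟨ solve 6(\ a t q z s p -> a :+ :-((t :* q) :* z) :=(s :* z :+ a) :+ :-((s :* p :+ t) :*(q :* z)) :+(s :* z) :*(p :* q :- con 1z))R.refl a t q z(s zero)p ⟩
     (s zero ⊛ z ⊕ a)⊕ -((s zero ⊛ p ⊕ t)⊛(q ⊛ z))⊕(s zero ⊛ z)⊛((p ⊛ q)⊕ -(1# ⊕ 0#))
      ≈⟨ R.+-cong(R.+-cong(kernel(Fin.punchIn c j))(R.-‿cong(R.*-congʳ(kernel c))))(R.*-congˡ(R.+-cong pq(R.-‿cong(R.+-identityʳ 1#))))⟩
     (0# ⊕ -(0# ⊛(q ⊛ z)))⊕(s zero ⊛ z)⊛(1# ⊕ - 1#)≈⟨ solve 3(\ x y o →(con 0z :+ :-(con 0z :* x)) :+ y :*(o :+ :- o) := con 0z)R.refl(q ⊛ z)(s zero ⊛ z)1# ⟩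
     0# ∎)
    s0≈0 : s zero ≈ 0#
    s0≈0 = cancel p≉0(begin
     p ⊛ s zero ≈⟨ R.*-comm p _ ⟩
     s zero ⊛ p ≈⟨ R.+-identityʳ _ ⟨
     s zero ⊛ p ⊕ 0# ≈⟨ R.+-congˡ(sum-zero(\ i -> R.trans(R.*-congʳ(tail≈0 i))(R.zeroˡ _)))⟨
     s zero ⊛ p ⊕ t ≈⟨ kernel c ⟩
     0# ∎)

-- As for abelian groups, with polynomial coefficients: an identity between vector expressions is
-- reduced to one ring identity per vector.
module ModuleSolver{c ℓ m ℓm}{R : CommutativeRing c ℓ}(M : LeftModule(CommutativeRing.ring R)m ℓm)where
 private
  module R = CommutativeRing R
  module P = IntegerSolver R
 open LeftModule M
 open Renamed M
 open SetoidReasoning ≈ᴹ-setoid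
 private
  module MT = ModuleTheory M
  interchange = AbelianGroupSolver.interchange +ᴹ-abelianGroup

 infixl 6 _⊹_
 infixr 7 _✶_
 data Expr(k n : ℕ) : Set where
  vec : Fin n -> Expr k n
  _⊹_ : Expr k n -> Expr k n -> Expr k n
  ⊝_ : Expr k n -> Expr k n
  ∅ : Expr k n
  _✶_ : P.Polynomial k -> Expr k n -> Expr k n

 module _{k : ℕ}(σ : Vec R.Carrier k)where
  eval : ∀{n} -> Expr k n -> Vec Carrierᴹ n -> Carrierᴹ
  eval(vec i)ρ = Vec.lookup ρ i
  eval(s ⊹ t)ρ = eval s ρ +ᴹ eval t ρ
  eval(⊝ s)ρ = -ᴹ eval s ρ
  eval ∅ ρ = 0ᴹ
  eval(p ✶ s)ρ = P.⟦ p ⟧ σ *ₗ eval s ρ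

  evalᵛ : ∀{n} -> Vec(P.Polynomial k)n -> Vec Carrierᴹ n -> Carrierᴹ
  evalᵛ [] [] = 0ᴹ
  evalᵛ(p ∷ ps)(x ∷ ρ) = P.⟦ p ⟧ σ *ₗ x +ᴹ evalᵛ ps ρ

 coefficients : ∀{k n} -> Expr k n -> Vec(P.Polynomial k)n
 coefficients(vec i) = Vec.replicate _(P.con 0z)Vec.[ i ]≔ P.con 1z
 coefficients(s ⊹ t) = Vec.zipWith P._:+_(coefficients s)(coefficients t)
 coefficients(⊝ s) = Vec.map P.:-_(coefficients s)
 coefficients ∅ = Vec.replicate _(P.con 0z)
 coefficients(p ✶ s) = Vec.map(p P.:*_)(coefficients s)

 module _{k : ℕ}(σ : Vec R.Carrier k)where
  private
   E = evalᵛ σ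
   E-0 : ∀{n}(ρ : Vec Carrierᴹ n)-> E(Vec.replicate n(P.con 0z))ρ ≈ᴹ 0ᴹ
   E-0 [] = rf
   E-0(x ∷ ρ) = +≈(*ₗ-zeroˡ x)(E-0 ρ)⊚ +0 _

   E-var : ∀{n}(i : Fin n)ρ -> E(Vec.replicate n(P.con 0z)Vec.[ i ]≔ P.con 1z)ρ ≈ᴹ Vec.lookup ρ i
   E-var zero(x ∷ ρ) = +≈(*ₗ-congʳ(R.+-identityʳ R.1#)⊚ 1* x)(E-0 ρ)⊚ +0 x
   E-var(suc i)(x ∷ ρ) = +≈(*ₗ-zeroˡ x)(E-var i ρ)⊚ 0+ _

   E-+ : ∀{n}(a b : Vec(P.Polynomial k)n)ρ -> E(Vec.zipWith P._:+_ a b)ρ ≈ᴹ E a ρ +ᴹ E b ρ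
   E-+ [] [] [] = sm(+0 _)
   E-+(a ∷ p)(b ∷ q)(x ∷ ρ) = +≈(*ₗ-distribʳ x _ _)(E-+ p q ρ)⊚ interchange _ _ _ _

   E-neg : ∀{n}(a : Vec(P.Polynomial k)n)ρ -> E(Vec.map P.:-_ a)ρ ≈ᴹ -ᴹ E a ρ
   E-neg [] [] = sm MT.-0≈0
   E-neg(a ∷ p)(x ∷ ρ) = +≈(neg* _ x)(E-neg p ρ)⊚ MT.-ᴹ-+ _ _ where
    neg* : ∀ a x →(R.- a)*ₗ x ≈ᴹ -ᴹ(a *ₗ x)
    neg* a x = MT.-ᴹ-unique _ _(sm(*ₗ-distribʳ x _ _)⊚ *ₗ-congʳ(R.-‿inverseˡ a)⊚ *ₗ-zeroˡ x)

   E-* : ∀{n} p(a : Vec(P.Polynomial k)n)ρ -> E(Vec.map(p P.:*_)a)ρ ≈ᴹ P.⟦ p ⟧ σ *ₗ E a ρ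
   E-* p [] [] = sm(*ₗ-zeroʳ _)
   E-* p(a ∷ q)(x ∷ ρ) = +≈(*ₗ-assoc _ _ x)(E-* p q ρ)⊚ sm(*ₗ-distribˡ _ _ _)

   correct : ∀{n}(s : Expr k n)ρ -> E(coefficients s)ρ ≈ᴹ eval σ s ρ
   correct(vec i)ρ = E-var i ρ
   correct(s ⊹ t)ρ = E-+(coefficients s)_ ρ ⊚ +≈(correct s ρ)(correct t ρ)
   correct(⊝ s)ρ = E-neg(coefficients s)ρ ⊚ -≈(correct s ρ)
   correct ∅ ρ = E-0 ρ
   correct(p ✶ s)ρ = E-* p(coefficients s)ρ ⊚ *ₗ-congˡ(correct s ρ)

  Same : ∀{n} -> Vec(P.Polynomial k)n -> Vec(P.Polynomial k)n -> Set ℓ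
  Same [] [] = Unit.⊤
  Same(p ∷ a)(q ∷ b) = P.⟦ p ⟧↓ σ R.≈ P.⟦ q ⟧↓ σ × Same a b

  solveᴹ : ∀{n}(ρ : Vec Carrierᴹ n)(s t : Expr k n)-> Same(coefficients s)(coefficients t)-> eval σ s ρ ≈ᴹ eval σ t ρ
  solveᴹ ρ s t h = sm(correct s ρ)⊚ go(coefficients s)(coefficients t)ρ h ⊚ correct t ρ where
   go : ∀{n}(a b : Vec(P.Polynomial k)n)ρ -> Same a b -> E a ρ ≈ᴹ E b ρ
   go [] [] [] _ = rf
   go(p ∷ a)(q ∷ b)(x ∷ ρ)(h , r) = +≈(*ₗ-congʳ(P.prove σ p q h))(go a b ρ r)

-- Linear combinations, exchange and decidable dependence.

module Combinations{c ℓ₁ ℓ₂ ℓ₃ v ℓv}{F : OrderedField c ℓ₁ ℓ₂ ℓ₃}(E : EuclideanSpace F v ℓv)where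
 private module F = CommutativeRing(OrderedField.commutativeRing F)
 open EuclideanSpace E
 open Renamed leftModule
 open LinearAlgebra E
 open ModuleTheory leftModule
 open OrderedFieldTheory F using(rowRelation; Kernel; module Line)
 open SetoidReasoning ≈ᴹ-setoid

 smul-lin : ∀ x -> Lin(OrderedFieldTheory.line F)leftModule(_*ₗ x)
 smul-lin x = record{ map-cong = *ₗ-congʳ; map-+ = \ a b -> *ₗ-distribʳ x a b; map-* = \ k a -> *ₗ-assoc k a x }

 scale-lin : ∀ k -> Lin leftModule leftModule(k *ₗ_)
 scale-lin k = record
  { map-cong = *ₗ-congˡ
  ; map-+ = \ _ _ -> *ₗ-distribˡ _ _ _
  ; map-* = \ k′ x -> sm(*ₗ-assoc k k′ x)⊚ *ₗ-congʳ(F.*-comm k k′)⊚ *ₗ-assoc k′ k x }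

 comb-cong : ∀{k}{s t : Vector F.Carrier k}(x : Vector Carrierᴹ k)→(∀ i -> s i F.≈ t i)-> combination s x ≈ᴹ combination t x
 comb-cong x h = sum-cong-≋(\ i -> *ₗ-congʳ(h i))

 comb-zero : ∀{k}{s : Vector F.Carrier k}(x : Vector Carrierᴹ k)→(∀ i -> s i F.≈ F.0#)-> combination s x ≈ᴹ 0ᴹ
 comb-zero x h = sum-zero(\ i -> *ₗ-congʳ(h i)⊚ *ₗ-zeroˡ(x i))

 comb-+ : ∀{k}(s t : Vector F.Carrier k)x -> combination(\ i -> s i F.+ t i)x ≈ᴹ combination s x +ᴹ combination t x
 comb-+ s t x = sum-cong-≋{_}{\ i →(s i F.+ t i)*ₗ x i}(\ i -> *ₗ-distribʳ(x i)(s i)(t i))⊚ ∑-distrib-+(\ i -> s i *ₗ x i)(\ i -> t i *ₗ x i)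

 comb-* : ∀{k} a(s : Vector F.Carrier k)x -> combination(\ i -> a F.* s i)x ≈ᴹ a *ₗ combination s x
 comb-* a s x = sum-cong-≋{_}{\ i →(a F.* s i)*ₗ x i}(\ i -> *ₗ-assoc a(s i)(x i))⊚ sm(Lin.map-sum(scale-lin a)(\ i -> s i *ₗ x i))

 comb-matrix : ∀{k r}{x : Vector Carrierᴹ k}{y : Vector Carrierᴹ r}(m : Fin k -> Fin r -> F.Carrier)->
            (∀ i -> x i ≈ᴹ combination(m i)y)-> ∀ s -> combination s x ≈ᴹ combination(\ j -> Line.sum(\ i -> s i F.* m i j))y
 comb-matrix{k}{r}{x}{y} m h s = begin
  sum(\ i -> s i *ₗ x i)≈⟨ sum-cong-≋(\ i -> *ₗ-congˡ(h i))⟩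
  sum(\ i -> s i *ₗ sum(\ j -> m i j *ₗ y j))≈⟨ sum-cong-≋(\ i -> Lin.map-sum(scale-lin(s i))(\ j -> m i j *ₗ y j))⟩
  sum(\ i -> sum(\ j -> s i *ₗ(m i j *ₗ y j)))≈⟨ sum-cong-≋{_}{\ i -> sum(\ j -> s i *ₗ(m i j *ₗ y j))}(\ i -> sum-cong-≋{_}{\ j -> s i *ₗ(m i j *ₗ y j)}(\ j -> sm(*ₗ-assoc(s i)(m i j)(y j))))⟩
  sum(\ i -> sum(\ j →(s i F.* m i j)*ₗ y j))≈⟨ ∑-comm(\ i j →(s i F.* m i j)*ₗ y j)⟩
  sum(\ j -> sum(\ i →(s i F.* m i j)*ₗ y j))≈⟨ sum-cong-≋(\ j -> sm(Lin.map-sum(smul-lin(y j))(\ i -> s i F.* m i j)))⟩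
  sum(\ j -> Line.sum(\ i -> s i F.* m i j)*ₗ y j)∎

 -- A left kernel vector of the matrix of expansions would be a relation among the x i, so
 -- `rowRelation` can only return the bound.
 exchange : ∀{k r}{x : Vector Carrierᴹ k}{y : Vector Carrierᴹ r} -> LinearlyIndependent x →(∀ i -> ∃ \ m -> x i ≈ᴹ combination m y)-> k ≤ r
 exchange{x = x}{y} independent expansion with rowRelation(\ i -> fst(expansion i))
 ... | inr(_ , k≤r) = k≤r
 ... | inl(s , kernel , i , s≉0) = contra
  (independent s(comb-matrix(\ i -> fst(expansion i))(\ i -> snd(expansion i))s ⊚ comb-zero y kernel)i)s≉0

 dependent? : ∀{k r}{y : Vector Carrierᴹ r} -> LinearlyIndependent y →(x : Vector Carrierᴹ k)→(∀ i -> ∃ \ m -> x i ≈ᴹ combination m y)->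
        LinearlyDependent x ⊎ LinearlyIndependent x
 dependent?{y = y} independent x expansion with rowRelation(\ i -> fst(expansion i))
 ... | inl(s , kernel , ntriv) = inl(s , comb-matrix{y = y}(\ i -> fst(expansion i))(\ i -> snd(expansion i))s ⊚ comb-zero y kernel , ntriv)
 ... | inr(none , _) = inr(\ s h -> none s(independent _(sm(comb-matrix{y = y}(\ i -> fst(expansion i))(\ i -> snd(expansion i))s)⊚ h)))

 single : ∀{k} -> Fin k -> F.Carrier -> Vector F.Carrier k
 single i a j with j Fin.≟ i
 ... | yes _ = a
 ... | no _ = F.0#

 single-off : ∀{k}{i j : Fin k} a -> j ≢ i -> single i a j F.≈ F.0#
 single-off{i = i}{j} a j≢i with j Fin.≟ i
 ... | yes j≡i = contra j≡i j≢i
 ... | no _ = F.refl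

 comb-single : ∀{k}(i : Fin k)a x -> combination(single i a)x ≈ᴹ a *ₗ x i
 comb-single i a x = sum-cong-≋ term ⊚ ∑-single(\ _ -> yes tt){\ j -> single i a j *ₗ x j} i tt(\ j _ j≢i -> *ₗ-congʳ(single-off a j≢i)⊚ *ₗ-zeroˡ _)⟨≈⟩ *ₗ-congʳ at where
  _⟨≈⟩_ = ≈ᴹ-trans
  term : ∀ j -> single i a j *ₗ x j ≈ᴹ(yes tt ⊢ single i a j *ₗ x j)
  term j = rf
  at : single i a i F.≈ a
  at with i Fin.≟ i
  ... | yes _ = F.refl
  ... | no h = contra refl h

module _{N : ℕ} where
 open import Data.Fin.Subset using(⋃)
 open import Data.Fin.Subset.Properties using(x∈p∪q⁻; p⊆p∪q; q⊆p∪q; ∉⊥)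
 open import Data.List.Base using(take; tabulate)

 ∈take⇒ : ∀{m}(P : Vector(Subset N)m)k{x} -> x ∈ ⋃(take k(tabulate P))-> ∃ \ j -> toℕ j < k × x ∈ P j
 ∈take⇒{zero} P zero h = contra h ∉⊥
 ∈take⇒{zero} P(suc k)h = contra h ∉⊥
 ∈take⇒{suc m} P zero h = contra h ∉⊥
 ∈take⇒{suc m} P(suc k)h with x∈p∪q⁻(P zero)_ h
 ... | inl h0 = zero , s≤s z≤n , h0
 ... | inr h' = let(j , j< , hj) = ∈take⇒(P ∘ suc)k h' in suc j , s≤s j< , hj

 ⇒∈take : ∀{m}(P : Vector(Subset N)m)k{x} j -> toℕ j < k -> x ∈ P j -> x ∈ ⋃(take k(tabulate P))
 ⇒∈take P(suc k)zero _ h = p⊆p∪q _ h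
 ⇒∈take P(suc k)(suc j)(s≤s j<)h = q⊆p∪q(P zero)_(⇒∈take(P ∘ suc)k j j< h)

-- From a supersolvable partition to a fibration.

module SupersolvableFibration{c ℓ₁ ℓ₂ ℓ₃ v ℓv}{F : OrderedField c ℓ₁ ℓ₂ ℓ₃}(E : EuclideanSpace F v ℓv)
  {r}{β : Vector(EuclideanSpace.Carrierᴹ E)r}(β-indep : LinearAlgebra.LinearlyIndependent E β)
  (β-spans : ∀ x -> ∃ \ s -> EuclideanSpace._≈ᴹ_ E x(LinearAlgebra.combination E s β))
  {N}(𝒜 : Vector(EuclideanSpace.Carrierᴹ E)N)
  (𝒜-nonzero : ∀ x{a} -> EuclideanSpace._≈ᴹ_ E(EuclideanSpace._*ₗ_ E a(𝒜 x))(EuclideanSpace.0ᴹ E)-> OrderedField._≈_ F a(OrderedField.0# F))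
  (𝒜-nonpar : ∀{x y} -> x ≢ y -> ∀{a b} -> EuclideanSpace._≈ᴹ_ E(EuclideanSpace._+ᴹ_ E(EuclideanSpace._*ₗ_ E a(𝒜 x))(EuclideanSpace._*ₗ_ E b(𝒜 y)))(EuclideanSpace.0ᴹ E)->
    OrderedField._≈_ F a(OrderedField.0# F)× OrderedField._≈_ F b(OrderedField.0# F))
  (supersolvable : Arrangement.Supersolvable E 𝒜)where

 private module F = CommutativeRing(OrderedField.commutativeRing F)
 open EuclideanSpace E
 open Renamed leftModule
 open LinearAlgebra E
 open Arrangement E 𝒜
 open Combinations E
 open ModuleTheory leftModule using(sum; sum-zero; -0≈0)
 open OrderedFieldTheory F using(inverse; cancel; 1≉0; _≟_; _:+_; _:*_; :-_; con; var; _:=_)renaming(solve to ring)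
 open ModuleSolver{R = OrderedField.commutativeRing F} leftModule using(solveᴹ; vec; _⊹_; ⊝_; ∅; _✶_)
 open SetoidReasoning ≈ᴹ-setoid
 open import Data.Fin.Subset using(_∪_; ⊤)
 open import Data.Fin.Subset.Properties using(_∈?_)
 open import Data.Vec.Properties using(lookup⇒[]=; []=⇒lookup; lookup∘tabulate)

 private
  n = fst supersolvable
  Π = fst(snd(snd supersolvable))
  partition = fst(snd(snd(snd supersolvable)))
  conditions = snd(snd(snd(snd supersolvable)))

 part : Fin N -> Fin n
 part x = fst(partition x)

 lev : Fin N -> ℕ
 lev x = toℕ(part x)

 private
  ∈part : ∀ x -> x ∈ Π(part x)
  ∈part x = fst(snd(partition x))

  part-unique : ∀{x i} -> x ∈ Π i -> part x ≡ i
  part-unique{x} h = snd(snd(partition x))h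

  initial⇒ : ∀ i{x} -> x ∈ initial Π i -> lev x ≤ toℕ i
  initial⇒ i h = let(j , j< , hj) = ∈take⇒ Π(suc(toℕ i))h in ℕ.≤-pred(subst(\ k -> toℕ k < suc(toℕ i))(sym(part-unique hj))j<)

  ⇒initial : ∀ i{x} -> lev x ≤ toℕ i -> x ∈ initial Π i
  ⇒initial i{x} h = ⇒∈take Π(suc(toℕ i))(part x)(s≤s h)(∈part x)

 OnLine : Fin N -> Fin N -> Carrierᴹ -> Set(c ⊔ ℓv)
 OnLine x y z = ∃₂ \ a b -> z ≈ᴹ a *ₗ 𝒜 x +ᴹ b *ₗ 𝒜 y

 -- Elimination on z and the two normals: in a nontrivial relation z must have a nonzero
 -- coefficient, since the normals are not parallel, and it can be solved for.
 onLine? : ∀{x y} -> x ≢ y -> ∀ z -> Dec(OnLine x y z)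
 onLine?{x}{y} x≢y z = go(dependent? β-indep xs(\ i -> β-spans(xs i)))where
  xs : Vector Carrierᴹ 3
  xs zero = z
  xs(suc zero) = 𝒜 x
  xs(suc(suc zero)) = 𝒜 y
  go : LinearlyDependent xs ⊎ LinearlyIndependent xs -> Dec(OnLine x y z)
  go(inr independent) = no \(a , b , h)-> 1≉0(independent(s a b)(begin
    F.1# *ₗ z +ᴹ((F.- a)*ₗ 𝒜 x +ᴹ((F.- b)*ₗ 𝒜 y +ᴹ 0ᴹ))
     ≈⟨ +≈ʳ(1* z ⊚ h)⟩
    (a *ₗ 𝒜 x +ᴹ b *ₗ 𝒜 y)+ᴹ((F.- a)*ₗ 𝒜 x +ᴹ((F.- b)*ₗ 𝒜 y +ᴹ 0ᴹ))
     ≈⟨ solveᴹ(a ∷ b ∷ [])(𝒜 x ∷ 𝒜 y ∷ [])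
        ((var zero ✶ vec zero ⊹ var(suc zero)✶ vec(suc zero))⊹((:- var zero)✶ vec zero ⊹((:- var(suc zero))✶ vec(suc zero)⊹ ∅)))∅(F.refl , F.refl , _)⟩
    0ᴹ ∎)zero)where
   s : F.Carrier -> F.Carrier -> Vector F.Carrier 3
   s a b zero = F.1#
   s a b(suc zero) = F.- a
   s a b(suc(suc zero)) = F.- b
  go(inl(s , h , i , s≉0))with s zero ≟ F.0#
  ... | yes s0≈0 = contra(all i)s≉0 where
   rest = begin
    s(suc zero)*ₗ 𝒜 x +ᴹ s(suc(suc zero))*ₗ 𝒜 y
     ≈⟨ solveᴹ(s(suc zero)∷ s(suc(suc zero))∷ [])(z ∷ 𝒜 x ∷ 𝒜 y ∷ [])
        (var zero ✶ vec(suc zero)⊹ var(suc zero)✶ vec(suc(suc zero)))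
        (con 0z ✶ vec zero ⊹(var zero ✶ vec(suc zero)⊹(var(suc zero)✶ vec(suc(suc zero))⊹ ∅)))(F.refl , F.refl , F.refl , _)⟩
    F.0# *ₗ z +ᴹ(s(suc zero)*ₗ 𝒜 x +ᴹ(s(suc(suc zero))*ₗ 𝒜 y +ᴹ 0ᴹ))≈⟨ +≈ʳ(*ₗ-congʳ(F.sym s0≈0))⟩
    combination s xs ≈⟨ h ⟩
    0ᴹ ∎
   all : ∀ i -> s i F.≈ F.0#
   all zero = s0≈0
   all(suc zero) = fst(𝒜-nonpar x≢y rest)
   all(suc(suc zero)) = snd(𝒜-nonpar x≢y rest)
  ... | no s0≉0 = yes(F.-(t F.* s(suc zero)), F.-(t F.* s(suc(suc zero))),(begin
    z
     ≈⟨ 1* z ⟨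
    F.1# *ₗ z
     ≈⟨ *ₗ-congʳ(F.sym st)⟩
    (s zero F.* t)*ₗ z
     ≈⟨ solveᴹ(s zero ∷ s(suc zero)∷ s(suc(suc zero))∷ t ∷ [])(z ∷ 𝒜 x ∷ 𝒜 y ∷ [])
        ((var zero :* τ)✶ vec zero)
        (τ ✶(var zero ✶ vec zero ⊹(var(suc zero)✶ vec(suc zero)⊹(var(suc(suc zero))✶ vec(suc(suc zero))⊹ ∅)))
         ⊹((:-(τ :* var(suc zero)))✶ vec(suc zero)⊹(:-(τ :* var(suc(suc zero))))✶ vec(suc(suc zero))))(F.refl , F.refl , F.refl , _)⟩
    t *ₗ combination s xs +ᴹ((F.-(t F.* s(suc zero)))*ₗ 𝒜 x +ᴹ(F.-(t F.* s(suc(suc zero))))*ₗ 𝒜 y)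
     ≈⟨ +≈ʳ(*ₗ-congˡ h ⊚ *ₗ-zeroʳ t)⟩
    0ᴹ +ᴹ((F.-(t F.* s(suc zero)))*ₗ 𝒜 x +ᴹ(F.-(t F.* s(suc(suc zero))))*ₗ 𝒜 y)
     ≈⟨ 0+ _ ⟩
    (F.-(t F.* s(suc zero)))*ₗ 𝒜 x +ᴹ(F.-(t F.* s(suc(suc zero))))*ₗ 𝒜 y ∎))where
   t = fst(inverse s0≉0)
   st = snd(inverse s0≉0)
   τ = var(suc(suc(suc zero)))

 record LowSpan(l : ℕ)(x : Carrierᴹ) : Set(c ⊔ ℓ₁ ⊔ ℓv)where
  constructor low
  field
   coords : Vector F.Carrier N
   support : ∀ i -> ¬ lev i < l -> coords i F.≈ F.0#
   value : x ≈ᴹ combination coords 𝒜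

 low-resp : ∀{l x y} -> x ≈ᴹ y -> LowSpan l x -> LowSpan l y
 low-resp h(low s p q) = low s p(sm h ⊚ q)

 low-atom : ∀{l} x -> lev x < l -> LowSpan l(𝒜 x)
 low-atom{l} x x< = low(single x F.1#)(\ i ¬i< -> single-off{i = x}{i} F.1#(\{ refl -> ¬i< x< }))(sm(comb-single x F.1# 𝒜 ⊚ 1* _))

 low-+ : ∀{l x y} -> LowSpan l x -> LowSpan l y -> LowSpan l(x +ᴹ y)
 low-+(low s p q)(low s' p' q') = low(\ i -> s i F.+ s' i)(\ i h -> F.trans(F.+-cong(p i h)(p' i h))(F.+-identityʳ _))
  (+≈ q q' ⊚ sm(comb-+ s s' 𝒜))

 low-* : ∀{l x} a -> LowSpan l x -> LowSpan l(a *ₗ x)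
 low-* a(low s p q) = low(\ i -> a F.* s i)(\ i h -> F.trans(F.*-congˡ(p i h))(F.zeroʳ a))(*ₗ-congˡ q ⊚ sm(comb-* a s 𝒜))

 low-0 : ∀{l} -> LowSpan l 0ᴹ
 low-0 = low(\ _ -> F.0#)(\ _ _ -> F.refl)(sm(comb-zero 𝒜(\ _ -> F.refl)))

 low-cancel : ∀{l x a} -> ¬(a F.≈ F.0#)-> LowSpan l(a *ₗ x)-> LowSpan l x
 low-cancel{x = x}{a} a≉0 h = let(b , ab) = inverse a≉0 in low-resp(begin
  b *ₗ(a *ₗ x)≈⟨ *ₗ-assoc b a x ⟨
  (b F.* a)*ₗ x ≈⟨ *ₗ-congʳ(F.trans(F.*-comm b a)ab)⟩
  F.1# *ₗ x ≈⟨ 1* x ⟩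
  x ∎)(low-* b h)

 low-comb : ∀{l}(s : Vector F.Carrier N)→(∀ x -> ¬(s x F.≈ F.0#)-> LowSpan l(𝒜 x))-> LowSpan l(combination s 𝒜)
 low-comb{l} s h = go(\ x -> s x *ₗ 𝒜 x)term where
  term : ∀ x -> LowSpan l(s x *ₗ 𝒜 x)
  term x with s x ≟ F.0#
  ... | yes z = low-resp(sm(*ₗ-congʳ z ⊚ *ₗ-zeroˡ _))low-0
  ... | no nz = low-*(s x)(h x nz)
  go : ∀{m}(f : Vector Carrierᴹ m)→(∀ i -> LowSpan l(f i))-> LowSpan l(sum f)
  go{zero} f h = low-0
  go{suc m} f h = low-+(h zero)(go(f ∘ suc)(h ∘ suc))

 record Thd(x y z : Fin N) : Set(c ⊔ ℓ₁ ⊔ ℓv)where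
  field
   lower : lev z < lev x
   a b : F.Carrier
   on : 𝒜 z ≈ᴹ a *ₗ 𝒜 x +ᴹ b *ₗ 𝒜 y
   a≉0 : ¬(a F.≈ F.0#)
   b≉0 : ¬(b F.≈ F.0#)

 private
  module _{x y}(x≢y : x ≢ y)(xy : lev x ≡ lev y)where
   ι = part x

   InX : Fin N -> Set _
   InX z = lev z ≤ toℕ ι × OnLine x y(𝒜 z)

   inX? : ∀ z -> Dec(InX z)
   inX? z =(lev z ℕ.≤? toℕ ι)×-dec onLine? x≢y(𝒜 z)

   X = Vec.tabulate(\ z -> does(inX? z))

   X⇒ : ∀{z} -> z ∈ X -> InX z
   X⇒{z} h = decode(inX? z)(sym(lookup∘tabulate(\ z -> does(inX? z))z)⨾ []=⇒lookup h)where
    decode : ∀{p}{P : Set p}(q : Dec P)-> does q ≡ true -> P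
    decode(yes p)_ = p

   ⇒X : ∀{z} -> InX z -> z ∈ X
   ⇒X{z} p = lookup⇒[]= z X(lookup∘tabulate(\ z -> does(inX? z))z ⨾ here(inX? z))where
    here :(q : Dec(InX z))-> does q ≡ true
    here(yes _) = refl
    here(no ¬p) = contra p ¬p

   pair : Vector Carrierᴹ 2
   pair zero = 𝒜 x
   pair(suc zero) = 𝒜 y

   on-x : OnLine x y(𝒜 x)
   on-x = F.1# , F.0# , sm(+≈(1* _)(*ₗ-zeroˡ _)⊚ +0 _)

   on-y : OnLine x y(𝒜 y)
   on-y = F.0# , F.1# , sm(+≈(*ₗ-zeroˡ _)(1* _)⊚ 0+ _)

   span-line : ∀{z} -> Span 𝒜 X z -> OnLine x y z
   span-line{z}(s , support , h) = let(a , b , q) = go(\ i -> s i *ₗ 𝒜 i)term in a , b , h ⊚ q where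
    term : ∀ i -> OnLine x y(s i *ₗ 𝒜 i)
    term i with i ∈? X
    ... | no i∉ = F.0# , F.0# , *ₗ-congʳ(support i i∉)⊚ *ₗ-zeroˡ _ ⊚ sm(+≈(*ₗ-zeroˡ _)(*ₗ-zeroˡ _)⊚ +0 _)
    ... | yes i∈ = let(a , b , q) = snd(X⇒ i∈)in s i F.* a , s i F.* b , *ₗ-congˡ q ⊚ *ₗ-distribˡ _ _ _ ⊚ +≈(sm(*ₗ-assoc _ _ _))(sm(*ₗ-assoc _ _ _))
    go : ∀{m}(f : Vector Carrierᴹ m)→(∀ i -> OnLine x y(f i))-> OnLine x y(sum f)
    go{zero} f h = F.0# , F.0# , sm(+≈(*ₗ-zeroˡ _)(*ₗ-zeroˡ _)⊚ +0 _)
    go{suc m} f h = let(a , b , q) = h zero; (a' , b' , q') = go(f ∘ suc)(h ∘ suc)in a F.+ a' , b F.+ b' ,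
     +≈ q q' ⊚ AbelianGroupSolver.interchange +ᴹ-abelianGroup _ _ _ _ ⊚ +≈(sm(*ₗ-distribʳ _ _ _))(sm(*ₗ-distribʳ _ _ _))

   flat : IsFlatOfRank 2(initial Π ι)X
   flat =((\ z∈ -> ⇒initial ι(fst(X⇒ z∈))), \ z(z∈ , sp)-> ⇒X(initial⇒ ι z∈ , span-line sp))
      , pair , independent , inside , spanning where
    expand : ∀ s -> combination s pair ≈ᴹ s zero *ₗ 𝒜 x +ᴹ s(suc zero)*ₗ 𝒜 y
    expand s = +≈ˡ(+0 _)
    independent : LinearlyIndependent pair
    independent s h zero = fst(𝒜-nonpar x≢y(sm(expand s)⊚ h))
    independent s h(suc zero) = snd(𝒜-nonpar x≢y(sm(expand s)⊚ h))
    atom : ∀{z} -> z ∈ X -> Span 𝒜 X(𝒜 z)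
    atom{z} z∈ = single z F.1# ,(\ i i∉ -> single-off{i = z}{i} F.1#(\{ refl -> i∉ z∈ })), sm(comb-single z F.1# 𝒜 ⊚ 1* _)
    inside : ∀ i -> Span 𝒜 X(pair i)
    inside zero = atom(⇒X(ℕ.≤-refl , on-x))
    inside(suc zero) = atom(⇒X(ℕ.≤-reflexive(sym xy), on-y))
    spanning : ∀ z -> Span 𝒜 X z -> Span pair ⊤ z
    spanning z sp = let(a , b , q) = span-line sp in coefs a b ,(\ i i∉ -> contra(∈⊤' i)i∉), q ⊚ sm(expand(coefs a b))where
     open import Data.Fin.Subset.Properties using(∈⊤)
     ∈⊤' : ∀(i : Fin 2)-> i ∈ ⊤
     ∈⊤' i = ∈⊤
     coefs : F.Carrier -> F.Carrier -> Vector F.Carrier 2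
     coefs a b zero = a
     coefs a b(suc zero) = b

   -- `X` is the rank two flat of the initial part through x and y. It is not contained in one part,
   -- so it has an atom of lower level; a vanishing coefficient there would make two atoms parallel.
   exists-thd : ∃(Thd x y)
   exists-thd with Fin.any?(\ z -> inX? z ×-dec(lev z ℕ.<? lev x))
   ... | yes(z ,(_ , a , b , q), z<) = z , record{ lower = z<; a = a; b = b; on = q; a≉0 = a≉0; b≉0 = b≉0 } where
    z≢x : z ≢ x
    z≢x refl = ℕ.<-irrefl refl z<
    z≢y : z ≢ y
    z≢y refl = ℕ.<-irrefl(sym xy)z<
    a≉0 : ¬(a F.≈ F.0#)
    a≉0 a≈0 = 1≉0(fst(𝒜-nonpar z≢y(begin
     F.1# *ₗ 𝒜 z +ᴹ(F.- b)*ₗ 𝒜 y ≈⟨ +≈ʳ(1* _ ⊚ q ⊚ +≈ʳ(*ₗ-congʳ a≈0))⟩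
     (F.0# *ₗ 𝒜 x +ᴹ b *ₗ 𝒜 y)+ᴹ(F.- b)*ₗ 𝒜 y ≈⟨ solveᴹ(b ∷ [])(𝒜 x ∷ 𝒜 y ∷ [])((con 0z ✶ vec zero ⊹ var zero ✶ vec(suc zero))⊹(:- var zero)✶ vec(suc zero))∅(F.refl , F.refl , _)⟩
     0ᴹ ∎)))
    b≉0 : ¬(b F.≈ F.0#)
    b≉0 b≈0 = 1≉0(fst(𝒜-nonpar z≢x(begin
     F.1# *ₗ 𝒜 z +ᴹ(F.- a)*ₗ 𝒜 x ≈⟨ +≈ʳ(1* _ ⊚ q ⊚ +≈ˡ(*ₗ-congʳ b≈0))⟩
     (a *ₗ 𝒜 x +ᴹ F.0# *ₗ 𝒜 y)+ᴹ(F.- a)*ₗ 𝒜 x ≈⟨ solveᴹ(a ∷ [])(𝒜 x ∷ 𝒜 y ∷ [])((var zero ✶ vec zero ⊹ con 0z ✶ vec(suc zero))⊹(:- var zero)✶ vec zero)∅(F.refl , F.refl , _)⟩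
     0ᴹ ∎)))
   ... | no none = ⊥-elim(snd(conditions ι)X flat X⊆Π)where
    X⊆Π : X ⊆ Π ι
    X⊆Π{z} z∈ with lev z ℕ.<? lev x
    ... | yes z< = contra(z , X⇒ z∈ , z<)none
    ... | no z≮ = subst(\ i -> z ∈ Π i)(Fin.toℕ-injective(ℕ.≤-antisym(fst(X⇒ z∈))(ℕ.≮⇒≥ z≮)))(∈part z)

 -- If one atom of level l were spanned by lower levels, then so would be every y of that level,
 -- through the lower atom on the line of x and y. The initial part of rank l + 1 would then lie in
 -- a space spanned by l vectors.
 not-low : ∀ x -> ¬ LowSpan(lev x)(𝒜 x)
 not-low x lowx = contra(exchange(fst(snd rank))expansion)(ℕ.<⇒≱(ℕ.n<1+n _))where
  l = lev x
  rank = fst(conditions(part x))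
  all-low : ∀ y -> lev y ≤ l -> LowSpan l(𝒜 y)
  all-low y y≤ with ℕ.m≤n⇒m<n∨m≡n y≤
  ... | inl y< = low-atom y y<
  ... | inr y≡ with x Fin.≟ y
  ... | yes refl = lowx
  ... | no x≢y = low-cancel(Thd.b≉0 t)(low-resp(begin
    𝒜 z +ᴹ(F.- a)*ₗ 𝒜 x ≈⟨ +≈ʳ(Thd.on t)⟩
    (a *ₗ 𝒜 x +ᴹ b *ₗ 𝒜 y)+ᴹ(F.- a)*ₗ 𝒜 x ≈⟨ solveᴹ(a ∷ b ∷ [])(𝒜 x ∷ 𝒜 y ∷ [])((var zero ✶ vec zero ⊹ var(suc zero)✶ vec(suc zero))⊹(:- var zero)✶ vec zero)(var(suc zero)✶ vec(suc zero))(F.refl , F.refl , _)⟩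
    b *ₗ 𝒜 y ∎)(low-+(low-atom z(Thd.lower t))(low-*(F.- a)lowx)))where
   found = exists-thd x≢y(sym y≡)
   z = fst found
   t = snd found
   a = Thd.a t
   b = Thd.b t
  -- Levels start at 0: the atoms of level below `suc l` form the initial part with index l, whose
  -- rank is `suc l`.
  lowSpan-basis : ∀ l -> l ≤ n -> ∃ \(b : Vector Carrierᴹ l)-> ∀{z} -> LowSpan l z -> ∃ \ s -> z ≈ᴹ combination s b
  lowSpan-basis zero _ =(\()), \(low s p q)→(\()), q ⊚ comb-zero 𝒜(\ i -> p i \())
  lowSpan-basis(suc l)l<n = subst(\ k -> ∃ \(b : Vector Carrierᴹ(suc k))-> ∀{z} -> LowSpan(suc l)z -> ∃ \ s -> z ≈ᴹ combination s b)(Fin.toℕ-fromℕ< l<n)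
    (b , \{z}(low s p q)-> let(s' , _ , h) = spanning z(s ,(\ i i∉ -> p i(\ i< -> i∉(⇒initial i0(subst(lev i ≤_)(sym(Fin.toℕ-fromℕ< l<n))(ℕ.≤-pred i<))))), q)in s' , h)where
   i0 = Fin.fromℕ< l<n
   b = fst(fst(conditions i0))
   spanning = snd(snd(snd(fst(conditions i0))))
  basis = lowSpan-basis l(ℕ.<⇒≤(Fin.toℕ<n(part x)))
  expansion : ∀ i -> ∃ \ s -> fst rank i ≈ᴹ combination s(fst basis)
  expansion i = let(s , support , h) = fst(snd(snd rank))i in snd basis(low-resp(sm h)(low-comb s
   (\ y s≉0 -> all-low y(below s support y s≉0))))where
   below : ∀ s →(∀ i -> i ∉ initial Π(part x)-> s i F.≈ F.0#)-> ∀ y -> ¬(s y F.≈ F.0#)-> lev y ≤ l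
   below s support y s≉0 with lev y ℕ.≤? l
   ... | yes y≤ = y≤
   ... | no y≰ = contra(support y(\ y∈ -> y≰(initial⇒(part x)y∈)))s≉0

 private
  chosen : ∀ x y -> ∃ \ z -> x ≢ y -> lev x ≡ lev y -> Thd x y z
  chosen x y with x Fin.≟ y | lev x ℕ.≟ lev y
  ... | yes x≡y | _ = x , \ x≢y _ -> contra x≡y x≢y
  ... | no _ | no xy = x , \ _ xy' -> contra xy' xy
  ... | no x≢y | yes xy = let(z , t) = exists-thd x≢y xy in z , \ _ _ -> t

  thd-by : ∀ x y -> Tri(x Fin.< y)(x ≡ y)(y Fin.< x)-> Fin N
  thd-by x y(tri< _ _ _) = fst(chosen x y)
  thd-by x y(tri≈ _ _ _) = x
  thd-by x y(tri> _ _ _) = fst(chosen y x)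

 -- The choice is always made for the pair in increasing order of indices, which gives the symmetry
 -- that anticommutativity requires.
 third : Fin N -> Fin N -> Fin N
 third x y = thd-by x y(Fin.<-cmp x y)

 thd-sym : ∀ x y -> third x y ≡ third y x
 thd-sym x y = go(Fin.<-cmp x y)(Fin.<-cmp y x)where
  go : ∀ s t -> thd-by x y s ≡ thd-by y x t
  go(tri< _ _ _)(tri> _ _ _) = refl
  go(tri> _ _ _)(tri< _ _ _) = refl
  go(tri≈ _ x≡y _)(tri≈ _ _ _) = x≡y
  go(tri< _ _ x≯y)(tri< y<x _ _) = contra y<x x≯y
  go(tri< _ x≢y _)(tri≈ _ y≡x _) = contra(sym y≡x)x≢y
  go(tri> _ x≢y _)(tri≈ _ y≡x _) = contra(sym y≡x)x≢y
  go(tri> x≮y _ _)(tri> _ _ x<y) = contra x<y x≮y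
  go(tri≈ _ x≡y _)(tri< _ y≢x _) = contra(sym x≡y)y≢x
  go(tri≈ _ x≡y _)(tri> _ y≢x _) = contra(sym x≡y)y≢x

 isThd : ∀{x y} -> x ≢ y -> lev x ≡ lev y -> Thd x y(third x y)
 isThd{x}{y} x≢y xy = go(Fin.<-cmp x y)where
  go : ∀ t -> Thd x y(thd-by x y t)
  go(tri< _ _ _) = snd(chosen x y)x≢y xy
  go(tri≈ _ x≡y _) = contra x≡y x≢y
  go(tri> _ _ _) = let t = snd(chosen y x)(x≢y ∘ sym)(sym xy)in record
   { lower = subst(\ k -> lev(fst(chosen y x))< k)(sym xy)(Thd.lower t)
   ; a = Thd.b t; b = Thd.a t; on = Thd.on t ⊚ +ᴹ-comm _ _; a≉0 = Thd.b≉0 t; b≉0 = Thd.a≉0 t }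

 Coefs : List(Fin N)-> Set c
 Coefs [] = Unit.⊤
 Coefs(x ∷ t) = F.Carrier × Coefs t

 total : ∀ t -> Coefs t -> Carrierᴹ
 total [] _ = 0ᴹ
 total(x ∷ t)(k , ks) = k *ₗ 𝒜 x +ᴹ total t ks

 Ntriv : ∀ t -> Coefs t -> Set ℓ₁
 Ntriv [] _ = Empty.⊥
 Ntriv(x ∷ t)(k , ks) = ¬(k F.≈ F.0#)⊎ Ntriv t ks

 Dep : List(Fin N)-> Set(c ⊔ ℓ₁ ⊔ ℓv)
 Dep t = ∃ \ ks -> total t ks ≈ᴹ 0ᴹ × Ntriv t ks

 private
  permute : ∀{s t} -> s ↭ t →(ks : Coefs s)-> ∃ \ ks' -> total t ks' ≈ᴹ total s ks ×(Ntriv s ks -> Ntriv t ks')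
  permute Perm.refl ks = ks , rf , id
  permute(Perm.prep x p)(k , ks) = let(ks' , h , f) = permute p ks in(k , ks'), +≈ˡ h , \{ (inl q)-> inl q; (inr q)-> inr(f q)}
  permute(Perm.swap x y p)(k , l , ks) = let(ks' , h , f) = permute p ks in(l , k , ks'),
   +≈ˡ(+≈ˡ h)⊚ sm(+ᴹ-assoc _ _ _)⊚ +≈ʳ(+ᴹ-comm _ _)⊚ +ᴹ-assoc _ _ _ ,
   \{ (inl q)-> inr(inl q); (inr(inl q))-> inl q; (inr(inr q))-> inr(inr(f q))}
  permute(Perm.trans p q)ks = let(ks' , h , f) = permute p ks; (ks″ , h' , f') = permute q ks' in ks″ , h' ⊚ h , f' ∘ f

 Dep-resp : ∀{s t} -> s ↭ t -> Dep s -> Dep t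
 Dep-resp p(ks , h , f) = let(ks' , h' , f') = permute p ks in ks' , h' ⊚ h , f' f

 private
  data Extremal : List(Fin N)-> Set(c ⊔ ℓ₁ ⊔ ℓv)where
   none : Extremal []
   collide : ∀{t x y u} -> t ↭ x ∷ y ∷ u -> lev x ≡ lev y -> Extremal t
   top : ∀{t x u} -> t ↭ x ∷ u →(∀ ks -> LowSpan(lev x)(total u ks))-> Extremal t

  open import Data.List.Membership.Propositional using()renaming(_∈_ to _∈ˡ_)
  open import Data.List.Relation.Unary.Any using(here; there)

  total-low : ∀{l} t →(∀{y} -> y ∈ˡ t -> lev y < l)-> ∀ ks -> LowSpan l(total t ks)
  total-low [] h ks = low-0
  total-low(x ∷ t)h(k , ks) = low-+(low-* k(low-atom x(h(here refl))))(total-low t(\ y∈ -> h(there y∈))ks)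

  maximum : ∀ x t -> ∃₂ \ y u -> x ∷ t ↭ y ∷ u ×(∀{z} -> z ∈ˡ u -> lev z ≤ lev y)
  maximum x [] = x , [] , Perm.refl , \()
  maximum x(x′ ∷ t)with maximum x′ t
  ... | y , u , p , h with ℕ.≤-total(lev x)(lev y)
  ... | inl x≤y = y , x ∷ u , Perm.trans(Perm.prep x p)(Perm.swap x y Perm.refl), \{ (here refl)-> x≤y; (there z∈)-> h z∈ }
  ... | inr y≤x = x , y ∷ u , Perm.prep x p , \{ (here refl)-> y≤x; (there z∈)-> ℕ.≤-trans(h z∈)y≤x }

  extract : ∀{y}{u : List(Fin N)} -> y ∈ˡ u -> ∃ \ u′ -> u ↭ y ∷ u′
  extract{u = x ∷ u}(here refl) = u , Perm.refl
  extract{u = x ∷ u}(there y∈) = let(u′ , p) = extract y∈ in x ∷ u′ , Perm.trans(Perm.prep x p)(Perm.swap x _ Perm.refl)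

  same-level : ∀ l u →(∃ \ y -> y ∈ˡ u × lev y ≡ l)⊎(∀{y} -> y ∈ˡ u -> lev y ≢ l)
  same-level l [] = inr \()
  same-level l(x ∷ u)with lev x ℕ.≟ l | same-level l u
  ... | yes h | _ = inl(x , here refl , h)
  ... | no _ | inl(y , y∈ , h) = inl(y , there y∈ , h)
  ... | no h | inr k = inr \{ (here refl)-> h; (there y∈)-> k y∈ }

  extremal : ∀ t -> Extremal t
  extremal [] = none
  extremal(x ∷ t)with maximum x t
  ... | y , u , p , h with same-level(lev y)u
  ... | inl(z , z∈ , zy) = let(u′ , q) = extract z∈ in collide(Perm.trans p(Perm.prep y q))(sym zy)
  ... | inr k = top p(total-low u(\ z∈ -> ℕ.≤∧≢⇒<(h z∈)(k z∈)))

 Dep-collide : ∀{t} -> Dep t -> ∃ \ x -> ∃ \ y -> ∃ \ u -> t ↭ x ∷ y ∷ u × lev x ≡ lev y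
 Dep-collide{t} dep = go t dep(<-wellFounded(length t))where
  open import Data.List.Base using(length)
  open import Data.List.Relation.Binary.Permutation.Propositional.Properties using(↭-length)
  go : ∀ t -> Dep t -> Acc _<_(length t)-> ∃ \ x -> ∃ \ y -> ∃ \ u -> t ↭ x ∷ y ∷ u × lev x ≡ lev y
  go t dep(acc rs)with extremal t
  go .[](_ , _ ,())_ | none
  go t dep _ | collide p h = _ , _ , _ , p , h
  go t dep(acc rs) | top{x = x}{u} p lowu with Dep-resp p dep
  ... |(k , ks), h , ntriv with k ≟ F.0#
  ... | no k≉0 = contra(low-cancel k≉0(low-resp(begin
    (F.- F.1#)*ₗ total u ks
     ≈⟨ solveᴹ(k ∷ [])(𝒜 x ∷ total u ks ∷ [])((:- con 1z)✶ vec(suc zero))(var zero ✶ vec zero ⊹ ⊝(var zero ✶ vec zero ⊹ vec(suc zero)))(F.refl , F.refl , _)⟨≈⟩ʳ ⟩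
    k *ₗ 𝒜 x +ᴹ -ᴹ(k *ₗ 𝒜 x +ᴹ total u ks)≈⟨ +≈ˡ(-≈ h ⊚ -0≈0)⟩
    k *ₗ 𝒜 x +ᴹ 0ᴹ ≈⟨ +0 _ ⟩
    k *ₗ 𝒜 x ∎)(low-*(F.- F.1#)(lowu ks))))(not-low x)where
   _⟨≈⟩ʳ : ∀{y} →(F.-(F.1# F.+ F.0#))*ₗ total u ks ≈ᴹ y →(F.- F.1#)*ₗ total u ks ≈ᴹ y
   q ⟨≈⟩ʳ = *ₗ-congʳ(F.-‿cong(F.sym(F.+-identityʳ F.1#)))⊚ q
  ... | yes k≈0 =
   let(y , z , w , q , yz) = go u(ks , sm(+≈ʳ(*ₗ-congʳ k≈0 ⊚ *ₗ-zeroˡ _)⊚ 0+ _)⊚ h , rest ntriv)(rs(subst(length u <_)(sym(↭-length p))ℕ.≤-refl))in y , z , x ∷ w , Perm.trans p(Perm.trans(Perm.prep x q)(Perm.trans(Perm.swap x y Perm.refl)(Perm.prep y(Perm.swap x z Perm.refl)))), yz where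
   rest : ¬(k F.≈ F.0#)⊎ Ntriv u ks -> Ntriv u ks
   rest(inl k≉0) = contra k≈0 k≉0
   rest(inr h) = h

 private
  scaleᶜ : F.Carrier -> ∀ t -> Coefs t -> Coefs t
  scaleᶜ a [] _ = _
  scaleᶜ a(x ∷ t)(k , ks) = a F.* k , scaleᶜ a t ks

  total-scale : ∀ a t ks -> total t(scaleᶜ a t ks)≈ᴹ a *ₗ total t ks
  total-scale a [] ks = sm(*ₗ-zeroʳ a)
  total-scale a(x ∷ t)(k , ks) = +≈(*ₗ-assoc a k _)(total-scale a t ks)⊚ sm(*ₗ-distribˡ a _ _)

  ntriv-scale : ∀{a} -> ¬(a F.≈ F.0#)-> ∀ t ks -> Ntriv t ks -> Ntriv t(scaleᶜ a t ks)
  ntriv-scale a≉0(x ∷ t)(k , ks)(inl h) = inl(\ q -> h(cancel a≉0 q))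
  ntriv-scale a≉0(x ∷ t)(k , ks)(inr h) = inr(ntriv-scale a≉0 t ks h)

 -- Multiply the relation by a and substitute a x = z - b y for z = `third x y`. It stays nontrivial
 -- because a is nonzero.
 Dep-thd : ∀{x y u} -> x ≢ y -> lev x ≡ lev y -> Dep(x ∷ y ∷ u)-> Dep(third x y ∷ y ∷ u)
 Dep-thd{x}{y}{u} x≢y xy((k , l , ks), h , ntriv) =(k , a F.* l F.+ F.-(k F.* b), scaleᶜ a u ks),(begin
   k *ₗ 𝒜(third x y)+ᴹ((a F.* l F.+ F.-(k F.* b))*ₗ 𝒜 y +ᴹ total u(scaleᶜ a u ks))
    ≈⟨ +≈(*ₗ-congˡ(Thd.on t))(+≈ˡ(total-scale a u ks))⟩
   k *ₗ(a *ₗ 𝒜 x +ᴹ b *ₗ 𝒜 y)+ᴹ((a F.* l F.+ F.-(k F.* b))*ₗ 𝒜 y +ᴹ a *ₗ total u ks)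
    ≈⟨ solveᴹ(a ∷ b ∷ k ∷ l ∷ [])(𝒜 x ∷ 𝒜 y ∷ total u ks ∷ [])
       (K ✶(A ✶ vec zero ⊹ B ✶ vec(suc zero))⊹((A :* L :+ :-(K :* B))✶ vec(suc zero)⊹ A ✶ vec(suc(suc zero))))
       (A ✶(K ✶ vec zero ⊹(L ✶ vec(suc zero)⊹ vec(suc(suc zero)))))(F.refl , F.refl , F.refl , _)⟩
   a *ₗ(k *ₗ 𝒜 x +ᴹ(l *ₗ 𝒜 y +ᴹ total u ks))≈⟨ *ₗ-congˡ h ⟩
   a *ₗ 0ᴹ ≈⟨ *ₗ-zeroʳ a ⟩
   0ᴹ ∎), ntriv' where
  t = isThd x≢y xy
  a = Thd.a t
  b = Thd.b t
  A = var zero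
  B = var(suc zero)
  K = var(suc(suc zero))
  L = var(suc(suc(suc zero)))
  Ntriv' = Ntriv(third x y ∷ y ∷ u)(k , a F.* l F.+ F.-(k F.* b), scaleᶜ a u ks)
  go : Dec(k F.≈ F.0#)-> Ntriv(x ∷ y ∷ u)(k , l , ks)-> Ntriv'
  go(no k≉0)_ = inl k≉0
  go(yes k≈0)(inl k≉0) = contra k≈0 k≉0
  go(yes k≈0)(inr(inl l≉0)) = inr(inl(\ q -> l≉0(cancel(Thd.a≉0 t)(F.trans(F.sym(F.trans(F.+-congˡ(F.-‿cong(F.trans(F.*-congʳ k≈0)(F.zeroˡ b))))
   (ring 1(\ z -> z :+ :- con 0z := z)F.refl(a F.* l))))q))))
  go(yes k≈0)(inr(inr h)) = inr(inr(ntriv-scale(Thd.a≉0 t)u ks h))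
  ntriv' = go(k ≟ F.0#)ntriv

 -- The three coefficients are chosen to eliminate x and y. What remains is a multiple w of z; as
 -- the left side lies in lower levels, `not-low` forces w = 0.
 Dep-triangle : ∀{x y z} -> x ≢ y -> x ≢ z -> y ≢ z -> lev x ≡ lev y -> lev x ≡ lev z -> Dep(third x y ∷ third x z ∷ third y z ∷ [])
 Dep-triangle{x}{y}{z} x≢y x≢z y≢z xy xz =(k1 , k2 , k3 , _), relation , inl(\ h -> Thd.a≉0 t2(cancel(Thd.a≉0 t3)h))where
  t1 = isThd x≢y xy
  t2 = isThd x≢z xz
  t3 = isThd y≢z(sym xy ⨾ xz)
  a1 = Thd.a t1
  b1 = Thd.b t1
  a2 = Thd.a t2
  b2 = Thd.b t2
  a3 = Thd.a t3
  b3 = Thd.b t3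
  k1 = a3 F.* a2
  k2 = F.-(a3 F.* a1)
  k3 = F.-(a2 F.* b1)
  w = F.-(a3 F.* a1 F.* b2)F.+ F.-(a2 F.* b1 F.* b3)
  A1 = var zero
  B1 = var(suc zero)
  A2 = var(suc(suc zero))
  B2 = var(suc(suc(suc zero)))
  A3 = var(suc(suc(suc(suc zero))))
  B3 = var(suc(suc(suc(suc(suc zero)))))
  S = total(third x y ∷ third x z ∷ third y z ∷ [])(k1 , k2 , k3 , _)
  S≈wz = begin
   k1 *ₗ 𝒜(third x y)+ᴹ(k2 *ₗ 𝒜(third x z)+ᴹ(k3 *ₗ 𝒜(third y z)+ᴹ 0ᴹ))
    ≈⟨ +≈(*ₗ-congˡ(Thd.on t1))(+≈(*ₗ-congˡ(Thd.on t2))(+≈ʳ(*ₗ-congˡ(Thd.on t3))))⟩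
   k1 *ₗ(a1 *ₗ 𝒜 x +ᴹ b1 *ₗ 𝒜 y)+ᴹ(k2 *ₗ(a2 *ₗ 𝒜 x +ᴹ b2 *ₗ 𝒜 z)+ᴹ(k3 *ₗ(a3 *ₗ 𝒜 y +ᴹ b3 *ₗ 𝒜 z)+ᴹ 0ᴹ))
    ≈⟨ solveᴹ(a1 ∷ b1 ∷ a2 ∷ b2 ∷ a3 ∷ b3 ∷ [])(𝒜 x ∷ 𝒜 y ∷ 𝒜 z ∷ [])
       ((A3 :* A2)✶(A1 ✶ vec zero ⊹ B1 ✶ vec(suc zero))⊹((:-(A3 :* A1))✶(A2 ✶ vec zero ⊹ B2 ✶ vec(suc(suc zero)))⊹
        ((:-(A2 :* B1))✶(A3 ✶ vec(suc zero)⊹ B3 ✶ vec(suc(suc zero)))⊹ ∅)))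
       ((:-(A3 :* A1 :* B2) :+ :-(A2 :* B1 :* B3))✶ vec(suc(suc zero)))(F.refl , F.refl , F.refl , _)⟩
   w *ₗ 𝒜 z ∎
  l = lev z
  S-low = low-+(low-* k1(low-atom _(subst(lev(third x y)<_)xz(Thd.lower t1))))
   (low-+(low-* k2(low-atom _(subst(lev(third x z)<_)xz(Thd.lower t2))))
   (low-+(low-* k3(low-atom _(subst(lev(third y z)<_)(sym xy ⨾ xz)(Thd.lower t3))))low-0))
  relation : S ≈ᴹ 0ᴹ
  relation with w ≟ F.0#
  ... | yes w≈0 = S≈wz ⊚ *ₗ-congʳ w≈0 ⊚ *ₗ-zeroˡ _
  ... | no w≉0 = contra(low-cancel w≉0(low-resp S≈wz S-low))(not-low z)

 fibration : Fibration N(c ⊔ ℓ₁ ⊔ ℓv)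
 fibration = record
  { lev = lev; third = third; thd-sym = thd-sym
  ; thd-lower = \ x≢y xy -> Thd.lower(isThd x≢y xy)
  ; Dep = Dep; Dep-resp = Dep-resp; Dep-collide = Dep-collide; Dep-thd = Dep-thd; Dep-triangle = Dep-triangle }

 fibration-bounded : ∀ x -> lev x < n
 fibration-bounded x = Fin.toℕ<n(part x)

-- Supersolvable arrangements are Koszul.

module SupersolvableToKoszul{c ℓ₁ ℓ₂ ℓ₃ v ℓv k ℓk₁ ℓk₂}{F : OrderedField c ℓ₁ ℓ₂ ℓ₃}(E : EuclideanSpace F v ℓv)
  {r}{β : Vector(EuclideanSpace.Carrierᴹ E)r}(β-indep : LinearAlgebra.LinearlyIndependent E β)
  (β-spans : ∀ x -> ∃ \ s -> EuclideanSpace._≈ᴹ_ E x(LinearAlgebra.combination E s β))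
  {N}(𝒜 : Vector(EuclideanSpace.Carrierᴹ E)N)
  (𝒜-nonzero : ∀ x{a} -> EuclideanSpace._≈ᴹ_ E(EuclideanSpace._*ₗ_ E a(𝒜 x))(EuclideanSpace.0ᴹ E)-> OrderedField._≈_ F a(OrderedField.0# F))
  (𝒜-nonpar : ∀{x y} -> x ≢ y -> ∀{a b} -> EuclideanSpace._≈ᴹ_ E(EuclideanSpace._+ᴹ_ E(EuclideanSpace._*ₗ_ E a(𝒜 x))(EuclideanSpace._*ₗ_ E b(𝒜 y)))(EuclideanSpace.0ᴹ E)->
    OrderedField._≈_ F a(OrderedField.0# F)× OrderedField._≈_ F b(OrderedField.0# F))
  (K : HeytingField k ℓk₁ ℓk₂)(supersolvable : Arrangement.Supersolvable E 𝒜)where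
 private
  module F = CommutativeRing(OrderedField.commutativeRing F)
  module R = CommutativeRing(fieldRing K)
 open EuclideanSpace E using(_≈ᴹ_; _+ᴹ_; _*ₗ_; 0ᴹ; ≈ᴹ-trans; ≈ᴹ-sym; +ᴹ-cong; +ᴹ-congˡ; +ᴹ-congʳ; *ₗ-identityˡ; ≈ᴹ-setoid; leftModule)
 open Renamed leftModule
 open LinearAlgebra E
 open OrlikSolomon K{E = E} 𝒜
 open Exterior(fieldRing K)(Fin N)
 open Quotient exteriorAlgebra Relator using(_~_; generator)
 open SupersolvableFibration E β-indep β-spans 𝒜 𝒜-nonzero 𝒜-nonpar supersolvable
 open ModelOfFibration(fieldRing K)fibration(fst supersolvable)fibration-bounded Relator
 open ModuleSolver{R = OrderedField.commutativeRing F} leftModule using(solveᴹ; vec; _⊹_; ∅; _✶_)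
 open OrderedFieldTheory F using(var; 1≉0)renaming(:-_ to ∼_)
 private
  module Rep = Representation(fieldRing K)fibration
  module Top = Rep.Stage(Rep.stage(fst supersolvable))
  module Int = Interpretation(fieldRing K)Top.M Top.E Top.E-lin Top.E-square Top.E-anti

  coefs : ∀{d}(t : Vector(Fin N)d)-> Vector F.Carrier d -> Coefs(Int.toList t)
  coefs{zero} t s = _
  coefs{suc d} t s = s zero , coefs(Vector.tail t)(Vector.tail s)

  total-coefs : ∀{d}(t : Vector(Fin N)d)s -> total(Int.toList t)(coefs t s)≡ combination s(𝒜 ∘ t)
  total-coefs{zero} t s = refl
  total-coefs{suc d} t s = cong(s zero *ₗ 𝒜(t zero)+ᴹ_)(total-coefs(Vector.tail t)(Vector.tail s))

  ntriv : ∀{d}(t : Vector(Fin N)d)s i -> ¬(s i F.≈ F.0#)-> Ntriv(Int.toList t)(coefs t s)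
  ntriv t s zero h = inl h
  ntriv t s(suc i)h = inr(ntriv(Vector.tail t)(Vector.tail s)i h)

  dependent : ∀{d}(t : Vector(Fin N)d)-> LinearlyDependent(𝒜 ∘ t)-> Dep(Int.toList t)
  dependent t(s , h , i , s≉0) = coefs t s , subst(_≈ᴹ 0ᴹ)(sym(total-coefs t s))h , ntriv t s i s≉0

  relators : ∀{d}{x : Term d} -> Relator x -> ∀ v -> Int.⟦ x ⟧ v Top.≈ᴹ Top.0ᴹ
  relators(∂-dependent t _ h)v = ∂-sound t(dependent t h)v

  module _{x y}(x≢y : x ≢ y)(xy : lev x ≡ lev y)where
   z = third x y
   t3 = isThd x≢y xy
   a = Thd.a t3
   b = Thd.b t3
   z≢x : z ≢ x
   z≢x h = ℕ.<-irrefl(cong lev h)(Thd.lower t3)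
   z≢y : z ≢ y
   z≢y h = ℕ.<-irrefl(cong lev h ⨾ sym xy)(Thd.lower t3)
   triple : Vector(Fin N)3
   triple zero = z
   triple(suc zero) = x
   triple(suc(suc zero)) = y
   injective : Injective _≡_ _≡_ triple
   injective{zero}{zero} _ = refl
   injective{zero}{suc zero} h = contra h z≢x
   injective{zero}{suc(suc zero)} h = contra h z≢y
   injective{suc zero}{zero} h = contra(sym h)z≢x
   injective{suc zero}{suc zero} _ = refl
   injective{suc zero}{suc(suc zero)} h = contra h x≢y
   injective{suc(suc zero)}{zero} h = contra(sym h)z≢y
   injective{suc(suc zero)}{suc zero} h = contra(sym h)x≢y
   injective{suc(suc zero)}{suc(suc zero)} _ = refl
   s3 : Vector F.Carrier 3
   s3 zero = F.1#
   s3(suc zero) = F.- a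
   s3(suc(suc zero)) = F.- b
   dependent3 : LinearlyDependent(𝒜 ∘ triple)
   dependent3 = s3 ,(begin
    F.1# *ₗ 𝒜 z +ᴹ((F.- a)*ₗ 𝒜 x +ᴹ((F.- b)*ₗ 𝒜 y +ᴹ 0ᴹ))
     ≈⟨ +≈ʳ(1* _ ⊚ Thd.on t3)⟩
    (a *ₗ 𝒜 x +ᴹ b *ₗ 𝒜 y)+ᴹ((F.- a)*ₗ 𝒜 x +ᴹ((F.- b)*ₗ 𝒜 y +ᴹ 0ᴹ))
     ≈⟨ solveᴹ(a ∷ b ∷ [])(𝒜 x ∷ 𝒜 y ∷ [])
        ((var zero ✶ vec zero ⊹ var(suc zero)✶ vec(suc zero))⊹((∼ var zero)✶ vec zero ⊹((∼ var(suc zero))✶ vec(suc zero)⊹ ∅)))∅(F.refl , F.refl , _)⟩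
    0ᴹ ∎), zero , 1≉0
    where open SetoidReasoning ≈ᴹ-setoid

   -- The difference of the two sides is exactly the boundary of the collinear triple z, x, y.
   thd-rel : prod refl(e x)(e y)~ prod refl(e z)(e y ⊞(R.- R.1#)· e x)
   thd-rel = ∂ triple , generator(∂-dependent triple injective dependent3), ≋-sym(begin
    prod refl(e z)(e y ⊞(R.- R.1#)· e x)⊞ ∂ triple
     ≈⟨ ⊞-cong(≋-trans(prod-distribˡ refl _ _ _)(⊞-cong ≋-refl(prod-scalarʳ refl _ _ _)))
        (⊞-cong(≋-trans(·-identity _)(two x y))(⊞-cong(·-cong(R.*-identityʳ _)(two z y))(⊞-cong(≋-trans(·-cong square ≋-refl)(≋-trans(·-identity _)(two z x)))≋-refl)))⟩
    (p ⊞(R.- R.1#)· q)⊞(prod refl(e x)(e y)⊞((R.- R.1#)· p ⊞(q ⊞ 𝟘)))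
     ≈⟨ solve(p ∷ q ∷ prod refl(e x)(e y)∷ [])((# zero :+ :- # suc zero) :+(# suc(suc zero) :+(:- # zero :+(# suc zero :+ :0))))(# suc(suc zero))refl ⟩
    prod refl(e x)(e y)∎)where
    module T2 = LeftModule(GradedAlgebra.component exteriorAlgebra 2)
    open ModuleTheory(GradedAlgebra.component exteriorAlgebra 2)using(solve; #_; _:+_; :-_; :0)
    open SetoidReasoning T2.≈ᴹ-setoid
    p = prod refl(e z)(e y)
    q = prod refl(e z)(e x)
    two : ∀ x y -> prod refl(e x)(prod refl(e y)𝟙)≋ prod refl(e x)(e y)
    two x y = prod-cong refl ≋-refl(prod-identityʳ refl(e y))
    square = KS.solve 1(\ o →(KS.:- o)KS.:*((KS.:- o)KS.:* o)KS.:= o KS.:*(o KS.:* o))R.refl R.1# ⟨t⟩(R.trans(R.*-identityˡ _)(R.*-identityˡ _))where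
     _⟨t⟩_ = R.trans
     module KS = IntegerSolver(fieldRing K)

 koszul : Koszul K 𝒪𝒮
 koszul = KoszulOfModel.torVanishes(linModel relators thd-rel)

-- A class of Tor₂ in degree four.

-- A labelling of the atoms by at most four letters under which every dependent set of at most four atoms
-- collides makes OS(𝒜) → Λ(K⁴) multiplicative in degrees ≤ 3. A dependency among five atoms, four of them
-- carrying distinct letters, then gives a class of Tor₂ in degree 4 on which [u|v] ↦ uv does not vanish.
boolean : ∀ m -> Fibration(suc m)0ℓ
boolean m = record
 { lev = toℕ; third = \ _ _ -> zero; thd-sym = \ _ _ -> refl
 ; thd-lower = \ x≢y xy -> contra(Fin.toℕ-injective xy)x≢y
 ; Dep = \ _ -> ⊥; Dep-resp = \ _(); Dep-collide = \(); Dep-thd = \ _ _()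
 ; Dep-triangle = \ x≢y _ _ xy -> contra(Fin.toℕ-injective xy)x≢y }

-- In `boolean m` all levels are distinct and nothing is dependent, so the last stage is the
-- exterior algebra on suc m letters; `coef` reads off the coefficient of the product of all of
-- them.
module Boolean{c ℓ}(R : CommutativeRing c ℓ)(m : ℕ)where
 private module R = CommutativeRing R
 open Representation R(boolean m)
 open Strip R(boolean m)
 private
  module S l = Stage(stage l)
  module P l = Strips(strips l)

 atom : ∀{l} -> l < suc m -> Fin(suc m)
 atom l< = Fin.fromℕ< l<

 coef : ∀ l -> l ≤ suc m -> S.Carrierᴹ l -> R.Carrier
 coef zero _ k = k
 coef(suc l)l<(a , b) = coef l(ℕ.<⇒≤ l<)(b(atom l<))

 coef-cong : ∀ l l≤{v w} -> S._≈ᴹ_ l v w -> coef l l≤ v R.≈ coef l l≤ w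
 coef-cong zero _ h = h
 coef-cong(suc l)l<(_ , h) = coef-cong l(ℕ.<⇒≤ l<)(h(atom l<)(Fin.toℕ-fromℕ< l<))

 initial-word : ∀ s l -> l ≤ suc m -> S.Carrierᴹ s -> S.Carrierᴹ s
 initial-word s zero _ v = v
 initial-word s(suc l)l< v = initial-word s l(ℕ.<⇒≤ l<)(S.E s(atom l<)v)

 initial-word-cong : ∀ s l l≤{v w} -> S._≈ᴹ_ s v w -> S._≈ᴹ_ s(initial-word s l l≤ v)(initial-word s l l≤ w)
 initial-word-cong s zero _ h = h
 initial-word-cong s(suc l)l< h = initial-word-cong s l(ℕ.<⇒≤ l<)(S.E.map-cong s(atom l<)h)

 initial-word-each : ∀ s l l≤ -> l ≤ s -> ∀ v z -> toℕ z ≡ s ->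
           S._≈ᴹ_ s(snd(initial-word(suc s)l l≤ v)z)(initial-word s l l≤(snd v z))
 initial-word-each s zero _ _ v z z≡ = S.≈ᴹ-refl s
 initial-word-each s(suc l)l< l<s v z z≡ = S.≈ᴹ-trans s(initial-word-each s l(ℕ.<⇒≤ l<)(ℕ.<⇒≤ l<s)_ z z≡)
  (initial-word-cong s l(ℕ.<⇒≤ l<)(snd(act-low(subst(_< s)(sym(Fin.toℕ-fromℕ< l<))l<s)(cmp(atom l<))v)z z≡))
  where open Next(stage s)

 coef-word : ∀ l l≤ -> coef l l≤(initial-word l l l≤(P.ι l R.1#))R.≈ R.1#
 coef-word zero _ = R.refl
 coef-word(suc l)l< = R.trans(coef-cong l(ℕ.<⇒≤ l<)(S.≈ᴹ-trans l
   (initial-word-each l l(ℕ.<⇒≤ l<)ℕ.≤-refl _(atom l<)l≡)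
   (initial-word-cong l l(ℕ.<⇒≤ l<)(top-vacuum(cmp(atom l<))))))(coef-word l(ℕ.<⇒≤ l<))where
  open Next(stage l)
  open Stage(stage l)
  l≡ = Fin.toℕ-fromℕ< l<
  v = P.ι(suc l)R.1#
  top-vacuum : ∀ t -> snd(act(atom l<)t v)(atom l<)≈ᴹ P.ι l R.1#
  top-vacuum(tri< _ l≢ _) = contra l≡ l≢
  top-vacuum(tri> _ l≢ _) = contra l≡ l≢
  top-vacuum(tri≈ _ _ _) = top-at(atom l<)v ⊚ +≈(P.gι l R.1#)
   (-≈(∑-zero L?(\ y _ -> H.map-0(atom l<)y))⊚ -0≈0)⊚ +0 _

record ExteriorAction{c ℓ}(R : CommutativeRing c ℓ)(n : ℕ) : Set(Level.suc(c ⊔ ℓ))where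
 private module R = CommutativeRing R
 field
  M : LeftModule R.ring c ℓ
 open LeftModule M public
 open Renamed M public
 open ModuleTheory M public
 field
  E : Fin n -> Carrierᴹ -> Carrierᴹ
  E-lin : ∀ i -> Lin M M(E i)
  E-square : ∀ i v -> E i(E i v)≈ᴹ 0ᴹ
  E-anti : ∀ i j v -> E i(E j v)+ᴹ E j(E i v)≈ᴹ 0ᴹ
  vacuum : Carrierᴹ

f0 f1 f2 f3 : Fin 4
f0 = zero
f1 = suc zero
f2 = suc(suc zero)
f3 = suc(suc(suc zero))

module _{c ℓ}(R : CommutativeRing c ℓ)where
 private
  module R = CommutativeRing R
  open Representation R(boolean 3)
  open Strip R(boolean 3)
  module S l = Stage(stage l)

  actionAt : ℕ -> ExteriorAction R 4
  actionAt l = record{ M = S.M l; E = S.E l; E-lin = S.E-lin l; E-square = S.E-square l; E-anti = S.E-anti l; vacuum = Strips.ι(strips l)R.1# }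

  unfold-word : ∀ l v -> Boolean.initial-word R 3 l 4 ℕ.≤-refl v ≡ S.E l f0(S.E l f1(S.E l f2(S.E l f3 v)))
  unfold-word l v = refl

  NonzeroAt : ℕ -> Set ℓ
  NonzeroAt l = let open ExteriorAction(actionAt l)in E f0(E f1(E f2(E f3 vacuum)))≈ᴹ 0ᴹ -> R.1# R.≈ R.0#

  nonzero-at : ∀ l -> l ≡ 4 -> NonzeroAt l
  nonzero-at .4 refl h = R.trans(R.sym(Boolean.coef-word R 3 4 ℕ.≤-refl))(Boolean.coef-cong R 3 4 ℕ.≤-refl
   (subst(\ v -> S._≈ᴹ_ 4 v(S.0ᴹ 4))(sym(unfold-word 4(Strips.ι(strips 4)R.1#)))h))

 exteriorAction : ∃ \(A : ExteriorAction R 4)-> let open ExteriorAction A in E f0(E f1(E f2(E f3 vacuum)))≈ᴹ 0ᴹ -> R.1# R.≈ R.0#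
 exteriorAction = actionAt 4 , nonzero-at 4 refl

module Obstruction{c ℓ₁ ℓ₂ ℓ₃ v ℓv k ℓk₁ ℓk₂}(K : HeytingField k ℓk₁ ℓk₂){F : OrderedField c ℓ₁ ℓ₂ ℓ₃}{E : EuclideanSpace F v ℓv}
  (S0 : ExteriorAction(fieldRing K)4){N}(𝒜 : Vector(EuclideanSpace.Carrierᴹ E)N)(label : Fin N -> Maybe(Fin 4))where
 private
  module R = CommutativeRing(fieldRing K)
  module S = ExteriorAction S0
 open S using(M; _≈ᴹ_; _+ᴹ_; -ᴹ_; 0ᴹ; _*ₗ_; ≈ᴹ-refl; ≈ᴹ-sym; ≈ᴹ-trans; ≈ᴹ-setoid; +ᴹ-cong; +ᴹ-congˡ; -ᴹ‿cong; +ᴹ-identityʳ; +ᴹ-identityˡ; -0≈0; -ᴹ-invol; solve; #_; _:+_; :-_; :0)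
 open S using(_⊚_; sm; rf; +≈; +≈ˡ; +≈ʳ; -≈; +0; 0+; 1*)
 open LinearAlgebra E using(LinearlyDependent)
 open OrlikSolomon K{E = E} 𝒜
 open Exterior(fieldRing K)(Fin N)
 open Quotient exteriorAlgebra Relator using(_~_; ≈⇒~; generator)

 private
  letter : Maybe(Fin 4)-> S.Carrierᴹ -> S.Carrierᴹ
  letter(just i)v = S.E i v
  letter nothing v = 0ᴹ

  letter-lin : ∀ l -> Lin M M(letter l)
  letter-lin(just i) = S.E-lin i
  letter-lin nothing = zero-lin{R = fieldRing K} M M

  letter-square : ∀ l v -> letter l(letter l v)≈ᴹ 0ᴹ
  letter-square(just i)v = S.E-square i v
  letter-square nothing v = rf

  letter-anti : ∀ l l' v -> letter l(letter l' v)+ᴹ letter l'(letter l v)≈ᴹ 0ᴹ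
  letter-anti(just i)(just j)v = S.E-anti i j v
  letter-anti(just i)nothing v = +0 _ ⊚ Lin.map-0(S.E-lin i)
  letter-anti nothing l' v = 0+ _ ⊚ Lin.map-0(letter-lin l')

 open Interpretation(fieldRing K){G = Fin N} M(\ s -> letter(label s))(\ s -> letter-lin(label s))
  (\ s -> letter-square(label s))(\ s t -> letter-anti(label s)(label t))

 private
  act' : Fin N -> S.Carrierᴹ -> S.Carrierᴹ
  act' s = letter(label s)

  swap-act : ∀ x y w -> act' x(act' y w)≈ᴹ -ᴹ act' y(act' x w)
  swap-act x y w = S.-ᴹ-unique _ _(letter-anti(label x)(label y)w)

  -- Reordering multiplies the word and its boundary by the same sign, so a collision of labels may
  -- be assumed to occur at the front.
  signs : ∀{s t} -> s ↭ t -> ∀ v →(word s v ≈ᴹ word t v × bdry s v ≈ᴹ bdry t v)⊎(word s v ≈ᴹ -ᴹ word t v × bdry s v ≈ᴹ -ᴹ bdry t v)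
  signs Perm.refl v = inl(rf , rf)
  signs(Perm.prep x p)v with signs p v
  ... | inl(w , b) = inl(act.map-cong x w , +≈ w(-≈(act.map-cong x b)))
  ... | inr(w , b) = inr(act.map-cong x w ⊚ act.map-neg x _ ,
    +≈ w(-≈(act.map-cong x b ⊚ act.map-neg x _))⊚ S.-ᴹ-+ _ _)
  signs{_ ∷ _ ∷ s}{_ ∷ _ ∷ t}(Perm.swap x y p)v with signs p v
  ... | inl(w , b) = inr(act.map-cong x(act.map-cong y w)⊚ swap-act x y _ , swap-bdry(word t v)(bdry t v)w b)where
   swap-bdry : ∀ W B -> word s v ≈ᴹ W -> bdry s v ≈ᴹ B -> bdry(x ∷ y ∷ s)v ≈ᴹ -ᴹ(act' x W +ᴹ -ᴹ act' y(W +ᴹ -ᴹ act' x B))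
   swap-bdry W B w b = begin
    act' y(word s v)+ᴹ -ᴹ act' x(word s v +ᴹ -ᴹ act' y(bdry s v))
     ≈⟨ +≈(act.map-cong y w)(-≈(act.map-cong x(+≈ w(-≈(act.map-cong y b)))))⟩
    act' y W +ᴹ -ᴹ act' x(W +ᴹ -ᴹ act' y B)
     ≈⟨ +≈ˡ(-≈(act.map-+ x _ _ ⊚ +≈ˡ(act.map-neg x _ ⊚ -≈(swap-act x y B))))⟩
    act' y W +ᴹ -ᴹ(act' x W +ᴹ -ᴹ -ᴹ act' y(act' x B))
     ≈⟨ solve(act' y W ∷ act' x W ∷ act' y(act' x B)∷ [])(# zero :+ :-(# suc zero :+ :- :- # suc(suc zero)))(:-(# suc zero :+ :-(# zero :+ :- # suc(suc zero))))refl ⟩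
    -ᴹ(act' x W +ᴹ -ᴹ(act' y W +ᴹ -ᴹ act' y(act' x B)))
     ≈⟨ -≈(+≈ˡ(-≈(act.map-+ y _ _ ⊚ +≈ˡ(act.map-neg y _))))⟨
    -ᴹ(act' x W +ᴹ -ᴹ act' y(W +ᴹ -ᴹ act' x B))∎
    where open SetoidReasoning ≈ᴹ-setoid
  ... | inr(w , b) = inl(act.map-cong x(act.map-cong y w ⊚ act.map-neg y _)⊚ act.map-neg x _ ⊚ -≈(swap-act x y _)⊚ -ᴹ-invol _ ,(begin
    act' y(word s v)+ᴹ -ᴹ act' x(word s v +ᴹ -ᴹ act' y(bdry s v))
     ≈⟨ +≈(act.map-cong y w ⊚ act.map-neg y _)(-≈(act.map-+ x _ _ ⊚ +≈(act.map-cong x w ⊚ act.map-neg x _)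
        (act.map-neg x _ ⊚ -≈(act.map-cong x(act.map-cong y b ⊚ act.map-neg y _)⊚ act.map-neg x _ ⊚ -≈(swap-act x y _)))))⟩
    -ᴹ act' y W +ᴹ -ᴹ(-ᴹ act' x W +ᴹ -ᴹ -ᴹ -ᴹ act' y(act' x B))
     ≈⟨ solve(act' y W ∷ act' x W ∷ act' y(act' x B)∷ [])(:- # zero :+ :-(:- # suc zero :+ :- :- :- # suc(suc zero)))(# suc zero :+ :-(# zero :+ :- # suc(suc zero)))refl ⟩
    act' x W +ᴹ -ᴹ(act' y W +ᴹ -ᴹ act' y(act' x B))
     ≈⟨ +≈ˡ(-≈(act.map-+ y _ _ ⊚ +≈ˡ(act.map-neg y _)))⟨
    act' x W +ᴹ -ᴹ act' y(W +ᴹ -ᴹ act' x B)∎))where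
   open SetoidReasoning ≈ᴹ-setoid
   W = word t v
   B = bdry t v
  signs(Perm.trans p q)v with signs p v | signs q v
  ... | inl(w , b) | inl(w' , b') = inl(w ⊚ w' , b ⊚ b')
  ... | inl(w , b) | inr(w' , b') = inr(w ⊚ w' , b ⊚ b')
  ... | inr(w , b) | inl(w' , b') = inr(w ⊚ -≈ w' , b ⊚ -≈ b')
  ... | inr(w , b) | inr(w' , b') = inl(w ⊚ -≈ w' ⊚ -ᴹ-invol _ , b ⊚ -≈ b' ⊚ -ᴹ-invol _)

  bdry-collision : ∀{x y u} -> label x ≡ label y -> ∀ v -> bdry(x ∷ y ∷ u)v ≈ᴹ 0ᴹ
  bdry-collision{x}{y}{u} eq v = begin
   act' y W +ᴹ -ᴹ act' x(W +ᴹ -ᴹ act' y B)≡⟨ cong(\ l -> letter l W +ᴹ -ᴹ act' x(W +ᴹ -ᴹ letter l B))(sym eq)⟩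
   act' x W +ᴹ -ᴹ act' x(W +ᴹ -ᴹ act' x B)≈⟨ +≈ˡ(-≈(act.map-+ x _ _ ⊚ +≈ˡ(act.map-neg x _ ⊚ -≈(letter-square(label x)B)⊚ -0≈0)))⟩
   act' x W +ᴹ -ᴹ(act' x W +ᴹ 0ᴹ)≈⟨ solve(act' x W ∷ [])(# zero :+ :-(# zero :+ :0)) :0 refl ⟩
   0ᴹ ∎ where
   open SetoidReasoning ≈ᴹ-setoid
   W = word u v
   B = bdry u v

 open import Data.List.Relation.Unary.All using(All; []; _∷_)

 -- `nothing` counts as a label: two unlabelled atoms collide as well, consistently with both acting
 -- as zero.
 data Distinct : List(Fin N)-> Set where
  [] : Distinct []
  _∷_ : ∀{x t} -> All(\ y -> label x ≢ label y)t -> Distinct t -> Distinct(x ∷ t)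

 private
  _≟ᴸ_ :(l l' : Maybe(Fin 4))-> Dec(l ≡ l')
  nothing ≟ᴸ nothing = yes refl
  nothing ≟ᴸ just _ = no \()
  just _ ≟ᴸ nothing = no \()
  just i ≟ᴸ just j with i Fin.≟ j
  ... | yes refl = yes refl
  ... | no h = no \{ refl -> h refl }

  meets : ∀ x t →(∃₂ \ y u -> t ↭ y ∷ u × label x ≡ label y)⊎ All(\ y -> label x ≢ label y)t
  meets x [] = inr []
  meets x(y ∷ t)with label x ≟ᴸ label y | meets x t
  ... | yes h | _ = inl(y , t , Perm.refl , h)
  ... | no _ | inl(z , u , p , h) = inl(z , y ∷ u , Perm.trans(Perm.prep y p)(Perm.swap y z Perm.refl), h)
  ... | no h | inr a = inr(h ∷ a)

  collision : ∀ t →(∃ \ x -> ∃₂ \ y u -> t ↭ x ∷ y ∷ u × label x ≡ label y)⊎ Distinct t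
  collision [] = inr []
  collision(x ∷ t)with meets x t | collision t
  ... | inl(y , u , p , h) | _ = inl(x , y , u , Perm.prep x p , h)
  ... | inr _ | inl(y , z , u , p , h) = inl(y , z , x ∷ u , Perm.trans(Perm.prep x p)(Perm.trans(Perm.swap x y Perm.refl)(Perm.prep y(Perm.swap x z Perm.refl))), h)
  ... | inr a | inr b = inr(a ∷ b)

 toList' : ∀{n} -> Vector(Fin N)n -> List(Fin N)
 toList' = toList

 module _(collide : ∀{d} -> d ≤ 3 →(t : Vector(Fin N)(suc d))-> Injective _≡_ _≡_ t -> LinearlyDependent(𝒜 ∘ t)-> ¬ Distinct(toList' t))where
  private
   relators : ∀{d}{x : Term d} -> d ≤ 3 -> Relator x -> ∀ v -> ⟦ x ⟧ v ≈ᴹ 0ᴹ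
   relators d≤(∂-dependent t inj dep)v with collision(toList t)
   ... | inr distinct = contra distinct(collide d≤ t inj dep)
   ... | inl(x , y , u , p , h)with signs p v
   ... | inl(_ , b) = ⟦∂⟧ t v ⊚ b ⊚ bdry-collision{x}{y}{u} h v
   ... | inr(_ , b) = ⟦∂⟧ t v ⊚ b ⊚ -≈(bdry-collision{x}{y}{u} h v)⊚ -0≈0

   open OfQuotient Relator 3 relators using(sound~)
   module B = Tor 𝒪𝒮
   open B using(Bar; cons; δ)

   -- The iterated product [u₁|...|uᵢ] ↦ u₁⋯uᵢ, evaluated at the vacuum.
   Ψ : ∀{i j} -> Bar i j -> S.Carrierᴹ
   Ψ B.[] = S.vacuum
   Ψ(cons _ u x) = ⟦ u ⟧(Ψ x)
   Ψ B.𝟘 = 0ᴹ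
   Ψ(x B.⊞ y) = Ψ x +ᴹ Ψ y
   Ψ(k B.· x) = k *ₗ Ψ x

   Ψ-zero : ∀{i}(x : Bar(suc i)0)-> Ψ x ≈ᴹ 0ᴹ
   Ψ-zero B.𝟘 = rf
   Ψ-zero(x B.⊞ y) = +≈(Ψ-zero x)(Ψ-zero y)⊚ +0 _
   Ψ-zero(k B.· x) = S.*ₗ-congˡ(Ψ-zero x)⊚ S.*ₗ-zeroʳ k

   -- The bidegrees in which `Ψ` respects equality of chains, that is, in which no factor of degree
   -- 4 matters. In (2, 4) such a factor would leave degree 0 for the other, and there are no such
   -- chains. The bidegree (1, 4) has to be excluded: there lives the boundary of the five-term
   -- dependency.
   data Admissible : ℕ -> ℕ -> Set where
    small : ∀{i j} -> j ≤ 3 -> Admissible i j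
    two : Admissible 2 4

   parts : ∀{i d j′ j} -> Admissible(suc i)j -> suc d + j′ ≡ j →(suc d ≤ 3 × Admissible i j′)⊎(suc d ≡ 4 × i ≡ 1 × j′ ≡ 0)
   parts{d = d}{j′}(small j≤)refl = inl(ℕ.≤-trans(ℕ.m≤m+n(suc d)j′)j≤ , small(ℕ.≤-trans(ℕ.m≤n+m j′(suc d))j≤))
   parts{d = d}{zero} two eq = inr(sym(ℕ.+-identityʳ(suc d))⨾ eq , refl , refl)
   parts{d = d}{suc j′} two eq = inl(ℕ.≤-trans(ℕ.m≤m+n(suc d)j′)sum≤ , small(ℕ.≤-trans(s≤s(ℕ.m≤n+m j′ d))sum≤))where
    sum≤ : suc(d + j′)≤ 3
    sum≤ = ℕ.≤-reflexive(ℕ.suc-injective(sym(cong suc(ℕ.+-suc d j′))⨾ eq))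

   Ψ-cong : ∀{i j} -> Admissible i j →{x y : Bar i j} -> x B.≋ y -> Ψ x ≈ᴹ Ψ y
   Ψ-cong ad B.≋-refl = rf
   Ψ-cong ad(B.≋-sym h) = sm(Ψ-cong ad h)
   Ψ-cong ad(B.≋-trans h k) = Ψ-cong ad h ⊚ Ψ-cong ad k
   Ψ-cong ad(B.⊞-cong h k) = +≈(Ψ-cong ad h)(Ψ-cong ad k)
   Ψ-cong ad(B.·-cong h k) = S.*ₗ-cong h(Ψ-cong ad k)
   Ψ-cong ad(B.cons-cong eq{u}{u′}{x}{x′} h k)with parts ad eq
   ... | inl(d≤ , ad') = sound~ d≤ h _ ⊚ ⟦⟧.map-cong u′(Ψ-cong ad' k)
   ... | inr(refl , refl , refl) = ⟦⟧.map-≈0 u(Ψ-zero x)⊚ sm(⟦⟧.map-≈0 u′(Ψ-zero x′))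
   Ψ-cong ad(B.⊞-assoc x y z) = S.+ᴹ-assoc _ _ _
   Ψ-cong ad(B.⊞-comm x y) = S.+ᴹ-comm _ _
   Ψ-cong ad(B.⊞-identityˡ x) = 0+ _
   Ψ-cong ad(B.·-zeroˡ x) = S.*ₗ-zeroˡ _
   Ψ-cong ad(B.·-zeroʳ k) = S.*ₗ-zeroʳ _
   Ψ-cong ad(B.·-identity x) = S.*ₗ-identityˡ _
   Ψ-cong ad(B.·-assoc k l x) = S.*ₗ-assoc _ _ _
   Ψ-cong ad(B.·-distribˡ k x y) = S.*ₗ-distribˡ _ _ _
   Ψ-cong ad(B.·-distribʳ x k l) = S.*ₗ-distribʳ _ _ _
   Ψ-cong ad(B.cons-distribˡ eq u x y) = ⟦⟧.map-+ u _ _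
   Ψ-cong ad(B.cons-distribʳ eq u w x) = rf
   Ψ-cong ad(B.cons-scalarˡ eq k u x) = rf
   Ψ-cong ad(B.cons-scalarʳ eq k u x) = ⟦⟧.map-* u _ _

   Ψ-absorb : ∀{i d j′ j}(eq : suc d + j′ ≡ j)(u : Term(suc d))(x : Bar(suc i)j′)-> Ψ(B.absorb eq u x)≈ᴹ ⟦ u ⟧(Ψ x)
   Ψ-absorb eq u(cons _ w x) = rf
   Ψ-absorb eq u B.𝟘 = sm(⟦⟧.map-0 u)
   Ψ-absorb eq u(x B.⊞ y) = +≈(Ψ-absorb eq u x)(Ψ-absorb eq u y)⊚ sm(⟦⟧.map-+ u _ _)
   Ψ-absorb eq u(k B.· x) = S.*ₗ-congˡ(Ψ-absorb eq u x)⊚ sm(⟦⟧.map-* u _ _)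

   Ψδ1 : ∀{j}(x : Bar 1 j)-> Ψ(δ x)≈ᴹ 0ᴹ
   Ψδ1(cons _ _ _) = rf
   Ψδ1 B.𝟘 = rf
   Ψδ1(x B.⊞ y) = +≈(Ψδ1 x)(Ψδ1 y)⊚ +0 _
   Ψδ1(k B.· x) = S.*ₗ-congˡ(Ψδ1 x)⊚ S.*ₗ-zeroʳ k

   Ψδ2 : ∀{j}(x : Bar 2 j)-> Ψ(δ x)≈ᴹ Ψ x
   Ψδ2(cons eq u x) = +≈(Ψ-absorb eq u x)(S.*ₗ-congˡ(⟦⟧.map-≈0 u(Ψδ1 x))⊚ S.*ₗ-zeroʳ _)⊚ +0 _
   Ψδ2 B.𝟘 = rf
   Ψδ2(x B.⊞ y) = +≈(Ψδ2 x)(Ψδ2 y)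
   Ψδ2(k B.· x) = S.*ₗ-congˡ(Ψδ2 x)

   -- The terms [uv|w] and [u|vw] have the same product and opposite signs. Hence `Ψ` detects
   -- nontrivial classes in bidegree (2, 4).
   Ψδ3 : ∀{j}(x : Bar 3 j)-> Ψ(δ x)≈ᴹ 0ᴹ
   Ψδ3(cons eq u x) = +≈(Ψ-absorb eq u x)(S.-1*ₗ _ ⊚ -≈(⟦⟧.map-cong u(Ψδ2 x)))⊚ S.-ᴹ‿inverseʳ _
   Ψδ3 B.𝟘 = rf
   Ψδ3(x B.⊞ y) = +≈(Ψδ3 x)(Ψδ3 y)⊚ +0 _
   Ψδ3(k B.· x) = S.*ₗ-congˡ(Ψδ3 x)⊚ S.*ₗ-zeroʳ k

  vanishing-word :(s : Vector(Fin N)4)→(∀ i -> label(s i)≡ just i)→(a : Fin N)-> label a ≡ nothing ->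
         LinearlyDependent(𝒜 ∘(a Vector.∷ s))-> Koszul K 𝒪𝒮 -> S.E f0(S.E f1(S.E f2(S.E f3 S.vacuum)))≈ᴹ 0ᴹ
  vanishing-word s labels a unlabelled dep koszul = word≈0 where
   module BC = BarComplex 𝒪𝒮
   module O d = LeftModule(GradedAlgebra.component 𝒪𝒮 d)
   t = a Vector.∷ s
   s-inj : ∀{i j} -> s i ≡ s j -> i ≡ j
   s-inj{i}{j} h = just-injective(sym(labels i)⨾ cong label h ⨾ labels j)
    where open import Data.Maybe.Properties using(just-injective)
   a≢s : ∀ i -> a ≢ s i
   a≢s i h = nothing≢just(sym unlabelled ⨾ cong label h ⨾ labels i)where
    nothing≢just : ∀{i : Fin 4} -> nothing ≢ just i
    nothing≢just()
   t-inj : Injective _≡_ _≡_ t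
   t-inj{zero}{zero} _ = refl
   t-inj{zero}{suc j} h = contra h(a≢s j)
   t-inj{suc i}{zero} h = contra(sym h)(a≢s i)
   t-inj{suc i}{suc j} h = cong suc(s-inj h)
   w = wedge(Vector.tail s)
   -- For t = a ∷ s the boundary of t is the product of the four letters minus e_a times the
   -- boundary of s. `X` factors this expression into two tensors, so it multiplies to zero in the
   -- algebra; under `Ψ` the second tensor dies because a acts as zero.
   X = cons refl(e(s zero))(cons{d = 2} refl w B.[])B.⊞(R.- R.1#)B.· cons refl(e a)(cons{d = 2} refl(∂ s)B.[])
   ∂t = prod refl(e(s zero))w ⊞(R.- R.1#)· prod refl(e a)(∂ s)
   ∂t~0 = ∂ t , generator(∂-dependent t t-inj dep), ≋-trans(≋-sym expand)(≋-sym(⊞-identityˡ _))where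
    module T4 = LeftModule(GradedAlgebra.component exteriorAlgebra 4)
    module T4T = ModuleTheory(GradedAlgebra.component exteriorAlgebra 4)
    module T3 = ModuleTheory(GradedAlgebra.component exteriorAlgebra 3)
    open Exp R.semiring using(_^_)
    left-lin = neg-lin{R = fieldRing K}(GradedAlgebra.component exteriorAlgebra 3)(GradedAlgebra.component exteriorAlgebra 4)
     (BarComplex.mul-linʳ exteriorAlgebra refl(e a))
    expand : ∂ t ≋ ∂t
    expand = ⊞-cong(·-identity _)(≋-sym(≋-trans(Lin.map-sum left-lin(\ j →((R.- R.1#)^ toℕ j)· wedge(Vector.removeAt s j)))
     (T4T.sum-cong-≋{_}{\ j →(R.- R.1#)· prod refl(e a)(((R.- R.1#)^ toℕ j)· wedge(Vector.removeAt s j))}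
      (\ j -> ≋-trans(·-cong R.refl(prod-scalarʳ refl _ _ _))(≋-sym(·-assoc _ _ _))))))
   cycle = begin
    (cons refl(prod refl(e(s zero))w)B.[] B.⊞(R.- R.1#)B.· cons refl(e(s zero))B.𝟘)B.⊞
    (R.- R.1#)B.·(cons refl(prod refl(e a)(∂ s))B.[] B.⊞(R.- R.1#)B.· cons refl(e a)B.𝟘)
     ≈⟨ B.⊞-cong(B.⊞-cong B.≋-refl(B.·-cong R.refl(Lin.map-0(BC.cons-linʳ refl(e(s zero))))))
           (B.·-cong R.refl(B.⊞-cong B.≋-refl(B.·-cong R.refl(Lin.map-0(BC.cons-linʳ refl(e a))))))⟩
    (cons refl(prod refl(e(s zero))w)B.[] B.⊞(R.- R.1#)B.· B.𝟘)B.⊞(R.- R.1#)B.·(cons refl(prod refl(e a)(∂ s))B.[] B.⊞(R.- R.1#)B.· B.𝟘)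
     ≈⟨ BT.solve(cons refl(prod refl(e(s zero))w)B.[] ∷ cons refl(prod refl(e a)(∂ s))B.[] ∷ [])
        ((BT.# zero BT.:+ BT.:- BT.:0)BT.:+ BT.:-(BT.# suc zero BT.:+ BT.:- BT.:0))(BT.# zero BT.:+ BT.:- BT.# suc zero)refl ⟩
    cons refl(prod refl(e(s zero))w)B.[] B.⊞(R.- R.1#)B.· cons refl(prod refl(e a)(∂ s))B.[]
     ≈⟨ B.⊞-cong B.≋-refl(B.≋-sym(B.cons-scalarˡ refl _ _ _))⟩
    cons refl(prod refl(e(s zero))w)B.[] B.⊞ cons refl((R.- R.1#)· prod refl(e a)(∂ s))B.[]
     ≈⟨ B.≋-sym(B.cons-distribʳ refl _ _ _)⟩
    cons refl ∂t B.[]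
     ≈⟨ B.cons-cong refl ∂t~0 B.≋-refl ⟩
    cons refl 𝟘 B.[]
     ≈⟨ Lin.map-0(BC.cons-linˡ{d = 3} refl B.[])⟩
    B.𝟘 ∎ where
    open SetoidReasoning(LeftModule.≈ᴹ-setoid(BC.barM 1 4))
    module BT = BC.BT 1 4
   word≈0 = sm ΨX ⊚(let(y , h) = koszul 2 4(\())X cycle in sm(Ψ-cong two h)⊚ Ψδ3 y)where
    as-letter : ∀ i v -> ⟦ e(s i)⟧ v ≡ S.E i v
    as-letter i v = cong(\ l -> letter l v)(labels i)
    a-zero : ∀ v -> ⟦ e a ⟧ v ≡ 0ᴹ
    a-zero v = cong(\ l -> letter l v)unlabelled
    ΨX = +≈(S.≈ᴹ-reflexive four)(S.*ₗ-congˡ(S.≈ᴹ-reflexive(a-zero _))⊚ S.*ₗ-zeroʳ _)⊚ +0 _ where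
     four = as-letter f0 _ ⨾ cong(S.E f0)(as-letter f1 _ ⨾ cong(S.E f1)(as-letter f2 _ ⨾ cong(S.E f2)(as-letter f3 _)))

module _{c ℓ₁ ℓ₂ ℓ₃ v ℓv k ℓk₁ ℓk₂}(K : HeytingField k ℓk₁ ℓk₂){F : OrderedField c ℓ₁ ℓ₂ ℓ₃}{E : EuclideanSpace F v ℓv}
     {N}(𝒜 : Vector(EuclideanSpace.Carrierᴹ E)N)(label : Fin N -> Maybe(Fin 4))where
 open Obstruction K{E = E}(fst(exteriorAction(fieldRing K)))𝒜 label using(Distinct; toList'; vanishing-word)
 open LinearAlgebra E using(LinearlyDependent)

 not-koszul :(∀{d} -> d ≤ 3 →(t : Vector(Fin N)(suc d))-> Injective _≡_ _≡_ t -> LinearlyDependent(𝒜 ∘ t)-> ¬ Distinct(toList' t))->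
        (s : Vector(Fin N)4)→(∀ i -> label(s i)≡ just i)→(a : Fin N)-> label a ≡ nothing ->
        LinearlyDependent(𝒜 ∘(a Vector.∷ s))-> ¬ Koszul K(OrlikSolomon.𝒪𝒮 K{E = E} 𝒜)
 not-koszul collide s labels a unlabelled dep koszul =
  FieldTheory.1≉0 K(snd(exteriorAction(fieldRing K))(vanishing-word collide s labels a unlabelled dep koszul))

-- Integer vectors and root data.

module Dot where
 open import Data.Integer.Base using(_*_)renaming(_+_ to _⊕_)

 infixl 7 _∙_
 _∙_ : ∀{n} -> Vec ℤ n -> Vec ℤ n -> ℤ
 [] ∙ [] = 0z
 (x ∷ xs)∙(y ∷ ys) = x * y ⊕ xs ∙ ys

 infixl 6 _+ᵛ_ _-ᵛ_
 infixr 7 _*ᵛ_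
 _+ᵛ_ _-ᵛ_ : ∀{n} -> Vec ℤ n -> Vec ℤ n -> Vec ℤ n
 _+ᵛ_ = Vec.zipWith Z._+_
 _-ᵛ_ = Vec.zipWith Z._-_

 _*ᵛ_ : ∀{n} -> ℤ -> Vec ℤ n -> Vec ℤ n
 k *ᵛ x = Vec.map(k *_)x

 0ᵛ : ∀{n} -> Vec ℤ n
 0ᵛ = Vec.replicate _ 0z

 unit : ∀{n} -> Fin n -> Vec ℤ n
 unit zero = 1z ∷ 0ᵛ
 unit(suc i) = 0z ∷ unit i

 infixl 9 _!_
 _!_ : ∀{n} -> Vec ℤ n -> Fin n -> ℤ
 _!_ = Vec.lookup

 open import Data.Vec.Properties using(lookup-zipWith; lookup-map; lookup-replicate)
 open import Data.Integer.Solver using(module +-*-Solver)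
 open +-*-Solver using(solve; _:=_; _:+_; _:*_; _:-_; :-_; con)

 !-+ : ∀{n}(x y : Vec ℤ n)i →(x +ᵛ y)! i ≡ x ! i ⊕ y ! i
 !-+ x y i = lookup-zipWith Z._+_ i x y

 !-- : ∀{n}(x y : Vec ℤ n)i →(x -ᵛ y)! i ≡ x ! i Z.- y ! i
 !-- x y i = lookup-zipWith Z._-_ i x y

 !-* : ∀{n} k(x : Vec ℤ n)i →(k *ᵛ x)! i ≡ k * x ! i
 !-* k x i = lookup-map i(k *_)x

 !-0 : ∀{n}(i : Fin n)-> 0ᵛ ! i ≡ 0z
 !-0 i = lookup-replicate i 0z

 unit-at : ∀{n}(i : Fin n)-> unit i ! i ≡ 1z
 unit-at zero = refl
 unit-at(suc i) = unit-at i

 unit-off : ∀{n}{i j : Fin n} -> j ≢ i -> unit i ! j ≡ 0z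
 unit-off{i = zero}{zero} h = contra refl h
 unit-off{i = zero}{suc j} h = !-0 j
 unit-off{i = suc i}{zero} h = refl
 unit-off{i = suc i}{suc j} h = unit-off(h ∘ cong suc)

 ext : ∀{n}{x y : Vec ℤ n} →(∀ i -> x ! i ≡ y ! i)-> x ≡ y
 ext{x = []}{[]} h = refl
 ext{x = x ∷ p}{y ∷ q} h = cong₂ _∷_(h zero)(ext(h ∘ suc))

 ∙-+ : ∀{n}(x y z : Vec ℤ n)→(x +ᵛ y)∙ z ≡ x ∙ z ⊕ y ∙ z
 ∙-+ [] [] [] = refl
 ∙-+(x ∷ p)(y ∷ q)(z ∷ r)rewrite ∙-+ p q r = solve 5(\ x y z a b →(x :+ y) :* z :+(a :+ b) :=(x :* z :+ a) :+(y :* z :+ b))refl x y z(p ∙ r)(q ∙ r)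

 ∙-- : ∀{n}(x y z : Vec ℤ n)→(x -ᵛ y)∙ z ≡ x ∙ z Z.- y ∙ z
 ∙-- [] [] [] = refl
 ∙--(x ∷ p)(y ∷ q)(z ∷ r)rewrite ∙-- p q r = solve 5(\ x y z a b →(x :- y) :* z :+(a :- b) :=(x :* z :+ a) :-(y :* z :+ b))refl x y z(p ∙ r)(q ∙ r)

 ∙-* : ∀{n} k(x z : Vec ℤ n)→(k *ᵛ x)∙ z ≡ k *(x ∙ z)
 ∙-* k [] [] = sym(Z.*-zeroʳ k)
 ∙-* k(x ∷ p)(z ∷ r)rewrite ∙-* k p r = solve 4(\ k x z a →(k :* x) :* z :+ k :* a := k :*(x :* z :+ a))refl k x z(p ∙ r)

 ∙-zero : ∀{n}(x y : Vec ℤ n)→(∀ i -> x ! i * y ! i ≡ 0z)-> x ∙ y ≡ 0z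
 ∙-zero [] [] h = refl
 ∙-zero(x ∷ p)(y ∷ q)h = cong₂ _⊕_(h zero)(∙-zero p q(h ∘ suc))

 ∙-single : ∀{n}(x y : Vec ℤ n)i →(∀ j -> j ≢ i -> x ! j * y ! j ≡ 0z)-> x ∙ y ≡ x ! i * y ! i
 ∙-single(x ∷ p)(y ∷ q)zero h = cong(x * y ⊕_)(∙-zero p q(\ j -> h(suc j)\()))⨾ Z.+-identityʳ _
 ∙-single(x ∷ p)(y ∷ q)(suc i)h = cong₂ _⊕_(h zero \())(∙-single p q i(\ j j≢ -> h(suc j)(j≢ ∘ Fin.suc-injective)))⨾ Z.+-identityˡ _

 ∙-double : ∀{n}(x y : Vec ℤ n)i k -> i ≢ k →(∀ j -> j ≢ i -> j ≢ k -> x ! j * y ! j ≡ 0z)-> x ∙ y ≡ x ! i * y ! i ⊕ x ! k * y ! k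
 ∙-double(x ∷ p)(y ∷ q)zero zero h _ = contra refl h
 ∙-double(x ∷ p)(y ∷ q)zero(suc k)_ h = cong(x * y ⊕_)(∙-single p q k(\ j j≢ -> h(suc j)(\())(j≢ ∘ Fin.suc-injective)))
 ∙-double(x ∷ p)(y ∷ q)(suc i)zero _ h = cong(x * y ⊕_)(∙-single p q i(\ j j≢ -> h(suc j)(j≢ ∘ Fin.suc-injective)(\())))⨾ Z.+-comm(x * y)_
 ∙-double(x ∷ p)(y ∷ q)(suc i)(suc k)i≢k h = cong₂ _⊕_(h zero(\())(\()))
  (∙-double p q i k(i≢k ∘ cong suc)(\ j j≢i j≢k -> h(suc j)(j≢i ∘ Fin.suc-injective)(j≢k ∘ Fin.suc-injective)))⨾ Z.+-identityˡ _

 unit-∙ : ∀{n}(i : Fin n)y -> unit i ∙ y ≡ y ! i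
 unit-∙ i y = ∙-single(unit i)y i(\ j j≢ -> cong(_* y ! j)(unit-off j≢)⨾ Z.*-zeroˡ(y ! j))⨾
  cong(_* y ! i)(unit-at i)⨾ Z.*-identityˡ(y ! i)

 ∙-nn : ∀{n}(x y : Vec ℤ n)→(∀ i -> 0z Z.≤ x ! i * y ! i)-> 0z Z.≤ x ∙ y
 ∙-nn [] [] h = Z.≤-refl
 ∙-nn(x ∷ p)(y ∷ q)h = Z.+-mono-≤(h zero)(∙-nn p q(h ∘ suc))

 ∙-term : ∀{n}(x y : Vec ℤ n)→(∀ i -> 0z Z.≤ x ! i * y ! i)-> ∀ i -> x ! i * y ! i Z.≤ x ∙ y
 ∙-term(x ∷ p)(y ∷ q)h zero = subst(Z._≤ x * y ⊕ p ∙ q)(Z.+-identityʳ _)(Z.+-monoʳ-≤(x * y)(∙-nn p q(h ∘ suc)))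
 ∙-term(x ∷ p)(y ∷ q)h(suc i) = subst(Z._≤ x * y ⊕ p ∙ q)(Z.+-identityˡ _)(Z.+-mono-≤(h zero)(∙-term p q(h ∘ suc)i))

 ∙-terms : ∀{n}(x y : Vec ℤ n)→(∀ i -> 0z Z.≤ x ! i * y ! i)-> ∀{i k} -> i ≢ k -> x ! i * y ! i ⊕ x ! k * y ! k Z.≤ x ∙ y
 ∙-terms(x ∷ p)(y ∷ q)h{zero}{zero} i≢k = contra refl i≢k
 ∙-terms(x ∷ p)(y ∷ q)h{zero}{suc k} i≢k = Z.+-monoʳ-≤(x * y)(∙-term p q(h ∘ suc)k)
 ∙-terms(x ∷ p)(y ∷ q)h{suc i}{zero} i≢k = subst(Z._≤ x * y ⊕ p ∙ q)(Z.+-comm(x * y)_)(Z.+-monoʳ-≤(x * y)(∙-term p q(h ∘ suc)i))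
 ∙-terms(x ∷ p)(y ∷ q)h{suc i}{suc k} i≢k = subst(Z._≤ x * y ⊕ p ∙ q)(Z.+-identityˡ _)(Z.+-mono-≤(h zero)(∙-terms p q(h ∘ suc)(i≢k ∘ cong suc)))

 NonNegative NonPositive : ∀{n} -> Vec ℤ n -> Set
 NonNegative x = ∀ i -> 0z Z.≤ x ! i
 NonPositive x = ∀ i -> x ! i Z.≤ 0z

open Dot

-- Here m and n are the absolute values of the Cartan numbers minus one: of two nonproportional
-- roots one number is ±1 or both vanish, and neither exceeds 3 in absolute value.
data CartanPair(a b : ℤ) : Set where
 orth : a ≡ 0z -> b ≡ 0z -> CartanPair a b
 acute : ∀ m n -> a ≡ Z.+[1+ m ] -> b ≡ Z.+[1+ n ] -> m ≡ 0 ⊎ n ≡ 0 -> m ≤ 2 -> n ≤ 2 -> CartanPair a b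
 obtuse : ∀ m n -> a ≡ -[1+ m ] -> b ≡ -[1+ n ] -> m ≡ 0 ⊎ n ≡ 0 -> m ≤ 2 -> n ≤ 2 -> CartanPair a b

-- Coordinates of the roots on the simple roots; ⟨ x , k ⟩ is the Cartan number 2 (x , root k) / (root k , root k).
record RootDatum(r N : ℕ) : Set where
 field
  root : Fin N -> Vec ℤ r
  cor : Fin N -> Vec ℤ r
  simple : Fin r -> Fin N
  rfl : Fin N -> Fin N -> Fin N

 ⟨_,_⟩ : Vec ℤ r -> Fin N -> ℤ
 ⟨ x , k ⟩ = x ∙ cor k

 field
  root-simple : ∀ i -> root(simple i)≡ unit i
  root-inj : ∀{j k} -> root j ≡ root k -> j ≡ k
  sign : ∀ k -> NonNegative(root k)⊎ NonPositive(root k)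
  self : ∀ k -> ⟨ root k , k ⟩ ≡ + 2
  root-rfl : ∀ j k -> root(rfl j k)≡ root j -ᵛ ⟨ root j , k ⟩ *ᵛ root k
  cor-rfl : ∀ x j k -> ⟨ x , rfl j k ⟩ ≡ ⟨ x -ᵛ ⟨ x , k ⟩ *ᵛ root k , j ⟩
  cartPair : ∀ j k -> j ≡ k ⊎ root j ≡ 0ᵛ -ᵛ root k ⊎ CartanPair ⟨ root j , k ⟩ ⟨ root k , j ⟩
  definite : ∀ x →(∀ i -> x ! i ≢ 0z -> ⟨ x , simple i ⟩ ≡ 0z)-> ∀ i -> x ! i ≡ 0z

-- The root datum of a root system with a base.

module RootDatumOf{c ℓ₁ ℓ₂ ℓ₃ v ℓv}{F : OrderedField c ℓ₁ ℓ₂ ℓ₃}{E : EuclideanSpace F v ℓv}{N : ℕ}(Φ : RootSystem E N)(Δ : Base Φ)where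
 private
  module F where
   open OrderedField F public using(fromℤ; isStrictTotalOrder; +-monoˡ-<; *-positive)renaming(_<_ to infix 4 _<_)
   open CommutativeRing(OrderedField.commutativeRing F)public
  open import Relation.Binary.Structures using(module IsStrictTotalOrder)
  module < = IsStrictTotalOrder F.isStrictTotalOrder
 open EuclideanSpace E renaming(⟨_,_⟩ to infix 10 ⟪_,_⟫)
 open Renamed leftModule
 open LinearAlgebra E
 open RootSystem Φ using(distinct; nonzero; reduced; reflection; crystallographic; IsCartanNumber)renaming(root to vector)
 open Base Δ hiding(simple)
 open Base Δ using()renaming(simple to simpleIndex)
 open Combinations E
 open OrderedFieldTheory F
 open ModuleTheory leftModule using(sum; sum-cong-≋; sum-zero; -1*ₗ; -0≈0; -ᴹ-unique)
 open ModuleSolver{R = OrderedField.commutativeRing F} leftModule using(solveᴹ; vec; _⊹_; ⊝_; ∅; _✶_)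
 open Mult F.+-monoid using()renaming(_×_ to _timesF_)

 basis : Vector Carrierᴹ rank
 basis = vector ∘ simpleIndex

 basis-independent : LinearlyIndependent basis
 basis-independent = fst isBasis

 basis-spans : ∀ x -> ∃ \ s -> x ≈ᴹ combination s basis
 basis-spans x = let(s , _ , h) = snd(snd isBasis)x _ in s , h

 zero? : ∀ x -> Dec(x ≈ᴹ 0ᴹ)
 zero? x with basis-spans x
 ... | s , h with Fin.all?(\ i -> s i ≟ F.0#)
 ... | yes all = yes(h ⊚ comb-zero basis all)
 ... | no ¬all = no \ x≈0 -> ¬all(basis-independent s(sm h ⊚ x≈0))

 0<+ : ∀{x y} -> F.0# F.< x -> F.0# F.< y -> F.0# F.<(x F.+ y)
 0<+{x}{y} 0<x 0<y = <.trans 0<y(<.<-respˡ-≈(F.+-identityˡ y)(F.+-monoˡ-< y 0<x))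

 0<1 : F.0# F.< F.1#
 0<1 with compare F.0# F.1#
 ... | tri< h _ _ = h
 ... | tri≈ _ h _ = contra(F.sym h)1≉0
 ... | tri> _ _ h = let -1>0 = <.<-respˡ-≈(F.-‿inverseʳ F.1#)(<.<-respʳ-≈(F.+-identityˡ _)(F.+-monoˡ-<(F.- F.1#)h))in
  <.<-respʳ-≈(F.trans(solve 1(\ o →(:- o) :*(:- o) := o :* o)F.refl F.1#)(F.*-identityˡ _))(F.*-positive -1>0 -1>0)

 ι-pos : ∀ n -> F.0# F.< ιz Z.+[1+ n ]
 ι-pos zero = <.<-respʳ-≈(F.sym(F.+-identityʳ F.1#))0<1
 ι-pos(suc n) = 0<+ 0<1(ι-pos n)

 ι-zero : ∀ z -> ιz z F.≈ F.0# -> z ≡ 0z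
 ι-zero(+ zero)h = refl
 ι-zero Z.+[1+ n ] h = contra(ι-pos n)(<.irrefl(F.sym h))
 ι-zero -[1+ n ] h = contra(ι-pos n)(<.irrefl(F.sym(F.trans(solve 1(\ x -> x := :-(:- x))F.refl(ιz Z.+[1+ n ]))
  (F.trans(F.-‿cong h)(solve 0(:- con 0z := con 0z)F.refl)))))

 ι-inj : ∀{y z} -> ιz y F.≈ ιz z -> y ≡ z
 ι-inj{y}{z} h = Z.i-j≡0⇒i≡j y z(ι-zero(y Z.- z)(F.trans(ιz-+ y(Z.- z))(F.trans(F.+-cong h(ιz-neg z))(F.-‿inverseʳ _))))

 2≉0 : ¬(F.1# F.+ F.1# F.≈ F.0#)
 2≉0 h = <.irrefl(F.sym h)(0<+ 0<1 0<1)

 pos-nonzero : ∀{x} -> F.0# F.< x -> ¬(x F.≈ F.0#)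
 pos-nonzero h e = <.irrefl(F.sym e)h

 fromℤ≡ι : ∀ z -> F.fromℤ z ≡ ιz z
 fromℤ≡ι(+ n) = refl
 fromℤ≡ι -[1+ n ] = refl

 real : Vec ℤ rank -> Carrierᴹ
 real x = combination(\ i -> ιz(x ! i))basis

 real-+ : ∀ x y -> real(x +ᵛ y)≈ᴹ real x +ᴹ real y
 real-+ x y = comb-cong basis(\ i -> F.trans(F.reflexive(cong ιz(!-+ x y i)))(ιz-+(x ! i)(y ! i)))⊚ comb-+ _ _ basis

 real-* : ∀ k x -> real(k *ᵛ x)≈ᴹ ιz k *ₗ real x
 real-* k x = comb-cong basis(\ i -> F.trans(F.reflexive(cong ιz(!-* k x i)))(ιz-* k(x ! i)))⊚ comb-*(ιz k)_ basis

 real-neg : ∀ x -> real(0ᵛ -ᵛ x)≈ᴹ -ᴹ real x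
 real-neg x = comb-cong basis(\ i -> F.trans(F.reflexive(cong ιz(!-- 0ᵛ x i ⨾ cong(Z._-(x ! i))(!-0 i)⨾ Z.+-identityˡ(Z.-(x ! i))⨾ sym(Z.-1*i≡-i(x ! i)))))
  (ιz-* -[1+ 0 ](x ! i)))⊚ comb-*(ιz -[1+ 0 ])_ basis ⊚ *ₗ-congʳ(F.-‿cong(F.+-identityʳ F.1#))⊚ -1*ₗ _

 real-- : ∀ x y -> real(x -ᵛ y)≈ᴹ real x +ᴹ -ᴹ real y
 real-- x y = ≈ᴹ-reflexive(cong real(ext{x = x -ᵛ y}{x +ᵛ(0ᵛ -ᵛ y)}(\ i -> !-- x y i ⨾ sym(!-+ x(0ᵛ -ᵛ y)i ⨾ cong(Z._+_(x ! i))(!-- 0ᵛ y i ⨾ cong(Z._-(y ! i))(!-0 i)⨾ Z.+-identityˡ(Z.-(y ! i)))))))⊚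
  real-+ x(0ᵛ -ᵛ y)⊚ +≈ˡ(real-neg y)

 real-inj : ∀{x y} -> real x ≈ᴹ real y -> x ≡ y
 real-inj{x}{y} h = ext(\ i -> ι-inj(begin
   ιz(x ! i)≈⟨ solve 2(\ a b -> a :=(a :+ :- b) :+ b)F.refl(ιz(x ! i))(ιz(y ! i))⟩
   (ιz(x ! i)F.+ F.- ιz(y ! i))F.+ ιz(y ! i)≈⟨ F.+-congʳ(basis-independent(\ i -> ιz(x ! i)F.+ F.- ιz(y ! i))diff i)⟩
   F.0# F.+ ιz(y ! i)≈⟨ F.+-identityˡ _ ⟩
   ιz(y ! i)∎))where
  open SetoidReasoning F.setoid
  diff : combination(\ i -> ιz(x ! i)F.+ F.- ιz(y ! i))basis ≈ᴹ 0ᴹ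
  diff = comb-cong basis(\ i -> F.trans(F.+-congˡ(F.sym(ιz-neg(y ! i))))(F.trans(F.sym(ιz-+(x ! i)(Z.-(y ! i))))(F.reflexive(cong ιz(sym(!-- x y i))))))⊚
   real-- x y ⊚ +≈ʳ h ⊚ -ᴹ‿inverseʳ _

 times-ι : ∀ n x -> Mult._×_ +ᴹ-monoid n x ≈ᴹ ιz(+ n)*ₗ x
 times-ι zero x = sm(*ₗ-zeroˡ x)
 times-ι(suc n)x = sm(*ₗ-distribʳ x _ _ ⊚ +≈(1* x)(sm(times-ι n x)))

 natural : Vector ℕ rank -> Vec ℤ rank
 natural n = Vec.tabulate(\ i -> + n i)

 natural-! : ∀ n i -> natural n ! i ≡ + n i
 natural-! n i = lookup∘tabulate(\ i -> + n i)i
  where open import Data.Vec.Properties using(lookup∘tabulate)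

 simpleSum-real : ∀ n -> simpleSum n ≈ᴹ real(natural n)
 simpleSum-real n = sum-cong-≋(\ i -> times-ι(n i)_ ⊚ *ₗ-congʳ(F.reflexive(cong ιz(sym(natural-! n i)))))

 private
  coordinates : ∀ k -> ∃ \ x -> vector k ≈ᴹ real x ×(NonNegative x ⊎ NonPositive x)
  coordinates k with signed k
  ... | n , inl h = natural n , h ⊚ simpleSum-real n , inl(\ i -> subst(0z Z.≤_)(sym(natural-! n i))(Z.+≤+ z≤n))
  ... | n , inr h = 0ᵛ -ᵛ natural n , h ⊚ -≈(simpleSum-real n)⊚ sm(real-neg(natural n)),
   inr(\ i -> subst(Z._≤ 0z)(sym(!-- 0ᵛ(natural n)i ⨾ cong₂ Z._-_(!-0 i)(natural-! n i)⨾ Z.+-identityˡ(Z.-(+ n i))))(Z.neg-mono-≤{+ 0}{+ n i}(Z.+≤+ z≤n)))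

 root : Fin N -> Vec ℤ rank
 root k = fst(coordinates k)

 vector-root : ∀ k -> vector k ≈ᴹ real(root k)
 vector-root k = fst(snd(coordinates k))

 cart : Fin N -> Fin N -> ℤ
 cart i k = fst(crystallographic i k)

 cor : Fin N -> Vec ℤ rank
 cor k = Vec.tabulate(\ i -> cart(simpleIndex i)k)

 pairing-lin : ∀ y -> Lin leftModule line(\ x -> ⟪ x , y ⟫)
 pairing-lin y = record{ map-cong = \ h -> ⟨⟩-cong h rf; map-+ = \ x x′ -> ⟨⟩-additive x x′ y; map-* = \ k x -> ⟨⟩-homogeneous k x y }
 module pairing y = Lin(pairing-lin y)

 norm : Fin N -> F.Carrier
 norm k = ⟪ vector k , vector k ⟫

 norm-pos : ∀ k -> F.0# F.< norm k
 norm-pos k = positive-definite _(nonzero k)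

 norm-nonzero : ∀ k -> ¬(norm k F.≈ F.0#)
 norm-nonzero k = pos-nonzero(norm-pos k)

 cart-simple : ∀ i k -> ιz(cart i k)F.* norm k F.≈ ⟪ vector i , vector k ⟫ F.+ ⟪ vector i , vector k ⟫
 cart-simple i k = F.trans(F.*-congʳ(F.reflexive(sym(fromℤ≡ι(cart i k)))))(snd(crystallographic i k))

 private
  double-lin : ∀ k -> Lin leftModule line(\ x -> ⟪ x , vector k ⟫ F.+ ⟪ x , vector k ⟫)
  double-lin k = +-lin{R = OrderedField.commutativeRing F} leftModule line(pairing-lin(vector k))(pairing-lin(vector k))

 ι-dot : ∀{n}(x y : Vec ℤ n)-> ιz(x ∙ y)F.≈ Line.sum(\ i -> ιz(x ! i)F.* ιz(y ! i))
 ι-dot [] [] = F.refl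
 ι-dot(x ∷ p)(y ∷ q) = F.trans(ιz-+(x Z.* y)(p ∙ q))(F.+-cong(ιz-* x y)(ι-dot p q))

 -- The bridge between integers and scalars. Identities of Cartan numbers are proved after
 -- multiplication by (β, β), which `norm-cancel` removes, and pulled back along the injection of
 -- the integers.
 cart-real : ∀ x k -> ιz(x ∙ cor k)F.* norm k F.≈ ⟪ real x , vector k ⟫ F.+ ⟪ real x , vector k ⟫
 cart-real x k = begin
  ιz(x ∙ cor k)F.* norm k ≈⟨ F.*-congʳ(ι-dot x(cor k))⟩
  Line.sum(\ i -> ιz(x ! i)F.* ιz(cor k ! i))F.* norm k ≈⟨ Lin.map-sum(*ʳ-lin(norm k))(\ i -> ιz(x ! i)F.* ιz(cor k ! i))⟩
  Line.sum(\ i →(ιz(x ! i)F.* ιz(cor k ! i))F.* norm k)≈⟨ Line.sum-cong-≋{_}{\ i →(ιz(x ! i)F.* ιz(cor k ! i))F.* norm k}(\ i -> term i)⟩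
  Line.sum(\ i -> ⟪ ιz(x ! i)*ₗ basis i , vector k ⟫ F.+ ⟪ ιz(x ! i)*ₗ basis i , vector k ⟫)
   ≈⟨ Lin.map-sum(double-lin k)(\ i -> ιz(x ! i)*ₗ basis i)⟨
  ⟪ real x , vector k ⟫ F.+ ⟪ real x , vector k ⟫ ∎ where
  open SetoidReasoning F.setoid
  term : ∀ i →(ιz(x ! i)F.* ιz(cor k ! i))F.* norm k F.≈ ⟪ ιz(x ! i)*ₗ basis i , vector k ⟫ F.+ ⟪ ιz(x ! i)*ₗ basis i , vector k ⟫
  term i = begin
   (ιz(x ! i)F.* ιz(cor k ! i))F.* norm k ≈⟨ F.*-assoc _ _ _ ⟩
   ιz(x ! i)F.*(ιz(cor k ! i)F.* norm k)≈⟨ F.*-congˡ(F.trans(F.*-congʳ(F.reflexive(cong ιz(lookup∘tabulate(\ i -> cart(simpleIndex i)k)i))))(cart-simple(simpleIndex i)k))⟩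
   ιz(x ! i)F.*(⟪ basis i , vector k ⟫ F.+ ⟪ basis i , vector k ⟫)≈⟨ Lin.map-*(double-lin k)(ιz(x ! i))(basis i)⟨
   ⟪ ιz(x ! i)*ₗ basis i , vector k ⟫ F.+ ⟪ ιz(x ! i)*ₗ basis i , vector k ⟫ ∎
   where open import Data.Vec.Properties using(lookup∘tabulate)

 norm-cancel : ∀ k{x y} -> x F.* norm k F.≈ y F.* norm k -> x F.≈ y
 norm-cancel k{x}{y} h = begin
  x ≈⟨ solve 2(\ x y -> x :=(x :+ :- y) :+ y)F.refl x y ⟩
  (x F.+ F.- y)F.+ y ≈⟨ F.+-congʳ(cancel(norm-nonzero k)(begin
   norm k F.*(x F.+ F.- y)≈⟨ solve 3(\ n x y -> n :*(x :+ :- y) := x :* n :+ :-(y :* n))F.refl(norm k)x y ⟩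
   x F.* norm k F.+ F.-(y F.* norm k)≈⟨ F.+-congʳ h ⟩
   y F.* norm k F.+ F.-(y F.* norm k)≈⟨ F.-‿inverseʳ _ ⟩
   F.0# ∎))⟩
  F.0# F.+ y ≈⟨ F.+-identityˡ y ⟩
  y ∎
  where open SetoidReasoning F.setoid

 cart-root : ∀ i k -> root i ∙ cor k ≡ cart i k
 cart-root i k = ι-inj(norm-cancel k(F.trans(cart-real(root i)k)(F.trans(Lin.map-cong(double-lin k)(sm(vector-root i)))(F.sym(cart-simple i k)))))

 private
  rfled : ∀ j k -> ∃ \ m -> vector m ≈ᴹ vector j +ᴹ -ᴹ(ιz(cart j k)*ₗ vector k)
  rfled j k = reflection j k(ιz(cart j k))(cart-simple j k)

 rfl : Fin N -> Fin N -> Fin N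
 rfl j k = fst(rfled j k)

 vector-rfl : ∀ j k -> vector(rfl j k)≈ᴹ vector j +ᴹ -ᴹ(ιz(cart j k)*ₗ vector k)
 vector-rfl j k = snd(rfled j k)

 root-rfl : ∀ j k -> root(rfl j k)≡ root j -ᵛ(root j ∙ cor k)*ᵛ root k
 root-rfl j k = real-inj(begin
  real(root(rfl j k))≈⟨ vector-root(rfl j k)⟨
  vector(rfl j k)≈⟨ vector-rfl j k ⟩
  vector j +ᴹ -ᴹ(ιz(cart j k)*ₗ vector k)≈⟨ +≈(vector-root j)(-≈(*ₗ-cong(F.reflexive(cong ιz(sym(cart-root j k))))(vector-root k)))⟩
  real(root j)+ᴹ -ᴹ(ιz(root j ∙ cor k)*ₗ real(root k))≈⟨ +≈ˡ(-≈(real-*(root j ∙ cor k)(root k)))⟨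
  real(root j)+ᴹ -ᴹ real((root j ∙ cor k)*ᵛ root k)≈⟨ real--(root j)((root j ∙ cor k)*ᵛ root k)⟨
  real(root j -ᵛ(root j ∙ cor k)*ᵛ root k)∎)
  where open SetoidReasoning ≈ᴹ-setoid

 pairing-diff : ∀ x k y z -> ⟪ x +ᴹ -ᴹ(k *ₗ y), z ⟫ F.≈ ⟪ x , z ⟫ F.+ F.-(k F.* ⟪ y , z ⟫)
 pairing-diff x k y z = F.trans(pairing.map-+ z _ _)(F.+-congˡ(F.trans(pairing.map-neg z _)(F.-‿cong(pairing.map-* z k y))))

 norm-rfl : ∀ j k -> norm(rfl j k)F.≈ norm j
 norm-rfl j k = begin
  norm(rfl j k)≈⟨ ⟨⟩-cong(vector-rfl j k)(vector-rfl j k)⟩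
  ⟪ γ , γ ⟫ ≈⟨ pairing-diff(vector j)z(vector k)γ ⟩
  ⟪ vector j , γ ⟫ F.+ F.-(z F.* ⟪ vector k , γ ⟫)≈⟨ F.+-cong(expand(vector j))(F.-‿cong(F.*-congˡ(expand(vector k))))⟩
  (norm j F.+ F.-(z F.* b))F.+ F.-(z F.*(⟪ vector k , vector j ⟫ F.+ F.-(z F.* norm k)))
   ≈⟨ F.+-congˡ(F.-‿cong(F.*-congˡ(F.+-congʳ(⟨⟩-sym _ _))))⟩
  (norm j F.+ F.-(z F.* b))F.+ F.-(z F.*(b F.+ F.-(z F.* norm k)))
   ≈⟨ solve 4(\ n z b m →(n :+ :-(z :* b)) :+ :-(z :*(b :+ :-(z :* m))) := n :+ z :*(z :* m :+ :-(b :+ b)))F.refl(norm j)z b(norm k)⟩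
  norm j F.+ z F.*(z F.* norm k F.+ F.-(b F.+ b))≈⟨ F.+-congˡ(F.*-congˡ(F.trans(F.+-congʳ(cart-simple j k))(F.-‿inverseʳ _)))⟩
  norm j F.+ z F.* F.0# ≈⟨ solve 2(\ n z -> n :+ z :* con 0z := n)F.refl(norm j)z ⟩
  norm j ∎ where
  open SetoidReasoning F.setoid
  z = ιz(cart j k)
  b = ⟪ vector j , vector k ⟫
  γ = vector j +ᴹ -ᴹ(z *ₗ vector k)
  expand : ∀ x -> ⟪ x , γ ⟫ F.≈ ⟪ x , vector j ⟫ F.+ F.-(z F.* ⟪ x , vector k ⟫)
  expand x = F.trans(⟨⟩-sym x γ)(F.trans(pairing-diff(vector j)z(vector k)x)(F.+-cong(⟨⟩-sym _ _)(F.-‿cong(F.*-congˡ(⟨⟩-sym _ _)))))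

 -- Reflections are self-adjoint and preserve lengths, so pairing with a reflected coroot is pairing
 -- the reflected vector with the original one.
 cor-rfl : ∀ x j k -> x ∙ cor(rfl j k)≡(x -ᵛ(x ∙ cor k)*ᵛ root k)∙ cor j
 cor-rfl x j k = ι-inj(norm-cancel j(begin
  ιz(x ∙ cor m)F.* norm j ≈⟨ F.*-congˡ(norm-rfl j k)⟨
  ιz(x ∙ cor m)F.* norm m ≈⟨ cart-real x m ⟩
  ⟪ X , vector m ⟫ F.+ ⟪ X , vector m ⟫ ≈⟨ F.+-cong left left ⟩
  (p F.+ F.-(z F.* q))F.+(p F.+ F.-(z F.* q))≈⟨ solve 3(\ p z q →(p :+ :-(z :* q)) :+(p :+ :-(z :* q)) :=(p :+ p) :+ :-(z :*(q :+ q)))F.refl p z q ⟩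
  (p F.+ p)F.+ F.-(z F.*(q F.+ q))≈⟨ F.+-congˡ(F.-‿cong(F.*-congˡ(cart-real x k)))⟨
  (p F.+ p)F.+ F.-(z F.*(y F.* norm k))≈⟨ solve 4(\ p z y n →(p :+ p) :+ :-(z :*(y :* n)) :=(p :+ p) :+ :-(y :*(z :* n)))F.refl p z y(norm k)⟩
  (p F.+ p)F.+ F.-(y F.*(z F.* norm k))≈⟨ F.+-congˡ(F.-‿cong(F.*-congˡ(F.trans(cart-simple j k)(F.+-cong(⟨⟩-sym _ _)(⟨⟩-sym _ _)))))⟩
  (p F.+ p)F.+ F.-(y F.*(w F.+ w))≈⟨ solve 3(\ p y w →(p :+ p) :+ :-(y :*(w :+ w)) :=(p :+ :-(y :* w)) :+(p :+ :-(y :* w)))F.refl p y w ⟩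
  (p F.+ F.-(y F.* w))F.+(p F.+ F.-(y F.* w))≈⟨ F.+-cong right right ⟨
  ⟪ real x′ , vector j ⟫ F.+ ⟪ real x′ , vector j ⟫ ≈⟨ cart-real x′ j ⟨
  ιz(x′ ∙ cor j)F.* norm j ∎))where
  open SetoidReasoning F.setoid
  m = rfl j k
  X = real x
  z = ιz(cart j k)
  y = ιz(x ∙ cor k)
  p = ⟪ X , vector j ⟫
  q = ⟪ X , vector k ⟫
  w = ⟪ vector k , vector j ⟫
  x′ = x -ᵛ(x ∙ cor k)*ᵛ root k
  left : ⟪ X , vector m ⟫ F.≈ p F.+ F.-(z F.* q)
  left = F.trans(⟨⟩-sym _ _)(F.trans(⟨⟩-cong(vector-rfl j k)rf)(F.trans(pairing-diff _ z _ X)(F.+-cong(⟨⟩-sym _ _)(F.-‿cong(F.*-congˡ(⟨⟩-sym _ _))))))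
  right : ⟪ real x′ , vector j ⟫ F.≈ p F.+ F.-(y F.* w)
  right = F.trans(⟨⟩-cong(real-- x((x ∙ cor k)*ᵛ root k)⊚ +≈ˡ(-≈(real-*(x ∙ cor k)(root k)⊚ *ₗ-congˡ(sm(vector-root k)))))rf)(pairing-diff X y(vector k)(vector j))

 self : ∀ k -> root k ∙ cor k ≡ + 2
 self k = ι-inj(norm-cancel k(F.trans(cart-real(root k)k)(F.trans(Lin.map-cong(double-lin k)(sm(vector-root k)))
  (solve 1(\ n -> n :+ n := con(+ 2) :* n)F.refl(norm k)))))

 root-simple : ∀ i -> root(simpleIndex i)≡ unit i
 root-simple i = real-inj(sm(vector-root(simpleIndex i))⊚ sm(1* _)⊚
  sm(comb-single i F.1# basis)⊚ comb-cong basis same)where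
  same : ∀ j -> single i F.1# j F.≈ ιz(unit i ! j)
  same j = go(j Fin.≟ i)where
   go : Dec(j ≡ i)-> single i F.1# j F.≈ ιz(unit i ! j)
   go(no j≢i) = F.trans(single-off{i = i}{j} F.1# j≢i)(F.reflexive(cong ιz(sym(unit-off j≢i))))
   go(yes refl) = F.trans at(F.trans(F.sym(F.+-identityʳ F.1#))(F.reflexive(cong ιz(sym(unit-at i)))))where
    at : single i F.1# i F.≈ F.1#
    at with i Fin.≟ i
    ... | yes _ = F.refl
    ... | no h = contra refl h

 root-inj : ∀{j k} -> root j ≡ root k -> j ≡ k
 root-inj{j}{k} h = distinct(vector-root j ⊚ ≈ᴹ-reflexive(cong real h)⊚ sm(vector-root k))

 sign : ∀ k -> NonNegative(root k)⊎ NonPositive(root k)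
 sign k = snd(snd(coordinates k))

 -- Twice (x, x) equals Σ x_i ⟨x, α_i^∨⟩ (α_i, α_i), and by assumption each term has a vanishing
 -- factor.
 definite : ∀ x →(∀ i -> x ! i ≢ 0z -> x ∙ cor(simpleIndex i)≡ 0z)-> ∀ i -> x ! i ≡ 0z
 definite x h i = cong(_! i)(real-inj{x}{0ᵛ}(go(zero?(real x))))⨾ !-0 i where
  real-0 : real 0ᵛ ≈ᴹ 0ᴹ
  real-0 = comb-zero basis(\ i -> F.reflexive(cong ιz(!-0 i)))
  doubled : ⟪ real x , real x ⟫ F.+ ⟪ real x , real x ⟫ F.≈ F.0#
  doubled = begin
   ⟪ real x , real x ⟫ F.+ ⟪ real x , real x ⟫
    ≈⟨ Lin.map-sum(+-lin{R = OrderedField.commutativeRing F} leftModule line(pairing-lin(real x))(pairing-lin(real x)))(\ i -> ιz(x ! i)*ₗ basis i)⟩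
   Line.sum(\ i -> ⟪ ιz(x ! i)*ₗ basis i , real x ⟫ F.+ ⟪ ιz(x ! i)*ₗ basis i , real x ⟫)
    ≈⟨ Line.sum-zero(\ i -> F.trans(F.+-cong(⟨⟩-homogeneous _ _ _)(⟨⟩-homogeneous _ _ _))(vanish i))⟩
   F.0# ∎ where
   open SetoidReasoning F.setoid
   vanish : ∀ i -> ιz(x ! i)F.* ⟪ basis i , real x ⟫ F.+ ιz(x ! i)F.* ⟪ basis i , real x ⟫ F.≈ F.0#
   vanish i with x ! i Z.≟ 0z
   ... | yes z rewrite z = F.trans(F.+-cong(F.zeroˡ _)(F.zeroˡ _))(F.+-identityʳ _)
   ... | no nz = begin
    ιz(x ! i)F.* ⟪ basis i , real x ⟫ F.+ ιz(x ! i)F.* ⟪ basis i , real x ⟫ ≈⟨ F.distribˡ _ _ _ ⟨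
    ιz(x ! i)F.*(⟪ basis i , real x ⟫ F.+ ⟪ basis i , real x ⟫)≈⟨ F.*-congˡ(F.+-cong(⟨⟩-sym _ _)(⟨⟩-sym _ _))⟩
    ιz(x ! i)F.*(⟪ real x , basis i ⟫ F.+ ⟪ real x , basis i ⟫)≈⟨ F.*-congˡ(cart-real x(simpleIndex i))⟨
    ιz(x ! i)F.*(ιz(x ∙ cor(simpleIndex i))F.* norm(simpleIndex i))≈⟨ F.*-congˡ(F.*-congʳ(F.reflexive(cong ιz(h i nz))))⟩
    ιz(x ! i)F.*(F.0# F.* norm(simpleIndex i))≈⟨ solve 2(\ a b -> a :*(con 0z :* b) := con 0z)F.refl _ _ ⟩
    F.0# ∎
  go : Dec(real x ≈ᴹ 0ᴹ)-> real x ≈ᴹ real 0ᵛ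
  go(yes z) = z ⊚ sm real-0
  go(no nz) = contra(F.sym doubled)(\ e -> <.irrefl e(0<+(positive-definite _ nz)(positive-definite _ nz)))

 private
  square-nn : ∀ b -> F.0# F.< b F.* b ⊎ b F.≈ F.0#
  square-nn b with compare F.0# b
  ... | tri< h _ _ = inl(F.*-positive h h)
  ... | tri≈ _ h _ = inr(F.sym h)
  ... | tri> _ _ h = let -b = <.<-respˡ-≈(F.-‿inverseʳ b)(<.<-respʳ-≈(F.+-identityˡ _)(F.+-monoˡ-<(F.- b)h))in
   inl(<.<-respʳ-≈(solve 1(\ b →(:- b) :*(:- b) := b :* b)F.refl b)(F.*-positive -b -b))

  pair-cases : ∀ a b →(a ≡ 0z -> b ≡ 0z)→(b ≡ 0z -> a ≡ 0z)→(∀ n -> a Z.* b ≢ -[1+ n ])→(∀ n -> a Z.* b ≢ +(4 + n))-> CartanPair a b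
  pair-cases(+ zero)b f g neg big = orth refl(f refl)
  pair-cases a(+ zero)f g neg big = orth(g refl)refl
  pair-cases Z.+[1+ m ] Z.+[1+ n ] f g neg big = let(p , q , r) = small m n big in acute m n refl refl p q r where
   small : ∀ m n →(∀ k -> Z.+[1+ m ] Z.* Z.+[1+ n ] ≢ +(4 + k))→(m ≡ 0 ⊎ n ≡ 0)× m ≤ 2 × n ≤ 2
   small zero zero big = inl refl , z≤n , z≤n
   small zero(suc zero)big = inl refl , z≤n , s≤s z≤n
   small zero(suc(suc zero))big = inl refl , z≤n , s≤s(s≤s z≤n)
   small zero(suc(suc(suc n)))big = contra(cong(\ k -> +(4 + k))(ℕ.+-identityʳ n))(big n)
   small(suc zero)zero big = inr refl , s≤s z≤n , z≤n
   small(suc(suc zero))zero big = inr refl , s≤s(s≤s z≤n), z≤n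
   small(suc(suc(suc m)))zero big = contra(cong(\ k -> +(4 + k))(ℕ.*-identityʳ m))(big m)
   small(suc m)(suc n)big = contra(cong(\ z -> + suc(suc z))(ℕ.+-suc n _ ⨾ cong suc(ℕ.+-suc n _)))(big _)
  pair-cases Z.+[1+ m ] -[1+ n ] f g neg big = contra refl(neg _)
  pair-cases -[1+ m ] Z.+[1+ n ] f g neg big = contra refl(neg _)
  pair-cases -[1+ m ] -[1+ n ] f g neg big with pair-cases Z.+[1+ m ] Z.+[1+ n ](\())(\())(\ _())big
  ... | acute m n refl refl p q r = obtuse m n refl refl p q r

 cartPair : ∀ j k -> j ≡ k ⊎ root j ≡ 0ᵛ -ᵛ root k ⊎ CartanPair(root j ∙ cor k)(root k ∙ cor j)
 cartPair j k = subst₂(\ a b -> j ≡ k ⊎ root j ≡ 0ᵛ -ᵛ root k ⊎ CartanPair a b)(sym(cart-root j k))(sym(cart-root k j))(go(zero? ω))where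
  open SetoidReasoning F.setoid
  B = norm j
  C = norm k
  b = ⟪ vector j , vector k ⟫
  a = cart j k
  a' = cart k j
  -- C times the component of the first root orthogonal to the second, with (ω, ω) = C (B C - b²).
  -- If ω = 0 the roots are parallel and reducedness applies; otherwise the strict Cauchy-Schwarz
  -- inequality bounds the product 4 b² / (B C) of the Cartan numbers by 3.
  ω = C *ₗ vector j +ᴹ -ᴹ(b *ₗ vector k)
  aC : ιz a F.* C F.≈ b F.+ b
  aC = cart-simple j k
  a'B : ιz a' F.* B F.≈ b F.+ b
  a'B = F.trans(cart-simple k j)(F.+-cong(⟨⟩-sym _ _)(⟨⟩-sym _ _))
  product : ιz(a Z.* a')F.*(B F.* C)F.≈ ιz(+ 4)F.*(b F.* b)
  product = begin
   ιz(a Z.* a')F.*(B F.* C)≈⟨ F.*-congʳ(ιz-* a a')⟩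
   (ιz a F.* ιz a')F.*(B F.* C)≈⟨ solve 4(\ p q B C →(p :* q) :*(B :* C) :=(p :* C) :*(q :* B))F.refl(ιz a)(ιz a')B C ⟩
   (ιz a F.* C)F.*(ιz a' F.* B)≈⟨ F.*-cong aC a'B ⟩
   (b F.+ b)F.*(b F.+ b)≈⟨ solve 1(\ b →(b :+ b) :*(b :+ b) := con(+ 4) :*(b :* b))F.refl b ⟩
   ιz(+ 4)F.*(b F.* b)∎
  BC-pos : F.0# F.< B F.* C
  BC-pos = F.*-positive(norm-pos j)(norm-pos k)
  double-zero : ∀{x} -> x F.+ x F.≈ F.0# -> x F.≈ F.0#
  double-zero{x} h = cancel 2≉0(F.trans(solve 2(\ o x →(o :+ o) :* x := o :* x :+ o :* x)F.refl F.1# x)(F.trans(F.+-cong(F.*-identityˡ x)(F.*-identityˡ x))h))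
  zero-zero : ∀{a a' C B} -> ιz a F.* C F.≈ b F.+ b -> ιz a' F.* B F.≈ b F.+ b -> ¬(B F.≈ F.0#)-> a ≡ 0z -> a' ≡ 0z
  zero-zero{a' = a'}{C}{B} h h' B≉0 refl = ι-zero a'(cancel B≉0(F.trans(F.*-comm B _)(F.trans h'(F.trans(F.sym h)(F.zeroˡ C)))))
  negative : ∀ n -> a Z.* a' ≢ -[1+ n ]
  negative n eq = <.irrefl(F.sym total)(add(square-nn b))where
   P = ιz Z.+[1+ n ] F.*(B F.* C)
   total : ιz(+ 4)F.*(b F.* b)F.+ P F.≈ F.0#
   total = F.trans(F.+-congʳ(F.sym product))(F.trans(F.+-congʳ(F.*-congʳ(F.reflexive(cong ιz eq))))(solve 2(\ p q →(:- p) :* q :+ p :* q := con 0z)F.refl(ιz Z.+[1+ n ])(B F.* C)))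
   P-pos : F.0# F.< P
   P-pos = F.*-positive(ι-pos n)BC-pos
   add : F.0# F.< b F.* b ⊎ b F.≈ F.0# -> F.0# F.< ιz(+ 4)F.*(b F.* b)F.+ P
   add(inl h) = 0<+(F.*-positive(ι-pos 3)h)P-pos
   add(inr h) = <.<-respʳ-≈(F.sym(F.trans(F.+-congʳ(F.trans(F.*-congˡ(F.*-congʳ h))(solve 2(\ p b -> p :*(con 0z :* b) := con 0z)F.refl _ _)))(F.+-identityˡ _)))P-pos
  par : ω ≈ᴹ 0ᴹ -> ∃ \ t -> vector j ≈ᴹ t *ₗ vector k
  par ω≈0 = let(t , Ct) = inverse(norm-nonzero k)in t F.* b , sm(1* _)⊚ *ₗ-congʳ(F.sym Ct)⊚ solveᴹ(C ∷ t ∷ b ∷ [])(vector j ∷ vector k ∷ [])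
     ((var zero :* var(suc zero))✶ vec zero)
     (var(suc zero)✶(var zero ✶ vec zero ⊹ ⊝(var(suc(suc zero))✶ vec(suc zero)))⊹(var(suc zero) :* var(suc(suc zero)))✶ vec(suc zero))(F.refl , F.refl , _)⊚
    +≈ʳ(*ₗ-congˡ ω≈0 ⊚ *ₗ-zeroʳ t)⊚ 0+ _
  gram : ⟪ ω , ω ⟫ F.≈ C F.*(B F.* C F.+ F.-(b F.* b))
  gram = begin
   ⟪ ω , ω ⟫ ≈⟨ expand ω ⟩
   C F.* ⟪ vector j , ω ⟫ F.+ F.-(b F.* ⟪ vector k , ω ⟫)≈⟨ F.+-cong(F.*-congˡ(expandʳ(vector j)))(F.-‿cong(F.*-congˡ(expandʳ(vector k))))⟩
   C F.*(C F.* B F.+ F.-(b F.* ⟪ vector k , vector j ⟫))F.+ F.-(b F.*(C F.* b F.+ F.-(b F.* C)))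
    ≈⟨ F.+-congʳ(F.*-congˡ(F.+-congˡ(F.-‿cong(F.*-congˡ(⟨⟩-sym _ _)))))⟩
   C F.*(C F.* B F.+ F.-(b F.* b))F.+ F.-(b F.*(C F.* b F.+ F.-(b F.* C)))
    ≈⟨ solve 3(\ B C b -> C :*(C :* B :+ :-(b :* b)) :+ :-(b :*(C :* b :+ :-(b :* C))) := C :*(B :* C :+ :-(b :* b)))F.refl B C b ⟩
   C F.*(B F.* C F.+ F.-(b F.* b))∎ where
   expand : ∀ x -> ⟪ ω , x ⟫ F.≈ C F.* ⟪ vector j , x ⟫ F.+ F.-(b F.* ⟪ vector k , x ⟫)
   expand x = F.trans(pairing-diff _ b _ x)(F.+-congʳ(pairing.map-* x C _))
   expandʳ : ∀ x -> ⟪ x , ω ⟫ F.≈ C F.* ⟪ vector j , x ⟫ F.+ F.-(b F.* ⟪ vector k , x ⟫)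
   expandʳ x = F.trans(⟨⟩-sym x ω)(expand x)
  large : ¬(ω ≈ᴹ 0ᴹ)-> ∀ n -> a Z.* a' ≢ +(4 + n)
  large ω≉0 n eq = <.irrefl(F.sym total)(F.*-positive(norm-pos k)(sum-pos n))where
   G = B F.* C F.+ F.-(b F.* b)
   sum-pos : ∀ n -> F.0# F.< ιz(+ 4)F.* G F.+ ιz(+ n)F.*(B F.* C)
   sum-pos zero = <.<-respʳ-≈(solve 2(\ x y -> x := x :+ con 0z :* y)F.refl _ _)(F.*-positive(ι-pos 3)G-pos)where
    G-pos : F.0# F.< G
    G-pos with compare F.0# G
    ... | tri< h _ _ = h
    ... | tri≈ _ h _ = contra(positive-definite ω ω≉0)(<.irrefl(F.sym(F.trans gram(F.trans(F.*-congˡ(F.sym h))(F.zeroʳ C)))))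
    ... | tri> _ _ h = contra(0<+(positive-definite ω ω≉0)(F.*-positive(norm-pos k)-G))
      (<.irrefl(F.sym(F.trans(F.+-congʳ gram)(solve 2(\ C G -> C :* G :+ C :*(:- G) := con 0z)F.refl C G))))
     where -G = <.<-respˡ-≈(F.-‿inverseʳ G)(<.<-respʳ-≈(F.+-identityˡ _)(F.+-monoˡ-<(F.- G)h))
   sum-pos(suc n) = <.<-respʳ-≈(solve 4(\ g x y o →(g :+ x :* y) :+ o :* y := g :+(o :+ x) :* y)F.refl _ _ _ F.1#)
    (0<+(sum-pos n)(F.*-positive 0<1 BC-pos))
   total : C F.*(ιz(+ 4)F.* G F.+ ιz(+ n)F.*(B F.* C))F.≈ F.0#
   total = begin
    C F.*(ιz(+ 4)F.* G F.+ ιz(+ n)F.*(B F.* C))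
     ≈⟨ solve 5(\ C f D q x -> C :*(f :*(D :+ :- q) :+ x :* D) := C :*((f :+ x) :* D :+ :-(f :* q)))F.refl C(ιz(+ 4))(B F.* C)(b F.* b)(ιz(+ n))⟩
    C F.*((ιz(+ 4)F.+ ιz(+ n))F.*(B F.* C)F.+ F.-(ιz(+ 4)F.*(b F.* b)))
     ≈⟨ F.*-congˡ(F.+-congʳ(F.*-congʳ(F.trans(F.sym(ιz-+(+ 4)(+ n)))(F.reflexive(cong ιz(sym eq))))))⟩
    C F.*(ιz(a Z.* a')F.*(B F.* C)F.+ F.-(ιz(+ 4)F.*(b F.* b)))
     ≈⟨ F.*-congˡ(F.trans(F.+-congʳ product)(F.-‿inverseʳ _))⟩
    C F.* F.0# ≈⟨ F.zeroʳ C ⟩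
    F.0# ∎
  go : Dec(ω ≈ᴹ 0ᴹ)-> j ≡ k ⊎ root j ≡ 0ᵛ -ᵛ root k ⊎ CartanPair a a'
  go(no ω≉0) = inr(inr(pair-cases a a'(zero-zero{a}{a'} aC a'B(norm-nonzero j))(zero-zero{a'}{a} a'B aC(norm-nonzero k))negative(large ω≉0)))
  go(yes ω≈0) = proportional(fst(par ω≈0))(snd(par ω≈0))(reduced k j(fst(par ω≈0))(snd(par ω≈0)))where
   proportional : ∀ t -> vector j ≈ᴹ t *ₗ vector k -> t F.≈ F.1# ⊎ t F.≈ F.- F.1# -> j ≡ k ⊎ root j ≡ 0ᵛ -ᵛ root k ⊎ CartanPair a a'
   proportional t h(inl t≈1) = inl(distinct(h ⊚ *ₗ-congʳ t≈1 ⊚ 1* _))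
   proportional t h(inr t≈-1) = inr(inl(real-inj(sm(vector-root j)⊚ h ⊚ *ₗ-congʳ t≈-1 ⊚ -1*ₗ _ ⊚
    -≈(vector-root k)⊚ sm(real-neg(root k)))))

 rootDatum : RootDatum rank N
 rootDatum = record
  { root = root; cor = cor; simple = simpleIndex; rfl = rfl
  ; root-simple = root-simple; root-inj = root-inj; sign = sign; self = self
  ; root-rfl = root-rfl; cor-rfl = cor-rfl; cartPair = cartPair; definite = definite }

-- Signs, and elementary facts on positive roots.

Positive Negative : ℤ -> Set
Positive x = ∃ \ k -> x ≡ Z.+[1+ k ]
Negative x = ∃ \ k -> x ≡ -[1+ k ]

module Signs where
 open import Data.Integer.Base using(_*_)renaming(_+_ to _⊕_; _-_ to _⊖_; -_ to ∼_)
 open import Data.Integer.Solver using(module +-*-Solver)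

 data Sign(x : ℤ) : Set where
  pos : Positive x -> Sign x
  zer : x ≡ 0z -> Sign x
  neg : Negative x -> Sign x

 signOf : ∀ x -> Sign x
 signOf(+ zero) = zer refl
 signOf Z.+[1+ k ] = pos(k , refl)
 signOf -[1+ k ] = neg(k , refl)

 pos⇒≥0 : ∀{x} -> Positive x -> 0z Z.≤ x
 pos⇒≥0(k , refl) = Z.+≤+ z≤n

 pos⇒≢0 : ∀{x} -> Positive x -> x ≢ 0z
 pos⇒≢0(k , refl)()

 ≥0⇒pos : ∀{x} -> 0z Z.≤ x -> x ≢ 0z -> Positive x
 ≥0⇒pos{+ zero} h ≢0 = contra refl ≢0
 ≥0⇒pos{Z.+[1+ k ]} h ≢0 = k , refl

 pos∧≤0 : ∀{x} -> Positive x -> ¬ x Z.≤ 0z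
 pos∧≤0(k , refl)(Z.+≤+())

 neg∧≥0 : ∀{x} -> Negative x -> ¬ 0z Z.≤ x
 neg∧≥0(k , refl)()

 pos∧neg : ∀{x} -> Positive x -> ¬ Negative x
 pos∧neg(k , refl)(l ,())

 *-pos : ∀{x y} -> Positive x -> Positive y -> Positive(x * y)
 *-pos(k , refl)(l , refl) = _ , refl

 *-posneg : ∀{x y} -> Positive x -> Negative y -> Negative(x * y)
 *-posneg(k , refl)(l , refl) = _ , refl

 0*ˡ : ∀{x} y -> x ≡ 0z -> x * y ≡ 0z
 0*ˡ y refl = Z.*-zeroˡ y

 ≥0*≥0 : ∀{x y} -> 0z Z.≤ x -> 0z Z.≤ y -> 0z Z.≤ x * y
 ≥0*≥0{+ m}{+ n} _ _ = subst(0z Z.≤_)(Z.pos-* m n)(Z.+≤+ z≤n)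

 ≥0*≤0 : ∀{x y} -> 0z Z.≤ x -> y Z.≤ 0z -> x * y Z.≤ 0z
 ≥0*≤0{+ m}{+ zero} _ _ = Z.≤-reflexive(Z.*-zeroʳ(+ m))
 ≥0*≤0{+ m}{Z.+[1+ n ]} _(Z.+≤+())
 ≥0*≤0{+ zero}{ -[1+ n ] } _ _ = Z.≤-refl
 ≥0*≤0{Z.+[1+ m ]}{ -[1+ n ] } _ _ = Z.-≤+

 1≤pos : ∀{x} -> 1z Z.≤ x -> Positive x
 1≤pos{+ zero}(Z.+≤+())
 1≤pos{Z.+[1+ k ]} _ = k , refl

 pos⇒1≤ : ∀{x} -> Positive x -> 1z Z.≤ x
 pos⇒1≤(k , refl) = Z.+≤+(s≤s z≤n)

 neg⇒≤-1 : ∀{x} -> Negative x -> x Z.≤ -[1+ 0 ]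
 neg⇒≤-1(k , refl) = Z.-≤- z≤n

 ≤-1⇒neg : ∀{x} -> x Z.≤ -[1+ 0 ] -> Negative x
 ≤-1⇒neg{ -[1+ k ] } _ = k , refl

 ≤0⇒neg : ∀{x} -> x Z.≤ 0z -> x ≢ 0z -> Negative x
 ≤0⇒neg{+ zero} _ h = contra refl h
 ≤0⇒neg{Z.+[1+ k ]}(Z.+≤+())h
 ≤0⇒neg{ -[1+ k ] } _ h = k , refl

 ∼pos : ∀{x} -> Positive x -> Negative(∼ x)
 ∼pos(k , refl) = k , refl

 ∼neg : ∀{x} -> Negative x -> Positive(∼ x)
 ∼neg(k , refl) = k , refl

open Signs

maximal : ∀{n p}{P : Fin n -> Set p}(P? : ∀ i -> Dec(P i))(h : Fin n -> ℤ)-> ∃ P -> ∃ \ i -> P i ×(∀ j -> P j -> h j Z.≤ h i)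
maximal{suc n}{P = P} P? h(i0 , p0)with Fin.any?(\ i -> P?(suc i)) | P? zero
... | no none | yes p = zero , p , \{ zero _ -> Z.≤-refl; (suc j)q -> contra(j , q)none }
maximal P? h(zero , p0) | no none | no ¬p = contra p0 ¬p
maximal P? h(suc i , p0) | no none | no ¬p = contra(i , p0)none
maximal P? h _ | yes some | d with maximal(\ i -> P?(suc i))(h ∘ suc)some
maximal P? h _ | yes some | no ¬p | i , p , m = suc i , p , \{ zero q -> contra q ¬p; (suc j)q -> m j q }
maximal P? h _ | yes some | yes p0 | i , p , m with Z.≤-total(h zero)(h(suc i))
... | inl le = suc i , p , \{ zero _ -> le; (suc j)q -> m j q }
... | inr ge = zero , p0 , \{ zero _ -> Z.≤-refl; (suc j)q -> Z.≤-trans(m j q)ge }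

module Roots{r N}(RD : RootDatum r N)where
 open RootDatum RD public
 open import Data.Integer.Base using(_*_)renaming(_+_ to _⊕_; _-_ to _⊖_; -_ to ∼_)
 open import Data.Integer.Solver using(module +-*-Solver)
 open +-*-Solver using(solve; _:=_; _:+_; _:*_; _:-_; :-_; con)

 Pos : Fin N -> Set
 Pos j = NonNegative(root j)

 C : Fin r -> Fin r -> ℤ
 C i k = ⟨ unit i , simple k ⟩

 at-unit : ∀ i j -> ⟨ unit i , j ⟩ ≡ cor j ! i
 at-unit i j = unit-∙ i(cor j)

 nonzero : ∀ j -> ¬(∀ i -> root j ! i ≡ 0z)
 nonzero j h = contra(sym(self j)⨾ ∙-zero(root j)(cor j)(\ i -> 0*ˡ(cor j ! i)(h i)))(\())

 pos-coef : ∀{j i} -> Positive(root j ! i)-> Pos j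
 pos-coef{j}{i} p with sign j
 ... | inl h = h
 ... | inr h = contra(h i)(pos∧≤0 p)

 no-mixed : ∀{j i k} -> Positive(root j ! i)-> ¬ Negative(root j ! k)
 no-mixed{j}{i}{k} p n = neg∧≥0 n(pos-coef{j}{i} p k)

 some-pos : ∀{j} -> Pos j -> ∃ \ i -> Positive(root j ! i)
 some-pos{j} h with Fin.any?(\ i -> ¬?(root j ! i Z.≟ 0z))
 ... | yes(i , ≢0) = i , ≥0⇒pos(h i)≢0
 ... | no none = contra(\ i -> all i)(nonzero j)where
  all : ∀ i -> root j ! i ≡ 0z
  all i with root j ! i Z.≟ 0z
  ... | yes z = z
  ... | no nz = contra(i , nz)none

 ⟨⟩-diff : ∀ x k y j -> ⟨ x -ᵛ k *ᵛ y , j ⟩ ≡ ⟨ x , j ⟩ ⊖ k * ⟨ y , j ⟩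
 ⟨⟩-diff x k y j = ∙-- x(k *ᵛ y)(cor j)⨾ cong(⟨ x , j ⟩ ⊖_)(∙-* k y(cor j))

 rfl-coef : ∀ j k i -> root(rfl j k)! i ≡ root j ! i ⊖ ⟨ root j , k ⟩ * root k ! i
 rfl-coef j k i = cong(_! i)(root-rfl j k)⨾ !--(root j)_ i ⨾ cong(root j ! i ⊖_)(!-* ⟨ root j , k ⟩(root k)i)

 rfl-⟨⟩ : ∀ j k m -> ⟨ root(rfl j k), m ⟩ ≡ ⟨ root j , m ⟩ ⊖ ⟨ root j , k ⟩ * ⟨ root k , m ⟩
 rfl-⟨⟩ j k m = cong(\ x -> ⟨ x , m ⟩)(root-rfl j k)⨾(⟨⟩-diff(root j)⟨ root j , k ⟩(root k)m)

 ⟨⟩-rfl : ∀ x j k -> ⟨ x , rfl j k ⟩ ≡ ⟨ x , j ⟩ ⊖ ⟨ x , k ⟩ * ⟨ root k , j ⟩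
 ⟨⟩-rfl x j k = cor-rfl x j k ⨾(⟨⟩-diff x ⟨ x , k ⟩(root k)j)

 opposite : Fin N -> Fin N
 opposite j = rfl j j

 oppo-coef : ∀ j i -> root(opposite j)! i ≡ ∼(root j ! i)
 oppo-coef j i = rfl-coef j j i ⨾ cong(\ z -> root j ! i ⊖ z * root j ! i)(self j)⨾ solve 1(\ x -> x :- con(+ 2) :* x := :- x)refl(root j ! i)

 ⟨⟩-oppo : ∀ x j -> ⟨ x , opposite j ⟩ ≡ ∼ ⟨ x , j ⟩
 ⟨⟩-oppo x j = ⟨⟩-rfl x j j ⨾ cong(\ z -> ⟨ x , j ⟩ ⊖ ⟨ x , j ⟩ * z)(self j)⨾(solve 1(\ x -> x :- x :* con(+ 2) := :- x)refl ⟨ x , j ⟩)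

 neg-root : ∀{j k} -> root j ≡ 0ᵛ -ᵛ root k -> ⟨ root j , k ⟩ ≡ -[1+ 1 ]
 neg-root{j}{k} h = cong(\ x -> ⟨ x , k ⟩)h ⨾ ∙-- 0ᵛ(root k)(cor k)⨾
  cong₂ _⊖_(∙-zero 0ᵛ(cor k)(\ i -> 0*ˡ(cor k ! i)(!-0 i)))(self k)⨾ refl

 pos-not-oppo : ∀{j k} -> Pos j -> Pos k -> root j ≢ 0ᵛ -ᵛ root k
 pos-not-oppo{j}{k} pj pk h = let(i , p) = some-pos pj in
  contra(pk i)(neg∧≥0(subst Negative(sym(oppo-sign i))(∼pos p)))where
  oppo-sign : ∀ i -> root k ! i ≡ ∼(root j ! i)
  oppo-sign i = sym(Z.neg-involutive _)⨾ cong ∼_(sym(cong(_! i)h ⨾ !-- 0ᵛ(root k)i ⨾ cong(_⊖ root k ! i)(!-0 i)⨾ Z.+-identityˡ(∼(root k ! i))))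

 pair : ∀{j k} -> Pos j -> Pos k -> j ≢ k -> CartanPair ⟨ root j , k ⟩ ⟨ root k , j ⟩
 pair{j}{k} pj pk j≢k with cartPair j k
 ... | inl j≡k = contra j≡k j≢k
 ... | inr(inl h) = contra h(pos-not-oppo pj pk)
 ... | inr(inr p) = p

 simple-pos : ∀ i -> Pos(simple i)
 simple-pos i k = subst(\ x -> 0z Z.≤ x ! k)(sym(root-simple i))(go(k Fin.≟ i))where
  go : Dec(k ≡ i)-> 0z Z.≤ unit i ! k
  go(yes refl) = subst(0z Z.≤_)(sym(unit-at i))(Z.+≤+ z≤n)
  go(no h) = Z.≤-reflexive(sym(unit-off h))

 simple-at : ∀ i -> root(simple i)! i ≡ 1z
 simple-at i = cong(_! i)(root-simple i)⨾ unit-at i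

 simple-off : ∀{i k} -> k ≢ i -> root(simple i)! k ≡ 0z
 simple-off{i}{k} h = cong(_! k)(root-simple i)⨾ unit-off h

 simple-inj : ∀{i k} -> simple i ≡ simple k -> i ≡ k
 simple-inj{i}{k} h with i Fin.≟ k
 ... | yes e = e
 ... | no i≢k = contra(sym(simple-at i)⨾ cong(\ j -> root j ! i)h ⨾ simple-off i≢k)(\())

 C-root : ∀ i k -> ⟨ root(simple i), simple k ⟩ ≡ C i k
 C-root i k = cong(\ x -> ⟨ x , simple k ⟩)(root-simple i)

 C-self : ∀ i -> C i i ≡ + 2
 C-self i = sym(C-root i i)⨾ self(simple i)

 pairᶜ : ∀{i k} -> i ≢ k -> CartanPair(C i k)(C k i)
 pairᶜ{i}{k} i≢k = subst₂ CartanPair(C-root i k)(C-root k i)(pair(simple-pos i)(simple-pos k)(i≢k ∘ simple-inj))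

 -- At an acute angle one of the two Cartan numbers is 1, so the difference is a reflection of the
 -- first root or the negative of a reflection of the second.
 diff : ∀{j k} -> Positive ⟨ root j , k ⟩ -> j ≢ k -> ∃ \ m -> ∀ i -> root m ! i ≡ root j ! i ⊖ root k ! i
 diff{j}{k} p j≢k with cartPair j k
 ... | inl j≡k = contra j≡k j≢k
 ... | inr(inl h) = contra(1 , neg-root{j}{k} h)(pos∧neg p)
 ... | inr(inr(orth z _)) = contra z(pos⇒≢0 p)
 ... | inr(inr(obtuse m n e _ _ _ _)) = contra(m , e)(pos∧neg p)
 ... | inr(inr(acute m n e _(inl refl)_ _)) = rfl j k , \ i -> rfl-coef j k i ⨾ cong(root j ! i ⊖_)(cong(_* root k ! i)e ⨾ Z.*-identityˡ _)
 ... | inr(inr(acute m n _ e(inr refl)_ _)) = opposite(rfl k j), \ i -> oppo-coef(rfl k j)i ⨾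
  cong ∼_(rfl-coef k j i ⨾ cong(root k ! i ⊖_)(cong(_* root j ! i)e ⨾ Z.*-identityˡ _))⨾
   solve 2(\ x y -> :-(x :- y) := y :- x)refl(root k ! i)(root j ! i)

 ⟨⟩-of-diff : ∀{j k m} →(∀ i -> root m ! i ≡ root j ! i ⊖ root k ! i)-> ∀ l -> ⟨ root m , l ⟩ ≡ ⟨ root j , l ⟩ ⊖ ⟨ root k , l ⟩
 ⟨⟩-of-diff{j}{k}{m} h l = cong(\ x -> ⟨ x , l ⟩)(ext{x = root m}{root j -ᵛ root k}(\ i -> h i ⨾ sym(!--(root j)(root k)i)))⨾ ∙--(root j)(root k)(cor l)

 symm-pos : ∀{j k} -> Positive ⟨ root j , k ⟩ -> Positive ⟨ root k , j ⟩
 symm-pos{j}{k} p with cartPair j k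
 ... | inl refl = p
 ... | inr(inl h) = contra(1 , neg-root{j}{k} h)(pos∧neg p)
 ... | inr(inr(orth z _)) = contra z(pos⇒≢0 p)
 ... | inr(inr(obtuse m n e _ _ _ _)) = contra(m , e)(pos∧neg p)
 ... | inr(inr(acute m n _ e _ _ _)) = n , e

 symm-zero : ∀{j k} -> ⟨ root j , k ⟩ ≡ 0z -> ⟨ root k , j ⟩ ≡ 0z
 symm-zero{j}{k} z with cartPair j k
 ... | inl refl = z
 ... | inr(inl h) = contra(sym(neg-root{j}{k} h)⨾ z)(\())
 ... | inr(inr(orth _ z')) = z'
 ... | inr(inr(obtuse m n e _ _ _ _)) = contra(sym e ⨾ z)(\())
 ... | inr(inr(acute m n e _ _ _ _)) = contra(sym e ⨾ z)(\())

 symm-neg : ∀{j k} -> Negative ⟨ root j , k ⟩ -> Negative ⟨ root k , j ⟩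
 symm-neg{j}{k} n with signOf ⟨ root k , j ⟩
 ... | neg h = h
 ... | zer h = contra(sym(symm-zero{k}{j} h)⨾ snd n)(\())
 ... | pos h = contra n(pos∧neg(symm-pos{k}{j} h))

 -- Otherwise `diff` would yield the root α_i - α_k, whose coefficients have both signs.
 C-np : ∀{i k} -> i ≢ k -> C i k Z.≤ 0z
 C-np{i}{k} i≢k with signOf(C i k)
 ... | zer h = Z.≤-reflexive h
 ... | neg(m , h) = subst(Z._≤ 0z)(sym h)Z.-≤+
 ... | pos p with diff{simple i}{simple k}(subst Positive(sym(C-root i k))p)(i≢k ∘ simple-inj)
 ... | m , h = ⊥-elim(no-mixed{m}{i}{k}(0 , h i ⨾ cong₂ _⊖_(simple-at i)(simple-off i≢k))
                 (0 , h k ⨾ cong₂ _⊖_(simple-off(i≢k ∘ sym))(simple-at k)))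

 C-zero-sym : ∀{i k} -> C i k ≡ 0z -> C k i ≡ 0z
 C-zero-sym{i}{k} z = sym(C-root k i)⨾ symm-zero{simple i}{simple k}(C-root i k ⨾ z)

 outside-np : ∀{j i} -> Pos j -> root j ! i ≡ 0z -> ⟨ root j , simple i ⟩ Z.≤ 0z
 outside-np{j}{i} pj z = ∙≤0(root j)(cor(simple i))term where
  ∙≤0 : ∀{n}(x y : Vec ℤ n)→(∀ i -> x ! i * y ! i Z.≤ 0z)-> x ∙ y Z.≤ 0z
  ∙≤0 [] [] h = Z.≤-refl
  ∙≤0(x ∷ p)(y ∷ q)h = Z.+-mono-≤(h zero)(∙≤0 p q(h ∘ suc))
  term : ∀ k -> root j ! k * cor(simple i)! k Z.≤ 0z
  term k with k Fin.≟ i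
  ... | yes refl = Z.≤-reflexive(0*ˡ(cor(simple i)! i)z)
  ... | no k≢i = ≥0*≤0(pj k)(subst(Z._≤ 0z)(at-unit k(simple i))(C-np k≢i))

 rfl-simple : ∀ j i k -> root(rfl j(simple i))! k ≡ root j ! k ⊖ ⟨ root j , simple i ⟩ * unit i ! k
 rfl-simple j i k = rfl-coef j(simple i)k ⨾ cong(\ x -> root j ! k ⊖ ⟨ root j , simple i ⟩ * x ! k)(root-simple i)

 rfl-off : ∀{j i k} -> k ≢ i -> root(rfl j(simple i))! k ≡ root j ! k
 rfl-off{j}{i}{k} h = rfl-simple j i k ⨾ cong(\ z -> root j ! k ⊖ ⟨ root j , simple i ⟩ * z)(unit-off h)⨾
  (solve 2(\ x y -> x :- y :* con 0z := x)refl(root j ! k)⟨ root j , simple i ⟩)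

 rfl-at : ∀ j i -> root(rfl j(simple i))! i ≡ root j ! i ⊖ ⟨ root j , simple i ⟩
 rfl-at j i = rfl-simple j i i ⨾ cong(\ z -> root j ! i ⊖ ⟨ root j , simple i ⟩ * z)(unit-at i)⨾
  (solve 2(\ x y -> x :- y :* con 1z := x :- y)refl(root j ! i)⟨ root j , simple i ⟩)

 -- A positive root without another simple root is a multiple of α_i; a proper multiple would have
 -- Cartan number at least 4 with α_i.
 another : ∀{j i} -> Pos j -> j ≢ simple i -> ∃ \ k -> k ≢ i × Positive(root j ! k)
 another{j}{i} pj j≢ with Fin.any?(\ k -> ¬?(k Fin.≟ i)×-dec ¬?(root j ! k Z.≟ 0z))
 ... | yes(k , k≢i , nz) = k , k≢i , ≥0⇒pos(pj k)nz
 ... | no none = ⊥-elim(go(≥0⇒pos(pj i)(\ z -> nonzero j(\ k -> zeros z k(k Fin.≟ i)))))where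
  off : ∀ k -> k ≢ i -> root j ! k ≡ 0z
  off k k≢i with root j ! k Z.≟ 0z
  ... | yes z = z
  ... | no nz = contra(k , k≢i , nz)none
  zeros : root j ! i ≡ 0z -> ∀ k -> Dec(k ≡ i)-> root j ! k ≡ 0z
  zeros z k(yes refl) = z
  zeros z k(no k≢i) = off k k≢i
  multiple : root j ≡ root j ! i *ᵛ unit i
  multiple = ext(\ k -> go' k(k Fin.≟ i))where
   go' : ∀ k -> Dec(k ≡ i)-> root j ! k ≡(root j ! i *ᵛ unit i)! k
   go' k(yes refl) = sym(!-*(root j ! i)(unit i)i ⨾ cong(root j ! i *_)(unit-at i)⨾ Z.*-identityʳ _)
   go' k(no k≢i) = off k k≢i ⨾ sym(!-*(root j ! i)(unit i)k ⨾ cong(root j ! i *_)(unit-off k≢i)⨾ Z.*-zeroʳ(root j ! i))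
  value : ⟨ root j , simple i ⟩ ≡ root j ! i * + 2
  value = cong(\ x -> ⟨ x , simple i ⟩)multiple ⨾ ∙-*(root j ! i)(unit i)_ ⨾ cong(root j ! i *_)(C-self i)
  go : Positive(root j ! i)-> ⊥
  go(zero , e) = j≢(root-inj(multiple ⨾ cong(_*ᵛ unit i)e ⨾ ext(\ k -> !-* 1z(unit i)k ⨾ Z.*-identityˡ _)⨾ sym(root-simple i)))
  go(suc m , e)with pair pj(simple-pos i)j≢
  ... | orth z _ = contra(sym(value ⨾ cong(_* + 2)e)⨾ z)(\())
  ... | obtuse _ _ z _ _ _ _ = contra(sym(value ⨾ cong(_* + 2)e)⨾ z)(\())
  ... | acute a b z _ _ a≤2 _ with trans(sym(value ⨾ cong(_* + 2)e))z | a≤2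
  ... | refl | s≤s(s≤s())

 height : Vec ℤ r -> ℤ
 height x = x ∙ Vec.replicate r 1z

 height-rfl : ∀ j i -> height(root(rfl j(simple i)))≡ height(root j)⊖ ⟨ root j , simple i ⟩
 height-rfl j i = cong height(root-rfl j(simple i))⨾ ∙--(root j)(⟨ root j , simple i ⟩ *ᵛ root(simple i))ones ⨾
  cong(height(root j)⊖_)((∙-* ⟨ root j , simple i ⟩(root(simple i))ones)⨾ cong(\ x -> ⟨ root j , simple i ⟩ *(x ∙ ones))(root-simple i)⨾
   cong(⟨ root j , simple i ⟩ *_)(unit-∙ i ones ⨾ lookup-replicate i 1z)⨾ Z.*-identityʳ _)where
  open import Data.Vec.Properties using(lookup-replicate)
  ones = Vec.replicate r 1z

 height-nn : ∀{j} -> Pos j -> 0z Z.≤ height(root j)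
 height-nn{j} h = ∙-nn(root j)_(\ i -> ≥0*≥0(h i)(subst(0z Z.≤_)(sym(lookup-replicate i 1z))(Z.+≤+ z≤n)))
  where open import Data.Vec.Properties using(lookup-replicate)

 rfl-pos : ∀{j i} -> Pos j -> j ≢ simple i -> Pos(rfl j(simple i))
 rfl-pos{j}{i} pj j≢ = let(k , k≢i , p) = another pj j≢ in pos-coef{rfl j(simple i)}{k}(subst Positive(sym(rfl-off{j}{i}{k} k≢i))p)

 -- In 2 = ⟨β, β^∨⟩ = Σ β_i ⟨α_i, β^∨⟩ some term is positive.
 lowering : ∀{j} -> Pos j -> ∃ \ i -> Positive(root j ! i)× Positive ⟨ root j , simple i ⟩
 lowering{j} pj with Fin.any?(\ i -> positive?(root j ! i)×-dec positive?(cor j ! i))where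
  positive? : ∀ x -> Dec(Positive x)
  positive?(+ zero) = no \()
  positive? Z.+[1+ k ] = yes(k , refl)
  positive? -[1+ k ] = no \()
 ... | yes(i , p , q) = i , p , symm-pos{simple i}{j}(subst Positive(sym(at-unit i j)⨾ cong(\ x -> ⟨ x , j ⟩)(sym(root-simple i)))q)
 ... | no none = contra(subst(Z._≤ 0z)(self j)(∙≤0(root j)(cor j)term))(\{ (Z.+≤+())})where
  ∙≤0 : ∀{n}(x y : Vec ℤ n)→(∀ i -> x ! i * y ! i Z.≤ 0z)-> x ∙ y Z.≤ 0z
  ∙≤0 [] [] h = Z.≤-refl
  ∙≤0(x ∷ p)(y ∷ q)h = Z.+-mono-≤(h zero)(∙≤0 p q(h ∘ suc))
  term : ∀ k -> root j ! k * cor j ! k Z.≤ 0z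
  term k with signOf(root j ! k) | signOf(cor j ! k)
  ... | neg n | _ = contra(pj k)(neg∧≥0 n)
  ... | zer z | _ = Z.≤-reflexive(0*ˡ(cor j ! k)z)
  ... | pos p | pos q = contra(k , p , q)none
  ... | pos p | zer z = Z.≤-reflexive(cong(root j ! k *_)z ⨾ Z.*-zeroʳ(root j ! k))
  ... | pos p | neg(m , e) = ≥0*≤0(pj k)(subst(Z._≤ 0z)(sym e)Z.-≤+)

 -- Reflection in the simple root found by `lowering` keeps a nonsimple root positive and reduces
 -- its height.
 pos-induction : ∀{q}(Q : Fin N -> Set q)→(∀ i -> Q(simple i))->
  (∀ j i -> Pos j -> Pos(rfl j(simple i))-> Positive(root j ! i)-> Positive ⟨ root j , simple i ⟩ -> Q(rfl j(simple i))-> Q j)->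
  ∀ j -> Pos j -> Q j
 pos-induction Q base step j pj = go j pj(<-wellFounded Z.∣ height(root j)∣)where
  go : ∀ j -> Pos j -> Acc _<_ Z.∣ height(root j)∣ -> Q j
  go j pj(acc rs)with lowering pj
  ... | i , p , q with j Fin.≟ simple i
  ... | yes e = subst Q(sym e)(base i)
  ... | no j≢ = step j i pj pj' p q(go j′ pj'(rs smaller))where
   j′ = rfl j(simple i)
   pj' = rfl-pos pj j≢
   abs-< : ∀{x y} -> 0z Z.≤ x -> x Z.< y -> Z.∣ x ∣ < Z.∣ y ∣
   abs-<{+ m}{+ n} _(Z.+<+ h) = h
   less : ∀{x} y -> Positive y -> x ⊖ y Z.< x
   less{x} y(k , refl) = subst(x ⊖ y Z.<_)(Z.+-identityʳ x)(Z.+-monoʳ-< x Z.-<+)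
   smaller : Z.∣ height(root j′)∣ < Z.∣ height(root j)∣
   smaller = abs-<(height-nn pj')(subst(Z._< height(root j))(sym(height-rfl j i))(less ⟨ root j , simple i ⟩ q))

 ⟨⟩-rfl-self : ∀ j i -> ⟨ root(rfl j(simple i)), simple i ⟩ ≡ ∼ ⟨ root j , simple i ⟩
 ⟨⟩-rfl-self j i = rfl-⟨⟩ j(simple i)(simple i)⨾ cong(\ z -> ⟨ root j , simple i ⟩ ⊖ ⟨ root j , simple i ⟩ * z)(self(simple i))⨾
  (solve 1(\ x -> x :- x :* con(+ 2) := :- x)refl ⟨ root j , simple i ⟩)

 module _{s}{S : Fin r -> Set s}(S? : ∀ i -> Dec(S i))where
  private
   Separated Sided : Fin N -> Set s
   Separated j = ∀ i k -> root j ! i ≢ 0z -> root j ! k ≢ 0z -> S i -> ¬ S k -> C i k ≡ 0z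
   Sided j =(∀ i -> root j ! i ≢ 0z -> S i)⊎(∀ i -> root j ! i ≢ 0z -> ¬ S i)

  -- Supports of roots are connected. In the induction the reflecting node i must be adjacent to the
  -- support of the lower root, since that root pairs negatively with α_i; hence i lies on the same
  -- side.
  connected : ∀ j -> Pos j -> Separated j -> Sided j
  connected = pos-induction(\ j -> Separated j -> Sided j)base step where
   only : ∀ i k -> root(simple i)! k ≢ 0z -> k ≡ i
   only i k nz with k Fin.≟ i
   ... | yes e = e
   ... | no k≢i = contra(simple-off k≢i)nz
   base : ∀ i -> Separated(simple i)-> Sided(simple i)
   base i _ with S? i
   ... | yes h = inl(\ k nz -> subst S(sym(only i k nz))h)
   ... | no h = inr(\ k nz q -> h(subst S(only i k nz)q))
   step : ∀ j i -> Pos j -> Pos(rfl j(simple i))-> Positive(root j ! i)-> Positive ⟨ root j , simple i ⟩ ->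
       (Separated(rfl j(simple i))-> Sided(rfl j(simple i)))-> Separated j -> Sided j
   step j i pj pj' p q ih sep = go(ih sep')(S? i)where
    j′ = rfl j(simple i)
    back : ∀ k -> root j′ ! k ≢ 0z -> root j ! k ≢ 0z
    back k nz with k Fin.≟ i
    ... | yes refl = pos⇒≢0 p
    ... | no k≢i = \ z -> nz(rfl-off{j} k≢i ⨾ z)
    forth : ∀ k -> k ≢ i -> root j ! k ≢ 0z -> root j′ ! k ≢ 0z
    forth k k≢i nz z = nz(sym(rfl-off{j} k≢i)⨾ z)
    sep' : Separated j′
    sep' a b na nb = sep a b(back a na)(back b nb)
    negative : Negative ⟨ root j′ , simple i ⟩
    negative = subst Negative(sym(⟨⟩-rfl-self j i))(∼pos q)
    absurd :(∀ k -> root j′ ! k ≢ 0z -> C k i ≡ 0z)-> ⊥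
    absurd h = contra(sym(∙-zero(root j′)(cor(simple i))term)⨾ snd negative)(\())where
     term : ∀ k -> root j′ ! k * cor(simple i)! k ≡ 0z
     term k with root j′ ! k Z.≟ 0z
     ... | yes z = 0*ˡ(cor(simple i)! k)z
     ... | no nz = cong(root j′ ! k *_)(sym(at-unit k(simple i))⨾ h k nz)⨾ Z.*-zeroʳ(root j′ ! k)
    go : Sided j′ -> Dec(S i)-> Sided j
    go(inl all)(yes si) = inl(\ k nz -> side k nz(k Fin.≟ i))where
     side : ∀ k -> root j ! k ≢ 0z -> Dec(k ≡ i)-> S k
     side k nz(yes e) = subst S(sym e)si
     side k nz(no k≢i) = all k(forth k k≢i nz)
    go(inr none)(no ¬si) = inr(\ k nz -> side k nz(k Fin.≟ i))where
     side : ∀ k -> root j ! k ≢ 0z -> Dec(k ≡ i)-> ¬ S k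
     side k nz(yes e)sk = ¬si(subst S e sk)
     side k nz(no k≢i) = none k(forth k k≢i nz)
    go(inl all)(no ¬si) = ⊥-elim(absurd(\ k nz -> sep k i(back k nz)(pos⇒≢0 p)(all k nz)¬si))
    go(inr none)(yes si) = ⊥-elim(absurd(\ k nz -> C-zero-sym{i}{k}(sep i k(pos⇒≢0 p)(back k nz)si(none k nz))))

 -- The roots of a rank two flat through j and k that do not involve the simple root w.
 record Between(w : Fin r)(j k : Fin N) : Set where
  field
   δ : Fin N
   δ-pos : Pos δ
   δ-free : root δ ! w ≡ 0z
   δ-below :(∀ i -> root δ ! i Z.≤ root j ! i)⊎(∀ i -> root δ ! i Z.≤ root k ! i)
   s p q : ℤ
   s≢0 : s ≢ 0z
   on-line : ∀ i -> s * root δ ! i ≡ p * root j ! i ⊕ q * root k ! i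

 between-sym : ∀{w j k} -> Between w j k -> Between w k j
 between-sym b = record
  { δ = δ; δ-pos = δ-pos; δ-free = δ-free; δ-below = [ inr , inl ]′ δ-below
  ; s = s; p = q; q = p; s≢0 = s≢0; on-line = \ i -> on-line i ⨾ Z.+-comm(p * _)_ }
  where open Between b

 -- If j - k = c (root m) with c > 0 then ± root m is the required root.
 between-multiple : ∀{w j k m} c -> Positive c -> Pos j -> Pos k →(∀ i -> c * root m ! i ≡ root j ! i ⊖ root k ! i)-> root j ! w ≡ root k ! w -> Between w j k
 between-multiple{w}{j}{k}{m} c(c' , refl)pj pk h e = go(sign m)where
  free : root m ! w ≡ 0z
  free with Z.i*j≡0⇒i≡0∨j≡0 c(h w ⨾ cong(_⊖ root k ! w)e ⨾ Z.+-inverseʳ(root k ! w))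
  ... | inr z = z
  below : ∀{x y z} -> 0z Z.≤ x -> 0z Z.≤ z -> Z.+[1+ c' ] * x ≡ y ⊖ z -> x Z.≤ y
  below{x}{y}{z} x≥0 z≥0 eq = Z.≤-trans(Z.≤-trans(subst(Z._≤ Z.+[1+ c' ] * x)(Z.*-identityˡ x)(mono x x≥0))(Z.≤-reflexive eq))(subst(y ⊖ z Z.≤_)(Z.+-identityʳ y)(Z.+-monoʳ-≤ y(Z.neg-mono-≤ z≥0)))where
   mono : ∀ x -> 0z Z.≤ x -> 1z * x Z.≤ Z.+[1+ c' ] * x
   mono(+ n)_ = Z.*-monoʳ-≤-nonNeg(+ n){1z}{Z.+[1+ c' ]}(Z.+≤+(s≤s z≤n))
  go : NonNegative(root m)⊎ NonPositive(root m)-> Between w j k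
  go(inl pm) = record
   { δ = m; δ-pos = pm; δ-free = free; δ-below = inl(\ i -> below(pm i)(pk i)(h i)); s = c; p = 1z; q = -[1+ 0 ]; s≢0 = \()
   ; on-line = \ i -> h i ⨾ solve 2(\ x y -> x :- y := con 1z :* x :+ con -[1+ 0 ] :* y)refl(root j ! i)(root k ! i)}
  go(inr nm) = record
   { δ = opposite m; δ-pos = po
   ; δ-free = oppo-coef m w ⨾ cong ∼_ free
   ; δ-below = inr(\ i -> below(po i)(pj i)(cong(c *_)(oppo-coef m i)⨾ sym(Z.neg-distribʳ-* c(root m ! i))⨾ cong ∼_(h i)⨾ solve 2(\ x y -> :-(x :- y) := y :- x)refl(root j ! i)(root k ! i)))
   ; s = c; p = -[1+ 0 ]; q = 1z; s≢0 = \()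
   ; on-line = \ i -> cong(c *_)(oppo-coef m i)⨾ sym(Z.neg-distribʳ-* c(root m ! i))⨾ cong ∼_(h i)⨾ solve 2(\ x y -> :-(x :- y) := con -[1+ 0 ] :* x :+ con 1z :* y)refl(root j ! i)(root k ! i)} where
   po : Pos(opposite m)
   po i = subst(0z Z.≤_)(sym(oppo-coef m i))(Z.neg-mono-≤(nm i))

 between-acute : ∀{w j k} -> Pos j -> Pos k -> j ≢ k -> Positive ⟨ root j , k ⟩ -> root j ! w ≡ root k ! w -> Between w j k
 between-acute pj pk j≢k p e = let(m , h) = diff p j≢k in between-multiple{m = m} 1z(0 , refl)pj pk(\ i -> Z.*-identityˡ _ ⨾ h i)e

 equal-of-large : ∀{j k} →(+ 2)Z.≤ ⟨ root j , k ⟩ →(+ 2)Z.≤ ⟨ root k , j ⟩ -> j ≡ k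
 equal-of-large{j}{k} p q with cartPair j k
 ... | inl e = e
 ... | inr(inl h) = contra(subst(+ 2 Z.≤_)(neg-root{j}{k} h)p)(\())
 ... | inr(inr(orth z _)) = contra(subst(+ 2 Z.≤_)z p)(\{ (Z.+≤+())})
 ... | inr(inr(obtuse _ _ z _ _ _ _)) = contra(subst(+ 2 Z.≤_)z p)(\())
 ... | inr(inr(acute _ _ z _(inl refl)_ _)) = contra(subst(+ 2 Z.≤_)z p)(\{ (Z.+≤+(s≤s()))})
 ... | inr(inr(acute _ _ _ z(inr refl)_ _)) = contra(subst(+ 2 Z.≤_)z q)(\{ (Z.+≤+(s≤s()))})

 -- The recurrent source of contradictions: a node or bond that does not belong in a diagram is
 -- excluded by a root that would pair with a simple root as -2 or less in both directions.
 not-very-obtuse : ∀{j k} -> Pos j -> Pos k -> ⟨ root j , k ⟩ Z.≤ -[1+ 1 ] -> ¬ ⟨ root k , j ⟩ Z.≤ -[1+ 1 ]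
 not-very-obtuse{j}{k} pj pk p q with j Fin.≟ k
 ... | yes refl = contra(subst(Z._≤ -[1+ 1 ])(self j)p)(\())
 ... | no j≢k with pair pj pk j≢k
 ... | orth z _ = contra(subst(Z._≤ -[1+ 1 ])z p)(\())
 ... | acute _ _ z _ _ _ _ = contra(subst(Z._≤ -[1+ 1 ])z p)(\())
 ... | obtuse _ _ z _(inl refl)_ _ = contra(subst(Z._≤ -[1+ 1 ])z p)(\{ (Z.-≤-())})
 ... | obtuse _ _ _ z(inr refl)_ _ = contra(subst(Z._≤ -[1+ 1 ])z q)(\{ (Z.-≤-())})

-- Good simple roots in the presence of a double bond.

module Cases{r N}(RD : RootDatum r N){g}{G : Fin r -> Set g}(G? : ∀ i -> Dec(G i))where
 open Roots RD
 open import Data.Integer.Base using(_*_)renaming(_+_ to _⊕_; _-_ to _⊖_; -_ to ∼_)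
 open import Data.Integer.Solver using(module +-*-Solver)
 open +-*-Solver using(solve; _:=_; _:+_; _:*_; _:-_; :-_; con)
 open import Data.Integer.Divisibility.Signed using(_∣_; divides; _∣?_; ∣m∣n⇒∣m-n; ∣n⇒∣m*n; ∣m⇒∣m*n)
 open import Relation.Nullary.Decidable using(_→-dec_)

 Supp : Fin N -> Set g
 Supp j = ∀ i -> ¬ G i -> root j ! i ≡ 0z

 -- G is the set of simple roots that have not been removed yet, so only roots supported on it are
 -- compared.
 Good : Fin r →(Fin N -> Set)-> Set g
 Good w Id = ∀ μ ν -> Id μ -> Id ν -> Supp μ -> Supp ν -> Positive(root μ ! w)-> Positive(root ν ! w)-> μ ≢ ν -> Between w μ ν

 in-G : ∀{j i} -> Supp j -> root j ! i ≢ 0z -> G i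
 in-G{j}{i} s nz with G? i
 ... | yes h = h
 ... | no h = contra(s i h)nz

 pos? : ∀ j -> Dec(Pos j)
 pos? j = Fin.all?(\ i -> 0z Z.≤? root j ! i)

 supp? : ∀ j -> Dec(Supp j)
 supp? j = Fin.all?(\ i -> ¬?(G? i)→-dec(root j ! i Z.≟ 0z))

 supp-simple : ∀{i} -> G i -> Supp(simple i)
 supp-simple{i} h k ¬k = simple-off(\{ refl -> ¬k h })

 supp-rfl : ∀{j i} -> Supp j -> G i -> Supp(rfl j(simple i))
 supp-rfl{j}{i} s h k ¬k = rfl-off(\{ refl -> ¬k h })⨾ s k ¬k

 cor-simple : ∀ i k -> cor(simple k)! i ≡ C i k
 cor-simple i k = sym(at-unit i(simple k))

 cor-at : ∀ i j -> ⟨ root(simple i), j ⟩ ≡ cor j ! i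
 cor-at i j = cong(\ x -> ⟨ x , j ⟩)(root-simple i)⨾ at-unit i j

 not-simple-of-neg : ∀{j i} -> Negative ⟨ root j , simple i ⟩ -> j ≢ simple i
 not-simple-of-neg{i = i} n refl = contra(sym(self(simple i))⨾ snd n)(\())

 record Top(P : Fin N -> Set g) : Set g where
  field
   η : Fin N
   holds : P η
   highest : ∀ j -> P j -> height(root j)Z.≤ height(root η)
   dominant : ∀ i -> G i -> 0z Z.≤ ⟨ root η , simple i ⟩

 raises : ∀{j i} -> Negative ⟨ root j , simple i ⟩ -> height(root j)Z.< height(root(rfl j(simple i)))
 raises{j}{i} n = subst(height(root j)Z.<_)(sym(height-rfl j i))(more ⟨ root j , simple i ⟩ n)where
  more : ∀{x} y -> Negative y -> x Z.< x ⊖ y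
  more{x} y(k , refl) = subst(Z._< x ⊖ y)(Z.+-identityʳ x)(Z.+-monoʳ-< x(Z.+<+(s≤s z≤n)))

 -- Closure under raising reflections stands in for a Weyl group orbit: a highest member cannot pair
 -- negatively with a simple root of G.
 top : ∀{P : Fin N -> Set g} →(∀ j -> Dec(P j))→(∀{j i} -> P j -> G i -> Negative ⟨ root j , simple i ⟩ -> P(rfl j(simple i)))-> ∃ P -> Top P
 top{P} P? closed start = let(η , p , h) = maximal P?(height ∘ root)start in record
  { η = η; holds = p; highest = h; dominant = \ i gi -> dominant η p h i gi } where
  dominant : ∀ η -> P η →(∀ j -> P j -> height(root j)Z.≤ height(root η))-> ∀ i -> G i -> 0z Z.≤ ⟨ root η , simple i ⟩
  dominant η p h i gi with signOf ⟨ root η , simple i ⟩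
  ... | pos q = pos⇒≥0 q
  ... | zer z = Z.≤-reflexive(sym z)
  ... | neg n = contra(h _(closed p gi n))(Z.<⇒≱(raises n))

 height-simple : ∀ i -> height(root(simple i))≡ 1z
 height-simple i = cong height(root-simple i)⨾ unit-∙ i(Vec.replicate r 1z)⨾ lookup-replicate i 1z
  where open import Data.Vec.Properties using(lookup-replicate)

 top-not-simple : ∀{P}(t : Top P)→(∀{j i} -> P j -> G i -> Negative ⟨ root j , simple i ⟩ -> P(rfl j(simple i)))->
          ∀{c d} -> P(simple c)-> G d -> Negative(C c d)-> ∀ w -> Top.η t ≢ simple w
 top-not-simple t closed{c}{d} pc gd n w e = Z.<⇒≱(raises n')
   (Z.≤-trans(Top.highest t _(closed pc gd n'))(Z.≤-reflexive(cong(height ∘ root)e ⨾ height-simple w ⨾ sym(height-simple c))))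
  where n' = subst Negative(sym(C-root c d))n

 cor-nn : ∀{η i} -> 0z Z.≤ ⟨ root η , simple i ⟩ -> 0z Z.≤ cor η ! i
 cor-nn{η}{i} h with signOf(cor η ! i)
 ... | pos q = pos⇒≥0 q
 ... | zer z = Z.≤-reflexive(sym z)
 ... | neg n = contra h(neg∧≥0(symm-neg(subst Negative(sym(cor-at i η))n)))

 cor-outside : ∀{η i} -> Pos η -> 0z Z.≤ ⟨ root η , simple i ⟩ -> root η ! i ≡ 0z -> cor η ! i ≡ 0z
 cor-outside{η}{i} pη h z = sym(cor-at i η)⨾ symm-zero(Z.≤-antisym(outside-np pη z)h)

 dominant-terms : ∀{η} -> Pos η -> Supp η →(∀ i -> G i -> 0z Z.≤ ⟨ root η , simple i ⟩)-> ∀ i -> 0z Z.≤ root η ! i * cor η ! i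
 dominant-terms{η} pη s d i with G? i
 ... | yes h = ≥0*≥0(pη i)(cor-nn{η}(d i h))
 ... | no h = Z.≤-reflexive(sym(0*ˡ(cor η ! i)(s i h)))

 end : ∀{η} -> Pos η -> ∃ \ w -> Positive(root η ! w)× Positive(cor η ! w)× Positive ⟨ root η , simple w ⟩
 end{η} pη = let(w , p , q) = lowering pη in w , p , subst Positive(cor-at w η)(symm-pos q), q

 pairing-single : ∀{η w} →(∀ i -> G i -> i ≢ w -> cor η ! i ≡ 0z)-> ∀{μ} -> Supp μ -> ⟨ root μ , η ⟩ ≡ root μ ! w * cor η ! w
 pairing-single{η}{w} h{μ} s = ∙-single(root μ)(cor η)w(\ i i≢w -> term i i≢w(G? i))where
  term : ∀ i -> i ≢ w -> Dec(G i)-> root μ ! i * cor η ! i ≡ 0z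
  term i i≢w(yes gi) = cong(root μ ! i *_)(h i gi i≢w)⨾ Z.*-zeroʳ(root μ ! i)
  term i i≢w(no ¬gi) = 0*ˡ(cor η ! i)(s i ¬gi)

 even-pos : ∀{x} -> + 2 ∣ x -> Positive x -> ∃ \ k -> x ≡ +(2 + k)
 even-pos(divides q e)(zero , refl) = contra e(odd q)where
  odd : ∀ q -> 1z ≢ q * + 2
  odd(+ zero)()
  odd Z.+[1+ k ]()
  odd -[1+ k ]()
 even-pos _(suc k , e) = k , e

 two≥ : ∀{x} -> x Z.≤ 0z -> + 2 Z.≤ + 2 ⊖ x
 two≥{x} h = subst(Z._≤ + 2 ⊖ x)(Z.+-identityʳ(+ 2))(Z.+-monoʳ-≤(+ 2)(Z.neg-mono-≤ h))

 np-sym : ∀{j k} -> ¬ Positive ⟨ root j , k ⟩ -> ⟨ root j , k ⟩ Z.≤ 0z × ⟨ root k , j ⟩ Z.≤ 0z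
 np-sym{j}{k} h = nonpos h , nonpos(h ∘ symm-pos)where
  nonpos : ∀{x} -> ¬ Positive x -> x Z.≤ 0z
  nonpos{+ zero} _ = Z.≤-refl
  nonpos{Z.+[1+ k ]} h = contra(k , refl)h
  nonpos{ -[1+ k ] } _ = Z.-≤+

 positive? : ∀ x -> Dec(Positive x)
 positive?(+ zero) = no \()
 positive? Z.+[1+ k ] = yes(k , refl)
 positive? -[1+ k ] = no \()

 -- Types B: the short root c pairs evenly with everything, and the highest root η in its orbit is a
 -- fundamental weight with η_w = 1; each long root μ through w has a mirror image 2η - μ.
 module _(Id : Fin N -> Set)(Id-pos : ∀{μ} -> Id μ -> Pos μ)where

  caseB : ∀{c d} -> G c -> G d -> Negative(C c d)→(∀ j -> G j -> + 2 ∣ C j c)-> ∃ \ w -> G w × Good w Id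
  caseB{c}{d} gc gd adjacent even = fromTop(top P? closed(simple c , start))where
   P : Fin N -> Set g
   P η = Pos η × Supp η ×(∀ j -> G j -> + 2 ∣ cor η ! j)
   P? : ∀ η -> Dec(P η)
   P? η = pos? η ×-dec(supp? η ×-dec Fin.all?(\ j -> G? j →-dec((+ 2)∣?(cor η ! j))))
   closed : ∀{j i} -> P j -> G i -> Negative ⟨ root j , simple i ⟩ -> P(rfl j(simple i))
   closed{j}{i}(pj , sj , ej)gi n = rfl-pos pj(not-simple-of-neg n), supp-rfl sj gi , \ k gk ->
    subst(+ 2 ∣_)(cong₂(\ x y -> x ⊖ C k i * y)(sym(at-unit k j))(sym(cor-at i j))⨾ sym(⟨⟩-rfl(unit k)j(simple i))⨾ at-unit k(rfl j(simple i)))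
     (∣m∣n⇒∣m-n(ej k gk)(∣n⇒∣m*n(C k i)(ej i gi)))
   start = simple-pos c , supp-simple gc , \ j gj -> subst(+ 2 ∣_)(sym(cor-simple j c))(even j gj)
   fromTop : Top P -> ∃ \ w -> G w × Good w Id
   fromTop t = w , in-G sη(pos⇒≢0 ηw>0), good where
    open Top t
    pη = fst holds
    sη = fst(snd holds)
    eη = snd(snd holds)
    e = end pη
    w = fst e
    ηw>0 = fst(snd e)
    cw>0 = fst(snd(snd e))
    terms = dominant-terms pη sη dominant
    -- The terms of 2 = Σ η_i ⟨α_i, η^∨⟩ are nonnegative and the second factor at w is positive and
    -- even; so η_w = 1, the factor is 2, and nothing is left for the other terms.
    units = go ηw>0(even-pos(eη w(in-G sη(pos⇒≢0 ηw>0)))cw>0)(subst(root η ! w * cor η ! w Z.≤_)(self η)(∙-term(root η)(cor η)terms w))where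
     go : Positive(root η ! w)→(∃ \ k -> cor η ! w ≡ +(2 + k))-> root η ! w * cor η ! w Z.≤ + 2 →(root η ! w ≡ 1z)×(cor η ! w ≡ + 2)
     go(zero , x)(zero , y)_ = x , y
     go(zero , x)(suc k , y)h with subst₂(\ a b -> a * b Z.≤ + 2)x y h
     ... | Z.+≤+(s≤s(s≤s()))
     go(suc m , x)(k , y)h with subst₂(\ a b -> a * b Z.≤ + 2)x y h
     ... | Z.+≤+(s≤s(s≤s h')) = contra(ℕ.≤-trans(ℕ.m≤n+m 1 k)(ℕ.≤-trans(ℕ.+-monoʳ-≤ k(s≤s z≤n))h'))(\())
    others : ∀ i -> G i -> i ≢ w -> cor η ! i ≡ 0z
    others i gi i≢w with root η ! i Z.≟ 0z
    ... | yes z = cor-outside pη(dominant i gi)z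
    ... | no nz with signOf(cor η ! i)
    ... | zer z = z
    ... | neg n = contra(cor-nn(dominant i gi))(neg∧≥0 n)
    ... | pos q = contra(Z.≤-trans(Z.+-monoʳ-≤(+ 2)(pos⇒1≤(*-pos(≥0⇒pos(pη i)nz)q)))(subst₂(\ a b -> a ⊕ root η ! i * cor η ! i Z.≤ b)
      (cong₂ _*_(fst units)(snd units))(self η)(∙-terms(root η)(cor η)terms(i≢w ∘ sym))))(\{ (Z.+≤+(s≤s(s≤s())))})
    formula : ∀{μ} -> Supp μ -> ⟨ root μ , η ⟩ ≡ root μ ! w * + 2
    formula{μ} s = pairing-single others s ⨾ cong(root μ ! w *_)(snd units)
    Shape : Fin N -> Set
    Shape μ = root μ ! w ≡ 1z × ⟨ root μ , η ⟩ ≡ + 2 × ⟨ root η , μ ⟩ ≡ 1z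
    shape : ∀{μ} -> Pos μ -> Supp μ -> Positive(root μ ! w)-> μ ≢ η -> Shape μ
    shape{μ} pμ sμ(k , x)μ≢η = go k x(pair pμ pη μ≢η)where
     value : ∀ k -> root μ ! w ≡ Z.+[1+ k ] -> ⟨ root μ , η ⟩ ≡ Z.+[1+ k ] * + 2
     value k x = formula sμ ⨾ cong(_* + 2)x
     go : ∀ k -> root μ ! w ≡ Z.+[1+ k ] -> CartanPair ⟨ root μ , η ⟩ ⟨ root η , μ ⟩ -> Shape μ
     go k x(orth z _) = contra(sym(value k x)⨾ z)(\())
     go k x(obtuse _ _ z _ _ _ _) = contra(sym(value k x)⨾ z)(\())
     go k x(acute m n z z' o m≤2 _)with trans(sym(value k x))z
     go zero x(acute .1 n z z'(inl())m≤2 _) | refl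
     go zero x(acute .1 .0 z z'(inr refl)m≤2 _) | refl = x , z , z'
     go(suc k)x(acute _ n z z' o(s≤s(s≤s()))_) | refl
    -- The root 2η - μ pairs with ν in both directions as 2 minus a nonpositive number, hence is
    -- equal to ν.
    mirror : ∀{μ ν} -> Shape μ -> Shape ν -> ¬ Positive ⟨ root μ , ν ⟩ -> ∀ i -> root ν ! i ≡ + 2 * root η ! i ⊖ root μ ! i
    mirror{μ}{ν}(_ , μη , ημ)(_ , νη , ην)np i = cong(\ j -> root j ! i)(sym same)⨾ oppo-coef(rfl μ η)i ⨾
      cong ∼_(rfl-coef μ η i ⨾ cong(\ z -> root μ ! i ⊖ z * root η ! i)μη)⨾ solve 2(\ x y -> :-(x :- con(+ 2) :* y) := con(+ 2) :* y :- x)refl(root μ ! i)(root η ! i)where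
     μ' = opposite(rfl μ η)
     first = rfl-⟨⟩(rfl μ η)(rfl μ η)ν ⨾ cong(\ z -> ⟨ root(rfl μ η), ν ⟩ ⊖ z * ⟨ root(rfl μ η), ν ⟩)(self(rfl μ η))⨾
      cong(\ z -> z ⊖ + 2 * z)(rfl-⟨⟩ μ η ν ⨾ cong₂(\ x y -> ⟨ root μ , ν ⟩ ⊖ x * y)μη ην)⨾(solve 1(\ x →(x :- con(+ 2) :* con 1z) :- con(+ 2) :*(x :- con(+ 2) :* con 1z) := con(+ 2) :- x)refl ⟨ root μ , ν ⟩)
     second = ⟨⟩-oppo(root ν)(rfl μ η)⨾ cong ∼_(⟨⟩-rfl(root ν)μ η ⨾ cong₂(\ x y -> ⟨ root ν , μ ⟩ ⊖ x * y)νη ημ)⨾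
      (solve 1(\ x -> :-(x :- con(+ 2) :* con 1z) := con(+ 2) :- x)refl ⟨ root ν , μ ⟩)
     same = equal-of-large(subst(+ 2 Z.≤_)(sym first)(two≥(fst(np-sym np))))(subst(+ 2 Z.≤_)(sym second)(two≥(snd(np-sym np))))
    with-η : ∀{ν} -> Pos ν -> Supp ν -> Positive(root ν ! w)-> ν ≢ η -> Between w η ν
    with-η{ν} pν sν p ν≢η = let(a , b , c') = shape pν sν p ν≢η in between-acute pη pν(ν≢η ∘ sym)(0 , c')(fst units ⨾ sym a)
    good : Good w Id
    good μ ν iμ iν sμ sν p q μ≢ν with μ Fin.≟ η | ν Fin.≟ η
    ... | yes refl | yes refl = contra refl μ≢ν
    ... | yes refl | no ν≢η = with-η(Id-pos iν)sν q ν≢η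
    ... | no μ≢η | yes refl = between-sym(with-η(Id-pos iμ)sμ p μ≢η)
    ... | no μ≢η | no ν≢η with positive? ⟨ root μ , ν ⟩
    ... | yes acuteμν = between-acute(Id-pos iμ)(Id-pos iν)μ≢ν acuteμν(fst(shape(Id-pos iμ)sμ p μ≢η)⨾ sym(fst(shape(Id-pos iν)sν q ν≢η)))
    ... | no np = let(m , h) = diff(1 , fst(snd shμ))μ≢η in
      between-multiple{m = m}(+ 2)(1 , refl)(Id-pos iμ)(Id-pos iν)(\ i -> cong(+ 2 *_)(h i)⨾ solve 2(\ x y -> con(+ 2) :*(x :- y) := x :-(con(+ 2) :* y :- x))refl(root μ ! i)(root η ! i)⨾ cong(root μ ! i ⊖_)(sym(mirror shμ shν np i)))
       (fst shμ ⨾ sym(fst shν))where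
     shμ = shape(Id-pos iμ)sμ p μ≢η
     shν = shape(Id-pos iν)sν q ν≢η

 rfl-invol : ∀ j i -> rfl(rfl j(simple i))(simple i)≡ j
 rfl-invol j i = root-inj(ext(\ k -> rfl-simple(rfl j(simple i))i k ⨾ cong₂(\ x y -> x ⊖ y * unit i ! k)(rfl-simple j i k)(⟨⟩-rfl-self j i)⨾
   (solve 3(\ x a u →(x :- a :* u) :-(:- a) :* u := x)refl(root j ! k)⟨ root j , simple i ⟩(unit i ! k))))

 even-row : ∀{η} →(∀ j -> G j -> + 2 ∣ ⟨ root η , simple j ⟩)-> ∀ μ -> Pos μ -> Supp μ -> + 2 ∣ ⟨ root η , μ ⟩
 even-row{η} e = pos-induction(\ μ -> Supp μ -> + 2 ∣ ⟨ root η , μ ⟩)(\ i s -> e i(in-G s(\ z -> contra(sym(simple-at i)⨾ z)(\()))))step where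
  step : ∀ j i -> Pos j -> Pos(rfl j(simple i))-> Positive(root j ! i)-> Positive ⟨ root j , simple i ⟩ ->
      (Supp(rfl j(simple i))-> + 2 ∣ ⟨ root η , rfl j(simple i)⟩)-> Supp j -> + 2 ∣ ⟨ root η , j ⟩
  step j i _ _ p _ ih s = subst(\ k -> + 2 ∣ ⟨ root η , k ⟩)(rfl-invol j i)(subst(+ 2 ∣_)(sym(⟨⟩-rfl(root η)(rfl j(simple i))(simple i)))
   (∣m∣n⇒∣m-n(ih(supp-rfl s gi))(∣m⇒∣m*n ⟨ root(simple i), rfl j(simple i)⟩(e i gi))))
   where gi = in-G{j} s(pos⇒≢0 p)

 -- Types C: dually, the long root d has even Cartan numbers against everything.
 module _(Id : Fin N -> Set)(Id-pos : ∀{μ} -> Id μ -> Pos μ)where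

  caseC : ∀{c d} -> G c -> G d -> Negative(C d c)→(∀ j -> G j -> + 2 ∣ C d j)-> ∃ \ w -> G w × Good w Id
  caseC{c}{d} gc gd adjacent even = fromTop(top P? closed(simple d , start))where
   P : Fin N -> Set g
   P η = Pos η × Supp η ×(∀ j -> G j -> + 2 ∣ ⟨ root η , simple j ⟩)
   P? : ∀ η -> Dec(P η)
   P? η = pos? η ×-dec(supp? η ×-dec Fin.all?(\ j -> G? j →-dec((+ 2)∣? ⟨ root η , simple j ⟩)))
   closed : ∀{j i} -> P j -> G i -> Negative ⟨ root j , simple i ⟩ -> P(rfl j(simple i))
   closed{j}{i}(pj , sj , ej)gi n = rfl-pos pj(not-simple-of-neg n), supp-rfl sj gi , \ k gk ->
    subst(+ 2 ∣_)(sym(rfl-⟨⟩ j(simple i)(simple k)))(∣m∣n⇒∣m-n(ej k gk)(∣m⇒∣m*n ⟨ root(simple i), simple k ⟩(ej i gi)))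
   start = simple-pos d , supp-simple gd , \ j gj -> subst(+ 2 ∣_)(sym(C-root d j))(even j gj)
   fromTop : Top P -> ∃ \ w -> G w × Good w Id
   fromTop t = w , gw , good where
    open Top t
    pη = fst holds
    sη = fst(snd holds)
    eη = snd(snd holds)
    e = end pη
    w = fst e
    ηw>0 = fst(snd e)
    cw>0 = fst(snd(snd e))
    gw = in-G sη(pos⇒≢0 ηw>0)
    terms = dominant-terms pη sη dominant
    Shape : Fin N -> Set
    Shape μ = root μ ! w ≡ 1z × ⟨ root μ , η ⟩ ≡ 1z × ⟨ root η , μ ⟩ ≡ + 2
    two-one : ∀{μ} -> Pos μ -> Supp μ -> Positive ⟨ root μ , η ⟩ -> μ ≢ η -> ⟨ root μ , η ⟩ ≡ 1z × ⟨ root η , μ ⟩ ≡ + 2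
    two-one{μ} pμ sμ p μ≢η = go(pair pμ pη μ≢η)(even-pos(even-row eη μ pμ sμ)(symm-pos p))where
     go : CartanPair ⟨ root μ , η ⟩ ⟨ root η , μ ⟩ →(∃ \ k -> ⟨ root η , μ ⟩ ≡ +(2 + k))-> ⟨ root μ , η ⟩ ≡ 1z × ⟨ root η , μ ⟩ ≡ + 2
     go(orth z _)_ = contra z(pos⇒≢0 p)
     go(obtuse m _ z _ _ _ _)_ = contra(m , z)(pos∧neg p)
     go(acute m .0 z z'(inr refl)_ _)(k , x) = contra(sym z' ⨾ x)(\())
     go(acute .0 .0 z z'(inl refl)_ z≤n)(k , x) = contra(sym z' ⨾ x)(\())
     go(acute .0 .1 z z'(inl refl)_(s≤s z≤n))(k , x) = z , z'
     go(acute .0 .2 z z'(inl refl)_(s≤s(s≤s z≤n)))(k , x) = contra(subst(+ 2 ∣_)z'(even-row eη μ pμ sμ))three where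
      three : ¬ + 2 ∣ + 3
      three(divides(+ zero)())
      three(divides Z.+[1+ zero ]())
      three(divides Z.+[1+ suc k ]())
      three(divides -[1+ k ]())
    -- η is not simple, since the reflection of α_d in α_c belongs to the same family and is higher.
    -- Thus `two-one` applies to α_w and η and gives the value 1 below.
    η≢w = top-not-simple t(\{j} -> closed)start gc adjacent w
    cw≡1 = sym(cor-at w η)⨾ fst(two-one(simple-pos w)(supp-simple gw)(subst Positive(sym(cor-at w η))cw>0)(η≢w ∘ sym))
    pairing-terms : ∀{μ} -> Pos μ -> Supp μ -> ∀ i -> 0z Z.≤ root μ ! i * cor η ! i
    pairing-terms pμ sμ i with G? i
    ... | yes gi = ≥0*≥0(pμ i)(cor-nn(dominant i gi))
    ... | no ¬gi = Z.≤-reflexive(sym(0*ˡ(cor η ! i)(sμ i ¬gi)))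
    w-bound : ∀{μ} -> Pos μ -> Supp μ -> root μ ! w Z.≤ ⟨ root μ , η ⟩
    w-bound{μ} pμ sμ = subst(Z._≤ ⟨ root μ , η ⟩)(cong(root μ ! w *_)cw≡1 ⨾ Z.*-identityʳ _)(∙-term(root μ)(cor η)(pairing-terms pμ sμ)w)
    shape : ∀{μ} -> Pos μ -> Supp μ -> Positive(root μ ! w)-> μ ≢ η -> Shape μ
    shape{μ} pμ sμ p μ≢η = let(a , b) = two-one pμ sμ(1≤pos(Z.≤-trans(pos⇒1≤ p)(w-bound pμ sμ)))μ≢η in
     Z.≤-antisym(subst(root μ ! w Z.≤_)a(w-bound pμ sμ))(pos⇒1≤ p), a , b
    complement : ∀{μ ν} -> Shape μ -> Shape ν -> ¬ Positive ⟨ root μ , ν ⟩ -> ∀ i -> root ν ! i ≡ root η ! i ⊖ root μ ! i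
    complement{μ}{ν}(_ , μη , ημ)(_ , νη , ην)np i = cong(\ j -> root j ! i)(sym same)⨾ oppo-coef(rfl μ η)i ⨾
      cong ∼_(rfl-coef μ η i ⨾ cong(\ z -> root μ ! i ⊖ z * root η ! i)μη)⨾ solve 2(\ x y -> :-(x :- con 1z :* y) := y :- x)refl(root μ ! i)(root η ! i)where
     μ' = opposite(rfl μ η)
     first = rfl-⟨⟩(rfl μ η)(rfl μ η)ν ⨾ cong(\ z -> ⟨ root(rfl μ η), ν ⟩ ⊖ z * ⟨ root(rfl μ η), ν ⟩)(self(rfl μ η))⨾
      cong(\ z -> z ⊖ + 2 * z)(rfl-⟨⟩ μ η ν ⨾ cong₂(\ x y -> ⟨ root μ , ν ⟩ ⊖ x * y)μη ην)⨾(solve 1(\ x →(x :- con 1z :* con(+ 2)) :- con(+ 2) :*(x :- con 1z :* con(+ 2)) := con(+ 2) :- x)refl ⟨ root μ , ν ⟩)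
     second = ⟨⟩-oppo(root ν)(rfl μ η)⨾ cong ∼_(⟨⟩-rfl(root ν)μ η ⨾ cong₂(\ x y -> ⟨ root ν , μ ⟩ ⊖ x * y)νη ημ)⨾
      (solve 1(\ x -> :-(x :- con 1z :* con(+ 2)) := con(+ 2) :- x)refl ⟨ root ν , μ ⟩)
     same = equal-of-large(subst(+ 2 Z.≤_)(sym first)(two≥(fst(np-sym np))))(subst(+ 2 Z.≤_)(sym second)(two≥(snd(np-sym np))))
    ηw≤2 = subst(root η ! w Z.≤_)(self η)(w-bound pη sη)
    with-η : ∀{ν} -> Pos ν -> Supp ν -> Positive(root ν ! w)-> ν ≢ η -> Between w η ν
    with-η{ν} pν sν p ν≢η = go ηw>0 ηw≤2 where
     sh = shape pν sν p ν≢η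
     ην = snd(snd sh)
     go : Positive(root η ! w)-> root η ! w Z.≤ + 2 -> Between w η ν
     go(zero , x)_ = between-acute pη pν(ν≢η ∘ sym)(1 , ην)(x ⨾ sym(fst sh))
     go(suc(suc k), x)h with subst(Z._≤ + 2)x h
     ... | Z.+≤+(s≤s(s≤s()))
     -- If η_w = 2 then η - 2ν, a reflection of η, does not involve w. Should it be negative, its
     -- opposite is ν - (η - ν) and lies below ν, because η - ν is a positive root.
     go(suc zero , x)_ = build(sign m)where
      m = rfl η ν
      m-at : ∀ i -> root m ! i ≡ root η ! i ⊖ + 2 * root ν ! i
      m-at i = rfl-coef η ν i ⨾ cong(\ z -> root η ! i ⊖ z * root ν ! i)ην
      free = m-at w ⨾ cong₂(\ a b -> a ⊖ + 2 * b)x(fst sh)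
      rest = diff(1 , ην)(ν≢η ∘ sym)
      rest-pos = pos-coef(0 , snd rest w ⨾ cong₂ _⊖_ x(fst sh))
      build : NonNegative(root m)⊎ NonPositive(root m)-> Between w η ν
      build(inl pm) = record
       { δ = m; δ-pos = pm; δ-free = free
       ; δ-below = inl(\ i -> subst(Z._≤ root η ! i)(sym(m-at i))(subst(root η ! i ⊖ + 2 * root ν ! i Z.≤_)(Z.+-identityʳ _)(Z.+-monoʳ-≤(root η ! i)(Z.neg-mono-≤(≥0*≥0{+ 2}(Z.+≤+ z≤n)(pν i))))))
       ; s = 1z; p = 1z; q = -[1+ 1 ]; s≢0 = \()
       ; on-line = \ i -> Z.*-identityˡ _ ⨾ m-at i ⨾ solve 2(\ a b -> a :- con(+ 2) :* b := con 1z :* a :+ con -[1+ 1 ] :* b)refl(root η ! i)(root ν ! i)}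
      build(inr nm) = record
       { δ = opposite m; δ-pos = \ i -> subst(0z Z.≤_)(sym(oppo-coef m i))(Z.neg-mono-≤(nm i))
       ; δ-free = oppo-coef m w ⨾ cong ∼_ free
       ; δ-below = inr(\ i -> subst(Z._≤ root ν ! i)(sym(value i))(subst(root ν ! i ⊖ root(fst rest)! i Z.≤_)(Z.+-identityʳ _)(Z.+-monoʳ-≤(root ν ! i)(Z.neg-mono-≤(rest-pos i)))))
       ; s = 1z; p = -[1+ 0 ]; q = + 2; s≢0 = \()
       ; on-line = \ i -> Z.*-identityˡ _ ⨾ oppo-coef m i ⨾ cong ∼_(m-at i)⨾ solve 2(\ a b -> :-(a :- con(+ 2) :* b) := con -[1+ 0 ] :* a :+ con(+ 2) :* b)refl(root η ! i)(root ν ! i)} where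
       value : ∀ i -> root(opposite m)! i ≡ root ν ! i ⊖ root(fst rest)! i
       value i = oppo-coef m i ⨾ cong ∼_(m-at i)⨾ solve 2(\ a b -> :-(a :- con(+ 2) :* b) := b :-(a :- b))refl(root η ! i)(root ν ! i)⨾ cong(root ν ! i ⊖_)(sym(snd rest i))
    good : Good w Id
    good μ ν iμ iν sμ sν p q μ≢ν with μ Fin.≟ η | ν Fin.≟ η
    ... | yes refl | yes refl = contra refl μ≢ν
    ... | yes refl | no ν≢η = with-η(Id-pos iν)sν q ν≢η
    ... | no μ≢η | yes refl = between-sym(with-η(Id-pos iμ)sμ p μ≢η)
    ... | no μ≢η | no ν≢η with positive? ⟨ root μ , ν ⟩
    ... | yes acuteμν = between-acute(Id-pos iμ)(Id-pos iν)μ≢ν acuteμν(fst(shape(Id-pos iμ)sμ p μ≢η)⨾ sym(fst(shape(Id-pos iν)sν q ν≢η)))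
    ... | no np = between-sym(between-multiple{m = rfl η μ} 1z(0 , refl)(Id-pos iν)(Id-pos iμ)
       (\ i -> Z.*-identityˡ _ ⨾ rfl-coef η μ i ⨾ cong(\ z -> root η ! i ⊖ z * root μ ! i)(snd(snd shμ))⨾
        solve 2(\ x y -> x :- con(+ 2) :* y :=(x :- y) :- y)refl(root η ! i)(root μ ! i)⨾ cong(_⊖ root μ ! i)(sym(complement shμ shν np i)))
       (fst shν ⨾ sym(fst shμ)))where
     shμ = shape(Id-pos iμ)sμ p μ≢η
     shν = shape(Id-pos iν)sν q ν≢η

 module SimplyLaced(symmetric : ∀{i k} -> G i -> G k -> C i k ≡ C k i)where
  symm-simple = pos-induction(\ γ -> Supp γ -> ∀ j -> G j -> cor γ ! j ≡ ⟨ root γ , simple j ⟩)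
    (\ i s j gj -> cor-simple j i ⨾ symmetric gj(in-G s(\ z -> contra(sym(simple-at i)⨾ z)(\())))⨾ sym(C-root i j))step where
   step : ∀ γ i -> Pos γ -> Pos(rfl γ(simple i))-> Positive(root γ ! i)-> Positive ⟨ root γ , simple i ⟩ ->
       (Supp(rfl γ(simple i))-> ∀ j -> G j -> cor(rfl γ(simple i))! j ≡ ⟨ root(rfl γ(simple i)), simple j ⟩)->
       Supp γ -> ∀ j -> G j -> cor γ ! j ≡ ⟨ root γ , simple j ⟩
   step γ i _ _ p _ ih s j gj = subst(\ k -> cor k ! j ≡ ⟨ root k , simple j ⟩)(rfl-invol γ i)(begin
    cor(rfl γ'(simple i))! j ≡⟨ at-unit j(rfl γ'(simple i))⟨
    ⟨ unit j , rfl γ'(simple i)⟩ ≡⟨ ⟨⟩-rfl(unit j)γ'(simple i)⟩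
    ⟨ unit j , γ' ⟩ ⊖ C j i * ⟨ root(simple i), γ' ⟩ ≡⟨ cong₂(\ x y -> x ⊖ C j i * y)(at-unit j γ' ⨾ ih' j gj)(cor-at i γ' ⨾ ih' i gi)⟩
    ⟨ root γ' , simple j ⟩ ⊖ C j i * ⟨ root γ' , simple i ⟩ ≡⟨ cong(⟨ root γ' , simple j ⟩ ⊖_)(Z.*-comm(C j i)_ ⨾ cong(⟨ root γ' , simple i ⟩ *_)(symmetric gj gi ⨾ sym(C-root i j)))⟩
    ⟨ root γ' , simple j ⟩ ⊖ ⟨ root γ' , simple i ⟩ * ⟨ root(simple i), simple j ⟩ ≡⟨ rfl-⟨⟩ γ'(simple i)(simple j)⟨
    ⟨ root(rfl γ'(simple i)), simple j ⟩ ∎)where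
    open import Relation.Binary.PropositionalEquality using(module ≡-Reasoning)
    open ≡-Reasoning
    γ' = rfl γ(simple i)
    gi = in-G s(pos⇒≢0 p)
    ih' = ih(supp-rfl s gi)

  symm-roots : ∀{γ} -> Pos γ -> Supp γ -> ∀ β -> Pos β -> Supp β -> ⟨ root β , γ ⟩ ≡ ⟨ root γ , β ⟩
  symm-roots{γ} pγ sγ = pos-induction(\ β -> Supp β -> ⟨ root β , γ ⟩ ≡ ⟨ root γ , β ⟩)
    (\ i s -> cor-at i γ ⨾ symm-simple γ pγ sγ i(in-G s(\ z -> contra(sym(simple-at i)⨾ z)(\()))))step where
   step : ∀ β i -> Pos β -> Pos(rfl β(simple i))-> Positive(root β ! i)-> Positive ⟨ root β , simple i ⟩ ->
       (Supp(rfl β(simple i))-> ⟨ root(rfl β(simple i)), γ ⟩ ≡ ⟨ root γ , rfl β(simple i)⟩)-> Supp β -> ⟨ root β , γ ⟩ ≡ ⟨ root γ , β ⟩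
   step β i pβ pβ' p _ ih s = subst(\ k -> ⟨ root k , γ ⟩ ≡ ⟨ root γ , k ⟩)(rfl-invol β i)(rfl-⟨⟩ β'(simple i)γ ⨾
    cong₂ _⊖_(ih sβ')(cong₂ _*_(sym(symm-simple β' pβ' sβ' i gi)⨾ sym(cor-at i β'))(cor-at i γ ⨾ symm-simple γ pγ sγ i gi)⨾(Z.*-comm ⟨ root(simple i), β' ⟩ _))⨾
     sym(⟨⟩-rfl(root γ)β'(simple i)))where
    β' = rfl β(simple i)
    gi = in-G s(pos⇒≢0 p)
    sβ' = supp-rfl s gi

  pair-one : ∀{β γ} -> Pos β -> Supp β -> Pos γ -> Supp γ -> β ≢ γ -> Positive ⟨ root β , γ ⟩ -> ⟨ root β , γ ⟩ ≡ 1z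
  pair-one{β}{γ} pβ sβ pγ sγ β≢γ p with pair pβ pγ β≢γ
  ... | orth z _ = contra z(pos⇒≢0 p)
  ... | obtuse m _ z _ _ _ _ = contra(m , z)(pos∧neg p)
  ... | acute .0 _ z _(inl refl)_ _ = z
  ... | acute _ .0 _ z(inr refl)_ _ = symm-roots{γ} pγ sγ β pβ sβ ⨾ z

  -- Types A: if θ = w₁ + … + w₂ is orthogonal to the other simple roots, two roots through w₁ with nonpositive
  -- product would make θ - μ - ν a root with coefficients of both signs.
  two-ends : ∀{θ w1 w2} -> Pos θ -> Supp θ -> root θ ! w1 ≡ 1z -> root θ ! w2 ≡ 1z →(Rel : Fin N -> Set g)->
        (∀{μ} -> Rel μ -> Pos μ × Supp μ)→(∀{μ} -> Rel μ -> ⟨ root μ , θ ⟩ ≡ root μ ! w1 ⊕ root μ ! w2)->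
        ∀ μ ν -> Rel μ -> Rel ν -> Positive(root μ ! w1)-> Positive(root ν ! w1)-> μ ≢ ν -> Between w1 μ ν
  two-ends{θ}{w1}{w2} pθ sθ θ1 θ2 Rel rel formula = \ μ ν rμ rν p q μ≢ν -> go μ ν rμ rν p q μ≢ν(μ Fin.≟ θ)(ν Fin.≟ θ)(positive? ⟨ root μ , ν ⟩)where
   split-one : ∀{x y} -> Positive x -> 0z Z.≤ y -> x ⊕ y ≡ 1z -> x ≡ 1z × y ≡ 0z
   split-one{Z.+[1+ zero ]}{+ zero} _ _ _ = refl , refl
   split-one{Z.+[1+ suc k ]}{+ n} _ _()
   split-one{Z.+[1+ zero ]}{Z.+[1+ n ]} _ _()
   split-one{+ zero}(_ ,())
   shape : ∀{μ} -> Rel μ -> Positive(root μ ! w1)-> μ ≢ θ -> ⟨ root μ , θ ⟩ ≡ 1z × root μ ! w1 ≡ 1z × root μ ! w2 ≡ 0z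
   shape{μ} rμ p μ≢θ = one , split-one p(pμ w2)(sym(formula rμ)⨾ one)where
    pμ = fst(rel rμ)
    sμ = snd(rel rμ)
    positive = subst Positive(sym(formula rμ))(1≤pos(subst(Z._≤ root μ ! w1 ⊕ root μ ! w2)(Z.+-identityʳ 1z)(Z.+-mono-≤(pos⇒1≤ p)(pμ w2))))
    one = pair-one pμ sμ pθ sθ μ≢θ positive
   with-θ : ∀{ν} -> Rel ν -> Positive(root ν ! w1)-> ν ≢ θ -> Between w1 ν θ
   with-θ{ν} rν q ν≢θ = let(a , b , _) = shape rν q ν≢θ in between-acute(fst(rel rν))pθ ν≢θ(0 , a)(b ⨾ sym θ1)
   go : ∀ μ ν -> Rel μ -> Rel ν -> Positive(root μ ! w1)-> Positive(root ν ! w1)-> μ ≢ ν -> Dec(μ ≡ θ)-> Dec(ν ≡ θ)-> Dec(Positive ⟨ root μ , ν ⟩)-> Between w1 μ ν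
   go μ ν rμ rν p q μ≢ν(yes e)(yes e')_ = contra(e ⨾ sym e')μ≢ν
   go μ ν rμ rν p q μ≢ν(yes refl)(no ν≢θ)_ = between-sym(with-θ rν q ν≢θ)
   go μ ν rμ rν p q μ≢ν(no μ≢θ)(yes refl)_ = with-θ rμ p μ≢θ
   go μ ν rμ rν p q μ≢ν(no μ≢θ)(no ν≢θ)(yes angle) = between-acute(fst(rel rμ))(fst(rel rν))μ≢ν angle
    (fst(snd(shape rμ p μ≢θ))⨾ sym(fst(snd(shape rν q ν≢θ))))
   go μ ν rμ rν p q μ≢ν(no μ≢θ)(no ν≢θ)(no np) = ⊥-elim(no-mixed{fst ζν}{w2}{w1}
     (0 , snd ζν w2 ⨾ cong₂ _⊖_(snd ζ w2 ⨾ cong₂ _⊖_ θ2(snd(snd shμ)))(snd(snd shν))⨾ refl)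
     (0 , snd ζν w1 ⨾ cong₂ _⊖_ ζ1(fst(snd shν))))where
    shμ = shape rμ p μ≢θ
    shν = shape rν q ν≢θ
    θμ = symm-roots(fst(rel rμ))(snd(rel rμ))θ pθ sθ ⨾ fst shμ
    θν = symm-roots(fst(rel rν))(snd(rel rν))θ pθ sθ ⨾ fst shν
    ζ = diff(0 , θμ)(μ≢θ ∘ sym)
    ζ1 = snd ζ w1 ⨾ cong₂ _⊖_ θ1(fst(snd shμ))
    positive = subst Positive(sym(⟨⟩-of-diff(snd ζ)ν ⨾ cong(_⊖ ⟨ root μ , ν ⟩)θν))
     (1≤pos(subst(Z._≤ 1z ⊖ ⟨ root μ , ν ⟩)(Z.+-identityʳ 1z)(Z.+-monoʳ-≤ 1z(Z.neg-mono-≤(fst(np-sym np))))))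
    ζν = diff positive(\ e -> contra(sym ζ1 ⨾ cong(\ j -> root j ! w1)e ⨾ fst(snd shν))(\()))

-- Bounding a pairing by a few of its terms.

module Erase where
 open import Data.Integer.Base using(_*_)renaming(_+_ to _⊕_; _-_ to _⊖_; -_ to ∼_)

 infixl 8 _∖_
 _∖_ : ∀{n} -> Vec ℤ n -> Fin n -> Vec ℤ n
 (x ∷ p)∖ zero = 0z ∷ p
 (x ∷ p)∖ suc i = x ∷ p ∖ i

 ∖-at : ∀{n}(x : Vec ℤ n)i →(x ∖ i)! i ≡ 0z
 ∖-at(x ∷ p)zero = refl
 ∖-at(x ∷ p)(suc i) = ∖-at p i

 ∖-off : ∀{n}(x : Vec ℤ n){i k} -> k ≢ i →(x ∖ i)! k ≡ x ! k
 ∖-off(x ∷ p){zero}{zero} h = contra refl h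
 ∖-off(x ∷ p){zero}{suc k} h = refl
 ∖-off(x ∷ p){suc i}{zero} h = refl
 ∖-off(x ∷ p){suc i}{suc k} h = ∖-off p(h ∘ cong suc)

 ∙-∖ : ∀{n}(x y : Vec ℤ n)i -> x ∙ y ≡ x ! i * y ! i ⊕(x ∖ i)∙ y
 ∙-∖(x ∷ p)(y ∷ q)zero = cong(x * y ⊕_)(sym(Z.+-identityˡ(p ∙ q)))
 ∙-∖(x ∷ p)(y ∷ q)(suc i) = cong(x * y ⊕_)(∙-∖ p q i)⨾ sym(Z.+-assoc(x * y)(p ! i * q ! i)(p ∖ i ∙ q))⨾
  cong(_⊕ p ∖ i ∙ q)(Z.+-comm(x * y)(p ! i * q ! i))⨾ Z.+-assoc(p ! i * q ! i)(x * y)(p ∖ i ∙ q)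

 ∙-mono : ∀{n}(x y x′ y′ : Vec ℤ n)→(∀ i -> x ! i * y ! i Z.≤ x′ ! i * y′ ! i)-> x ∙ y Z.≤ x′ ∙ y′
 ∙-mono [] [] [] [] h = Z.≤-refl
 ∙-mono(x ∷ p)(y ∷ q)(x′ ∷ p')(y′ ∷ q')h = Z.+-mono-≤(h zero)(∙-mono p q p' q'(h ∘ suc))

 ∙-≡ : ∀{n}(x y x′ y′ : Vec ℤ n)→(∀ i -> x ! i * y ! i ≡ x′ ! i * y′ ! i)-> x ∙ y ≡ x′ ∙ y′
 ∙-≡ x y x′ y′ h = Z.≤-antisym(∙-mono x y x′ y′(\ i -> Z.≤-reflexive(h i)))(∙-mono x′ y′ x y(\ i -> Z.≤-reflexive(sym(h i))))

 ∙≤0 : ∀{n}(x y : Vec ℤ n)→(∀ i -> x ! i * y ! i Z.≤ 0z)-> x ∙ y Z.≤ 0z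
 ∙≤0 [] [] h = Z.≤-refl
 ∙≤0(x ∷ p)(y ∷ q)h = Z.+-mono-≤(h zero)(∙≤0 p q(h ∘ suc))

 by-index : ∀{n p}{P : Fin n -> Set p} i -> P i →(∀ k -> k ≢ i -> P k)-> ∀ k -> P k
 by-index{P = P} i at off k with k Fin.≟ i
 ... | yes e = subst P(sym e)at
 ... | no h = off k h

 ∖-np : ∀{n}(x y : Vec ℤ n)i →(∀ k -> k ≢ i -> x ! k * y ! k Z.≤ 0z)-> ∀ k →(x ∖ i)! k * y ! k Z.≤ 0z
 ∖-np x y i h = by-index i(Z.≤-reflexive(0*ˡ(y ! i)(∖-at x i)))(\ k k≢i -> subst(\ z -> z * y ! k Z.≤ 0z)(sym(∖-off x k≢i))(h k k≢i))

 ∙-bound : ∀{n}(x y : Vec ℤ n)i →(∀ k -> k ≢ i -> x ! k * y ! k Z.≤ 0z)-> x ∙ y Z.≤ x ! i * y ! i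
 ∙-bound x y i h = subst₂ Z._≤_(sym(∙-∖ x y i))(Z.+-identityʳ _)(Z.+-monoʳ-≤(x ! i * y ! i)(∙≤0(x ∖ i)y(∖-np x y i h)))

 ∙-bound2 : ∀{n}(x y : Vec ℤ n){i j} -> i ≢ j →(∀ k -> k ≢ i -> k ≢ j -> x ! k * y ! k Z.≤ 0z)-> x ∙ y Z.≤ x ! i * y ! i ⊕ x ! j * y ! j
 ∙-bound2 x y{i}{j} i≢j h = subst(Z._≤ x ! i * y ! i ⊕ x ! j * y ! j)(sym(∙-∖ x y i))(Z.+-monoʳ-≤(x ! i * y ! i)
  (subst(\ z →(x ∖ i)∙ y Z.≤ z * y ! j)(∖-off x(i≢j ∘ sym))(∙-bound(x ∖ i)y j(\ k k≢j -> by-index{P = \ k -> k ≢ j →(x ∖ i)! k * y ! k Z.≤ 0z} i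
   (\ _ -> Z.≤-reflexive(0*ˡ(y ! i)(∖-at x i)))(\ k k≢i k≢j -> subst(\ z -> z * y ! k Z.≤ 0z)(sym(∖-off x k≢i))(h k k≢i k≢j))k k≢j))))

 ∙-bound3 : ∀{n}(x y : Vec ℤ n){i j l} -> i ≢ j -> i ≢ l -> j ≢ l →(∀ k -> k ≢ i -> k ≢ j -> k ≢ l -> x ! k * y ! k Z.≤ 0z)->
       x ∙ y Z.≤ x ! i * y ! i ⊕(x ! j * y ! j ⊕ x ! l * y ! l)
 ∙-bound3 x y{i}{j}{l} i≢j i≢l j≢l h = subst(Z._≤ x ! i * y ! i ⊕(x ! j * y ! j ⊕ x ! l * y ! l))(sym(∙-∖ x y i))(Z.+-monoʳ-≤(x ! i * y ! i)
  (subst₂(\ z z' →(x ∖ i)∙ y Z.≤ z * y ! j ⊕ z' * y ! l)(∖-off x(i≢j ∘ sym))(∖-off x(i≢l ∘ sym))(∙-bound2(x ∖ i)y j≢l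
   (\ k k≢j k≢l -> by-index{P = \ k -> k ≢ j -> k ≢ l →(x ∖ i)! k * y ! k Z.≤ 0z} i
    (\ _ _ -> Z.≤-reflexive(0*ˡ(y ! i)(∖-at x i)))(\ k k≢i k≢j k≢l -> subst(\ z -> z * y ! k Z.≤ 0z)(sym(∖-off x k≢i))(h k k≢i k≢j k≢l))k k≢j k≢l))))

 negative-term : ∀{n}(x y : Vec ℤ n)-> Negative(x ∙ y)-> ∃ \ k -> Negative(x ! k * y ! k)
 negative-term x y n with Fin.any?(\ k -> negative?(x ! k * y ! k))where
  negative? : ∀ x -> Dec(Negative x)
  negative?(+ _) = no \()
  negative? -[1+ k ] = yes(k , refl)
 ... | yes h = h
 ... | no none = contra(∙-nn x y nn)(neg∧≥0 n)where
  nn : ∀ i -> 0z Z.≤ x ! i * y ! i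
  nn i with signOf(x ! i * y ! i)
  ... | pos p = pos⇒≥0 p
  ... | zer z = Z.≤-reflexive(sym z)
  ... | neg m = contra(i , m)none

open Erase

-- Good simple roots in the simply laced case.

module SimplyLacedCase{r N}(RD : RootDatum r N){G : Fin r -> Set}(G? : ∀ i -> Dec(G i))
  (Id : Fin N -> Set)(Id? : ∀ j -> Dec(Id j))(Id-pos : ∀{j} -> Id j -> Roots.Pos RD j)
  (Id-down : ∀{j k} -> Id j -> Roots.Pos RD k →(∀ i -> RootDatum.root RD k ! i Z.≤ RootDatum.root RD j ! i)-> Id k)
  (laced : ∀{i k} -> G i -> G k -> i ≢ k -> Roots.C RD i k ≡ 0z ⊎ Roots.C RD i k ≡ -[1+ 0 ])where
 open Roots RD
 open Cases RD G?
 open import Data.Integer.Base using(_*_)renaming(_+_ to _⊕_; _-_ to _⊖_; -_ to ∼_)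
 open import Data.Integer.Solver using(module +-*-Solver)
 open +-*-Solver using(solve; _:=_; _:+_; _:*_; _:-_; :-_; con)

 C-symm : ∀{i k} -> G i -> G k -> C i k ≡ C k i
 C-symm{i}{k} gi gk with i Fin.≟ k
 ... | yes refl = refl
 ... | no i≢k with laced gi gk i≢k | laced gk gi(i≢k ∘ sym)
 ... | inl a | _ = a ⨾ sym(C-zero-sym{i}{k} a)
 ... | inr a | inr b = a ⨾ sym b
 ... | inr a | inl b = contra(sym(C-zero-sym{k}{i} b)⨾ a)(\())

 open SimplyLaced C-symm

 pair-minus-one : ∀{β γ} -> Pos β -> Supp β -> Pos γ -> Supp γ -> Negative ⟨ root β , γ ⟩ -> ⟨ root β , γ ⟩ ≡ -[1+ 0 ]
 pair-minus-one{β}{γ} pβ sβ pγ sγ n with β Fin.≟ γ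
 ... | yes refl = contra(sym(self β)⨾ snd n)(\())
 ... | no β≢γ with pair pβ pγ β≢γ
 ... | orth z _ = contra(sym z ⨾ snd n)(\())
 ... | acute m _ z _ _ _ _ = contra n(pos∧neg(m , z))
 ... | obtuse .0 _ z _(inl refl)_ _ = z
 ... | obtuse _ .0 _ z(inr refl)_ _ = symm-roots pγ sγ β pβ sβ ⨾ z

 simple-minus-one : ∀{β i} -> Pos β -> Supp β -> G i -> Negative ⟨ root β , simple i ⟩ -> ⟨ root β , simple i ⟩ ≡ -[1+ 0 ]
 simple-minus-one{β}{i} pβ sβ gi = pair-minus-one pβ sβ(simple-pos i)(supp-simple gi)

 term-np : ∀{j i k} -> Pos j -> k ≢ i -> root j ! k * cor(simple i)! k Z.≤ 0z
 term-np{j}{i}{k} pj k≢i = ≥0*≤0(pj k)(subst(Z._≤ 0z)(at-unit k(simple i))(C-np k≢i))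

 -- Outside the support a pairing with a simple root is a sum of nonpositive terms; if the total is
 -- not negative, no node of the support can be adjacent.
 separated : ∀{j i k} -> Pos j -> root j ! i ≡ 0z -> 0z Z.≤ ⟨ root j , simple i ⟩ -> root j ! k ≢ 0z -> C k i ≡ 0z
 separated{j}{i}{k} pj z h nz with signOf(C k i)
 ... | zer e = e
 ... | pos p = contra(C-np{k}{i}(\{ refl -> nz z }))(pos∧≤0 p)
 ... | neg n = contra(Z.≤-trans h(∙-bound(root j)(cor(simple i))k(\ l _ -> by-index{P = \ l -> root j ! l * cor(simple i)! l Z.≤ 0z} i
   (Z.≤-reflexive(0*ˡ(cor(simple i)! i)z))(\ l l≢i -> term-np pj l≢i)l)))
   (neg∧≥0(*-posneg(≥0⇒pos(pj k)nz)(subst Negative(at-unit k(simple i))n)))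

 Isolated : Fin r -> Set
 Isolated w = ∀ i -> G i -> i ≢ w -> C i w ≡ 0z

 -- A root μ on G involving an isolated w pairs with α_w as 2 μ_w, in both directions by symmetry,
 -- so it is α_w; there are no two distinct roots to compare.
 isolated-good : ∀{w} -> G w -> Isolated w -> Good w Id
 isolated-good{w} gw iso μ ν iμ iν sμ sν p q μ≢ν = contra(is-simple(Id-pos iμ)sμ p ⨾ sym(is-simple(Id-pos iν)sν q))μ≢ν where
  is-simple : ∀{μ} -> Pos μ -> Supp μ -> Positive(root μ ! w)-> μ ≡ simple w
  is-simple{μ} pμ sμ p = equal-of-large large(subst(+ 2 Z.≤_)(sym(symm-roots pμ sμ(simple w)(simple-pos w)(supp-simple gw)))large)where
   value = pairing-single(\ i gi i≢w -> cor-simple i w ⨾ iso i gi i≢w)sμ ⨾ cong(root μ ! w *_)(cor-simple w w ⨾ C-self w)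
   doubled : ∀{x} -> Positive x -> + 2 Z.≤ x * + 2
   doubled(k , refl) = Z.+≤+(s≤s(s≤s z≤n))
   large = subst(+ 2 Z.≤_)(sym value)(doubled p)

 -- A dominant root θ (on the set of simple roots H ⊆ G) is simple, or has one end of coefficient 2, or two ends.
 data Ends(H : Fin r -> Set)(θ : Fin N) : Set where
  simple-end : ∀ w -> θ ≡ simple w -> G w →(∀ i -> H i -> i ≢ w -> cor θ ! i ≡ 0z)-> Ends H θ
  one-end : ∀ w -> root θ ! w ≡ + 2 →(∀ i -> H i -> i ≢ w -> cor θ ! i ≡ 0z)-> Ends H θ
  two-ends' : ∀ w1 w2 -> w1 ≢ w2 -> root θ ! w1 ≡ 1z -> root θ ! w2 ≡ 1z -> cor θ ! w1 ≡ 1z -> cor θ ! w2 ≡ 1z ->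
         (∀ i -> H i -> i ≢ w1 -> i ≢ w2 -> cor θ ! i ≡ 0z)-> Ends H θ

 -- The number 2 = Σ θ_i ⟨α_i, θ^∨⟩ is a sum of nonnegative integers, so it arises as 1·2, as 2·1 or
 -- as 1·1 + 1·1; these are the three cases.
 ends : ∀{H : Fin r -> Set} →(∀ i -> Dec(H i))-> ∀{θ} -> Pos θ -> Supp θ →(∀ i -> ¬ H i -> root θ ! i ≡ 0z)→(∀ i -> H i -> 0z Z.≤ ⟨ root θ , simple i ⟩)-> Ends H θ
 ends{H} H?{θ} pθ sθ hθ dom = first(end pθ)where
  x = root θ
  y = cor θ
  terms : ∀ i -> 0z Z.≤ x ! i * y ! i
  terms i with H? i
  ... | yes h = ≥0*≥0(pθ i)(cor-nn(dom i h))
  ... | no h = Z.≤-reflexive(sym(0*ˡ(y ! i)(hθ i h)))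
  vanish : ∀ i -> H i -> x ! i * y ! i Z.≤ 0z -> y ! i ≡ 0z
  vanish i hi h with x ! i Z.≟ 0z
  ... | yes z = cor-outside pθ(dom i hi)z
  ... | no nz with signOf(y ! i)
  ... | zer z = z
  ... | neg n = contra(cor-nn(dom i hi))(neg∧≥0 n)
  ... | pos p = contra h(pos∧≤0(*-pos(≥0⇒pos(pθ i)nz)p))
  rest : Fin r -> Vec ℤ r
  rest w = x ∖ w
  rest-terms : ∀ w i -> 0z Z.≤ rest w ! i * y ! i
  rest-terms w = by-index w(Z.≤-reflexive(sym(0*ˡ(y ! w)(∖-at x w))))(\ i i≢w -> subst(\ z -> 0z Z.≤ z * y ! i)(sym(∖-off x i≢w))(terms i))
  total : ∀ w{n} -> x ! w * y ! w ≡ n -> rest w ∙ y ≡ + 2 ⊖ n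
  total w{n} e = solve 2(\ a b -> b :=(a :+ b) :- a)refl n(rest w ∙ y)⨾ cong(_⊖ n)(cong(_⊕ rest w ∙ y)(sym e)⨾ sym(∙-∖ x y w)⨾ self θ)
  rest-vanish : ∀ w -> x ! w * y ! w ≡ + 2 -> ∀ i -> H i -> i ≢ w -> y ! i ≡ 0z
  rest-vanish w e i hi i≢w = vanish i hi(subst₂(\ z t -> z * y ! i Z.≤ t)(∖-off x i≢w)(total w e)(∙-term(rest w)y(rest-terms w)i))
  value : ∀ w -> x ! w * y ! w Z.≤ + 2
  value w = subst(x ! w * y ! w Z.≤_)(self θ)(∙-term x y terms w)
  small : ∀{a b} -> Positive a -> Positive b -> a * b Z.≤ + 2 →(a ≡ 1z × b ≡ 1z)⊎(a ≡ 1z × b ≡ + 2)⊎(a ≡ + 2 × b ≡ 1z)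
  small(zero , refl)(zero , refl)_ = inl(refl , refl)
  small(zero , refl)(suc zero , refl)_ = inr(inl(refl , refl))
  small(suc zero , refl)(zero , refl)_ = inr(inr(refl , refl))
  small(zero , refl)(suc(suc l), refl)(Z.+≤+(s≤s(s≤s())))
  small(suc(suc k), refl)(zero , refl)(Z.+≤+(s≤s(s≤s())))
  small(suc k , refl)(suc l , refl)(Z.+≤+(s≤s(s≤s h))) = contra(ℕ.≤-trans(ℕ.≤-trans(s≤s z≤n)(ℕ.m≤n+m _ l))h)(\())
  second : ∀ w -> x ! w ≡ 1z -> y ! w ≡ 1z →(∃ \ k -> k ≢ w × Positive(x ! k)× Positive(y ! k))-> Ends H θ
  second w xw yw(k , k≢w , p , q)with small p q(value k)
  ... | inl(xk , yk) = two-ends' w k(k≢w ∘ sym)xw xk yw yk(\ i hi i≢w i≢k -> vanish i hi(bound i i≢w i≢k))where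
   one = total w(cong₂ _*_ xw yw)
   bound : ∀ i -> i ≢ w -> i ≢ k -> x ! i * y ! i Z.≤ 0z
   bound i i≢w i≢k = subst₂(\ a b -> a Z.≤ b)(solve 1(\ t -> con -[1+ 0 ] :+(con 1z :+ t) := t)refl(x ! i * y ! i))refl
    (Z.+-monoʳ-≤ -[1+ 0 ](subst₂ Z._≤_(cong₂ _⊕_(cong₂ _*_(∖-off x k≢w ⨾ xk)yk)(cong(_* y ! i)(∖-off x i≢w)))one(∙-terms(rest w)y(rest-terms w)(i≢k ∘ sym))))
  ... | inr(inl(xk , yk)) = contra(subst₂ Z._≤_(cong₂ _⊕_(cong₂ _*_ xw yw)(cong₂ _*_ xk yk))(self θ)(∙-terms x y terms(k≢w ∘ sym)))(\{ (Z.+≤+(s≤s(s≤s())))})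
  ... | inr(inr(xk , yk)) = contra(subst₂ Z._≤_(cong₂ _⊕_(cong₂ _*_ xw yw)(cong₂ _*_ xk yk))(self θ)(∙-terms x y terms(k≢w ∘ sym)))(\{ (Z.+≤+(s≤s(s≤s())))})
  find : ∀ w -> x ! w ≡ 1z -> y ! w ≡ 1z -> ∃ \ k -> k ≢ w × Positive(x ! k)× Positive(y ! k)
  find w xw yw with Fin.any?(\ k -> ¬?(k Fin.≟ w)×-dec(positive?(x ! k)×-dec positive?(y ! k)))
  ... | yes h = h
  ... | no none = contra(sym(total w(cong₂ _*_ xw yw))⨾ ∙-zero(rest w)y(by-index w(0*ˡ(y ! w)(∖-at x w))zeros))(\())where
   zeros : ∀ k -> k ≢ w -> rest w ! k * y ! k ≡ 0z
   zeros k k≢w with signOf(x ! k) | signOf(y ! k)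
   ... | zer z | _ = 0*ˡ(y ! k)(∖-off x k≢w ⨾ z)
   ... | neg n | _ = contra(pθ k)(neg∧≥0 n)
   ... | pos p | pos q = contra(k , k≢w , p , q)none
   ... | pos p | zer z = cong(rest w ! k *_)z ⨾ Z.*-zeroʳ(rest w ! k)
   ... | pos p | neg n = contra(terms k)(neg∧≥0(*-posneg p n))
  first :(∃ \ w -> Positive(x ! w)× Positive(y ! w)× Positive ⟨ root θ , simple w ⟩)-> Ends H θ
  first(w , p , q , q')with small p q(value w)
  ... | inl(xw , yw) = second w xw yw(find w xw yw)
  ... | inr(inl(xw , yw)) = simple-end w(equal-of-large(Z.≤-reflexive(sym(sym(symm-simple θ pθ sθ w gw)⨾ yw)))
    (Z.≤-reflexive(sym(cor-at w θ ⨾ yw))))gw(rest-vanish w(cong₂ _*_ xw yw))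
   where gw = in-G{θ} sθ(pos⇒≢0 p)
  ... | inr(inr(xw , yw)) = one-end w xw(rest-vanish w(cong₂ _*_ xw yw))

 record Branch : Set where
  field
   u x y z : Fin r
   gu : G u
   gx : G x
   gy : G y
   gz : G z
   x≢u : x ≢ u
   y≢u : y ≢ u
   z≢u : z ≢ u
   x≢y : x ≢ y
   x≢z : x ≢ z
   y≢z : y ≢ z
   xu : C x u ≡ -[1+ 0 ]
   yu : C y u ≡ -[1+ 0 ]
   zu : C z u ≡ -[1+ 0 ]

 simple-sum : ∀{i k} -> C i k ≡ -[1+ 0 ] -> ∀ l -> root(rfl(simple i)(simple k))! l ≡ unit i ! l ⊕ unit k ! l
 simple-sum{i}{k} e l = rfl-simple(simple i)k l ⨾ cong₂(\ a b -> a ! l ⊖ b * unit k ! l)(root-simple i)(C-root i k ⨾ e)⨾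
  solve 2(\ a b -> a :- con -[1+ 0 ] :* b := a :+ b)refl(unit i ! l)(unit k ! l)

 -- Two neighbours of a node are not adjacent, since a triangle is not definite.
 no-triangle : ∀{u x y} -> G u -> G x -> G y -> x ≢ u -> y ≢ u -> x ≢ y -> C x u ≡ -[1+ 0 ] -> C y u ≡ -[1+ 0 ] -> C x y ≡ 0z
 no-triangle{u}{x}{y} gu gx gy x≢u y≢u x≢y xu yu with laced gx gy x≢y
 ... | inl e = e
 ... | inr e = ⊥-elim(not-very-obtuse{m}{simple y} pm(simple-pos y)(Z.≤-reflexive value)(Z.≤-reflexive(symm-roots{m} pm sm(simple y)(simple-pos y)(supp-simple gy)⨾ value)))where
  ux = C-symm gu gx ⨾ xu
  m = rfl(simple u)(simple x)
  pm : Pos m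
  pm = rfl-pos(simple-pos u)(x≢u ∘ sym ∘ simple-inj)
  sm : Supp m
  sm = supp-rfl{simple u}(supp-simple gu)gx
  value : ⟨ root m , simple y ⟩ ≡ -[1+ 1 ]
  value = rfl-⟨⟩(simple u)(simple x)(simple y)⨾ cong₂ _⊖_(C-root u y ⨾ C-symm gu gy ⨾ yu)(cong₂ _*_(C-root u x ⨾ ux)(C-root x y ⨾ e))⨾ refl

 open import Relation.Nullary.Decidable using(_→-dec_)

 -- With y removed, let θ be the highest root on H that involves u. If it has two ends, one of them
 -- is good for all of G: roots of the ideal that prevent this must pass through u and y, hence
 -- avoid x, because the ideal does not contain u + x + y.
 module Avoiding(B : Branch)(mxy : Fin N)(mxy-root : ∀ l -> root mxy ! l ≡ unit(Branch.u B)! l ⊕(unit(Branch.x B)! l ⊕ unit(Branch.y B)! l))(avoids : ¬ Id mxy)where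
  open Branch B

  H : Fin r -> Set
  H i = G i × i ≢ y
  H? : ∀ i -> Dec(H i)
  H? i = G? i ×-dec ¬?(i Fin.≟ y)

  module CH = Cases RD H?

  P : Fin N -> Set
  P η = Pos η × CH.Supp η × Positive(root η ! u)

  H-supp : ∀{j} -> CH.Supp j -> Supp j
  H-supp s i ¬g = s i(\ h -> ¬g(fst h))

  closed : ∀{j i} -> P j -> H i -> Negative ⟨ root j , simple i ⟩ -> P(rfl j(simple i))
  closed{j}{i}(pj , sj , p)hi n = rfl-pos pj(not-simple-of-neg n), CH.supp-rfl sj hi , grow(u Fin.≟ i)where
   grow : Dec(u ≡ i)-> Positive(root(rfl j(simple i))! u)
   grow(yes refl) = subst Positive(sym(rfl-at j i))(increase p n)where
    increase : ∀{a b} -> Positive a -> Negative b -> Positive(a ⊖ b)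
    increase(k , refl)(l , refl) = _ , refl
   grow(no u≢i) = subst Positive(sym(rfl-off u≢i))p

  conclude : CH.Top P -> ∃ \ w -> G w × Good w Id
  conclude t = by-ends(ends H? pθ sθ sHθ dominant)where
   open CH.Top t renaming(η to θ)
   pθ = fst holds
   sHθ = fst(snd holds)
   sθ = H-supp sHθ
   θu>0 = snd(snd holds)
   θy≡0 = sHθ y(\ h -> snd h refl)
   uy = C-symm gu gy ⨾ yu
   ux = C-symm gu gx ⨾ xu
   uz = C-symm gu gz ⨾ zu
   θ-term : ∀{i k} -> k ≢ i -> root θ ! k * cor(simple i)! k Z.≤ 0z
   θ-term = term-np pθ
   neighbour : ∀{i} -> C u i ≡ -[1+ 0 ] -> root θ ! i ≡ 0z -> Negative ⟨ root θ , simple i ⟩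
   neighbour{i} ui z = ≤-1⇒neg(Z.≤-trans(∙-bound(root θ)(cor(simple i))u(\ k _ -> by-index{P = \ k -> root θ ! k * cor(simple i)! k Z.≤ 0z} i(Z.≤-reflexive(0*ˡ _ z))(\ k k≢i -> θ-term k≢i)k))
    (neg⇒≤-1(*-posneg θu>0(0 , cor-simple u i ⨾ ui))))
   -- As y is a neighbour of u outside the support, the pairing is -1. The node u alone accounts for
   -- it, so θ_u = 1 and y has no other neighbour in the support of θ.
   yθ = simple-minus-one pθ sθ gy(neighbour uy θy≡0)
   y-term = by-index y(Z.≤-reflexive(0*ˡ _ θy≡0))(\ k k≢y -> θ-term k≢y)
   one-of : ∀{a} -> Positive a -> -[1+ 0 ] Z.≤ a * -[1+ 0 ] -> a ≡ 1z
   one-of(zero , refl)_ = refl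
   one-of(suc k , refl)(Z.-≤-())
   θu≡1 = one-of θu>0(subst₂(\ a b -> a Z.≤ root θ ! u * b)yθ(cor-simple u y ⨾ uy)(∙-bound(root θ)(cor(simple y))u(\ k _ -> y-term k)))
   only-u : ∀{k} -> root θ ! k ≢ 0z -> k ≢ u -> C k y ≡ 0z
   only-u{k} nz k≢u with signOf(C k y)
   ... | zer e = e
   ... | pos p = contra(C-np{k}{y}(\{ refl -> nz θy≡0 }))(pos∧≤0 p)
   ... | neg n = contra(Z.≤-trans(Z.≤-reflexive(sym yθ))(Z.≤-trans(∙-bound2(root θ)(cor(simple y))(k≢u ∘ sym)(\ l _ _ -> y-term l))
     (Z.+-mono-≤(Z.≤-reflexive(cong₂ _*_ θu≡1(cor-simple u y ⨾ uy)))(neg⇒≤-1(*-posneg(≥0⇒pos(pθ k)nz)(subst Negative(at-unit k(simple y))n))))))(\{ (Z.-≤-())})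
   θ-neighbour : ∀{i} -> G i -> i ≢ y -> C u i ≡ -[1+ 0 ] -> Positive(root θ ! i)
   θ-neighbour{i} gi i≢y ui = ≥0⇒pos(pθ i)(\ z -> neg∧≥0(neighbour ui z)(dominant i(gi , i≢y)))
   θx>0 = θ-neighbour gx x≢y ux
   θz>0 = θ-neighbour gz(y≢z ∘ sym)uz
   hu = gu , y≢u ∘ sym
   minus : ∀{a} -> Positive a -> a * -[1+ 0 ] Z.≤ -[1+ 0 ]
   minus(k , refl) = Z.-≤- z≤n
   u-sum : ∀{k} -> k ≢ u -> k ≢ x -> k ≢ z -> 0z Z.≤ root θ ! k * cor(simple u)! k
   u-sum{k} k≢u k≢x k≢z with signOf(root θ ! k * cor(simple u)! k)
   ... | pos p = pos⇒≥0 p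
   ... | zer e = Z.≤-reflexive(sym e)
   ... | neg n = contra(Z.≤-trans(dominant u hu)(Z.≤-trans(Z.≤-reflexive(∙-∖(root θ)(cor(simple u))u))
     (Z.+-mono-≤(Z.≤-reflexive(cong₂ _*_ θu≡1(cor-simple u u ⨾ C-self u)))(Z.≤-trans(∙-bound3(root θ ∖ u)(cor(simple u))x≢z(k≢x ∘ sym)(k≢z ∘ sym)
      (\ l _ _ _ -> ∖-np(root θ)(cor(simple u))u(\ l l≢u -> θ-term l≢u)l))
      (Z.+-mono-≤(at x≢u xu θx>0)(Z.+-mono-≤(at z≢u zu θz>0)(neg⇒≤-1(subst(\ a -> Negative(a * cor(simple u)! k))(sym(∖-off(root θ)k≢u))n))))))))(\())where
    at : ∀{i} -> i ≢ u -> C i u ≡ -[1+ 0 ] -> Positive(root θ ! i)→(root θ ∖ u)! i * cor(simple u)! i Z.≤ -[1+ 0 ]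
    at{i} i≢u iu p = subst₂(\ a b -> a * b Z.≤ -[1+ 0 ])(sym(∖-off(root θ)i≢u))(sym(cor-simple i u ⨾ iu))(minus p)
   -- At a node of coefficient 1 orthogonal to θ the neighbours' coefficients sum to 2; a neighbour
   -- l taking at least 1 leaves at most 1 for any other.
   at-most-one : ∀{i l} -> H i -> l ≢ i -> root θ ! i ≡ 1z -> ⟨ root θ , simple i ⟩ ≡ 0z -> ∀{k} -> k ≢ i -> k ≢ l -> G k -> C k i ≡ -[1+ 0 ] -> C l i ≡ -[1+ 0 ] -> Positive(root θ ! l)-> root θ ! k Z.≤ 1z
   at-most-one{i}{l} hi l≢i θi zero-i{k} k≢i k≢l gk ki li p = final(Z.≤-trans(Z.≤-reflexive(sym zero-i))(Z.≤-trans(Z.≤-reflexive(∙-∖(root θ)(cor(simple i))i))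
     (Z.+-mono-≤(Z.≤-reflexive(cong₂ _*_ θi(cor-simple i i ⨾ C-self i)))(Z.≤-trans(∙-bound2(root θ ∖ i)(cor(simple i))(k≢l ∘ sym)
      (\ m _ _ -> ∖-np(root θ)(cor(simple i))i(\ m m≢i -> θ-term m≢i)m))
      (Z.+-mono-≤(subst₂(\ a b -> a * b Z.≤ -[1+ 0 ])(sym(∖-off(root θ)l≢i))(sym(cor-simple l i ⨾ li))(minus p))
       (Z.≤-reflexive(cong₂ _*_(∖-off(root θ)k≢i)(cor-simple k i ⨾ ki))))))))where
    final : ∀{a} -> 0z Z.≤ + 2 ⊕(-[1+ 0 ] ⊕ a * -[1+ 0 ])-> a Z.≤ 1z
    final{a} h = subst₂ Z._≤_(solve 1(\ a -> a :+ con 0z := a)refl a)(solve 1(\ a -> a :+(con(+ 2) :+(con -[1+ 0 ] :+ a :* con -[1+ 0 ])) := con 1z)refl a)(Z.+-monoʳ-≤ a h)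
   -- One end is impossible: the coefficient-one part of the support near u would be a union of cycles.
   no-one-end : ∀ w -> root θ ! w ≡ + 2 →(∀ i -> H i -> i ≢ w -> cor θ ! i ≡ 0z)-> ⊥
   no-one-end w θw others = contra(sym(v-yes u-in)⨾ definite v in-L u)(\())where
    Near : Fin r -> Set
    Near i = root θ ! i ≡ 1z ×(∀ k -> G k -> C k i ≡ -[1+ 0 ] -> root θ ! k Z.≤ 1z)
    near? : ∀ i -> Dec(Near i)
    near? i =(root θ ! i Z.≟ 1z)×-dec Fin.all?(\ k -> G? k →-dec((C k i Z.≟ -[1+ 0 ])→-dec(root θ ! k Z.≤? 1z)))
    indicator : ∀{p}{Q : Set p} -> Dec Q -> ℤ
    indicator(yes _) = 1z
    indicator(no _) = 0z
    v = Vec.tabulate(\ i -> indicator(near? i))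
    open import Data.Vec.Properties using(lookup∘tabulate)
    v-at : ∀ i -> v ! i ≡ indicator(near? i)
    v-at i = lookup∘tabulate(\ i -> indicator(near? i))i
    v-yes : ∀{i} -> Near i -> v ! i ≡ 1z
    v-yes{i} h = v-at i ⨾ go(near? i)where
     go :(d : Dec(Near i))-> indicator d ≡ 1z
     go(yes _) = refl
     go(no ¬h) = contra h ¬h
    v-no : ∀{i} -> ¬ Near i -> v ! i ≡ 0z
    v-no{i} ¬h = v-at i ⨾ go(near? i)where
     go :(d : Dec(Near i))-> indicator d ≡ 0z
     go(yes h) = contra h ¬h
     go(no _) = refl
    near-of : ∀{i} -> v ! i ≢ 0z -> Near i
    near-of{i} nz with near? i
    ... | yes h = h
    ... | no ¬h = contra(v-no ¬h)nz
    h-of : ∀{i} -> root θ ! i ≡ 1z -> H i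
    h-of{i} e = CH.in-G sHθ(\ z -> contra(sym e ⨾ z)(\()))
    zero-at : ∀{i} -> root θ ! i ≡ 1z -> ⟨ root θ , simple i ⟩ ≡ 0z
    zero-at{i} e = sym(symm-simple θ pθ sθ i(fst(h-of e)))⨾ others i(h-of e)(\{ refl -> contra(sym e ⨾ θw)(\())})
    one-if : ∀{a} -> Positive a -> a Z.≤ 1z -> a ≡ 1z
    one-if(zero , refl)_ = refl
    one-if(suc k , refl)(Z.+≤+(s≤s()))
    spread : ∀{i k} -> Near i -> G k -> k ≢ i -> C k i ≡ -[1+ 0 ] -> root θ ! k ≡ 1z -> Near k
    spread{i}{k}(θi , _)gk k≢i ki θk = θk , bound where
     bound : ∀ l -> G l -> C l k ≡ -[1+ 0 ] -> root θ ! l Z.≤ 1z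
     bound l gl lk with l Fin.≟ i
     ... | yes refl = Z.≤-reflexive θi
     ... | no l≢i = at-most-one(h-of θk)(k≢i ∘ sym)θk(zero-at θk)(\{ refl -> contra(sym(C-self l)⨾ lk)(\())})l≢i gl lk(C-symm(fst(h-of θi))gk ⨾ ki)(0 , θi)
    u-in = θu≡1 , bound where
     one-nbr : ∀{i l} -> i ≢ u -> l ≢ u -> l ≢ i -> G i -> C i u ≡ -[1+ 0 ] -> C l u ≡ -[1+ 0 ] -> Positive(root θ ! l)-> root θ ! i Z.≤ 1z
     one-nbr i≢u l≢u l≢i gi iu lu p = at-most-one hu l≢u θu≡1(zero-at θu≡1)i≢u(l≢i ∘ sym)gi iu lu p
     bound : ∀ k -> G k -> C k u ≡ -[1+ 0 ] -> root θ ! k Z.≤ 1z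
     bound k gk ku with k Fin.≟ x | k Fin.≟ z
     ... | yes refl | _ = one-nbr x≢u z≢u(x≢z ∘ sym)gx xu zu θz>0
     ... | no _ | yes refl = one-nbr z≢u x≢u x≢z gz zu xu θx>0
     ... | no k≢x | no k≢z = one-nbr(\{ refl -> contra(sym(C-self k)⨾ ku)(\())})x≢u(k≢x ∘ sym)gk ku xu θx>0
    -- Every neighbour of a near node in the support of θ has coefficient 1 and is near again. So v
    -- and θ pair equally with the simple root, namely to zero, the unique end having coefficient 2.
    in-L : ∀ i -> v ! i ≢ 0z -> ⟨ v , simple i ⟩ ≡ 0z
    in-L i nz = ∙-≡ v(cor(simple i))(root θ)(cor(simple i))same ⨾ zero-at(fst near)where
     near = near-of nz
     gi = fst(h-of(fst near))
     same : ∀ k -> v ! k * cor(simple i)! k ≡ root θ ! k * cor(simple i)! k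
     same k = cases(k Fin.≟ i)(G? k)where
      cases : Dec(k ≡ i)-> Dec(G k)-> v ! k * cor(simple i)! k ≡ root θ ! k * cor(simple i)! k
      cases(yes refl)_ = cong(_* cor(simple i)! i)(v-yes near ⨾ sym(fst near))
      cases(no k≢i)(no ¬gk) = cong(_* cor(simple i)! k)(v-no(\ h -> ¬gk(fst(h-of(fst h))))⨾ sym(sθ k ¬gk))
      cases(no k≢i)(yes gk)with laced gk gi k≢i
      ... | inl e = cong(v ! k *_)e' ⨾ Z.*-zeroʳ(v ! k)⨾ sym(cong(root θ ! k *_)e' ⨾ Z.*-zeroʳ(root θ ! k))
       where e' = cor-simple k i ⨾ e
      ... | inr e = cong(_* cor(simple i)! k)(value(root θ ! k Z.≟ 0z))where
       value : Dec(root θ ! k ≡ 0z)-> v ! k ≡ root θ ! k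
       value(yes z) = v-no(\ h -> contra(sym(fst h)⨾ z)(\()))⨾ sym z
       value(no nz') = v-yes(spread near gk k≢i e θk)⨾ sym θk
        where θk = one-if(≥0⇒pos(pθ k)nz')(snd near k gk e)
   θ-closed : ∀{k l} -> root θ ! k ≢ 0z -> root θ ! l ≡ 0z -> G l -> l ≢ y -> C k l ≡ 0z
   θ-closed{k}{l} nz z gl l≢y = separated pθ z(dominant l(gl , l≢y))nz
   inside? : ∀ i -> Dec(root θ ! i ≢ 0z)
   inside? i = ¬?(root θ ! i Z.≟ 0z)
   outside : ∀{i} -> ¬(root θ ! i ≢ 0z)-> root θ ! i ≡ 0z
   outside{i} h with root θ ! i Z.≟ 0z
   ... | yes z = z
   ... | no nz = contra nz h
   -- The ideal roots through w that do not live on H; if there are none, goodness of w on H is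
   -- goodness on G.
   Bad : Fin r -> Fin N -> Set
   Bad w β = Id β × Supp β × Positive(root β ! w)× Positive(root β ! y)
   bad? : ∀ w β -> Dec(Bad w β)
   bad? w β = Id? β ×-dec(supp? β ×-dec(positive?(root β ! w)×-dec positive?(root β ! y)))
   module _{w}(θw≡1 : root θ ! w ≡ 1z){β}(bad : Bad w β)where
    private
     iβ = fst bad
     pβ = Id-pos iβ
     sβ = fst(snd bad)
     βw>0 = fst(snd(snd bad))
     βy>0 = snd(snd(snd bad))
    -- Within β the node y can be reached from the support of θ only through u, and other nodes
    -- outside that support are not adjacent to it.
    β-u : root β ! u ≢ 0z
    β-u z with connected inside? β pβ(\ i k ni nk in-i out-k -> sep i k ni nk in-i out-k)where
     sep : ∀ i k -> root β ! i ≢ 0z -> root β ! k ≢ 0z -> root θ ! i ≢ 0z -> ¬(root θ ! k ≢ 0z)-> C i k ≡ 0z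
     sep i k ni nk in-i out-k with k Fin.≟ y
     ... | yes refl = only-u in-i(\{ refl -> ni z })
     ... | no k≢y = θ-closed in-i(outside out-k)(in-G sβ nk)k≢y
    ... | inl all = all y(pos⇒≢0 βy>0)θy≡0
    ... | inr none = none w(pos⇒≢0 βw>0)(\ z' -> contra(sym θw≡1 ⨾ z')(\()))
    -- Otherwise β would dominate u + x + y, which the ideal would then contain.
    β-x : root β ! x ≡ 0z
    β-x with root β ! x Z.≟ 0z
    ... | yes z = z
    ... | no nz = contra(Id-down iβ pm below)avoids where
     pm : Pos mxy
     pm l = subst(0z Z.≤_)(sym(mxy-root l))(Z.+-mono-≤(unit≥0 u l)(Z.+-mono-≤(unit≥0 x l)(unit≥0 y l)))where
      unit≥0 : ∀ i l -> 0z Z.≤ unit i ! l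
      unit≥0 i l = subst(\ a -> 0z Z.≤ a ! l)(root-simple i)(simple-pos i l)
     below : ∀ l -> root mxy ! l Z.≤ root β ! l
     below l = subst(Z._≤ root β ! l)(sym(mxy-root l))(go(l Fin.≟ u)(l Fin.≟ x)(l Fin.≟ y))where
      go : Dec(l ≡ u)-> Dec(l ≡ x)-> Dec(l ≡ y)-> unit u ! l ⊕(unit x ! l ⊕ unit y ! l)Z.≤ root β ! l
      go(yes refl)_ _ = subst(Z._≤ root β ! u)(sym(cong₂ _⊕_(unit-at u)(cong₂ _⊕_(unit-off(x≢u ∘ sym))(unit-off(y≢u ∘ sym)))))(pos⇒1≤(≥0⇒pos(pβ u)β-u))
      go(no a)(yes refl)_ = subst(Z._≤ root β ! x)(sym(cong₂ _⊕_(unit-off a)(cong₂ _⊕_(unit-at x)(unit-off x≢y))))(pos⇒1≤(≥0⇒pos(pβ x)nz))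
      go(no a)(no b)(yes refl) = subst(Z._≤ root β ! y)(sym(cong₂ _⊕_(unit-off a)(cong₂ _⊕_(unit-off b)(unit-at y))))(pos⇒1≤ βy>0)
      go(no a)(no b)(no c) = subst(Z._≤ root β ! l)(sym(cong₂ _⊕_(unit-off a)(cong₂ _⊕_(unit-off b)(unit-off c))))(pβ l)

    private
     K : Fin r -> Set
     K i = root β ! i ≢ 0z × i ≢ y
     K? : ∀ i -> Dec(K i)
     K? i = ¬?(root β ! i Z.≟ 0z)×-dec ¬?(i Fin.≟ y)
     module CK = Cases RD K?
     Q : Fin N -> Set
     Q η = Pos η × CK.Supp η × Positive(root η ! w)
     Q-closed : ∀{j i} -> Q j -> K i -> Negative ⟨ root j , simple i ⟩ -> Q(rfl j(simple i))
     Q-closed{j}{i}(pj , sj , p)ki n = rfl-pos pj(not-simple-of-neg n), CK.supp-rfl sj ki , grow(w Fin.≟ i)where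
      increase : ∀{a b} -> Positive a -> Negative b -> Positive(a ⊖ b)
      increase(k , refl)(l , refl) = _ , refl
      grow : Dec(w ≡ i)-> Positive(root(rfl j(simple i))! w)
      grow(yes refl) = subst Positive(sym(rfl-at j i))(increase p n)
      grow(no w≢i) = subst Positive(sym(rfl-off w≢i))p
     Q? : ∀ η -> Dec(Q η)
     Q? η = pos? η ×-dec(CK.supp? η ×-dec positive?(root η ! w))
     w≢y : w ≢ y
     w≢y refl = contra(sym θw≡1 ⨾ θy≡0)(\())

    -- The highest root through w on the support of β without y. It is confined to the support of θ,
    -- and it reaches u by the same connectedness argument, but it misses x.
    detour = fromTop(CK.top Q?(\{j} -> Q-closed)(simple w , simple-pos w , CK.supp-simple(pos⇒≢0 βw>0 , w≢y), 0 , simple-at w))where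
     fromTop : CK.Top Q -> ∃ \ b -> Pos b × CH.Supp b × Positive(root b ! w)× Positive(root b ! u)× root b ! x ≡ 0z
     fromTop T = b , pb , sHb , bw>0 , ≥0⇒pos(pb u)b-u , sb x(\ h -> fst h β-x)where
      open CK.Top T using()renaming(η to b; holds to hb; dominant to domb)
      pb = fst hb
      sb = fst(snd hb)
      bw>0 = snd(snd hb)
      sHb : CH.Supp b
      sHb i ¬h = sb i(\(nz , i≢y)-> ¬h(in-G sβ nz , i≢y))
      b-in-θ : ∀ i -> root b ! i ≢ 0z -> root θ ! i ≢ 0z
      b-in-θ with connected inside? b pb(\ i k ni nk in-i out-k -> let hk = CH.in-G sHb nk in θ-closed in-i(outside out-k)(fst hk)(snd hk))
      ... | inl all = all
      ... | inr none = contra(\ z -> contra(sym θw≡1 ⨾ z)(\()))(none w(pos⇒≢0 bw>0))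
      b-u : root b ! u ≢ 0z
      b-u z with connected(\ i -> ¬?(root b ! i Z.≟ 0z))β pβ sep where
       sep : ∀ i k -> root β ! i ≢ 0z -> root β ! k ≢ 0z -> root b ! i ≢ 0z -> ¬(root b ! k ≢ 0z)-> C i k ≡ 0z
       sep i k ni nk in-i out-k with k Fin.≟ y
       ... | yes refl = only-u(b-in-θ i in-i)(\{ refl -> in-i z })
       ... | no k≢y = separated pb(out'(root b ! k Z.≟ 0z))(domb k(nk , k≢y))in-i where
        out' : Dec(root b ! k ≡ 0z)-> root b ! k ≡ 0z
        out'(yes e) = e
        out'(no e) = contra e out-k
      ... | inl all = all y(pos⇒≢0 βy>0)(sb y(\ h -> snd h refl))
      ... | inr none = none w(pos⇒≢0 βw>0)(pos⇒≢0 bw>0)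

   module Two{w1 w2}(w1≢w2 : w1 ≢ w2)(θ1 : root θ ! w1 ≡ 1z)(θ2 : root θ ! w2 ≡ 1z)(c1 : cor θ ! w1 ≡ 1z)(c2 : cor θ ! w2 ≡ 1z)
         (others : ∀ i -> H i -> i ≢ w1 -> i ≢ w2 -> cor θ ! i ≡ 0z)where
    formula : ∀{μ} -> CH.Supp μ -> ⟨ root μ , θ ⟩ ≡ root μ ! w1 ⊕ root μ ! w2
    formula{μ} s = ∙-double(root μ)(cor θ)w1 w2 w1≢w2(\ i i≢1 i≢2 -> zeros i i≢1 i≢2(H? i))⨾
      cong₂ _⊕_(cong(root μ ! w1 *_)c1 ⨾ Z.*-identityʳ(root μ ! w1))(cong(root μ ! w2 *_)c2 ⨾ Z.*-identityʳ(root μ ! w2))where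
     zeros : ∀ i -> i ≢ w1 -> i ≢ w2 -> Dec(H i)-> root μ ! i * cor θ ! i ≡ 0z
     zeros i a b(yes h) = cong(root μ ! i *_)(others i h a b)⨾ Z.*-zeroʳ(root μ ! i)
     zeros i a b(no h) = 0*ˡ _(s i h)
    h1 = CH.in-G sHθ(\ z -> contra(sym θ1 ⨾ z)(\()))
    good : ¬ ∃(Bad w1)-> ∃ \ w -> G w × Good w Id
    good none = w1 , fst h1 , \ μ ν iμ iν sμ sν p q -> two-ends pθ sθ θ1 θ2(\ μ -> Pos μ × CH.Supp μ)
      (\{μ}(a , b)-> a , H-supp b)(\{μ}(_ , b)-> formula b)μ ν(Id-pos iμ , supp μ iμ sμ p)(Id-pos iν , supp ν iν sν q)p q where
     supp : ∀ μ -> Id μ -> Supp μ -> Positive(root μ ! w1)-> CH.Supp μ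
     supp μ iμ sμ p i ¬h with i Fin.≟ y
     ... | no i≢y = sμ i(\ gi -> ¬h(gi , i≢y))
     ... | yes refl with root μ ! y Z.≟ 0z
     ... | yes z = z
     ... | no nz = contra(μ , iμ , sμ , p , ≥0⇒pos(Id-pos iμ y)nz)none

   -- Let b₁, b₂ be the detours from the two ends; each pairs with θ to 1. If they form an acute
   -- angle, b₁ - b₂ is a root with opposite signs at w1 and w2. Otherwise θ - b₁ - b₂ is a root,
   -- positive at x, where both detours vanish, and negative at u, where θ has coefficient 1.
   clash : ∀{w1 w2}(w1≢w2 : w1 ≢ w2)(θ1 : root θ ! w1 ≡ 1z)(θ2 : root θ ! w2 ≡ 1z)(c1 : cor θ ! w1 ≡ 1z)(c2 : cor θ ! w2 ≡ 1z)->
       (∀ i -> H i -> i ≢ w1 -> i ≢ w2 -> cor θ ! i ≡ 0z)-> ∃(Bad w1)-> ∃(Bad w2)-> ⊥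
   clash{w1}{w2} w1≢w2 θ1 θ2 c1 c2 others(β1 , bad1)(β2 , bad2) = decide(detour θ1 bad1)(detour θ2 bad2)where
    module T1 = Two w1≢w2 θ1 θ2 c1 c2 others
    split : ∀{a b} -> Positive a -> 0z Z.≤ b -> a ⊕ b ≡ 1z -> a ≡ 1z × b ≡ 0z
    split{Z.+[1+ zero ]}{+ zero} _ _ _ = refl , refl
    split{Z.+[1+ suc k ]}{+ n} _ _()
    split{Z.+[1+ zero ]}{Z.+[1+ n ]} _ _()
    split{+ zero}(_ ,())
    one : ∀{b} -> Pos b -> CH.Supp b -> root b ! x ≡ 0z -> 1z Z.≤ root b ! w1 ⊕ root b ! w2 -> ⟨ root b , θ ⟩ ≡ 1z
    one{b} pb sb bx h = pair-one pb(H-supp sb)pθ sθ(\ e -> pos⇒≢0 θx>0(cong(\ j -> root j ! x)(sym e)⨾ bx))(subst Positive(sym(T1.formula sb))(1≤pos h))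
    decide :(∃ \ b -> Pos b × CH.Supp b × Positive(root b ! w1)× Positive(root b ! u)× root b ! x ≡ 0z)->
         (∃ \ b -> Pos b × CH.Supp b × Positive(root b ! w2)× Positive(root b ! u)× root b ! x ≡ 0z)-> ⊥
    decide(b1 , p1 , s1 , q1 , u1 , x1)(b2 , p2 , s2 , q2 , u2 , x2) = go(positive? ⟨ root b1 , b2 ⟩)where
     e₁ = one p1 s1 x1(Z.≤-trans(Z.≤-reflexive refl)(Z.+-mono-≤(pos⇒1≤ q1)(p1 w2)))
     e₂ = one p2 s2 x2(Z.≤-trans(Z.≤-reflexive refl)(Z.+-mono-≤(p2 w1)(pos⇒1≤ q2)))
     v₁ = split q1(p1 w2)(sym(T1.formula s1)⨾ e₁)
     v₂ = split q2(p2 w1)(Z.+-comm(root b2 ! w2)_ ⨾ sym(T1.formula s2)⨾ e₂)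
     θb1 = symm-roots p1(H-supp s1)θ pθ sθ ⨾ e₁
     θb2 = symm-roots p2(H-supp s2)θ pθ sθ ⨾ e₂
     go : Dec(Positive ⟨ root b1 , b2 ⟩)-> ⊥
     go(yes p) = let(m , h) = diff p(\ e -> contra(sym(fst v₁)⨾ cong(\ j -> root j ! w1)e ⨾ snd v₂)(\()))in
      no-mixed(0 , h w1 ⨾ cong₂ _⊖_(fst v₁)(snd v₂))(0 , h w2 ⨾ cong₂ _⊖_(snd v₁)(fst v₂))
     go(no np) = let(m , h) = diff positive(\ e -> contra(sym ζx ⨾ cong(\ j -> root j ! x)e ⨾ x2)(pos⇒≢0 θx>0))in
       no-mixed(subst Positive(sym(h x ⨾ cong₂ _⊖_ ζx x2 ⨾ Z.+-identityʳ _))θx>0)(subst Negative(sym(h u ⨾ cong(_⊖ root b2 ! u)(snd ζ u)))(low u1 u2))where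
      ζ = diff(0 , θb1)(\ e -> pos⇒≢0 θx>0(cong(\ j -> root j ! x)e ⨾ x1))
      ζx = snd ζ x ⨾ cong(root θ ! x ⊖_)x1 ⨾ Z.+-identityʳ _
      positive = subst Positive(sym(⟨⟩-of-diff(snd ζ)b2 ⨾ cong(_⊖ ⟨ root b1 , b2 ⟩)θb2))
       (1≤pos(subst(Z._≤ 1z ⊖ ⟨ root b1 , b2 ⟩)(Z.+-identityʳ 1z)(Z.+-monoʳ-≤ 1z(Z.neg-mono-≤(fst(np-sym np))))))
      low : ∀{a b} -> Positive a -> Positive b -> Negative((root θ ! u ⊖ a)⊖ b)
      low{a}{b} p q = subst(\ t -> Negative((t ⊖ a)⊖ b))(sym θu≡1)(≤-1⇒neg(Z.+-mono-≤{1z ⊖ a}{0z}(Z.+-mono-≤{1z}{1z} Z.≤-refl(Z.neg-mono-≤(pos⇒1≤ p)))(Z.neg-mono-≤(pos⇒1≤ q))))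

   by-ends : Ends H θ -> ∃ \ w -> G w × Good w Id
   by-ends(simple-end w e _ _) = contra(cong(\ j -> root j ! x)e ⨾ simple-off(\ x≡w -> x≢u(x≡w ⨾ sym u≡w)))(pos⇒≢0 θx>0)where
    u≡w : u ≡ w
    u≡w with u Fin.≟ w
    ... | yes h = h
    ... | no h = contra(cong(\ j -> root j ! u)e ⨾ simple-off h)(pos⇒≢0 θu>0)
   by-ends(one-end w θw others) = ⊥-elim(no-one-end w θw others)
   by-ends(two-ends' w1 w2 w1≢w2 θ1 θ2 c1 c2 others)with Fin.any?(bad? w1) | Fin.any?(bad? w2)
   ... | no none | _ = Two.good w1≢w2 θ1 θ2 c1 c2 others none
   ... | yes _ | no none = Two.good(w1≢w2 ∘ sym)θ2 θ1 c2 c1(\ i h a b -> others i h b a)none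
   ... | yes some1 | yes some2 = ⊥-elim(clash w1≢w2 θ1 θ2 c1 c2 others some1 some2)

  result = conclude(CH.top(\ η -> pos? η ×-dec(CH.supp? η ×-dec positive?(root η ! u)))(\{j} -> closed)
   (simple u , simple-pos u , CH.supp-simple(gu , y≢u ∘ sym), 0 , simple-at u))

 triple : Fin r -> Fin r -> Fin r -> Fin N
 triple u x y = rfl(rfl(simple u)(simple x))(simple y)

 triple-root : ∀{u x y} -> C u x ≡ -[1+ 0 ] -> C x y ≡ 0z -> C u y ≡ -[1+ 0 ] -> ∀ l -> root(triple u x y)! l ≡ unit u ! l ⊕(unit x ! l ⊕ unit y ! l)
 triple-root{u}{x}{y} ux xy uy l = rfl-simple(rfl(simple u)(simple x))y l ⨾ cong₂(\ a b -> a ⊖ b * unit y ! l)(simple-sum ux l)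
   (rfl-⟨⟩(simple u)(simple x)(simple y)⨾ cong₂ _⊖_(C-root u y ⨾ uy)(cong₂ _*_(C-root u x ⨾ ux)(C-root x y ⨾ xy)))⨾
  solve 3(\ a b c →(a :+ b) :- con -[1+ 0 ] :* c := a :+(b :+ c))refl(unit u ! l)(unit x ! l)(unit y ! l)

 record D4 : Set where
  field
   branch : Branch
  open Branch branch public
  field
   xy : Id(triple u x y)
   xz : Id(triple u x z)
   yz : Id(triple u y z)

 -- Each of the three sums of u with two of its neighbours that is missing from the ideal leads to
 -- `Avoiding` with the roles permuted; if none is missing, the obstruction of type D₄ is complete.
 resolve : Branch →(∃ \ w -> G w × Good w Id)⊎ D4
 resolve B = go(Id?(triple u x y))(Id?(triple u x z))(Id?(triple u y z))where
  open Branch B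
  ux = C-symm gu gx ⨾ xu
  uy = C-symm gu gy ⨾ yu
  uz = C-symm gu gz ⨾ zu
  go : Dec(Id(triple u x y))-> Dec(Id(triple u x z))-> Dec(Id(triple u y z))→(∃ \ w -> G w × Good w Id)⊎ D4
  go(yes a)(yes b)(yes c) = inr(record{ branch = B; xy = a; xz = b; yz = c })
  go(no a)_ _ = inl(Avoiding.result B _(triple-root ux(no-triangle gu gx gy x≢u y≢u x≢y xu yu)uy)a)
  go(yes _)(no b)_ = inl(Avoiding.result B' _(triple-root ux(no-triangle gu gx gz x≢u z≢u x≢z xu zu)uz)b)where
   B' = record{ u = u; x = x; y = z; z = y; gu = gu; gx = gx; gy = gz; gz = gy; x≢u = x≢u; y≢u = z≢u; z≢u = y≢u
         ; x≢y = x≢z; x≢z = x≢y; y≢z = y≢z ∘ sym; xu = xu; yu = zu; zu = yu }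
  go(yes _)(yes _)(no c) = inl(Avoiding.result B' _(triple-root uy(no-triangle gu gy gz y≢u z≢u y≢z yu zu)uz)c)where
   B' = record{ u = u; x = y; y = z; z = x; gu = gu; gx = gy; gy = gz; gz = gx; x≢u = y≢u; y≢u = z≢u; z≢u = x≢u
         ; x≢y = y≢z; x≢z = x≢y ∘ sym; y≢z = x≢z ∘ sym; xu = yu; yu = zu; zu = xu }

 -- v is the sum of the simple roots of a component.
 classify : ∃ G →(∃ \ w -> G w × Good w Id)⊎ D4
 classify(i0 , gi0) = fromMax(maximal P?(height ∘ root)(simple i0 , simple-pos i0 , supp-simple gi0 , small-simple , 0 , simple-at i0))where
  P : Fin N -> Set
  P η = Pos η × Supp η ×(∀ i -> root η ! i Z.≤ 1z)× Positive(root η ! i0)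
  P? : ∀ η -> Dec(P η)
  P? η = pos? η ×-dec(supp? η ×-dec(Fin.all?(\ i -> root η ! i Z.≤? 1z)×-dec positive?(root η ! i0)))
  small-simple = by-index i0(Z.≤-reflexive(simple-at i0))(\ k k≢ -> subst(Z._≤ 1z)(sym(simple-off k≢))(Z.+≤+ z≤n))
  fromMax :(∃ \ η -> P η ×(∀ j -> P j -> height(root j)Z.≤ height(root η)))→(∃ \ w -> G w × Good w Id)⊎ D4
  fromMax(v ,(pv , sv , v≤1 , vi>0), highest) = go(Fin.any?(\ u -> G? u ×-dec negative? ⟨ root v , simple u ⟩))where
   negative? : ∀ x -> Dec(Negative x)
   negative?(+ _) = no \()
   negative? -[1+ k ] = yes(k , refl)
   -- Reflecting in such an i would give a higher root with coefficients at most 1, against the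
   -- maximality of v.
   outside-zero : ∀{i} -> G i -> root v ! i ≡ 0z -> ¬ Negative ⟨ root v , simple i ⟩
   outside-zero{i} gi z n = Z.<⇒≱(raises n)(highest _(rfl-pos pv(not-simple-of-neg n), supp-rfl sv gi , small , positive(i0 Fin.≟ i)))where
    minus-one = simple-minus-one pv sv gi n
    small = by-index i(Z.≤-reflexive(rfl-at v i ⨾ cong₂ _⊖_ z minus-one))(\ k k≢i -> subst(Z._≤ 1z)(sym(rfl-off k≢i))(v≤1 k))
    positive : Dec(i0 ≡ i)-> Positive(root(rfl v(simple i))! i0)
    positive(yes e) = contra(cong(root v !_)e ⨾ z)(pos⇒≢0 vi>0)
    positive(no h) = subst Positive(sym(rfl-off h))vi>0
   one-if : ∀{a} -> Positive a -> a Z.≤ 1z -> a ≡ 1z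
   one-if(zero , refl)_ = refl
   one-if(suc k , refl)(Z.+≤+(s≤s()))
   v-one : ∀{i} -> root v ! i ≢ 0z -> root v ! i ≡ 1z
   v-one{i} nz = one-if(≥0⇒pos(pv i)nz)(v≤1 i)
   by-ends : Ends G v →(∃ \ w -> G w × Good w Id)⊎ D4
   by-ends(simple-end w e gw others) = inl(w , gw , isolated-good gw(\ i gi i≢w -> sym(cor-simple i w)⨾ cong(\ j -> cor j ! i)(sym e)⨾ others i gi i≢w))
   by-ends(one-end w e _) = contra(subst(Z._≤ 1z)e(v≤1 w))(\{ (Z.+≤+(s≤s()))})
   by-ends(two-ends' w1 w2 w1≢w2 θ1 θ2 c1 c2 others) = inl(w1 , in-G sv(\ z -> contra(sym θ1 ⨾ z)(\())),
     \ μ ν iμ iν sμ sν -> two-ends pv sv θ1 θ2(\ μ -> Pos μ × Supp μ)id(\{μ}(_ , s)-> formula s)μ ν(Id-pos iμ , sμ)(Id-pos iν , sν))where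
    formula : ∀{μ} -> Supp μ -> ⟨ root μ , v ⟩ ≡ root μ ! w1 ⊕ root μ ! w2
    formula{μ} s = ∙-double(root μ)(cor v)w1 w2 w1≢w2(\ i a b -> zeros i a b(G? i))⨾
      cong₂ _⊕_(cong(root μ ! w1 *_)c1 ⨾ Z.*-identityʳ(root μ ! w1))(cong(root μ ! w2 *_)c2 ⨾ Z.*-identityʳ(root μ ! w2))where
     zeros : ∀ i -> i ≢ w1 -> i ≢ w2 -> Dec(G i)-> root μ ! i * cor v ! i ≡ 0z
     zeros i a b(yes h) = cong(root μ ! i *_)(others i h a b)⨾ Z.*-zeroʳ(root μ ! i)
     zeros i a b(no h) = 0*ˡ(cor v ! i)(s i h)
   go : Dec(∃ \ u -> G u × Negative ⟨ root v , simple u ⟩)→(∃ \ w -> G w × Good w Id)⊎ D4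
   go(no none) = by-ends(ends G? pv sv sv dom)where
    dom : ∀ i -> G i -> 0z Z.≤ ⟨ root v , simple i ⟩
    dom i gi with signOf ⟨ root v , simple i ⟩
    ... | pos p = pos⇒≥0 p
    ... | zer z = Z.≤-reflexive(sym z)
    ... | neg n = contra(i , gi , n)none
   -- Here v_u = 1 and the pairing with α_u is 2 minus the number of neighbours of u in the support.
   -- Being at most -1 it leaves three neighbours, found one after another by erasing those already
   -- chosen.
   go(yes(u , gu , n)) = resolve(record
     { u = u; x = x; y = y; z = z; gu = gu; gx = fst(snd(snd N1)); gy = fst(snd(snd N2)); gz = fst(snd(snd N3))
     ; x≢u = fst(snd(snd(snd N1))); y≢u = fst(snd(snd(snd N2))); z≢u = fst(snd(snd(snd N3)))
     ; x≢y = \ e -> ≢-of{v ∖' u ∖ x}(∖-at(v ∖' u)x)(fst(snd N2))(sym e)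
     ; x≢z = \ e -> ≢-of{v ∖' u ∖ x ∖ y}(at2 x y)(fst(snd N3))(sym e)
     ; y≢z = \ e -> ≢-of{v ∖' u ∖ x ∖ y}(∖-at(v ∖' u ∖ x)y)(fst(snd N3))(sym e)
     ; xu = fst(snd(snd(snd(snd N1)))); yu = fst(snd(snd(snd(snd N2)))); zu = fst(snd(snd(snd(snd N3))))})where
    _∖'_ : Fin N -> Fin r -> Vec ℤ r
    j ∖' i = root j ∖ i
    c = cor(simple u)
    Sub : Vec ℤ r -> Set
    Sub a = ∀ k -> a ! k ≢ 0z -> a ! k ≡ 1z × G k × k ≢ u
    ≢-of : ∀{a : Vec ℤ r}{i k} -> a ! i ≡ 0z -> a ! k ≡ 1z -> k ≢ i
    ≢-of z e refl = contra(sym e ⨾ z)(\())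
    sub-∖ : ∀{a} i -> Sub a -> Sub(a ∖ i)
    sub-∖{a} i s k nz with k Fin.≟ i
    ... | yes refl = contra(∖-at a k)nz
    ... | no k≢i = let(e , gk , k≢u) = s k(\ z -> nz(∖-off a k≢i ⨾ z))in ∖-off a k≢i ⨾ e , gk , k≢u
    sub0 : Sub(v ∖' u)
    sub0 k nz with k Fin.≟ u
    ... | yes refl = contra(∖-at(root v)k)nz
    ... | no k≢u = let nz' = \ z -> nz(∖-off(root v)k≢u ⨾ z)in ∖-off(root v)k≢u ⨾ v-one nz' , in-G sv nz' , k≢u
    neighbour : ∀ a -> Sub a -> Negative(a ∙ c)-> ∃ \ k -> a ! k ≡ 1z × G k × k ≢ u × C k u ≡ -[1+ 0 ] ×(a ∖ k)∙ c ≡ a ∙ c ⊕ 1z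
    neighbour a s neg-ac = build(negative-term a c neg-ac)where
     build :(∃ \ k -> Negative(a ! k * c ! k))-> ∃ \ k -> a ! k ≡ 1z × G k × k ≢ u × C k u ≡ -[1+ 0 ] ×(a ∖ k)∙ c ≡ a ∙ c ⊕ 1z
     build(k , nk) = k , ak , gk , k≢u , ku , solve 1(\ t -> t :=(con 1z :* con -[1+ 0 ] :+ t) :+ con 1z)refl((a ∖ k)∙ c)⨾
       cong(_⊕ 1z)(sym(∙-∖ a c k ⨾ cong(_⊕(a ∖ k)∙ c)(cong₂ _*_ ak(cor-simple k u ⨾ ku))))where
      found = s k(\ z -> contra(sym(0*ˡ(c ! k)z)⨾ snd nk)(\()))
      ak = fst found
      gk = fst(snd found)
      k≢u = snd(snd found)
      ku : C k u ≡ -[1+ 0 ]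
      ku with laced gk gu k≢u
      ... | inr e = e
      ... | inl e = contra(sym(cong(a ! k *_)(cor-simple k u ⨾ e)⨾ Z.*-zeroʳ(a ! k))⨾ snd nk)(\())
    vu = v-one(\ z -> outside-zero gu z n)
    z0 = v ∖' u
    bound0 = subst(Z._≤ -[1+ 2 ])(solve 1(\ t -> con -[1+ 1 ] :+(con 1z :* con(+ 2) :+ t) := t)refl(z0 ∙ c))
     (Z.+-monoʳ-≤ -[1+ 1 ](subst(Z._≤ -[1+ 0 ])(∙-∖(root v)c u ⨾ cong(_⊕ z0 ∙ c)(cong₂ _*_ vu(cor-simple u u ⨾ C-self u)))(neg⇒≤-1 n)))
    weaken : ∀{a k} -> a Z.≤ -[1+ suc k ] -> a ⊕ 1z Z.≤ -[1+ k ]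
    weaken h = Z.+-monoˡ-≤ 1z h
    negative : ∀{a k} -> a Z.≤ -[1+ k ] -> Negative a
    negative h = ≤-1⇒neg(Z.≤-trans h(Z.-≤- z≤n))
    N1 = neighbour z0 sub0(negative bound0)
    x = fst N1
    bound1 = subst(Z._≤ -[1+ 1 ])(sym(snd(snd(snd(snd(snd N1))))))(weaken bound0)
    N2 = neighbour(z0 ∖ x)(sub-∖{z0} x sub0)(negative bound1)
    y = fst N2
    bound2 = subst(Z._≤ -[1+ 0 ])(sym(snd(snd(snd(snd(snd N2))))))(weaken bound1)
    N3 = neighbour(z0 ∖ x ∖ y)(sub-∖{z0 ∖ x} y(sub-∖{z0} x sub0))(negative bound2)
    z = fst N3
    at2 : ∀ x y →(z0 ∖ x ∖ y)! x ≡ 0z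
    at2 x y with x Fin.≟ y
    ... | yes refl = ∖-at(z0 ∖ x)x
    ... | no h = ∖-off(z0 ∖ x)h ⨾ ∖-at z0 x

-- Enumerated subsystems.

infixr 6 _◂_
data Word(n : ℕ) : Set where
 ⌈_⌉ : Fin n -> Word n
 _◂_ : Fin n -> Word n -> Word n

infix 4 _≤ᵛ_
_≤ᵛ_ : ∀{n} -> Vec ℤ n -> Vec ℤ n -> Set
x ≤ᵛ y = ∀ i -> x ! i Z.≤ y ! i

-- The word k₁ ◂ … ◂ kₘ ◂ ⌈ i ⌉ stands for the root s_{k₁} ⋯ s_{kₘ} αᵢ of the root system with Cartan matrix M.
module Enumeration{n}(M : Vec(Vec ℤ n)n)where
 open import Data.List.Relation.Unary.All as All using(All)
 open import Data.List.Relation.Unary.Any as Any using(Any)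
 open import Data.Vec.Properties using(≡-dec)
 open import Relation.Nullary.Decidable using(_→-dec_; _⊎-dec_)

 _≟ᵛ_ :(x y : Vec ℤ n)-> Dec(x ≡ y)
 _≟ᵛ_ = ≡-dec Z._≟_

 _≤ᵛ?_ :(x y : Vec ℤ n)-> Dec(x ≤ᵛ y)
 x ≤ᵛ? y = Fin.all?(\ i -> x ! i Z.≤? y ! i)

 negative? : ∀ x -> Dec(Negative x)
 negative?(+ _) = no \()
 negative? -[1+ k ] = yes(k , refl)

 column row : Fin n -> Vec ℤ n
 column k = Vec.map(_! k)M
 row k = Vec.lookup M k

 mirror : Fin n -> Vec ℤ n -> Vec ℤ n -> Vec ℤ n
 mirror k c x = x -ᵛ(x ∙ c)*ᵛ unit k

 rt cort : Word n -> Vec ℤ n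
 rt ⌈ i ⌉ = unit i
 rt(k ◂ w) = mirror k(column k)(rt w)
 cort ⌈ i ⌉ = unit i
 cort(k ◂ w) = mirror k(row k)(cort w)

 module _(W : List(Word n))where
  -- Containing the simple roots and being closed under raising reflections suffices, by
  -- `pos-induction`, for listing all positive roots of the subsystem.
  Complete : Set
  Complete =(∀ i -> Any(\ w -> rt w ≡ unit i)W)×
        All(\ w →(0ᵛ ≤ᵛ rt w × 0ᵛ ≤ᵛ cort w)×(∀ k -> Negative(rt w ∙ column k)-> Any(\ w' -> rt w' ≡ rt(k ◂ w))W))W

  Complete? : Dec Complete
  Complete? = Fin.all?(\ i -> Any.any?(\ w -> rt w ≟ᵛ unit i)W)×-dec
   All.all?(\ w →((0ᵛ ≤ᵛ? rt w)×-dec(0ᵛ ≤ᵛ? cort w))×-dec Fin.all?(\ k -> negative?(rt w ∙ column k)→-dec Any.any?(\ w' -> rt w' ≟ᵛ rt(k ◂ w))W))W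

  -- For each node one root that doubles, on the root and on the coroot side at once, the effect of
  -- a bond to a further node.
  Heavy : Set
  Heavy = ∀ i -> Any(\ w -> + 2 Z.≤ rt w ! i × + 2 Z.≤ cort w ! i)W

  Heavy? : Dec Heavy
  Heavy? = Fin.all?(\ i -> Any.any?(\ w →(+ 2 Z.≤? rt w ! i)×-dec(+ 2 Z.≤? cort w ! i))W)

  total : Vec ℤ n -> ℤ
  total x = x ∙ Vec.replicate n 1z

  -- Spans the part of the plane of x and y that does not involve w. In `Joins` proportionality to d
  -- is expressed by multiplying crosswise with the coordinate sums, which keeps the check in the
  -- integers.
  eliminate : Fin n -> Vec ℤ n -> Vec ℤ n -> Vec ℤ n
  eliminate w x y = x ! w *ᵛ y -ᵛ y ! w *ᵛ x

  Joins : Fin n -> Vec ℤ n -> Vec ℤ n -> Vec ℤ n -> Set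
  Joins w x y d = d ! w ≡ 0z ×(d ≤ᵛ x ⊎ d ≤ᵛ y)× total(eliminate w x y)≢ 0z ×
          total(eliminate w x y)*ᵛ d ≡ total d *ᵛ eliminate w x y

  Joins? : ∀ w x y d -> Dec(Joins w x y d)
  Joins? w x y d =(d ! w Z.≟ 0z)×-dec(((d ≤ᵛ? x)⊎-dec(d ≤ᵛ? y))×-dec(¬?(total(eliminate w x y)Z.≟ 0z)×-dec
           ((total(eliminate w x y)*ᵛ d)≟ᵛ(total d *ᵛ eliminate w x y))))

  -- What rules out that x is a root of the ideal through w: it does not involve w positively, or it
  -- lies above a root known to be missing.
  Outside : List(Word n)-> Fin n -> Vec ℤ n -> Set
  Outside avoid w x = x ! w Z.≤ 0z ⊎ Any(\ v -> rt v ≤ᵛ x)avoid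

  outside? : ∀ avoid w x -> Dec(Outside avoid w x)
  outside? avoid w x =(x ! w Z.≤? 0z)⊎-dec Any.any?(\ v -> rt v ≤ᵛ? x)avoid

  Joinable : List(Word n)-> Fin n -> Set
  Joinable avoid w = All(\ x -> Outside avoid w(rt x)⊎ All(\ y -> Outside avoid w(rt y)⊎ rt x ≡ rt y ⊎ Any(\ d -> Joins w(rt x)(rt y)(rt d))W)W)W

  Joinable? : ∀ avoid w -> Dec(Joinable avoid w)
  Joinable? avoid w = All.all?(\ x -> outside? avoid w(rt x)⊎-dec All.all?(\ y -> outside? avoid w(rt y)⊎-dec((rt x ≟ᵛ rt y)⊎-dec
   Any.any?(\ d -> Joins? w(rt x)(rt y)(rt d))W))W)W

module Subsystem{r N}(RD : RootDatum r N){n}(M : Vec(Vec ℤ n)n)(f : Fin n -> Fin r)(f-inj : ∀{i k} -> f i ≡ f k -> i ≡ k)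
         (cart : ∀ i k -> Roots.C RD(f i)(f k)≡ Vec.lookup M i ! k)where
 open Roots RD
 open Enumeration M
 open import Data.Integer.Base using(_*_)renaming(_+_ to _⊕_; _-_ to _⊖_; -_ to ∼_)
 open import Data.List.Relation.Unary.All as All using(All)
 open import Data.List.Relation.Unary.Any as Any using(Any)
 open import Data.Vec.Properties using(lookup∘tabulate; lookup-map)

 index : Word n -> Fin N
 index ⌈ i ⌉ = simple(f i)
 index(k ◂ w) = rfl(index w)(simple(f k))

 ∙-rfl : ∀(x : Vec ℤ n)c k ψ →(x -ᵛ c *ᵛ unit k)∙ Vec.tabulate ψ ≡ x ∙ Vec.tabulate ψ ⊖ c * ψ k
 ∙-rfl x c k ψ = ∙-- x(c *ᵛ unit k)(Vec.tabulate ψ)⨾ cong(x ∙ Vec.tabulate ψ ⊖_)(∙-* c(unit k)(Vec.tabulate ψ)⨾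
  cong(c *_)(unit-∙ k(Vec.tabulate ψ)⨾ lookup∘tabulate ψ k))

 ⟨⟩-index : ∀ w q -> ⟨ root(index w), q ⟩ ≡ rt w ∙ Vec.tabulate(\ i -> ⟨ unit(f i), q ⟩)
 on-column : ∀ w k -> ⟨ root(index w), simple(f k)⟩ ≡ rt w ∙ column k
 on-column w k = ⟨⟩-index w(simple(f k))⨾ cong(rt w ∙_)(ext(\ i -> lookup∘tabulate _ i ⨾ cart i k ⨾ sym(lookup-map i(_! k)M)))
 ⟨⟩-index ⌈ i ⌉ q = cong(\ x -> ⟨ x , q ⟩)(root-simple(f i))⨾ sym(unit-∙ i _ ⨾ lookup∘tabulate _ i)
 ⟨⟩-index(k ◂ w)q = rfl-⟨⟩(index w)(simple(f k))q ⨾ cong₂ _⊖_(⟨⟩-index w q)(cong₂ _*_(on-column w k)(cong(\ x -> ⟨ x , q ⟩)(root-simple(f k))))⨾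
  sym(∙-rfl(rt w)(rt w ∙ column k)k _)

 root-index : ∀ w l -> root(index w)! l ≡ rt w ∙ Vec.tabulate(\ i -> unit(f i)! l)
 root-index ⌈ i ⌉ l = cong(_! l)(root-simple(f i))⨾ sym(unit-∙ i _ ⨾ lookup∘tabulate _ i)
 root-index(k ◂ w)l = rfl-simple(index w)(f k)l ⨾ cong₂ _⊖_(root-index w l)(cong(_* unit(f k)! l)(on-column w k))⨾
  sym(∙-rfl(rt w)(rt w ∙ column k)k _)

 index-⟨⟩ : ∀ w x -> ⟨ x , index w ⟩ ≡ cort w ∙ Vec.tabulate(\ i -> ⟨ x , simple(f i)⟩)
 index-⟨⟩ ⌈ i ⌉ x = sym(unit-∙ i _ ⨾ lookup∘tabulate _ i)
 index-⟨⟩(k ◂ w)x = ⟨⟩-rfl x(index w)(simple(f k))⨾ cong₂ _⊖_(index-⟨⟩ w x)(cong(⟨ x , simple(f k)⟩ *_)on-row ⨾(Z.*-comm ⟨ x , simple(f k)⟩ _))⨾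
  sym(∙-rfl(cort w)(cort w ∙ row k)k _)where
  on-row : ⟨ root(simple(f k)), index w ⟩ ≡ cort w ∙ row k
  on-row = index-⟨⟩ w(root(simple(f k)))⨾ cong(cort w ∙_)(ext(\ i -> lookup∘tabulate _ i ⨾ C-root(f k)(f i)⨾ cart k i))

 coordinate : ∀ w k -> root(index w)! f k ≡ rt w ! k
 coordinate w k = root-index w(f k)⨾ ∙-single(rt w)_ k(\ i i≢k -> cong(rt w ! i *_)(lookup∘tabulate _ i ⨾ unit-off(i≢k ∘ f-inj ∘ sym))⨾ Z.*-zeroʳ(rt w ! i))⨾
  cong(rt w ! k *_)(lookup∘tabulate _ k ⨾ unit-at(f k))⨾ Z.*-identityʳ _

 Image : Fin r -> Set
 Image l = ∃ \ i -> f i ≡ l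

 image? : ∀ l -> Dec(Image l)
 image? l = Fin.any?(\ i -> f i Fin.≟ l)

 OnNodes : Fin N -> Set
 OnNodes j = ∀ l -> ¬ Image l -> root j ! l ≡ 0z

 index-on-nodes : ∀ w -> OnNodes(index w)
 index-on-nodes w l ¬l = root-index w l ⨾ ∙-zero(rt w)_(\ i -> cong(rt w ! i *_)(lookup∘tabulate _ i ⨾ unit-off{i = f i}{l}(\{ refl -> ¬l(i , refl)}))⨾ Z.*-zeroʳ(rt w ! i))

 on-nodes-≤ : ∀ w j -> Pos j -> rt w ≤ᵛ Vec.tabulate(\ i -> root j ! f i)-> ∀ l -> root(index w)! l Z.≤ root j ! l
 on-nodes-≤ w j pj h l with image? l
 ... | yes(i , refl) = subst₂ Z._≤_(sym(coordinate w i))(lookup∘tabulate _ i)(h i)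
 ... | no ¬l = subst(Z._≤ root j ! l)(sym(index-on-nodes w l ¬l))(pj l)

 index-≤ : ∀{v w} -> Pos(index w)-> rt v ≤ᵛ rt w -> ∀ l -> root(index v)! l Z.≤ root(index w)! l
 index-≤{v}{w} p h = on-nodes-≤ v(index w)p(\ i -> subst(rt v ! i Z.≤_)(sym(lookup∘tabulate _ i ⨾ coordinate w i))(h i))

 index-≡ : ∀{v w} -> rt v ≡ rt w -> index v ≡ index w
 index-≡{v}{w} e = root-inj(ext(\ l -> root-index v l ⨾ cong(_∙ Vec.tabulate(\ i -> unit(f i)! l))e ⨾ sym(root-index w l)))

 index-pos : ∀{w} -> 0ᵛ ≤ᵛ rt w -> Pos(index w)
 index-pos{w} h l with image? l
 ... | yes(i , refl) = subst₂ Z._≤_(!-0 i)(sym(coordinate w i))(h i)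
 ... | no ¬l = Z.≤-reflexive(sym(index-on-nodes w l ¬l))

 module _{W}(complete : Complete W)where
  -- A positive root on the nodes is reached from a simple one by raising reflections in these
  -- nodes, and `W` is closed under them.
  enumerated : ∀ j -> Pos j -> OnNodes j -> Any(\ w -> index w ≡ j)W
  enumerated = pos-induction(\ j -> OnNodes j -> Any(\ w -> index w ≡ j)W)base step where
   base : ∀ i -> OnNodes(simple i)-> Any(\ w -> index w ≡ simple i)W
   base i on with image? i
   ... | yes(k , refl) = Any.map(\{w} e -> index-≡{w}{⌈ k ⌉} e)(fst complete k)
   ... | no ¬i = contra(sym(simple-at i)⨾ on i ¬i)(\())
   step : ∀ j i -> Pos j -> Pos(rfl j(simple i))-> Positive(root j ! i)-> Positive ⟨ root j , simple i ⟩ ->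
       (OnNodes(rfl j(simple i))-> Any(\ w -> index w ≡ rfl j(simple i))W)-> OnNodes j -> Any(\ w -> index w ≡ j)W
   step j i _ _ p q ih on with image? i
   ... | no ¬i = contra(on i ¬i)(pos⇒≢0 p)
   ... | yes(k , refl) = raise(ih(\ l ¬l -> rfl-off{j}(\{ refl -> ¬l(k , refl)})⨾ on l ¬l))where
    raise : Any(\ w -> index w ≡ rfl j(simple(f k)))W -> Any(\ w -> index w ≡ j)W
    raise a = let(_ , closed), e = All.lookupAny(snd complete)a in
     Any.map(\{w} h -> index-≡{w}{k ◂ Any.lookup a} h ⨾ cong(\ m -> rfl m(simple(f k)))e ⨾ Cases.rfl-invol RD{G = Image} image? j(f k))
      (closed k(subst Negative(cong(\ m -> ⟨ root m , simple(f k)⟩)(sym e)⨾ on-column(Any.lookup a)k)(subst Negative(sym(⟨⟩-rfl-self j(f k)))(∼pos q))))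

  -- A further node attached to i would be very obtuse with a root in which αᵢ and αᵢ^∨ occur at least twice.
  isolated : Heavy W -> ∀{t} -> ¬ Image t -> ∀ i -> C t(f i)≡ 0z
  isolated heavy{t} ¬t i with C t(f i)Z.≟ 0z
  ... | yes z = z
  ... | no nz = ⊥-elim(clash(All.lookupAny(snd complete)(heavy i)))where
   t≢ : ∀ i -> t ≢ f i
   t≢ i e = ¬t(i , sym e)
   ω = Any.lookup(heavy i)
   bound : ∀(x : Vec ℤ n)ψ -> 0ᵛ ≤ᵛ x →(∀ k -> ψ k Z.≤ 0z)-> + 2 Z.≤ x ! i -> Negative(ψ i)-> x ∙ Vec.tabulate ψ Z.≤ -[1+ 1 ]
   bound x ψ x≥0 ψ≤0 two neg-ψ = Z.≤-trans(∙-bound x(Vec.tabulate ψ)i(\ k _ -> ≥0*≤0(subst(Z._≤ x ! k)(!-0 k)(x≥0 k))(subst(Z._≤ 0z)(sym(lookup∘tabulate ψ k))(ψ≤0 k))))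
    (subst(\ z -> x ! i * z Z.≤ -[1+ 1 ])(sym(lookup∘tabulate ψ i))(twice two neg-ψ))where
    twice : ∀{a b} -> + 2 Z.≤ a -> Negative b -> a * b Z.≤ -[1+ 1 ]
    twice{+ suc(suc a)}(Z.+≤+(s≤s(s≤s _)))(k , refl) = Z.-≤-(ℕ.≤-trans(s≤s z≤n)(ℕ.m≤n+m _ k))
   clash : _ -> ⊥
   clash(((x≥0 , y≥0), _), x≥2 , y≥2) = not-very-obtuse{index ω}{simple t}(index-pos{ω} x≥0)(simple-pos t)
    (subst(Z._≤ -[1+ 1 ])(sym(⟨⟩-index ω(simple t)))(bound(rt ω)_ x≥0(\ k -> C-np(t≢ k ∘ sym))x≥2(≤0⇒neg(C-np(t≢ i ∘ sym))(nz ∘ C-zero-sym{f i}{t}))))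
    (subst(Z._≤ -[1+ 1 ])(sym(cong(\ x -> ⟨ x , index ω ⟩)(root-simple t)⨾ index-⟨⟩ ω(unit t)))(bound(cort ω)_ y≥0(\ k -> C-np(t≢ k))y≥2(≤0⇒neg(C-np(t≢ i))nz)))

  module _{G : Fin r -> Set}(G? : ∀ i -> Dec(G i))(Id : Fin N -> Set)(Id-pos : ∀{j} -> Id j -> Pos j)
       (Id-down : ∀{j k} -> Id j -> Pos k →(∀ i -> root k ! i Z.≤ root j ! i)-> Id k)where
   open Cases RD G? using(Good)

   -- `isolated` and connectedness of supports confine an ideal root through w to the nodes, hence
   -- to the list `W`, where `joinable` is a finite computation.
   good : Heavy W -> ∀{avoid w} -> Joinable W avoid w -> All(\ v -> Pos(index v)× ¬ Id(index v))avoid -> Good(f w)Id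
   good heavy{avoid}{w} joinable avoids μ ν iμ iν _ _ μw νw μ≢ν = find(listed μ iμ μw)(listed ν iν νw)where
    on-nodes : ∀ μ -> Id μ -> Positive(root μ ! f w)-> OnNodes μ
    on-nodes μ iμ p with connected image? μ(Id-pos iμ)(\{ _ k _ _(i , refl)¬k -> C-zero-sym{k}{f i}(isolated heavy ¬k i)})
    ... | inr none = contra(w , refl)(none(f w)(pos⇒≢0 p))
    ... | inl all = \ l ¬l -> zero-of l ¬l(root μ ! l Z.≟ 0z)where
     zero-of : ∀ l -> ¬ Image l -> Dec(root μ ! l ≡ 0z)-> root μ ! l ≡ 0z
     zero-of l ¬l(yes z) = z
     zero-of l ¬l(no nz) = contra(all l nz)¬l
    listed : ∀ μ -> Id μ -> Positive(root μ ! f w)-> Any(\ v -> index v ≡ μ)W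
    listed μ iμ p = enumerated μ(Id-pos iμ)(on-nodes μ iμ p)
    inside : ∀{v μ} -> index v ≡ μ -> Id μ -> Positive(root μ ! f w)-> ¬ Outside W avoid w(rt v)
    inside{v} refl iμ p(inl h) = pos∧≤0 p(subst(Z._≤ 0z)(sym(coordinate v w))h)
    inside{v} refl iμ p(inr a) = let((pu , ¬iu), h) = All.lookupAny avoids a in ¬iu(Id-down iμ pu(index-≤{Any.lookup a}{v}(Id-pos iμ)h))
    find : Any(\ v -> index v ≡ μ)W -> Any(\ v -> index v ≡ ν)W -> Between(f w)μ ν
    find a b with All.lookupAny joinable a
    ... | inl out , e = contra out(inside{Any.lookup a} e iμ μw)
    ... | inr all , e with All.lookupAny all b
    ... | inl out , e' = contra out(inside{Any.lookup b} e' iν νw)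
    ... | inr(inl same), e' = contra(sym e ⨾ index-≡{Any.lookup a}{Any.lookup b} same ⨾ e')μ≢ν
    ... | inr(inr c), e' = let((d≥0 , _), _), joins = All.lookupAny(snd complete)c in
     join(Any.lookup a)(Any.lookup b)(Any.lookup c)e e' iμ iν d≥0 joins where
     open import Data.Integer.Solver using(module +-*-Solver)
     open +-*-Solver using(solve; _:=_; _:+_; _:*_; _:-_; :-_)
     join : ∀{μ ν} x y d -> index x ≡ μ -> index y ≡ ν -> Id μ -> Id ν -> 0ᵛ ≤ᵛ rt d -> Joins W w(rt x)(rt y)(rt d)-> Between(f w)μ ν
     join x y d refl refl iμ iν d≥0(d-free , d-below , s≢0 , line) = record
      { δ = index d; δ-pos = index-pos{d} d≥0; δ-free = coordinate d w ⨾ d-free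
      ; δ-below = [(\ h -> inl(index-≤{d}{x}(Id-pos iμ)h)),(\ h -> inr(index-≤{d}{y}(Id-pos iν)h))]′ d-below
      ; s = S; p = ∼(h * rt y ! w); q = h * rt x ! w; s≢0 = s≢0; on-line = on-line } where
      S = total W(eliminate W w(rt x)(rt y))
      h = total W(rt d)
      on-line : ∀ l -> S * root(index d)! l ≡ ∼(h * rt y ! w)* root(index x)! l ⊕(h * rt x ! w)* root(index y)! l
      on-line l = cong(S *_)(root-index d l)⨾ sym(∙-* S(rt d)ψ)⨾ cong(_∙ ψ)line ⨾ ∙-* h(eliminate W w(rt x)(rt y))ψ ⨾
        cong(h *_)(∙--(rt x ! w *ᵛ rt y)_ ψ ⨾ cong₂ _⊖_(∙-*(rt x ! w)(rt y)ψ)(∙-*(rt y ! w)(rt x)ψ))⨾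
        solve 5(\ h a b X Y -> h :*(a :* Y :- b :* X) := :-(h :* b) :* X :+(h :* a) :* Y)refl h(rt x ! w)(rt y ! w)(rt x ∙ ψ)(rt y ∙ ψ)⨾
         sym(cong₂(\ X Y -> ∼(h * rt y ! w)* X ⊕(h * rt x ! w)* Y)(root-index x l)(root-index y l))
       where ψ = Vec.tabulate(\ i -> unit(f i)! l)

-- Finite computations in types G₂, D₄ and F₄.

module Types where
 open import Data.Fin.Patterns
 open import Data.List.Relation.Unary.All as All using(All)
 open import Data.List.Relation.Unary.Any as Any using(Any)
 open import Relation.Nullary.Decidable using(from-yes; _⊎-dec_; _→-dec_)

 G2 : Vec(Vec ℤ 2)2
 G2 =(+ 2 ∷ -[1+ 2 ] ∷ [])∷(-[1+ 0 ] ∷ + 2 ∷ [])∷ []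

 data Type : Set where
  D4 F4 : Type

 -- Row i, column k holds ⟨α_i, α_k^∨⟩. Node 0 is the centre in type D₄; in type F₄ the nodes 0 and
 -- 1 are long, 2 and 3 short.
 matrix : Type -> Vec(Vec ℤ 4)4
 matrix D4 =(+ 2 ∷ -[1+ 0 ] ∷ -[1+ 0 ] ∷ -[1+ 0 ] ∷ [])∷(-[1+ 0 ] ∷ + 2 ∷ 0z ∷ 0z ∷ [])∷
       (-[1+ 0 ] ∷ 0z ∷ + 2 ∷ 0z ∷ [])∷(-[1+ 0 ] ∷ 0z ∷ 0z ∷ + 2 ∷ [])∷ []
 matrix F4 =(+ 2 ∷ -[1+ 0 ] ∷ 0z ∷ 0z ∷ [])∷(-[1+ 0 ] ∷ + 2 ∷ -[1+ 1 ] ∷ 0z ∷ [])∷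
       (0z ∷ -[1+ 0 ] ∷ + 2 ∷ -[1+ 0 ] ∷ [])∷(0z ∷ 0z ∷ -[1+ 0 ] ∷ + 2 ∷ [])∷ []

 diagonal : ∀ τ i k -> Vec.lookup(matrix τ)i ! k ≡ + 2 -> i ≡ k
 diagonal D4 = from-yes(Fin.all? \ i -> Fin.all? \ k →(Vec.lookup(matrix D4)i ! k Z.≟ + 2)→-dec(i Fin.≟ k))
 diagonal F4 = from-yes(Fin.all? \ i -> Fin.all? \ k →(Vec.lookup(matrix F4)i ! k Z.≟ + 2)→-dec(i Fin.≟ k))

 module E τ = Enumeration(matrix τ)

 roots : Type -> List(Word 4)
 roots D4 = ⌈ 0F ⌉ ∷ ⌈ 1F ⌉ ∷ ⌈ 2F ⌉ ∷ ⌈ 3F ⌉ ∷ 1F ◂ ⌈ 0F ⌉ ∷ 2F ◂ ⌈ 0F ⌉ ∷ 3F ◂ ⌈ 0F ⌉ ∷ 2F ◂ 1F ◂ ⌈ 0F ⌉ ∷ 3F ◂ 1F ◂ ⌈ 0F ⌉ ∷ 3F ◂ 2F ◂ ⌈ 0F ⌉ ∷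
       3F ◂ 2F ◂ 1F ◂ ⌈ 0F ⌉ ∷ 0F ◂ 3F ◂ 2F ◂ 1F ◂ ⌈ 0F ⌉ ∷ []
 roots F4 = ⌈ 0F ⌉ ∷ ⌈ 1F ⌉ ∷ ⌈ 2F ⌉ ∷ ⌈ 3F ⌉ ∷ 1F ◂ ⌈ 0F ⌉ ∷ 2F ◂ ⌈ 1F ⌉ ∷ 1F ◂ ⌈ 2F ⌉ ∷ 3F ◂ ⌈ 2F ⌉ ∷ 2F ◂ 1F ◂ ⌈ 0F ⌉ ∷ 3F ◂ 2F ◂ ⌈ 1F ⌉ ∷ 0F ◂ 1F ◂ ⌈ 2F ⌉ ∷
       3F ◂ 1F ◂ ⌈ 2F ⌉ ∷ 1F ◂ 2F ◂ 1F ◂ ⌈ 0F ⌉ ∷ 3F ◂ 2F ◂ 1F ◂ ⌈ 0F ⌉ ∷ 3F ◂ 0F ◂ 1F ◂ ⌈ 2F ⌉ ∷ 2F ◂ 3F ◂ 1F ◂ ⌈ 2F ⌉ ∷ 3F ◂ 1F ◂ 2F ◂ 1F ◂ ⌈ 0F ⌉ ∷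
       2F ◂ 3F ◂ 0F ◂ 1F ◂ ⌈ 2F ⌉ ∷ 2F ◂ 3F ◂ 1F ◂ 2F ◂ 1F ◂ ⌈ 0F ⌉ ∷ 1F ◂ 2F ◂ 3F ◂ 0F ◂ 1F ◂ ⌈ 2F ⌉ ∷ 1F ◂ 2F ◂ 3F ◂ 1F ◂ 2F ◂ 1F ◂ ⌈ 0F ⌉ ∷
       2F ◂ 1F ◂ 2F ◂ 3F ◂ 0F ◂ 1F ◂ ⌈ 2F ⌉ ∷ 0F ◂ 1F ◂ 2F ◂ 3F ◂ 1F ◂ 2F ◂ 1F ◂ ⌈ 0F ⌉ ∷ 3F ◂ 2F ◂ 1F ◂ 2F ◂ 3F ◂ 0F ◂ 1F ◂ ⌈ 2F ⌉ ∷ []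

 complete : ∀ τ -> E.Complete τ(roots τ)
 complete D4 = from-yes(E.Complete? D4(roots D4))
 complete F4 = from-yes(E.Complete? F4(roots F4))

 F4-heavy : E.Heavy F4(roots F4)
 F4-heavy = from-yes(E.Heavy? F4(roots F4))

 -- Four independent roots spanning the space of an unlabelled root; in type D₄ they are orthogonal, in type F₄
 -- they generate two orthogonal subsystems of type A₂.
 frame : Type -> Fin 4 -> Word 4
 frame D4 0F = ⌈ 0F ⌉
 frame D4 1F = 2F ◂ 1F ◂ ⌈ 0F ⌉
 frame D4 2F = 3F ◂ 1F ◂ ⌈ 0F ⌉
 frame D4 3F = 3F ◂ 2F ◂ ⌈ 0F ⌉
 frame F4 0F = ⌈ 1F ⌉
 frame F4 1F = 2F ◂ 0F ◂ ⌈ 1F ⌉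
 frame F4 2F = 2F ◂ 1F ◂ 3F ◂ ⌈ 2F ⌉
 frame F4 3F = 0F ◂ 1F ◂ 3F ◂ ⌈ 2F ⌉

 centre : Type -> Word 4
 centre D4 = 1F ◂ ⌈ 0F ⌉
 centre F4 = ⌈ 2F ⌉

 -- If one of the last three frame roots is missing from the ideal, an end of the diagram becomes
 -- good: the short end 3 for the third frame root, the long end 0 for the second and fourth.
 F4-joinable : ∀{v w} →(v , w)≡(frame F4 1F , 0F)⊎(v , w)≡(frame F4 2F , 3F)⊎(v , w)≡(frame F4 3F , 0F)-> E.Joinable F4(roots F4)(v ∷ [])w
 F4-joinable(inl refl) = from-yes(E.Joinable? F4(roots F4)(frame F4 1F ∷ [])0F)
 F4-joinable(inr(inl refl)) = from-yes(E.Joinable? F4(roots F4)(frame F4 2F ∷ [])3F)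
 F4-joinable(inr(inr refl)) = from-yes(E.Joinable? F4(roots F4)(frame F4 3F ∷ [])0F)

 -- In type F₄ the additional members are the sums of the first two and of the last two frame roots.
 -- Each pair spans a system of type A₂, whose three positive roots are dependent, so two of them
 -- have to share a letter.
 class : Type -> Fin 4 -> Fin 2 -> Vec ℤ 4
 class F4 1F 1F = + 1 ∷ + 2 ∷ + 2 ∷ + 0 ∷ []
 class F4 3F 1F = + 1 ∷ + 2 ∷ + 3 ∷ + 2 ∷ []
 class τ i _ = E.rt τ(frame τ i)

 -- Normals of the hyperplanes spanned by representatives of three different labels. By
 -- `nonvanishing` no unlabelled root lies on any of them, which is what makes small relations with
 -- distinct labels trivial.
 functionals : Type -> List(Vec ℤ 4)
 functionals D4 =(+ 2 ∷ -[1+ 0 ] ∷ -[1+ 0 ] ∷ -[1+ 0 ] ∷ [])∷(0z ∷ 1z ∷ 1z ∷ -[1+ 0 ] ∷ [])∷(0z ∷ 1z ∷ -[1+ 0 ] ∷ 1z ∷ [])∷(0z ∷ -[1+ 0 ] ∷ 1z ∷ 1z ∷ [])∷ []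
 functionals F4 =(+ 2 ∷ 0z ∷ -[1+ 0 ] ∷ + 2 ∷ [])∷(1z ∷ 0z ∷ 1z ∷ -[1+ 1 ] ∷ [])∷(+ 2 ∷ -[1+ 2 ] ∷ + 2 ∷ -[1+ 0 ] ∷ [])∷
          (+ 4 ∷ 0z ∷ -[1+ 1 ] ∷ 1z ∷ [])∷(+ 2 ∷ 0z ∷ -[1+ 0 ] ∷ -[1+ 0 ] ∷ [])∷(1z ∷ -[1+ 2 ] ∷ 1z ∷ 1z ∷ [])∷ []

 Labelled : Type -> Vec ℤ 4 -> Set
 Labelled τ x = ∃ \ i -> ∃ \ b -> x ≡ class τ i b

 labelled? : ∀ τ x -> Dec(Labelled τ x)
 labelled? τ x = Fin.any?(\ i -> Fin.any?(\ b -> E._≟ᵛ_ τ x(class τ i b)))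

 Dual : Type →(Fin 4 -> Fin 2)-> Fin 4 -> Vec ℤ 4 -> Set
 Dual τ b i φ = φ ∙ class τ i(b i)≢ 0z ×(∀ k -> k ≢ i -> φ ∙ class τ k(b k)≡ 0z)

 dual? : ∀ τ b i φ -> Dec(Dual τ b i φ)
 dual? τ b i φ = ¬?(φ ∙ class τ i(b i)Z.≟ 0z)×-dec Fin.all?(\ k -> ¬?(k Fin.≟ i)→-dec(φ ∙ class τ k(b k)Z.≟ 0z))

 nonvanishing : ∀ τ -> All(\ φ -> All(\ w -> φ ∙ E.rt τ w ≢ 0z ⊎ Labelled τ(E.rt τ w))(roots τ))(functionals τ)
 nonvanishing D4 = from-yes(All.all?(\ φ -> All.all?(\ w -> ¬?(φ ∙ E.rt D4 w Z.≟ 0z)⊎-dec labelled? D4(E.rt D4 w))(roots D4))(functionals D4))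
 nonvanishing F4 = from-yes(All.all?(\ φ -> All.all?(\ w -> ¬?(φ ∙ E.rt F4 w Z.≟ 0z)⊎-dec labelled? F4(E.rt F4 w))(roots F4))(functionals F4))

 choice : Fin 2 -> Fin 2 -> Fin 2 -> Fin 2 -> Fin 4 -> Fin 2
 choice a b c d = Vec.lookup(a ∷ b ∷ c ∷ d ∷ [])

 dual : ∀ τ a b c d i -> Any(Dual τ(choice a b c d)i)(functionals τ)
 dual D4 = from-yes(Fin.all? \ a -> Fin.all? \ b -> Fin.all? \ c -> Fin.all? \ d -> Fin.all? \ i -> Any.any?(dual? D4(choice a b c d)i)(functionals D4))
 dual F4 = from-yes(Fin.all? \ a -> Fin.all? \ b -> Fin.all? \ c -> Fin.all? \ d -> Fin.all? \ i -> Any.any?(dual? F4(choice a b c d)i)(functionals F4))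

 class-inj : ∀ τ i k b -> class τ i 0F ≡ class τ k b -> i ≡ k
 class-inj D4 = from-yes(Fin.all? \ i -> Fin.all? \ k -> Fin.all? \ b -> E._≟ᵛ_ D4(class D4 i 0F)(class D4 k b)→-dec(i Fin.≟ k))
 class-inj F4 = from-yes(Fin.all? \ i -> Fin.all? \ k -> Fin.all? \ b -> E._≟ᵛ_ F4(class F4 i 0F)(class F4 k b)→-dec(i Fin.≟ k))

 centre-unlabelled : ∀ τ -> ¬ Labelled τ(E.rt τ(centre τ))
 centre-unlabelled D4 = from-yes(¬?(labelled? D4(E.rt D4(centre D4))))
 centre-unlabelled F4 = from-yes(¬?(labelled? F4(E.rt F4(centre F4))))

 centre-below : ∀ τ -> 0ᵛ ≤ᵛ E.rt τ(centre τ)× E.rt τ(centre τ)≤ᵛ E.rt τ(frame τ 1F)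
 centre-below D4 = from-yes(E._≤ᵛ?_ D4 0ᵛ(E.rt D4(centre D4))×-dec E._≤ᵛ?_ D4(E.rt D4(centre D4))(E.rt D4(frame D4 1F)))
 centre-below F4 = from-yes(E._≤ᵛ?_ F4 0ᵛ(E.rt F4(centre F4))×-dec E._≤ᵛ?_ F4(E.rt F4(centre F4))(E.rt F4(frame F4 1F)))

 -- The first entry belongs to the centre. With frame roots f₀, ..., f₃ it says 2 c = f₀ + f₁ + f₂ -
 -- f₃ in type D₄ and 3 c = - f₀ + f₁ + f₂ - f₃ in type F₄.
 relation : Type -> Vec ℤ 5
 relation D4 = -[1+ 1 ] ∷ 1z ∷ 1z ∷ 1z ∷ -[1+ 0 ] ∷ []
 relation F4 = -[1+ 2 ] ∷ -[1+ 0 ] ∷ 1z ∷ 1z ∷ -[1+ 0 ] ∷ []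

 circuit : ∀ τ(i : Fin 4)-> relation τ ∙ Vec.map(_! i)(E.rt τ(centre τ)∷ Vec.tabulate(E.rt τ ∘ frame τ))≡ 0z
 circuit D4 = from-yes(Fin.all? \ i -> relation D4 ∙ Vec.map(_! i)(E.rt D4(centre D4)∷ Vec.tabulate(E.rt D4 ∘ frame D4))Z.≟ 0z)
 circuit F4 = from-yes(Fin.all? \ i -> relation F4 ∙ Vec.map(_! i)(E.rt F4(centre F4)∷ Vec.tabulate(E.rt F4 ∘ frame F4))Z.≟ 0z)

 module EG = Enumeration G2

 G2-roots : List(Word 2)
 G2-roots = ⌈ 0F ⌉ ∷ ⌈ 1F ⌉ ∷ 1F ◂ ⌈ 0F ⌉ ∷ 0F ◂ ⌈ 1F ⌉ ∷ 0F ◂ 1F ◂ ⌈ 0F ⌉ ∷ 1F ◂ 0F ◂ ⌈ 1F ⌉ ∷ []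

 G2-complete : EG.Complete G2-roots
 G2-complete = from-yes(EG.Complete? G2-roots)

 G2-heavy : EG.Heavy G2-roots
 G2-heavy = from-yes(EG.Heavy? G2-roots)

 G2-joinable : EG.Joinable G2-roots [] 1F
 G2-joinable = from-yes(EG.Joinable? G2-roots [] 1F)

open Types

-- A good simple root, or an obstruction in the ideal.

module Classification{r N}(RD : RootDatum r N){G : Fin r -> Set}(G? : ∀ i -> Dec(G i))
  (Id : Fin N -> Set)(Id? : ∀ j -> Dec(Id j))(Id-pos : ∀{j} -> Id j -> Roots.Pos RD j)
  (Id-down : ∀{j k} -> Id j -> Roots.Pos RD k →(∀ i -> RootDatum.root RD k ! i Z.≤ RootDatum.root RD j ! i)-> Id k)where
 open Roots RD
 open Cases RD G?
 open import Data.Fin.Patterns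
 open import Data.Integer.Base using(_*_)renaming(_+_ to _⊕_; _-_ to _⊖_; -_ to ∼_)
 open import Data.Integer.Divisibility.Signed using(_∣_; divides; _∣?_)
 open import Data.Integer.Solver using(module +-*-Solver)
 open import Data.List.Relation.Unary.All using(All; []; _∷_)
 open import Relation.Nullary.Decidable using(decidable-stable)
 open +-*-Solver using(solve; _:=_; _:+_; _:*_; _:-_; con)

 Entries : ∀{n} -> Vec(Vec ℤ n)n →(Fin n -> Fin r)-> Set
 Entries M f = ∀ i k -> C(f i)(f k)≡ Vec.lookup M i ! k

 nodes-inj : ∀ τ f -> Entries(matrix τ)f -> ∀{i k} -> f i ≡ f k -> i ≡ k
 nodes-inj τ f cart{i}{k} e = diagonal τ i k(sym(cart i k)⨾ cong(C(f i))(sym e)⨾ C-self(f i))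

 record Pattern : Set where
  field
   τ : Type
   node : Fin 4 -> Fin r
   cart : Entries(matrix τ)node
  open Subsystem RD(matrix τ)node(nodes-inj τ node cart)cart using(index)
  field
   framed : ∀ i -> Id(index(frame τ i))

 Outcome : Set
 Outcome =(∃ \ w -> G w × Good w Id)⊎ Pattern

 entry : ∀{i k} -> i ≢ k -> C i k ≡ 0z ⊎ C i k ≡ -[1+ 0 ] ⊎ C i k ≡ -[1+ 1 ] ⊎ C i k ≡ -[1+ 2 ]
 entry{i}{k} i≢k with pairᶜ i≢k
 ... | orth z _ = inl z
 ... | acute m _ e _ _ _ _ = contra(C-np i≢k)(pos∧≤0(m , e))
 ... | obtuse 0 _ e _ _ _ _ = inr(inl e)
 ... | obtuse 1 _ e _ _ _ _ = inr(inr(inl e))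
 ... | obtuse 2 _ e _ _ _ _ = inr(inr(inr e))
 ... | obtuse(suc(suc(suc _)))_ _ _ _(s≤s(s≤s()))_

 distinct : ∀{i k} -> C i k ≢ + 2 -> i ≢ k
 distinct{i} h refl = h(C-self i)

 ≢2 : ∀{x m} -> x ≡ -[1+ m ] -> x ≢ + 2
 ≢2 refl()

 partner : ∀{i k m} -> C i k ≡ -[1+ suc m ] -> C k i ≡ -[1+ 0 ]
 partner{i}{k} e with pairᶜ(distinct{i}{k}(≢2 e))
 ... | orth z _ = contra(sym z ⨾ e)(\())
 ... | acute _ _ z _ _ _ _ = contra(sym z ⨾ e)(\())
 ... | obtuse _ _ z _(inl refl)_ _ = contra(sym z ⨾ e)(\())
 ... | obtuse _ _ _ z(inr refl)_ _ = z

 adjacent : ∀{i k} -> i ≢ k -> C i k ≢ 0z -> C i k Z.≤ -[1+ 0 ] × C k i Z.≤ -[1+ 0 ]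
 adjacent{i}{k} i≢k nz = neg⇒≤-1(≤0⇒neg(C-np i≢k)nz), neg⇒≤-1(≤0⇒neg(C-np(i≢k ∘ sym))(nz ∘ C-zero-sym{k}{i}))

 not-four : ∀{j k} -> Pos j -> Pos k -> ⟨ root j , k ⟩ ≢ -[1+ 3 ]
 not-four{j}{k} pj pk e with j Fin.≟ k
 ... | yes refl = contra(sym(self j)⨾ e)(\())
 ... | no j≢k with pair pj pk j≢k
 ... | orth z _ = contra(sym z ⨾ e)(\())
 ... | acute _ _ z _ _ _ _ = contra(sym z ⨾ e)(\())
 ... | obtuse m _ z _ _ m≤2 _ with trans(sym z)e
 ... | refl with m≤2
 ... | s≤s(s≤s())

 -- A triple bond admits no further neighbour, so the computation in the rank two system decides.
 G2-outcome : ∀{c d} -> G c -> C d c ≡ -[1+ 2 ] -> Outcome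
 G2-outcome{c}{d} gc dc = inl(c , gc , good G2-complete G? Id Id-pos Id-down G2-heavy{[]}{1F} G2-joinable [])where
  cart : Entries G2(Vec.lookup(d ∷ c ∷ []))
  cart 0F 0F = C-self d
  cart 0F 1F = dc
  cart 1F 0F = partner{d}{c} dc
  cart 1F 1F = C-self c
  d≢c = distinct{d}{c}(≢2 dc)
  injective : ∀{i k} -> Vec.lookup(d ∷ c ∷ [])i ≡ Vec.lookup(d ∷ c ∷ [])k -> i ≡ k
  injective{0F}{0F} _ = refl
  injective{0F}{1F} e = contra e d≢c
  injective{1F}{0F} e = contra(sym e)d≢c
  injective{1F}{1F} _ = refl
  open Subsystem RD G2(Vec.lookup(d ∷ c ∷ []))injective cart using(good)

 module DoubleBond{c d c' d′}(gc : G c)(gd : G d)(gc' : G c')(gd' : G d′)(dc : C d c ≡ -[1+ 1 ])(c'c : C c' c ≡ -[1+ 0 ])(dd' : C d d′ ≡ -[1+ 0 ])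
          (no-three : ∀{i k} -> G i -> G k -> C i k ≢ -[1+ 2 ])where
  cd : C c d ≡ -[1+ 0 ]
  cd = partner{d}{c} dc

  long short : Fin N
  long = rfl(simple d)(simple c)
  short = rfl(simple c)(simple d)

  ⟨long⟩ : ∀ t -> ⟨ root long , simple t ⟩ ≡ C d t ⊕(C c t ⊕ C c t)
  ⟨long⟩ t = rfl-⟨⟩(simple d)(simple c)(simple t)⨾ cong₂ _⊖_(C-root d t)(cong₂ _*_(C-root d c ⨾ dc)(C-root c t))⨾
   solve 2(\ x y -> x :- con -[1+ 1 ] :* y := x :+(y :+ y))refl(C d t)(C c t)

  long⟨⟩ : ∀ t -> ⟨ root(simple t), long ⟩ ≡ C t d ⊕ C t c
  long⟨⟩ t = ⟨⟩-rfl(root(simple t))(simple d)(simple c)⨾ cong₂ _⊖_(C-root t d)(cong₂ _*_(C-root t c)(C-root c d ⨾ cd))⨾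
   solve 2(\ x y -> x :- y :* con -[1+ 0 ] := x :+ y)refl(C t d)(C t c)

  ⟨short⟩ : ∀ t -> ⟨ root short , simple t ⟩ ≡ C c t ⊕ C d t
  ⟨short⟩ t = rfl-⟨⟩(simple c)(simple d)(simple t)⨾ cong₂ _⊖_(C-root c t)(cong₂ _*_(C-root c d ⨾ cd)(C-root d t))⨾
   solve 2(\ x y -> x :- con -[1+ 0 ] :* y := x :+ y)refl(C c t)(C d t)

  short⟨⟩ : ∀ t -> ⟨ root(simple t), short ⟩ ≡ C t c ⊕(C t d ⊕ C t d)
  short⟨⟩ t = ⟨⟩-rfl(root(simple t))(simple c)(simple d)⨾ cong₂ _⊖_(C-root t c)(cong₂ _*_(C-root t d)(C-root d c ⨾ dc))⨾
   solve 2(\ x y -> x :- y :* con -[1+ 1 ] := x :+(y :+ y))refl(C t c)(C t d)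

  long-pos : Pos long
  long-pos = rfl-pos(simple-pos d)(distinct{d}{c}(≢2 dc)∘ simple-inj)

  short-pos : Pos short
  short-pos = rfl-pos(simple-pos c)(distinct{c}{d}(≢2 cd)∘ simple-inj)

  ≤-2 : ∀{x y} -> x Z.≤ -[1+ 0 ] -> y Z.≤ -[1+ 0 ] -> x ⊕ y Z.≤ -[1+ 1 ]
  ≤-2 = Z.+-mono-≤

  double : ∀{x} -> x Z.≤ -[1+ 0 ] -> x ⊕ x Z.≤ -[1+ 0 ]
  double h = Z.≤-trans(≤-2 h h)(Z.-≤- z≤n)

  c'≢c = distinct{c'}{c}(≢2 c'c)
  d≢d' = distinct{d}{d′}(≢2 dd')

  c'≢d : c' ≢ d
  c'≢d refl = contra(sym c'c ⨾ dc)(\())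

  d'≢c : d′ ≢ c
  d'≢c refl = contra(sym dd' ⨾ dc)(\())

  cc'≤ : C c c' Z.≤ -[1+ 0 ]
  cc'≤ = snd(adjacent c'≢c(\ z -> contra(sym c'c ⨾ z)(\())))

  d'd≤ : C d′ d Z.≤ -[1+ 0 ]
  d'd≤ = snd(adjacent d≢d'(\ z -> contra(sym dd' ⨾ z)(\())))

  zero-unless : ∀{x : ℤ} →(x ≢ 0z -> ⊥)-> x ≡ 0z
  zero-unless{x} h = decidable-stable(x Z.≟ 0z)h

  dc' : C d c' ≡ 0z
  dc' = zero-unless \ nz -> let(a , b) = adjacent(c'≢d ∘ sym)nz in not-very-obtuse{long}{simple c'} long-pos(simple-pos c')
   (subst(Z._≤ -[1+ 1 ])(sym(⟨long⟩ c'))(≤-2 a(double cc'≤)))(subst(Z._≤ -[1+ 1 ])(sym(long⟨⟩ c'))(≤-2 b(Z.≤-reflexive c'c)))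

  cd' : C c d′ ≡ 0z
  cd' = zero-unless \ nz -> let(a , b) = adjacent(d'≢c ∘ sym)nz in not-very-obtuse{short}{simple d′} short-pos(simple-pos d′)
   (subst(Z._≤ -[1+ 1 ])(sym(⟨short⟩ d′))(≤-2 a(Z.≤-reflexive dd')))(subst(Z._≤ -[1+ 1 ])(sym(short⟨⟩ d′))(≤-2 b(double d'd≤)))

  cc' : C c c' ≡ -[1+ 0 ]
  cc' with entry(c'≢c ∘ sym)
  ... | inl z = contra(subst(Z._≤ -[1+ 0 ])z cc'≤)(\())
  ... | inr(inl e) = e
  -- A second double bond would give the Cartan number -4.
  ... | inr(inr(inl e)) = contra(⟨long⟩ c' ⨾ cong₂ _⊕_ dc'(cong₂ _⊕_ e e))(not-four{long}{simple c'} long-pos(simple-pos c'))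
  ... | inr(inr(inr e)) = contra e(no-three gc gc')

  d'd : C d′ d ≡ -[1+ 0 ]
  d'd with entry(d≢d' ∘ sym)
  ... | inl z = contra(subst(Z._≤ -[1+ 0 ])z d'd≤)(\())
  ... | inr(inl e) = e
  ... | inr(inr(inl e)) = contra(short⟨⟩ d′ ⨾ cong₂ _⊕_(C-zero-sym{c}{d′} cd')(cong₂ _⊕_ e e))(not-four{simple d′}{short}(simple-pos d′)short-pos)
  ... | inr(inr(inr e)) = contra e(no-three gd' gd)

  -- A bond here would close a cycle of four nodes; the test root is α_c + α_d + α_c'.
  c'd' : C c' d′ ≡ 0z
  c'd' = zero-unless \ nz -> let(a , b) = adjacent c'≢d' nz in not-very-obtuse{rfl short(simple c')}{simple d′}
    (rfl-pos short-pos(not-simple-of-neg{short}{c'}(0 , sc')))(simple-pos d′)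
    (subst(Z._≤ -[1+ 1 ])(sym(rfl-⟨⟩ short(simple c')(simple d′)⨾ cong₂ _⊖_(⟨short⟩ d′ ⨾ cong₂ _⊕_ cd' dd')(cong₂ _*_ sc'(C-root c' d′))))
     (shift a))
    (subst(Z._≤ -[1+ 1 ])(sym(⟨⟩-rfl(root(simple d′))short(simple c')⨾ cong₂ _⊖_(short⟨⟩ d′ ⨾ cong₂ _⊕_(C-zero-sym{c}{d′} cd')(cong₂ _⊕_ d'd d'd))
     (cong₂ _*_(C-root d′ c')(short⟨⟩ c' ⨾ cong₂ _⊕_ c'c(cong₂ _⊕_ c'd c'd)))))
     (Z.≤-trans(shift2 b)(Z.-≤-(s≤s z≤n))))where
   c'd = C-zero-sym{d}{c'} dc'
   c'≢d' : c' ≢ d′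
   c'≢d' refl = contra(sym dc' ⨾ dd')(\())
   sc' : ⟨ root short , simple c' ⟩ ≡ -[1+ 0 ]
   sc' = ⟨short⟩ c' ⨾ cong₂ _⊕_ cc' dc'
   shift : ∀{x} -> x Z.≤ -[1+ 0 ] -> -[1+ 0 ] ⊖ -[1+ 0 ] * x Z.≤ -[1+ 1 ]
   shift{x} h = subst(Z._≤ -[1+ 1 ])(solve 1(\ x -> con -[1+ 0 ] :+ x := con -[1+ 0 ] :- con -[1+ 0 ] :* x)refl x)(Z.+-monoʳ-≤ -[1+ 0 ] h)
   shift2 : ∀{x} -> x Z.≤ -[1+ 0 ] -> -[1+ 1 ] ⊖ x * -[1+ 0 ] Z.≤ -[1+ 2 ]
   shift2{x} h = subst(Z._≤ -[1+ 2 ])(solve 1(\ x -> con -[1+ 1 ] :+ x := con -[1+ 1 ] :- x :* con -[1+ 0 ])refl x)(Z.+-monoʳ-≤ -[1+ 1 ] h)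

  node : Fin 4 -> Fin r
  node = Vec.lookup(d′ ∷ d ∷ c ∷ c' ∷ [])

  cart : Entries(matrix F4)node
  cart 0F 0F = C-self d′
  cart 0F 1F = d'd
  cart 0F 2F = C-zero-sym{c}{d′} cd'
  cart 0F 3F = C-zero-sym{c'}{d′} c'd'
  cart 1F 0F = dd'
  cart 1F 1F = C-self d
  cart 1F 2F = dc
  cart 1F 3F = dc'
  cart 2F 0F = cd'
  cart 2F 1F = cd
  cart 2F 2F = C-self c
  cart 2F 3F = cc'
  cart 3F 0F = c'd'
  cart 3F 1F = C-zero-sym{d}{c'} dc'
  cart 3F 2F = c'c
  cart 3F 3F = C-self c'

  open Subsystem RD(matrix F4)node(nodes-inj F4 node cart)cart

  frame-pos : ∀ i -> Pos(index(frame F4 i))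
  frame-pos i = index-pos{frame F4 i}(from-yes(Fin.all? \ i -> E._≤ᵛ?_ F4 0ᵛ(E.rt F4(frame F4 i)))i)
   where open import Relation.Nullary.Decidable using(from-yes)

  outcome : Outcome
  outcome = go(Id?(index(frame F4 1F)))(Id?(index(frame F4 2F)))(Id?(index(frame F4 3F)))where
   missing : ∀ i{w} -> G(node w)-> E.Joinable F4(roots F4)(frame F4 i ∷ [])w -> ¬ Id(index(frame F4 i))-> Outcome
   missing i{w} gw j h = inl(node w , gw , good(complete F4)G? Id Id-pos Id-down F4-heavy{frame F4 i ∷ []}{w} j((frame-pos i , h)∷ []))
   go : Dec(Id(index(frame F4 1F)))-> Dec(Id(index(frame F4 2F)))-> Dec(Id(index(frame F4 3F)))-> Outcome
   go(no h)_ _ = missing 1F{0F} gd'(F4-joinable(inl refl))h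
   go(yes _)(no h)_ = missing 2F{3F} gc'(F4-joinable(inr(inl refl)))h
   go(yes _)(yes _)(no h) = missing 3F{0F} gd'(F4-joinable(inr(inr refl)))h
   go(yes h1)(yes h2)(yes h3) = inr(record{ τ = F4; node = node; cart = cart; framed = λ
    { 0F -> Id-down h1(simple-pos d)(index-≤{frame F4 0F}{frame F4 1F}(frame-pos 1F)(from-yes(E._≤ᵛ?_ F4(E.rt F4(frame F4 0F))(E.rt F4(frame F4 1F)))))
    ; 1F -> h1; 2F -> h2; 3F -> h3 } })
    where open import Relation.Nullary.Decidable using(from-yes)

 odd : ∀{i k} -> C i k ≢ -[1+ 2 ] -> ¬(+ 2 ∣ C i k)-> C i k ≡ -[1+ 0 ]
 odd{i}{k} three h with entry{i}{k}(\{ refl -> h(divides 1z(C-self i))})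
 ... | inl z = contra(divides 0z z)h
 ... | inr(inl e) = e
 ... | inr(inr(inl e)) = contra(divides -[1+ 0 ] e)h
 ... | inr(inr(inr e)) = contra e three

 classify : ∃ G -> Outcome
 classify nonempty = triple?(Fin.any? \ c -> Fin.any? \ d -> G? c ×-dec(G? d ×-dec(C d c Z.≟ -[1+ 2 ])))where
  D4-outcome :(laced : ∀{i k} -> G i -> G k -> i ≢ k -> C i k ≡ 0z ⊎ C i k ≡ -[1+ 0 ])-> Outcome
  D4-outcome laced = [ inl , inr ∘ pattern' ]′(S.classify nonempty)where
   module S = SimplyLacedCase RD G? Id Id? Id-pos Id-down laced
   pattern' : S.D4 -> Pattern
   pattern' D = record{ τ = D4; node = Vec.lookup(u ∷ x ∷ y ∷ z ∷ []); cart = cart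
             ; framed = \{ 0F -> Id-down xy(simple-pos u)below; 1F -> xy; 2F -> xz; 3F -> yz } } where
    open S.D4 D
    ux = S.C-symm gu gx ⨾ xu
    uy = S.C-symm gu gy ⨾ yu
    uz = S.C-symm gu gz ⨾ zu
    x⊥y = S.no-triangle gu gx gy x≢u y≢u x≢y xu yu
    x⊥z = S.no-triangle gu gx gz x≢u z≢u x≢z xu zu
    y⊥z = S.no-triangle gu gy gz y≢u z≢u y≢z yu zu
    cart : Entries(matrix D4)(Vec.lookup(u ∷ x ∷ y ∷ z ∷ []))
    cart 0F 0F = C-self u
    cart 0F 1F = ux
    cart 0F 2F = uy
    cart 0F 3F = uz
    cart 1F 0F = xu
    cart 1F 1F = C-self x
    cart 1F 2F = x⊥y
    cart 1F 3F = x⊥z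
    cart 2F 0F = yu
    cart 2F 1F = C-zero-sym{x}{y} x⊥y
    cart 2F 2F = C-self y
    cart 2F 3F = y⊥z
    cart 3F 0F = zu
    cart 3F 1F = C-zero-sym{x}{z} x⊥z
    cart 3F 2F = C-zero-sym{y}{z} y⊥z
    cart 3F 3F = C-self z
    below : ∀ l -> root(simple u)! l Z.≤ root(S.triple u x y)! l
    below l = subst₂ Z._≤_(Z.+-identityʳ _ ⨾ cong(_! l)(sym(root-simple u)))(sym(S.triple-root ux x⊥y uy l))
     (Z.+-monoʳ-≤(unit u ! l)(Z.+-mono-≤(unit≥0 x)(unit≥0 y)))where
     unit≥0 : ∀ i -> 0z Z.≤ unit i ! l
     unit≥0 i = subst(\ v -> 0z Z.≤ v ! l)(root-simple i)(simple-pos i l)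
  triple? : Dec(∃ \ c -> ∃ \ d -> G c × G d × C d c ≡ -[1+ 2 ])-> Outcome
  triple?(yes(c , d , gc , _ , e)) = G2-outcome{c}{d} gc e
  triple?(no none) = double?(Fin.any? \ c -> Fin.any? \ d -> G? c ×-dec(G? d ×-dec(C d c Z.≟ -[1+ 1 ])))where
   no-three : ∀{i k} -> G i -> G k -> C i k ≢ -[1+ 2 ]
   no-three gi gk e = none(_ , _ , gk , gi , e)
   double? : Dec(∃ \ c -> ∃ \ d -> G c × G d × C d c ≡ -[1+ 1 ])-> Outcome
   double?(no none2) = D4-outcome laced where
    laced : ∀{i k} -> G i -> G k -> i ≢ k -> C i k ≡ 0z ⊎ C i k ≡ -[1+ 0 ]
    laced gi gk i≢k with entry i≢k
    ... | inl z = inl z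
    ... | inr(inl e) = inr e
    ... | inr(inr(inl e)) = contra(_ , _ , gk , gi , e)none2
    ... | inr(inr(inr e)) = contra e(no-three gi gk)
   double?(yes(c , d , gc , gd , e)) = both(Fin.any? \ j -> G? j ×-dec ¬?((+ 2)∣? C j c))(Fin.any? \ j -> G? j ×-dec ¬?((+ 2)∣? C d j))where
    -- For the double bond from d to c, evenness of all pairings with c leads to type B, evenness of
    -- all pairings of d to type C. If both fail, the two odd entries supply the outer nodes of a
    -- diagram of type F₄.
    both : Dec(∃ \ j -> G j × ¬(+ 2 ∣ C j c))-> Dec(∃ \ j -> G j × ¬(+ 2 ∣ C d j))-> Outcome
    both(no none)_ = inl(caseB Id Id-pos gc gd(0 , partner{d}{c} e)(\ j gj -> decidable-stable((+ 2)∣? C j c)(\ h -> none(j , gj , h))))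
    both(yes _)(no none) = inl(caseC Id Id-pos gc gd(1 , e)(\ j gj -> decidable-stable((+ 2)∣? C d j)(\ h -> none(j , gj , h))))
    both(yes(c' , gc' , h))(yes(d′ , gd' , h')) = DoubleBond.outcome gc gd gc' gd' e(odd{c'}{c}(no-three gc' gc)h)(odd{d}{d′}(no-three gd gd')h')no-three

-- The arrangement of an ideal and the obstruction inside it.

module IdealArrangement{c ℓ₁ ℓ₂ ℓ₃ v ℓv}{F : OrderedField c ℓ₁ ℓ₂ ℓ₃}{E : EuclideanSpace F v ℓv}{N : ℕ}(Φ : RootSystem E N)(Δ : Base Φ)
            (I : Subset N)(ideal : Base.IsOrderIdeal Δ I)
            (RD : RootDatum(Base.rank Δ)N)(vector-root : ∀ k -> EuclideanSpace._≈ᴹ_ E(RootSystem.root Φ k)(RootDatumOf.real Φ Δ(RootDatum.root RD k)))where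
 private module F = CommutativeRing(OrderedField.commutativeRing F)
 open EuclideanSpace E hiding(⟨_,_⟩)
 open Renamed leftModule
 open LinearAlgebra E
 open RootSystem Φ using()renaming(root to vector)
 open Base Δ using(rank; simpleSum; HasCoefficients)renaming(Positive to Posi')
 open Combinations E
 open OrderedFieldTheory F using(ιz; ιz-+; ιz-*; cancel; line; *ʳ-lin; module Line)
 open RootDatumOf Φ Δ using(basis; basis-independent; real; real-inj; natural; natural-!; simpleSum-real; ι-zero; ι-dot)
 open Roots RD
 open import Data.Fin.Patterns
 open import Data.Fin.Subset.Properties using(_∈?_)
 open import Data.Integer.Base using(_*_)renaming(_+_ to _⊕_)
 import Data.List.Base as List
 open import Data.List.Membership.Propositional.Properties using(∈-filter⁻; ∈-filter⁺; ∈-lookup; ∈-allFin)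
 open import Data.List.Relation.Unary.All as All using(All)
 open import Data.List.Relation.Unary.Any as Any using(Any)
 open import Data.List.Relation.Unary.Any.Properties using(lookup-index)
 open import Data.List.Relation.Unary.AllPairs using([]; _∷_)
 open import Data.List.Relation.Unary.Unique.Propositional using(Unique)
 import Data.List.Relation.Unary.Unique.Propositional.Properties as Unique
 open import Data.Maybe.Properties using(just-injective)renaming(≡-dec to ≡-decᴹ)
 open import Data.Vec.Properties using(lookup∘tabulate; lookup-map)
 open import Relation.Nullary.Decidable using(decidable-stable; _→-dec_)

 Id : Fin N -> Set
 Id j = j ∈ I

 Id? : ∀ j -> Dec(Id j)
 Id? j = j ∈? I

 root-of : ∀{j n} -> HasCoefficients j n -> root j ≡ natural n
 root-of{j}{n} h = real-inj(sm(vector-root j)⊚ h ⊚ simpleSum-real n)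

 coefs-of : ∀{j} -> Pos j -> HasCoefficients j(\ i -> Z.∣ root j ! i ∣)
 coefs-of{j} p = vector-root j ⊚ ≈ᴹ-reflexive(cong real(ext{x = root j}{natural n}(\ i -> sym(natural-! n i ⨾ Z.0≤i⇒+∣i∣≡i(p i)))))⊚ sm(simpleSum-real n)
  where n = \ i -> Z.∣ root j ! i ∣

 Id-pos : ∀{j} -> Id j -> Pos j
 Id-pos{j} h i = let(n , e) = fst ideal j h in subst(\ x -> 0z Z.≤ x ! i)(sym(root-of{j} e))(subst(0z Z.≤_)(sym(natural-! n i))(Z.+≤+ z≤n))

 Id-down : ∀{j k} -> Id j -> Pos k →(∀ i -> root k ! i Z.≤ root j ! i)-> Id k
 Id-down{j}{k} ij pk k≤j with k Fin.≟ j
 ... | yes refl = ij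
 ... | no k≢j = snd ideal j k ij((\ i -> Z.∣ root k ! i ∣), coefs-of{k} pk)((_ , _ , coefs-of{k} pk , coefs-of{j}(Id-pos ij), \ i -> abs-≤(pk i)(k≤j i)), k≢j)where
  abs-≤ : ∀{x y} -> 0z Z.≤ x -> x Z.≤ y -> Z.∣ x ∣ ≤ Z.∣ y ∣
  abs-≤{+ m}{+ n} _(Z.+≤+ h) = h

 Atom : Set
 Atom = Fin(List.length(members I))

 atom : Atom -> Fin N
 atom = List.lookup(members I)

 atom-in : ∀ a -> Id(atom a)
 atom-in a = snd(∈-filter⁻(_∈? I){xs = List.allFin N}(∈-lookup a))

 atom-pos : ∀ a -> Pos(atom a)
 atom-pos a = Id-pos(atom-in a)

 atom-inj : ∀{a b} -> atom a ≡ atom b -> a ≡ b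
 atom-inj = lookup-injective(Unique.filter⁺(_∈? I)(Unique.allFin⁺ N))where
  lookup-injective : ∀{xs : List(Fin N)} -> Unique xs -> ∀{a b} -> List.lookup xs a ≡ List.lookup xs b -> a ≡ b
  lookup-injective(p ∷ u){zero}{zero} e = refl
  lookup-injective{x ∷ xs}(p ∷ u){zero}{suc b} e = contra e(All.lookup p(∈-lookup b))
  lookup-injective{x ∷ xs}(p ∷ u){suc a}{zero} e = contra(sym e)(All.lookup p(∈-lookup a))
  lookup-injective(p ∷ u){suc a}{suc b} e = cong suc(lookup-injective u e)

 atom-of : ∀{j} -> Id j -> ∃ \ a -> atom a ≡ j
 atom-of{j} h = let p = ∈-filter⁺(_∈? I)(∈-allFin j)h in Any.index p , sym(lookup-index p)

 𝒜 : Vector Carrierᴹ(List.length(members I))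
 𝒜 = rootArrangement Φ I

 module _{k}(t : Vector Atom k)(s : Vector F.Carrier k)where
  weighted :(Fin k -> ℤ)-> F.Carrier
  weighted y = Line.sum(\ q -> s q F.* ιz(y q))

  comb-atoms : combination s(𝒜 ∘ t)≈ᴹ combination(\ l -> weighted(\ q -> root(atom(t q))! l))basis
  comb-atoms = comb-matrix(\ q l -> ιz(root(atom(t q))! l))(\ q -> vector-root(atom(t q)))s

  weighted-∙ : ∀{n}(φ : Vec ℤ n)(y : Fin k -> Vec ℤ n)→(∀ l -> weighted(\ q -> y q ! l)F.≈ F.0#)-> weighted(\ q -> φ ∙ y q)F.≈ F.0#
  weighted-∙ [] y h = Line.sum-zero(\ q -> F.trans(F.*-congˡ(F.reflexive(cong ιz(empty(y q)))))(F.zeroʳ(s q)))where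
   empty : ∀(x : Vec ℤ 0)-> [] ∙ x ≡ 0z
   empty [] = refl
  weighted-∙(p ∷ φ)y h = F.trans(Line.sum-cong-≋{_}{\ q -> s q F.* ιz((p ∷ φ)∙ y q)} term)
   (F.trans(Line.∑-distrib-+(\ q →(s q F.* ιz(y q ! zero))F.* ιz p)(\ q -> s q F.* ιz(φ ∙ Vec.tail(y q))))
   (F.trans(F.+-cong(F.trans(F.sym(Lin.map-sum(*ʳ-lin(ιz p))(\ q -> s q F.* ιz(y q ! zero))))(F.trans(F.*-congʳ(h zero))(F.zeroˡ _)))
    (weighted-∙ φ(Vec.tail ∘ y)(\ l -> F.trans(Line.sum-cong-≋{_}{\ q -> s q F.* ιz(Vec.tail(y q)! l)}(\ q -> F.reflexive(cong(\ z -> s q F.* ιz z)(tail-!(y q)l))))(h(suc l)))))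
    (F.+-identityʳ _)))where
   open OrderedFieldTheory F using(solve; _:=_; _:+_; _:*_)
   tail-! : ∀{n}(x : Vec ℤ(suc n))l -> Vec.tail x ! l ≡ x ! suc l
   tail-!(_ ∷ _)l = refl
   split : ∀{n} p(φ : Vec ℤ n)x →(p ∷ φ)∙ x ≡ p * x ! zero ⊕ φ ∙ Vec.tail x
   split p φ(_ ∷ _) = refl
   term : ∀ q -> s q F.* ιz((p ∷ φ)∙ y q)F.≈(s q F.* ιz(y q ! zero))F.* ιz p F.+ s q F.* ιz(φ ∙ Vec.tail(y q))
   term q = F.trans(F.*-congˡ(F.trans(F.reflexive(cong ιz(split p φ(y q))))(F.trans(ιz-+(p * y q ! zero)(φ ∙ Vec.tail(y q)))(F.+-congʳ(ιz-* p(y q ! zero))))))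
    (solve 4(\ s p a b -> s :*(p :* a :+ b) :=(s :* a) :* p :+ s :* b)F.refl(s q)(ιz p)(ιz(y q ! zero))(ιz(φ ∙ Vec.tail(y q))))

  -- How coefficients are shown to vanish throughout: weigh the relation by a function that is
  -- nonzero at p and kills every other term.
  isolate : ∀(y : Fin k -> ℤ)p -> weighted y F.≈ F.0# →(∀ q -> q ≢ p -> s q F.≈ F.0# ⊎ y q ≡ 0z)-> y p ≢ 0z -> s p F.≈ F.0#
  isolate y p sum≈0 others yp = cancel(\ z -> yp(ι-zero(y p)z))(F.trans(F.*-comm _ _)(F.trans(F.sym(Line.∑-single(\ _ -> yes tt){\ q -> s q F.* ιz(y q)} p tt(\ q _ q≢p -> vanish q(others q q≢p))))sum≈0))where
   vanish : ∀ q -> s q F.≈ F.0# ⊎ y q ≡ 0z -> s q F.* ιz(y q)F.≈ F.0#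
   vanish q(inl z) = F.trans(F.*-congʳ z)(F.zeroˡ _)
   vanish q(inr z) = F.trans(F.*-congˡ(F.reflexive(cong ιz z)))(F.zeroʳ _)

 module PatternObstruction{G : Fin rank -> Set}(G? : ∀ i -> Dec(G i))(P : Classification.Pattern RD G? Id Id? Id-pos Id-down){κ ℓκ1 ℓκ2}(K : HeytingField κ ℓκ1 ℓκ2)where
  open Classification RD G? Id Id? Id-pos Id-down using(nodes-inj; module Pattern)
  open Pattern P
  open Subsystem RD(matrix τ)node(nodes-inj τ node cart)cart

  coords : Fin N -> Vec ℤ 4
  coords j = Vec.tabulate(\ k -> root j ! node k)

  coords-index : ∀ w -> coords(index w)≡ E.rt τ w
  coords-index w = ext(\ k -> lookup∘tabulate(\ k -> root(index w)! node k)k ⨾ coordinate w k)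

  onNodes? : ∀ j -> Dec(OnNodes j)
  onNodes? j = Fin.all?(\ l -> ¬?(image? l)→-dec(root j ! l Z.≟ 0z))

  InClass : Fin N -> Fin 4 -> Set
  InClass j i = ∃ \ b -> OnNodes j × coords j ≡ class τ i b

  inClass? : ∀ j i -> Dec(InClass j i)
  inClass? j i = Fin.any?(\ b -> onNodes? j ×-dec E._≟ᵛ_ τ(coords j)(class τ i b))

  class-frame : ∀ τ i -> class τ i 0F ≡ E.rt τ(frame τ i)
  class-frame D4 i = refl
  class-frame F4 0F = refl
  class-frame F4 1F = refl
  class-frame F4 2F = refl
  class-frame F4 3F = refl

  abstract
   choose : ∀{j} -> Dec(∃(InClass j))-> Maybe(Fin 4)
   choose(yes(i , _)) = just i
   choose(no _) = nothing

   label : Fin N -> Maybe(Fin 4)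
   label j = choose{j}(Fin.any?(inClass? j))

   label-just : ∀{j i} -> label j ≡ just i -> InClass j i
   label-just{j} = go(Fin.any?(inClass? j))where
    go : ∀{i}(d : Dec(∃(InClass j)))-> choose{j} d ≡ just i -> InClass j i
    go(yes(_ , h))refl = h

   label-nothing : ∀{j} -> label j ≡ nothing -> ¬ ∃(InClass j)
   label-nothing{j} = go(Fin.any?(inClass? j))where
    go :(d : Dec(∃(InClass j)))-> choose{j} d ≡ nothing -> ¬ ∃(InClass j)
    go(no h)_ = h

   label-frame : ∀ i -> label(index(frame τ i))≡ just i
   label-frame i = go(Fin.any?(inClass?(index(frame τ i))))where
    at-frame : coords(index(frame τ i))≡ class τ i 0F
    at-frame = coords-index(frame τ i)⨾ sym(class-frame τ i)
    go :(d : Dec(∃(InClass(index(frame τ i)))))-> choose{index(frame τ i)} d ≡ just i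
    go(yes(k , b , _ , e)) = cong just(sym(class-inj τ i k b(sym at-frame ⨾ e)))
    go(no h) = contra(i , 0F , index-on-nodes(frame τ i), at-frame)h

   label-centre : label(index(centre τ))≡ nothing
   label-centre = go(Fin.any?(inClass?(index(centre τ))))where
    go :(d : Dec(∃(InClass(index(centre τ)))))-> choose{index(centre τ)} d ≡ nothing
    go(yes(k , b , _ , e)) = contra(k , b , sym(coords-index(centre τ))⨾ e)(centre-unlabelled τ)
    go(no _) = refl

  module _{d}(d≤3 : d ≤ 3)(t : Vector Atom(suc d))(s : Vector F.Carrier(suc d))(zero-sum : combination s(𝒜 ∘ t)≈ᴹ 0ᴹ)
       (apart : ∀{p q} -> p ≢ q -> label(atom(t p))≢ label(atom(t q)))where
   private
    lab : Fin(suc d)-> Maybe(Fin 4)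
    lab q = label(atom(t q))

    used? : ∀ i -> Dec(∃ \ q -> lab q ≡ just i)
    used? i = Fin.any?(\ q -> ≡-decᴹ Fin._≟_(lab q)(just i))

    pick : ∀{i} -> Dec(∃ \ q -> lab q ≡ just i)-> Fin 2
    pick(yes(q , e)) = fst(label-just{atom(t q)} e)
    pick(no _) = 0F

    -- The member of each class that actually occurs in t, unique because labels are distinct; for
    -- labels that do not occur the choice is arbitrary.
    b : Fin 4 -> Fin 2
    b i = pick(used? i)

    coords-b : ∀ q i -> lab q ≡ just i -> coords(atom(t q))≡ class τ i(b i)
    coords-b q i e = go(used? i)where
     go : ∀(u : Dec(∃ \ q -> lab q ≡ just i))-> coords(atom(t q))≡ class τ i(pick u)
     go(no h) = contra(q , e)h
     go(yes(p , e')) = same(p Fin.≟ q)where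
      same : Dec(p ≡ q)-> coords(atom(t q))≡ class τ i(fst(label-just{atom(t p)} e'))
      same(yes refl) = snd(snd(label-just{atom(t p)} e'))
      same(no p≢q) = contra(e' ⨾ sym e)(apart p≢q)

    coordinate-sum : ∀ l -> weighted t s(\ q -> root(atom(t q))! l)F.≈ F.0#
    coordinate-sum = basis-independent _(sm(comb-atoms t s)⊚ zero-sum)

    φ-sum : ∀ φ -> weighted t s(\ q -> φ ∙ coords(atom(t q)))F.≈ F.0#
    φ-sum φ = weighted-∙ t s φ(coords ∘ atom ∘ t)(\ l -> F.trans(Line.sum-cong-≋{_}{\ q -> s q F.* ιz(coords(atom(t q))! l)}(\ q -> F.reflexive(cong(\ z -> s q F.* ιz z)(lookup∘tabulate(\ k -> root(atom(t q))! node k)l))))(coordinate-sum(node l)))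

    eta : ∀ k -> choice(b 0F)(b 1F)(b 2F)(b 3F)k ≡ b k
    eta 0F = refl
    eta 1F = refl
    eta 2F = refl
    eta 3F = refl

    φᵢ : ∀ i -> ∃ \ φ -> φ ∙ class τ i(b i)≢ 0z ×(∀ k -> k ≢ i -> φ ∙ class τ k(b k)≡ 0z)× All(\ w -> φ ∙ E.rt τ w ≢ 0z ⊎ Labelled τ(E.rt τ w))(roots τ)
    φᵢ i = let a = dual τ(b 0F)(b 1F)(b 2F)(b 3F)i; (nonzero , at , off) = All.lookupAny(nonvanishing τ)a in
     Any.lookup a , subst(\ c -> Any.lookup a ∙ class τ i c ≢ 0z)(eta i)at ,(\ k k≢i -> subst(\ c -> Any.lookup a ∙ class τ k c ≡ 0z)(eta k)(off k k≢i)), nonzero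

    labelled-other : ∀{p q} -> q ≢ p -> lab p ≡ nothing -> ∃ \ i -> lab q ≡ just i
    labelled-other{p}{q} q≢p e = go(lab q)refl where
     go : ∀ m -> lab q ≡ m -> ∃ \ i -> lab q ≡ just i
     go(just i)h = i , h
     go nothing h = contra(h ⨾ sym e)(apart q≢p)

    -- Apart from p at most three atoms are left for four labels.
    unused : ∀ p -> lab p ≡ nothing -> ∃ \ i -> ¬ ∃ \ q -> lab q ≡ just i
    unused p e = go(Fin.all? used?)where
     go : Dec(∀ i -> ∃ \ q -> lab q ≡ just i)-> ∃ \ i -> ¬ ∃ \ q -> lab q ≡ just i
     go(no h) = Fin.¬∀⟶∃¬ 4 _ used? h
     go(yes all) = let(i , j , i<j , same) = Fin.pigeonhole(s≤s d≤3)(\ i -> Fin.punchOut(p≢ i))in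
       contra(just-injective(sym(snd(all i))⨾ cong lab(Fin.punchOut-injective(p≢ i)(p≢ j)same)⨾ snd(all j)))(Fin.<⇒≢ i<j)where
      p≢ : ∀ i -> p ≢ fst(all i)
      p≢ i h = contra(sym e ⨾ cong lab h ⨾ snd(all i))(\())

   unlabelled-zero : ∀ p -> lab p ≡ nothing -> s p F.≈ F.0#
   unlabelled-zero p e = go(Fin.any?(\ l -> ¬?(image? l)×-dec ¬?(root(atom(t p))! l Z.≟ 0z)))where
    go : Dec(∃ \ l -> ¬ Image l × root(atom(t p))! l ≢ 0z)-> s p F.≈ F.0#
    go(yes(l , ¬l , nz)) = isolate t s(\ q -> root(atom(t q))! l)p(coordinate-sum l)
     (\ q q≢p -> inr(fst(snd(label-just{atom(t q)}(snd(labelled-other q≢p e))))l ¬l))nz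
    go(no none) = let(i , free) = unused p e; (φ , _ , off , nonzero) = φᵢ i in isolate t s(\ q -> φ ∙ coords(atom(t q)))p(φ-sum φ)
      (\ q q≢p -> let(k , h) = labelled-other q≢p e in inr(cong(φ ∙_)(coords-b q k h)⨾ off k(\ k≡i -> free(q , h ⨾ cong just k≡i))))
      (value φ nonzero)where
     on : OnNodes(atom(t p))
     on l ¬l = decidable-stable(root(atom(t p))! l Z.≟ 0z)(\ nz -> none(l , ¬l , nz))
     value : ∀ φ -> All(\ w -> φ ∙ E.rt τ w ≢ 0z ⊎ Labelled τ(E.rt τ w))(roots τ)-> φ ∙ coords(atom(t p))≢ 0z
     value φ nonzero = go'{Any.lookup listed}(All.lookupAny nonzero listed)where
      listed = enumerated(complete τ)(atom(t p))(atom-pos(t p))on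
      go' : ∀{w} →(φ ∙ E.rt τ w ≢ 0z ⊎ Labelled τ(E.rt τ w))× index w ≡ atom(t p)-> φ ∙ coords(atom(t p))≢ 0z
      go'{w}(inl nz , h)z = nz(cong(φ ∙_)(sym(coords-index w)⨾ cong coords h)⨾ z)
      go'{w}(inr(k , c , h'), h)_ = label-nothing{atom(t p)} e(k , c , on , cong coords(sym h)⨾ coords-index w ⨾ h')

   -- The dual functional kills the other labels, and a possible unlabelled term already has
   -- coefficient zero.
   labelled-zero : ∀ p i -> lab p ≡ just i -> s p F.≈ F.0#
   labelled-zero p i e = let(φ , at , off , _) = φᵢ i in isolate t s(\ q -> φ ∙ coords(atom(t q)))p(φ-sum φ)
     (\ q q≢p -> other φ off q q≢p(lab q)refl)(\ z -> at(cong(φ ∙_)(sym(coords-b p i e))⨾ z))where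
    other : ∀ φ →(∀ k -> k ≢ i -> φ ∙ class τ k(b k)≡ 0z)-> ∀ q -> q ≢ p -> ∀ m -> lab q ≡ m -> s q F.≈ F.0# ⊎ φ ∙ coords(atom(t q))≡ 0z
    other φ off q q≢p nothing h = inl(unlabelled-zero q h)
    other φ off q q≢p(just k)h = inr(cong(φ ∙_)(coords-b q k h)⨾ off k(\ k≡i -> apart q≢p(h ⨾ cong just k≡i ⨾ sym e)))

   all-zero : ∀ p -> s p F.≈ F.0#
   all-zero p = go(lab p)refl where
    go : ∀ m -> lab p ≡ m -> s p F.≈ F.0#
    go nothing h = unlabelled-zero p h
    go(just i)h = labelled-zero p i h

  frameAtom : Fin 4 -> Atom
  frameAtom i = fst(atom-of(framed i))

  frameAtom-index : ∀ i -> atom(frameAtom i)≡ index(frame τ i)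
  frameAtom-index i = snd(atom-of(framed i))

  centre-in : Id(index(centre τ))
  centre-in = Id-down(framed 1F)(index-pos{centre τ}(fst(centre-below τ)))(index-≤{centre τ}{frame τ 1F}(Id-pos(framed 1F))(snd(centre-below τ)))

  tuple : Vector Atom 5
  tuple = fst(atom-of centre-in)Vector.∷ frameAtom

  tuple-dependent : LinearlyDependent(𝒜 ∘ tuple)
  tuple-dependent =(\ q -> ιz(relation τ ! q)), comb-atoms tuple(\ q -> ιz(relation τ ! q))⊚ comb-zero basis coef , 0F ,(\ z -> head≢0 τ(ι-zero(relation τ ! 0F)z))where
   head≢0 : ∀ τ -> relation τ ! 0F ≢ 0z
   head≢0 D4()
   head≢0 F4()
   tupleWord : Vec(Word 4)5
   tupleWord = centre τ ∷ Vec.tabulate(frame τ)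
   at : ∀ q -> atom(tuple q)≡ index(Vec.lookup tupleWord q)
   at zero = snd(atom-of centre-in)
   at(suc i) = frameAtom-index i ⨾ cong index(sym(lookup∘tabulate(frame τ)i))
   coef : ∀ l -> weighted tuple(\ q -> ιz(relation τ ! q))(\ q -> root(atom(tuple q))! l)F.≈ F.0#
   coef l = F.trans(Line.sum-cong-≋{_}{\ q -> ιz(relation τ ! q)F.* ιz(root(atom(tuple q))! l)}(\ q -> F.*-congˡ(F.reflexive(cong ιz(cong(\ j -> root j ! l)(at q)⨾
    sym(lookup-map q(\ w -> root(index w)! l)tupleWord))))))
    (F.trans(F.sym(ι-dot(relation τ)(Vec.map(\ w -> root(index w)! l)tupleWord)))(F.reflexive(cong ιz(integral(image? l)))))where
    integral : Dec(Image l)-> relation τ ∙ Vec.map(\ w -> root(index w)! l)tupleWord ≡ 0z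
    integral(no ¬l) = ∙-zero(relation τ)_(\ q -> cong(relation τ ! q *_)(lookup-map q(\ w -> root(index w)! l)tupleWord ⨾ index-on-nodes(Vec.lookup tupleWord q)l ¬l)⨾ Z.*-zeroʳ(relation τ ! q))
    integral(yes(k , refl)) = cong(relation τ ∙_)(ext(\ q -> lookup-map q(\ w -> root(index w)! node k)tupleWord ⨾ coordinate(Vec.lookup tupleWord q)k ⨾ sym(vector-at q)))⨾ circuit τ k where
     vector-at : ∀ q -> Vec.map(_! k)(E.rt τ(centre τ)∷ Vec.tabulate(E.rt τ ∘ frame τ))! q ≡ E.rt τ(Vec.lookup tupleWord q)! k
     vector-at zero = refl
     vector-at(suc i) = lookup-map i(_! k)(Vec.tabulate(E.rt τ ∘ frame τ))⨾ cong(_! k)(lookup∘tabulate(E.rt τ ∘ frame τ)i ⨾ cong(E.rt τ)(sym(lookup∘tabulate(frame τ)i)))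

  pattern-not-koszul : ¬ Koszul K(OrlikSolomon.𝒪𝒮 K{E = E} 𝒜)
  pattern-not-koszul = not-koszul K{E = E} 𝒜(label ∘ atom)
    (\{ d≤3 t _(s , zero-sum , p , nz)distinct -> nz(all-zero d≤3 t s zero-sum(apart t distinct)p)})
    frameAtom(\ i -> cong label(frameAtom-index i)⨾ label-frame i)(tuple 0F)(cong label(snd(atom-of centre-in))⨾ label-centre)tuple-dependent where
   open Obstruction K{E = E}(fst(exteriorAction(fieldRing K)))𝒜(label ∘ atom)using(Distinct; toList')renaming(_∷_ to _∷ᵈ_)
   later : ∀{k p}{P : Atom -> Set p}(t : Vector Atom k)-> All P(toList' t)-> ∀ q -> P(t q)
   later t(h All.∷ _)zero = h
   later t(_ All.∷ hs)(suc q) = later(Vector.tail t)hs q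
   apart : ∀{k}(t : Vector Atom k)-> Distinct(toList' t)-> ∀{p q} -> p ≢ q -> label(atom(t p))≢ label(atom(t q))
   apart t(h ∷ᵈ hs){zero}{zero} p≢q = contra refl p≢q
   apart t(h ∷ᵈ hs){zero}{suc q} _ = later(Vector.tail t)h q
   apart t(h ∷ᵈ hs){suc p}{zero} _ = later(Vector.tail t)h p ∘ sym
   apart t(h ∷ᵈ hs){suc p}{suc q} p≢q = apart(Vector.tail t)hs(p≢q ∘ cong suc)

-- From an elimination order to a supersolvable partition.

module Supersolvability{c ℓ₁ ℓ₂ ℓ₃ v ℓv}{F : OrderedField c ℓ₁ ℓ₂ ℓ₃}{E : EuclideanSpace F v ℓv}{N : ℕ}(Φ : RootSystem E N)(Δ : Base Φ)
            (I : Subset N)(ideal : Base.IsOrderIdeal Δ I)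
            (RD : RootDatum(Base.rank Δ)N)(vector-root : ∀ k -> EuclideanSpace._≈ᴹ_ E(RootSystem.root Φ k)(RootDatumOf.real Φ Δ(RootDatum.root RD k)))
            (simple-index : ∀ i -> Base.simple Δ i ≡ RootDatum.simple RD i)where
 private module F = CommutativeRing(OrderedField.commutativeRing F)
 open EuclideanSpace E hiding(⟨_,_⟩)
 open Renamed leftModule
 open LinearAlgebra E
 open RootSystem Φ using()renaming(root to vector)
 open Base Δ using(rank)
 open Combinations E
 open OrderedFieldTheory F using(ιz; cancel; 1≉0; module Line)
 open RootDatumOf Φ Δ using(basis; basis-independent; ι-zero; real-*)
 open IdealArrangement Φ Δ I ideal RD vector-root
 open Arrangement E 𝒜
 open Roots RD
 open import Data.Fin.Subset using(⊤; _-_; ∣_∣)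
 open import Data.Fin.Subset.Properties using(_∈?_; ∈⊤; p─q⊆p; x∈p∧x≢y⇒x∈p-y; x∈p⇒∣p-x∣<∣p∣)
 open import Data.Integer.Base using(_*_)renaming(_+_ to _⊕_; _-_ to _⊖_)
 open import Data.Integer.Solver using(module +-*-Solver)
 open import Data.Vec.Properties using(lookup⇒[]=; []=⇒lookup; lookup∘tabulate)
 open import Relation.Nullary.Decidable using(dec-true; decidable-stable; _→-dec_)

 nonzero-atom : ∀ x{a} -> a *ₗ 𝒜 x ≈ᴹ 0ᴹ -> a F.≈ F.0#
 nonzero-atom x{a} h = let(l , p) = some-pos(atom-pos x)in
  isolate{1}(\ _ -> x)(\ _ -> a)(\ _ -> root(atom x)! l)zero(basis-independent _(sm(comb-atoms{1}(\ _ -> x)(\ _ -> a))⊚ +0 _ ⊚ h)l)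
   (\{ zero h -> contra refl h })(pos⇒≢0 p)

 ∙-comm : ∀{n}(x y : Vec ℤ n)-> x ∙ y ≡ y ∙ x
 ∙-comm [] [] = refl
 ∙-comm(x ∷ p)(y ∷ q) = cong₂ _⊕_(Z.*-comm x y)(∙-comm p q)

 -- The functional (2 y^∨ - ⟨ x , y^∨ ⟩ x^∨) kills x but not y.
 second-zero : ∀{x y} -> x ≢ y -> ∀{a b} -> a *ₗ 𝒜 x +ᴹ b *ₗ 𝒜 y ≈ᴹ 0ᴹ -> b F.≈ F.0#
 second-zero{x}{y} x≢y{a}{b} h = isolate t s(\ i -> φ ∙ root(atom(t i)))(suc zero)
   (weighted-∙ t s φ(root ∘ atom ∘ t)(basis-independent _(sm(comb-atoms t s)⊚ +≈ˡ(+0 _)⊚ h)))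
   (\{ zero _ -> inr(value X ⨾ cong(\ z -> + 2 * q ⊖ q * z)(self X)⨾ solve 1(\ q -> con(+ 2) :* q :- q :* con(+ 2) := con 0z)refl q); (suc zero)h -> contra refl h })
   (\ z -> not-par(pair(atom-pos x)(atom-pos y)(x≢y ∘ atom-inj))(sym(value Y ⨾ cong(\ z -> + 2 * z ⊖ q * ⟨ root Y , X ⟩)(self Y))⨾ z))where
  open +-*-Solver using(solve; _:=_; _:*_; _:-_; con)
  X = atom x
  Y = atom y
  q = ⟨ root X , Y ⟩
  t : Vector Atom 2
  t = x Vector.∷ y Vector.∷ Vector.[]
  s : Vector F.Carrier 2
  s = a Vector.∷ b Vector.∷ Vector.[]
  φ = + 2 *ᵛ cor Y -ᵛ q *ᵛ cor X
  value : ∀ j -> φ ∙ root j ≡ + 2 * ⟨ root j , Y ⟩ ⊖ q * ⟨ root j , X ⟩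
  value j = ∙--(+ 2 *ᵛ cor Y)(q *ᵛ cor X)(root j)⨾ cong₂ _⊖_(∙-*(+ 2)(cor Y)(root j)⨾ cong(+ 2 *_)(∙-comm(cor Y)(root j)))
   (∙-* q(cor X)(root j)⨾ cong(q *_)(∙-comm(cor X)(root j)))
  -- Up to positive factors this is the Gram determinant: 4 minus the product of the Cartan numbers.
  not-par : ∀{p q} -> CartanPair p q -> + 4 ⊖ p * q ≢ 0z
  not-par(orth refl refl)()
  not-par(acute 0 0 refl refl _ _ _)()
  not-par(acute 0 1 refl refl _ _ _)()
  not-par(acute 0 2 refl refl _ _ _)()
  not-par(acute 1 0 refl refl _ _ _)()
  not-par(acute 2 0 refl refl _ _ _)()
  not-par(acute(suc _)(suc _)_ _(inl())_ _)
  not-par(acute(suc _)(suc _)_ _(inr())_ _)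
  not-par(acute 0(suc(suc(suc _)))_ _ _ _(s≤s(s≤s())))
  not-par(acute(suc(suc(suc _)))0 _ _ _(s≤s(s≤s()))_)
  not-par(obtuse 0 0 refl refl _ _ _)()
  not-par(obtuse 0 1 refl refl _ _ _)()
  not-par(obtuse 0 2 refl refl _ _ _)()
  not-par(obtuse 1 0 refl refl _ _ _)()
  not-par(obtuse 2 0 refl refl _ _ _)()
  not-par(obtuse(suc _)(suc _)_ _(inl())_ _)
  not-par(obtuse(suc _)(suc _)_ _(inr())_ _)
  not-par(obtuse 0(suc(suc(suc _)))_ _ _ _(s≤s(s≤s())))
  not-par(obtuse(suc(suc(suc _)))0 _ _ _(s≤s(s≤s()))_)

 nonparallel-atoms : ∀{x y} -> x ≢ y -> ∀{a b} -> a *ₗ 𝒜 x +ᴹ b *ₗ 𝒜 y ≈ᴹ 0ᴹ -> a F.≈ F.0# × b F.≈ F.0#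
 nonparallel-atoms x≢y h = second-zero(x≢y ∘ sym)(+ᴹ-comm _ _ ⊚ h), second-zero x≢y h

 single-at : ∀{k}(i : Fin k)a -> single i a i F.≈ a
 single-at i a with i Fin.≟ i
 ... | yes _ = F.refl
 ... | no h = contra refl h

 module _{m}(u : Vector(Fin rank)m)(u-inj : ∀{i k} -> u i ≡ u k -> i ≡ k)where
  private
   coef : Vector F.Carrier m -> Fin rank -> F.Carrier
   coef s l = Line.sum(\ k -> s k F.* single(u k)F.1# l)

   expand : ∀ s -> combination s(basis ∘ u)≈ᴹ combination(coef s)basis
   expand s = comb-matrix(\ k -> single(u k)F.1#)(\ k -> sm(comb-single(u k)F.1# basis ⊚ 1* _))s

   coef-at : ∀ s k -> coef s(u k)F.≈ s k
   coef-at s k = F.trans(Line.∑-single(\ _ -> yes tt){\ i -> s i F.* single(u i)F.1#(u k)} k tt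
    (\ i _ i≢k -> F.trans(F.*-congˡ(single-off F.1#(i≢k ∘ sym ∘ u-inj)))(F.zeroʳ _)))(F.trans(F.*-congˡ(single-at(u k)F.1#))(F.*-identityʳ _))

   coef-off : ∀ s l →(∀ k -> u k ≢ l)-> coef s l F.≈ F.0#
   coef-off s l h = Line.sum-zero(\ k -> F.trans(F.*-congˡ(single-off F.1#(h k ∘ sym)))(F.zeroʳ _))

   independent : LinearlyIndependent(basis ∘ u)
   independent s h k = F.trans(F.sym(coef-at s k))(basis-independent _(sm(expand s)⊚ h)(u k))

  SupportedOn : Fin N -> Set
  SupportedOn j = ∀ l -> root j ! l ≢ 0z -> ∃ \ k -> u k ≡ l

  private
   supported-span : ∀ j -> SupportedOn j -> vector j ≈ᴹ combination(\ k -> ιz(root j ! u k))(basis ∘ u)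
   supported-span j on = vector-root j ⊚ comb-cong basis(\ l -> F.sym(same l(Fin.any?(\ k -> u k Fin.≟ l))))⊚ sm(expand _)where
    same : ∀ l -> Dec(∃ \ k -> u k ≡ l)-> coef(\ k -> ιz(root j ! u k))l F.≈ ιz(root j ! l)
    same l(yes(k , refl)) = coef-at(\ k -> ιz(root j ! u k))k
    same l(no h) = F.trans(coef-off _ l(\ k e -> h(k , e)))(F.sym(F.reflexive(cong ιz(decidable-stable(root j ! l Z.≟ 0z)(\ nz -> h(on l nz))))))

  has-rank : ∀ S →(∀ a -> a ∈ S -> SupportedOn(atom a))→(∀ k -> ∃ \ a -> a ∈ S × atom a ≡ simple(u k))-> HasRank S m
  has-rank S supported present = basis ∘ u , independent , spanned , spanning where
   spanned : ∀ k -> Span 𝒜 S(basis(u k))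
   spanned k = let(a , a∈S , e) = present k in single a F.1# ,(\ i i∉S -> single-off{i = a}{i} F.1#(\{ refl -> i∉S a∈S })),
    sm(comb-single a F.1# 𝒜 ⊚ 1* _ ⊚ ≈ᴹ-reflexive(cong vector(e ⨾ sym(simple-index(u k)))))
   spanning : ∀ x -> Span 𝒜 S x -> Span(basis ∘ u)⊤ x
   spanning x(s , zero-off , h) = _ ,(\ i i∉ -> contra ∈⊤ i∉), h ⊚ sum-cong-≋{_}{\ a -> s a *ₗ 𝒜 a}{\ a -> s a *ₗ part a(a ∈? S)}(\ a -> term a(a ∈? S))⊚
     comb-matrix(\ a -> matrixRow a(a ∈? S))(\ a -> row a(a ∈? S))s where
    open ModuleTheory leftModule using(sum-cong-≋)
    part : ∀ a -> Dec(a ∈ S)-> Carrierᴹ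
    part a(yes _) = 𝒜 a
    part a(no _) = 0ᴹ
    term : ∀ a d -> s a *ₗ 𝒜 a ≈ᴹ s a *ₗ part a d
    term a(yes _) = rf
    term a(no a∉) = *ₗ-congʳ(zero-off a a∉)⊚ *ₗ-zeroˡ _ ⊚ sm(*ₗ-zeroʳ _)
    matrixRow : ∀ a -> Dec(a ∈ S)-> Vector F.Carrier m
    matrixRow a(yes _)k = ιz(root(atom a)! u k)
    matrixRow a(no _)k = F.0#
    row : ∀ a d -> part a d ≈ᴹ combination(matrixRow a d)(basis ∘ u)
    row a(yes a∈) = supported-span(atom a)(supported a a∈)
    row a(no _) = sm(comb-zero(basis ∘ u)(\ _ -> F.refl))

 -- With fewer members the span would be generated by at most one vector, against `exchange`.
 two-members : ∀ X -> HasRank X 2 -> ∃₂ \ a b -> a ∈ X × b ∈ X × a ≢ b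
 two-members X(e , independent , spanned , _) = first(Fin.any?(_∈? X))where
  none-of : Vector Carrierᴹ 0
  none-of()
  first : Dec(∃ \ a -> a ∈ X)-> ∃₂ \ a b -> a ∈ X × b ∈ X × a ≢ b
  first(no none) = contra(exchange{y = none-of} independent(\ i -> let(s , off , h) = spanned i in(\()), h ⊚ comb-zero 𝒜(\ a -> off a(\ a∈ -> none(a , a∈)))))(\())
  first(yes(a , a∈)) = second(Fin.any?(\ b →(b ∈? X)×-dec ¬?(a Fin.≟ b)))where
   second : Dec(∃ \ b -> b ∈ X × a ≢ b)-> ∃₂ \ a b -> a ∈ X × b ∈ X × a ≢ b
   second(yes(b , b∈ , a≢b)) = a , b , a∈ , b∈ , a≢b
   second(no none) = contra(exchange{y = \(_ : Fin 1)-> 𝒜 a} independent(\ i -> let(s , off , h) = spanned i in(\ _ -> s a),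
     h ⊚ comb-cong 𝒜(\ b -> at s off b(b Fin.≟ a))⊚ comb-single a(s a)𝒜 ⊚ sm(+0 _)))(\{ (s≤s())})where
    at : ∀ s →(∀ i -> i ∉ X -> s i F.≈ F.0#)-> ∀ b -> Dec(b ≡ a)-> s b F.≈ single a(s a)b
    at s off b(yes refl) = F.sym(single-at b(s b))
    at s off b(no b≢a) = F.trans(off b(\ b∈ -> none(b , b∈ , b≢a ∘ sym)))(F.sym(single-off(s a)b≢a))

 line-span : ∀{X a b d s p q} -> a ∈ X -> b ∈ X -> s ≢ 0z →(∀ l -> s * root(atom d)! l ≡ p * root(atom a)! l ⊕ q * root(atom b)! l)-> Span 𝒜 X(𝒜 d)
 line-span{X}{a}{b}{d}{s}{p}{q} a∈ b∈ s≢0 line = let(y , sy) = inverse(\ z -> s≢0(ι-zero s z))in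
   (\ i -> y F.* w i),(\ i i∉ -> F.trans(F.*-congˡ(F.trans(F.+-cong(single-off{i = a}{i}(ιz p)(\{ refl -> i∉ a∈ }))(single-off{i = b}{i}(ιz q)(\{ refl -> i∉ b∈ })))(F.+-identityʳ _)))(F.zeroʳ y)),
   sm(begin
    combination(\ i -> y F.* w i)𝒜 ≈⟨ comb-* y w 𝒜 ⟩
    y *ₗ combination w 𝒜 ≈⟨ *ₗ-congˡ(comb-+(single a(ιz p))(single b(ιz q))𝒜 ⊚ +≈(comb-single a(ιz p)𝒜)(comb-single b(ιz q)𝒜))⟩
    y *ₗ(ιz p *ₗ 𝒜 a +ᴹ ιz q *ₗ 𝒜 b)≈⟨ *ₗ-congˡ(+≈(scaled p(atom a))(scaled q(atom b)))⟨
    y *ₗ(real(p *ᵛ root(atom a))+ᴹ real(q *ᵛ root(atom b)))≈⟨ *ₗ-congˡ(real-+(p *ᵛ root(atom a))(q *ᵛ root(atom b)))⟨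
    y *ₗ real(p *ᵛ root(atom a)+ᵛ q *ᵛ root(atom b))≈⟨ *ₗ-congˡ(≈ᴹ-reflexive(cong real(ext{x = s *ᵛ root(atom d)}{p *ᵛ root(atom a)+ᵛ q *ᵛ root(atom b)}(\ l -> !-* s(root(atom d))l ⨾ line l ⨾
                                   sym(!-+(p *ᵛ root(atom a))(q *ᵛ root(atom b))l ⨾ cong₂ _⊕_(!-* p(root(atom a))l)(!-* q(root(atom b))l))))))⟨
    y *ₗ real(s *ᵛ root(atom d))≈⟨ *ₗ-congˡ(scaled s(atom d))⟩
    y *ₗ(ιz s *ₗ 𝒜 d)≈⟨ *ₗ-assoc y(ιz s)(𝒜 d)⟨
    (y F.* ιz s)*ₗ 𝒜 d ≈⟨ *ₗ-congʳ(F.trans(F.*-comm _ _)sy)⟩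
    F.1# *ₗ 𝒜 d ≈⟨ 1* _ ⟩
    𝒜 d ∎)where
  open SetoidReasoning ≈ᴹ-setoid
  open OrderedFieldTheory F using(inverse)
  open RootDatumOf Φ Δ using(real; real-+)
  w : Fin _ -> F.Carrier
  w i = single a(ιz p)i F.+ single b(ιz q)i
  scaled : ∀ k j -> real(k *ᵛ root j)≈ᴹ ιz k *ₗ vector j
  scaled k j = real-* k(root j)⊚ *ₗ-congˡ(sm(vector-root j))

 GoodOn :(Fin rank -> Set)-> Fin rank -> Set
 GoodOn G w = ∀ μ ν -> Id μ -> Id ν →(∀ l -> ¬ G l -> root μ ! l ≡ 0z)→(∀ l -> ¬ G l -> root ν ! l ≡ 0z)->
        Positive(root μ ! w)-> Positive(root ν ! w)-> μ ≢ ν -> Between w μ ν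

 good-on-⊆ : ∀{G H w} →(∀ l -> H l -> G l)-> GoodOn G w -> GoodOn H w
 good-on-⊆ h good μ ν iμ iν sμ sν = good μ ν iμ iν(\ l ¬l -> sμ l(¬l ∘ h l))(\ l ¬l -> sν l(¬l ∘ h l))

 -- Simple roots in the order of their removal: each is good relative to itself and those removed
 -- later.
 record Elimination(S : Subset rank) : Set where
  field
   n : ℕ
   order : Vector(Fin rank)n
   injective : ∀{i k} -> order i ≡ order k -> i ≡ k
   inside : ∀ i -> order i ∈ S
   covers : ∀ l -> l ∈ S -> ∃ \ i -> order i ≡ l
   good : ∀ i -> GoodOn(\ l -> ∃ \ k -> toℕ i ≤ toℕ k × order k ≡ l)(order i)

 subset : ∀{n p}{P : Fin n -> Set p} →(∀ i -> Dec(P i))-> Subset n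
 subset P? = Vec.tabulate(does ∘ P?)

 ∈-subset⁺ : ∀{n p}{P : Fin n -> Set p}(P? : ∀ i -> Dec(P i)){i} -> P i -> i ∈ subset P?
 ∈-subset⁺ P?{i} h = lookup⇒[]= i _(lookup∘tabulate _ i ⨾ dec-true(P? i)h)

 ∈-subset⁻ : ∀{n p}{P : Fin n -> Set p}(P? : ∀ i -> Dec(P i)){i} -> i ∈ subset P? -> P i
 ∈-subset⁻ P?{i} h = go(P? i)(sym(lookup∘tabulate(does ∘ P?)i)⨾ []=⇒lookup h)where
  go : ∀{p}{P : Set p}(d : Dec P)-> does d ≡ true -> P
  go(yes h)_ = h

 G0 : Subset rank
 G0 = subset(\ i -> Id?(simple i))

 module _(elimination : Elimination G0)where
  private
   module 𝓔 = Elimination elimination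
   n = 𝓔.n

  -- The partition runs in the opposite direction: what is removed first belongs to the last part.
  w : Vector(Fin rank)n
  w = 𝓔.order ∘ Fin.opposite

  w-inj : ∀{i k} -> w i ≡ w k -> i ≡ k
  w-inj{i}{k} e = sym(Fin.opposite-involutive i)⨾ cong Fin.opposite(𝓔.injective e)⨾ Fin.opposite-involutive k

  oppo-≤ : ∀{i k : Fin n} -> toℕ i ≤ toℕ k -> toℕ(Fin.opposite k)≤ toℕ(Fin.opposite i)
  oppo-≤{i}{k} h = subst₂ _≤_(sym(Fin.opposite-prop k))(sym(Fin.opposite-prop i))(ℕ.∸-monoʳ-≤ n(s≤s h))

  w-good : ∀ i -> GoodOn(\ l -> ∃ \ k -> toℕ k ≤ toℕ i × w k ≡ l)(w i)
  w-good i = good-on-⊆(\{ _(k , h , refl)-> Fin.opposite k , oppo-≤ h , refl })(𝓔.good(Fin.opposite i))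

  w-in : ∀ i -> Id(simple(w i))
  w-in i = ∈-subset⁻(\ i -> Id?(simple i))(𝓔.inside(Fin.opposite i))

  w-covers : ∀{j l} -> Id j -> root j ! l ≢ 0z -> ∃ \ i -> w i ≡ l
  w-covers{j}{l} ij nz = let(i , e) = 𝓔.covers l(∈-subset⁺(\ i -> Id?(simple i))(Id-down ij(simple-pos l)below))in
    Fin.opposite i , cong 𝓔.order(Fin.opposite-involutive i)⨾ e where
   below : ∀ i -> root(simple l)! i Z.≤ root j ! i
   below = by-index l(subst(Z._≤ root j ! l)(sym(simple-at l))(pos⇒1≤(≥0⇒pos(Id-pos ij l)nz)))
    (\ i i≢l -> subst(Z._≤ root j ! i)(sym(simple-off i≢l))(Id-pos ij i))

  -- An atom is assigned to the last simple root, in the order `w`, that it involves; the initial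
  -- parts are then the ideal roots supported on initial segments.
  Last : Fin n -> Atom -> Set
  Last i a = root(atom a)! w i ≢ 0z ×(∀ k -> toℕ i < toℕ k -> root(atom a)! w k ≡ 0z)

  last? : ∀ i a -> Dec(Last i a)
  last? i a = ¬?(root(atom a)! w i Z.≟ 0z)×-dec Fin.all?(\ k →(toℕ i ℕ.<? toℕ k)→-dec(root(atom a)! w k Z.≟ 0z))

  Π : Vector(Subset _)n
  Π i = subset(last? i)

  last-unique : ∀{a i k} -> Last i a -> Last k a -> i ≡ k
  last-unique{a}{i}{k}(nz , zeros)(nz' , zeros') = go(ℕ.<-cmp(toℕ i)(toℕ k))where
   go : Tri(toℕ i < toℕ k)(toℕ i ≡ toℕ k)(toℕ k < toℕ i)-> i ≡ k
   go(tri≈ _ e _) = Fin.toℕ-injective e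
   go(tri< i<k _ _) = contra(zeros k i<k)nz'
   go(tri> _ _ k<i) = contra(zeros' i k<i)nz

  last : ∀ a -> ∃ \ i -> Last i a
  last a = let(l , p) = some-pos(atom-pos a); (i , e) = w-covers(atom-in a)(pos⇒≢0 p)in
    from-top(maximal(\ i -> ¬?(root(atom a)! w i Z.≟ 0z))(\ i -> + toℕ i)(i , \ z -> pos⇒≢0 p(cong(root(atom a)!_)(sym e)⨾ z)))where
   from-top :(∃ \ i -> root(atom a)! w i ≢ 0z ×(∀ k -> root(atom a)! w k ≢ 0z -> + toℕ k Z.≤ + toℕ i))-> ∃ \ i -> Last i a
   from-top(i , nz , top) = i , nz , \ k i<k -> decidable-stable(root(atom a)! w k Z.≟ 0z)(\ nz' -> ℕ.<⇒≱ i<k(Z.drop‿+≤+(top k nz')))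

  partition : IsPartition Π
  partition a = let(i , h) = last a in i , ∈-subset⁺(last? i)h , \{k} h' -> last-unique{a}{i}{k} h(∈-subset⁻(last? k)h')

  initial⇒ : ∀ i{a} -> a ∈ initial Π i -> ∀ k -> toℕ i < toℕ k -> root(atom a)! w k ≡ 0z
  initial⇒ i h k i<k = let(j , j≤i , a∈) = ∈take⇒ Π(suc(toℕ i))h in snd(∈-subset⁻(last? j)a∈)k(ℕ.<-≤-trans j≤i i<k)

  ⇒initial : ∀ i{a} →(∀ k -> toℕ i < toℕ k -> root(atom a)! w k ≡ 0z)-> a ∈ initial Π i
  ⇒initial i{a} zeros = let(j , a∈ , _) = partition a in
   ⇒∈take Π(suc(toℕ i))j(s≤s(ℕ.≮⇒≥(\ i<j -> fst(∈-subset⁻(last? j)a∈)(zeros j i<j))))a∈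

  initial-index : ∀ i{a l} -> a ∈ initial Π i -> root(atom a)! l ≢ 0z -> ∃ \ k -> toℕ k ≤ toℕ i × w k ≡ l
  initial-index i{a}{l} h nz = let(k , e) = w-covers(atom-in a)nz in k , ℕ.≮⇒≥(\ i<k -> nz(cong(root(atom a)!_)(sym e)⨾ initial⇒ i h k i<k)), e

  simple-atom : ∀ k -> ∃ \ a -> atom a ≡ simple(w k)
  simple-atom k = atom-of(w-in k)

  initial-rank : ∀ i -> HasRank(initial Π i)(suc(toℕ i))
  initial-rank i = has-rank(\ k -> w(Fin.inject≤ k(Fin.toℕ<n i)))(\{a}{b} e -> Fin.inject≤-injective _ _ a b(w-inj e))(initial Π i)
    (\ a h l nz -> let(k , k≤i , e) = initial-index i h nz in Fin.fromℕ<(s≤s k≤i), cong w(Fin.toℕ-injective(Fin.toℕ-inject≤ _ _ ⨾ Fin.toℕ-fromℕ<(s≤s k≤i)))⨾ e)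
    (\ k -> let(a , e) = simple-atom(Fin.inject≤ k(Fin.toℕ<n i))in a , ⇒initial i(\ m i<m -> cong(\ j -> root j ! w m)e ⨾
     simple-off(\ h -> ℕ.<⇒≱ i<m(subst(\ z -> toℕ z ≤ toℕ i)(sym(w-inj h))(subst(_≤ toℕ i)(sym(Fin.toℕ-inject≤ k(Fin.toℕ<n i)))(ℕ.≤-pred(Fin.toℕ<n k)))))), e)

  total-rank : HasRank ⊤ n
  total-rank = has-rank w w-inj ⊤(\ a _ l nz -> w-covers(atom-in a)nz)(\ k -> let(a , e) = simple-atom k in a , ∈⊤ , e)

  -- Two members of such a flat both involve w i, so goodness gives a root δ on their line without w
  -- i. Lying below one of them, δ belongs to the ideal and to the initial part; closedness puts it
  -- into `X`, although it is not in `Π i`.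
  no-small-flat : ∀ i X -> IsFlatOfRank 2(initial Π i)X -> ¬(X ⊆ Π i)
  no-small-flat i X((X⊆A , closed), rank-X)X⊆Π = from-pair(two-members X rank-X)where
   positive : ∀{a} -> a ∈ X -> Positive(root(atom a)! w i)
   positive{a} a∈ = ≥0⇒pos(atom-pos a(w i))(fst(∈-subset⁻(last? i)(X⊆Π a∈)))
   support : ∀{a} -> a ∈ X -> ∀ l -> ¬(∃ \ k -> toℕ k ≤ toℕ i × w k ≡ l)-> root(atom a)! l ≡ 0z
   support{a} a∈ l none = decidable-stable(root(atom a)! l Z.≟ 0z)(\ nz -> none(initial-index i(X⊆A a∈)nz))
   from-pair : ¬ ∃₂ \ a b -> a ∈ X × b ∈ X × a ≢ b
   from-pair(a , b , a∈ , b∈ , a≢b) = join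
     (w-good i(atom a)(atom b)(atom-in a)(atom-in b)(support a∈)(support b∈)(positive a∈)(positive b∈)(a≢b ∘ atom-inj))where
    join : ¬ Between(w i)(atom a)(atom b)
    join B = at(atom-of([ Id-down(atom-in a)δ-pos , Id-down(atom-in b)δ-pos ]′ δ-below))where
     open Between B
     below-zero : ∀{a} m -> a ∈ X →(∀ l -> root δ ! l Z.≤ root(atom a)! l)-> toℕ i < toℕ m -> root δ ! w m ≡ 0z
     below-zero{a} m a∈ h i<m = Z.≤-antisym(subst(root δ ! w m Z.≤_)(initial⇒ i(X⊆A a∈)m i<m)(h(w m)))(δ-pos(w m))
     at : ¬ ∃ \ d -> atom d ≡ δ
     at(d , e) = fst(∈-subset⁻(last? i)(X⊆Π(closed d(⇒initial i low , line-span{X}{a}{b}{d}{s}{p}{q} a∈ b∈ s≢0 on-line'))))(cong(\ j -> root j ! w i)e ⨾ δ-free)where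
      low : ∀ m -> toℕ i < toℕ m -> root(atom d)! w m ≡ 0z
      low m i<m = cong(\ j -> root j ! w m)e ⨾([(\ h -> below-zero m a∈ h i<m),(\ h -> below-zero m b∈ h i<m)]′ δ-below)
      on-line' : ∀ l -> s * root(atom d)! l ≡ p * root(atom a)! l ⊕ q * root(atom b)! l
      on-line' l = cong(\ j -> s * root j ! l)e ⨾ on-line l

  supersolvable-of-elimination : Supersolvable
  supersolvable-of-elimination = n , total-rank , Π , partition , \ i -> initial-rank i , no-small-flat i

 module _{κ ℓκ1 ℓκ2}(K : HeytingField κ ℓκ1 ℓκ2)(koszul : Koszul K(OrlikSolomon.𝒪𝒮 K{E = E} 𝒜))where

  -- The other outcome of the classification is a pattern inside the ideal, which contradicts
  -- Koszulness.
  good-simple : ∀(S : Subset rank)-> ∃(_∈ S)-> ∃ \ w -> w ∈ S × GoodOn(_∈ S)w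
  good-simple S nonempty = [ id ,(\ P -> ⊥-elim(PatternObstruction.pattern-not-koszul(_∈? S)P K koszul))]′
   (Classification.classify RD{G = _∈ S}(_∈? S)Id Id? Id-pos Id-down nonempty)

  ∉-remove : ∀{n}(p : Subset n)x -> x ∉ p - x
  ∉-remove(_ ∷ p)zero()
  ∉-remove(_ ∷ p)(suc x)(Vec.there h) = ∉-remove p x h

  eliminate-all : ∀ S -> Acc _<_ ∣ S ∣ -> Elimination S
  eliminate-all S(acc rs) = go(Fin.any?(_∈? S))where
   go : Dec(∃(_∈ S))-> Elimination S
   go(no none) = record{ n = 0; order = \(); injective = \{ {()} }; inside = \(); covers = \ l h -> contra(l , h)none; good = \()}
   go(yes some) = extend(good-simple S some)where
    extend :(∃ \ w -> w ∈ S × GoodOn(_∈ S)w)-> Elimination S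
    extend(w , w∈ , good-w) = record{ n = suc R.n; order = order; injective = injective; inside = inside; covers = covers; good = good } where
     module R = Elimination(eliminate-all(S - w)(rs(x∈p⇒∣p-x∣<∣p∣ w∈)))
     order : Vector(Fin rank)(suc R.n)
     order = w Vector.∷ R.order
     apart : ∀ i -> w ≢ R.order i
     apart i e = ∉-remove S w(subst(_∈ S - w)(sym e)(R.inside i))
     injective : ∀{i k} -> order i ≡ order k -> i ≡ k
     injective{zero}{zero} _ = refl
     injective{zero}{suc k} e = contra e(apart k)
     injective{suc i}{zero} e = contra(sym e)(apart i)
     injective{suc i}{suc k} e = cong suc(R.injective e)
     inside : ∀ i -> order i ∈ S
     inside zero = w∈
     inside(suc i) = p─q⊆p S _(R.inside i)
     covers : ∀ l -> l ∈ S -> ∃ \ i -> order i ≡ l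
     covers l l∈ = at(l Fin.≟ w)where
      at : Dec(l ≡ w)-> ∃ \ i -> order i ≡ l
      at(yes e) = zero , sym e
      at(no l≢w) = let(i , e) = R.covers l(x∈p∧x≢y⇒x∈p-y l∈ l≢w)in suc i , e
     good : ∀ i -> GoodOn(\ l -> ∃ \ k -> toℕ i ≤ toℕ k × order k ≡ l)(order i)
     good zero = good-on-⊆(\{ _(k , _ , refl)-> inside k })good-w
     good(suc i) = good-on-⊆(\{ _(suc k , s≤s h , e)-> k , h , e })(R.good i)

  supersolvable : Supersolvable
  supersolvable = supersolvable-of-elimination(eliminate-all G0(<-wellFounded _))

theorem1p2 : {f ℓf₁ ℓf₂ ℓf₃ v ℓv k ℓk₁ ℓk₂ : Level}
    (F : OrderedField f ℓf₁ ℓf₂ ℓf₃) (E : EuclideanSpace F v ℓv)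
    {N : ℕ} (Φ : RootSystem E N) (Δ : Base Φ)
    (I : Subset N) → Base.IsOrderIdeal Δ I →
    (K : HeytingField k ℓk₁ ℓk₂) →
    Arrangement.Supersolvable E (rootArrangement Φ I) ⇔
    Koszul K (OrlikSolomon.𝒪𝒮 K {E = E} (rootArrangement Φ I))
theorem1p2 F E Φ Δ I ideal K = mk⇔ (SupersolvableToKoszul.koszul E basis-independent basis-spans (rootArrangement Φ I) nonzero-atom nonparallel-atoms K) (supersolvable K)
  where
  open RootDatumOf Φ Δ using (basis-independent; basis-spans; rootDatum; vector-root)
  open Supersolvability Φ Δ I ideal rootDatum vector-root (λ _ → refl)
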